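{- Let $\mathbb{H}$ be a definite quaternion division algebra over $\mathbb{Q}$ with maximal order $\mathcal{O}_{\mathbb{H}}$, and let $g>1$. Then the set $\overline{\mathscr{H}}_{g,1}(\mathcal{O}_{\mathbb{H}})$ is in one-to-one correspondence with $\mathscr{P}_g(\mathcal{O}_{\mathbb{H}})$.
   Context: Let $x\mapsto\bar x$ be the main involution of $\mathbb{H}$, $M^\dagger=\bar M^t$, and $\mathrm{Nm}$ the reduced norm on $\mathrm{Mat}_{g\times g}(\mathbb{H})$ (the multiplicative degree-$2g$ polynomial extending the quaternion reduced norm). $\mathscr{H}_{g,1}(\mathcal{O}_{\mathbb{H}})$ is the set of positive-definite hermitian $H\in\mathrm{Mat}_{g\times g}(\mathcal{O}_{\mathbb{H}})$ with Braun–Koecher Haupt norm $\mathrm{HNm}(H)=1$ (where $\mathrm{HNm}(H)$ is a positive integer with $\mathrm{HNm}(H)^2=\mathrm{Nm}(H)$), and $\overline{\mathscr{H}}_{g,1}(\mathcal{O}_{\mathbb{H}})=\mathscr{H}_{g,1}(\mathcal{O}_{\mathbb{H}})/\mathrm{SL}_g(\mathcal{O}_{\mathbb{H}})$ for the right action $H\cdot M=M^\dagger HM$ of $\mathrm{SL}_g(\mathcal{O}_{\mathbb{H}})=\{M\in\mathrm{Mat}_{g\times g}(\mathcal{O}_{\mathbb{H}}):\mathrm{Nm}(M)=1\}$. Put $\mathcal{O}_{\hat{\mathbb{H}}}=\mathcal{O}_{\mathbb{H}}\otimes\hat{\mathbb{Z}}$, $\hat{\mathbb{H}}=\mathcal{O}_{\hat{\mathbb{H}}}\otimes\mathbb{Q}$.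 For an algebra $B$ with anti-involution with fixed ring $R$, $\mathrm{GU}_g(B)=\{M\in\mathrm{Mat}_{g\times g}(B):M^\dagger M=\mu\,\mathrm{Id},\ \mu\in R^\times\}$. Then $\mathscr{P}_g(\mathcal{O}_{\mathbb{H}})=\mathrm{GU}_g(\mathbb{H})\backslash\mathrm{GU}_g(\hat{\mathbb{H}})/\mathrm{GU}_g(\mathcal{O}_{\hat{\mathbb{H}}})$; equivalently, the set of classes of principally polarized right $\mathcal{O}_{\mathbb{H}}$-submodules $L\subseteq\mathbb{H}^g$ (finitely generated, $L\otimes\mathbb{Q}=\mathbb{H}^g$, and $cH_0|_L$ is $\mathcal{O}_{\mathbb{H}}$-valued and unimodular for some $c\in\mathbb{Q}^\times$, where $H_0(x,y)=x^\dagger y$) modulo left multiplication by $\mathrm{GU}_g(\mathbb{H})$. -}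

module Defs where

open import Data.Nat as ℕ using (ℕ; zero; suc)
open import Data.Integer as ℤ using (ℤ)
open import Data.Rational using (ℚ; 0ℚ; 1ℚ; _+_; _*_; -_; _-_; _<_; _/_)
open import Data.Fin using (Fin; zero; suc; punchIn; remQuot; toℕ)
open import Data.Product using (Σ; ∃; ∃-syntax; _×_; _,_; proj₁; proj₂)
open import Relation.Binary.PropositionalEquality using (_≡_)
open import Relation.Nullary using (¬_)
open import Function using (_∘_)

ℤ→ℚ : ℤ → ℚ
ℤ→ℚ z = z / 1

-- Bijection between two "quotient sets" A/~ and B/≈, stated explicitly
-- (no quotient types in Agda): a map A → B that induces a well-defined
-- injective and surjective map on classes.
QuotientBijection : (A : Set) (_~_ : A → A → Set)
                    (B : Set) (_≈_ : B → B → Set) → Set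
QuotientBijection A _~_ B _≈_ =
  Σ (A → B) λ f →
      (∀ x y → x ~ y → f x ≈ f y)
    × (∀ x y → f x ≈ f y → x ~ y)
    × (∀ z → ∃[ x ] (f x ≈ z))

-- The quaternion algebra H = (a,b)_ℚ :  i² = a, j² = b, ij = -ji = k.
-- (Every quaternion algebra over ℚ is of this form; it is definite iff
-- a < 0 and b < 0, and definite ones are automatically division algebras.)

record ℍ : Set where
  constructor ⟨_,_,_,_⟩
  field
    re : ℚ
    ci : ℚ
    cj : ℚ
    ck : ℚ
open ℍ public

module Quaternion (a b : ℚ) where

  0H : ℍ
  0H = ⟨ 0ℚ , 0ℚ , 0ℚ , 0ℚ ⟩

  1H : ℍ
  1H = ⟨ 1ℚ , 0ℚ , 0ℚ , 0ℚ ⟩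

  _+H_ : ℍ → ℍ → ℍ
  x +H y = ⟨ re x + re y , ci x + ci y , cj x + cj y , ck x + ck y ⟩

  -- multiplication: i² = a, j² = b, k² = -ab, ij = k, ji = -k,
  -- ik = a j, ki = -a j, jk = -b i, kj = b i
  _*H_ : ℍ → ℍ → ℍ
  x *H y = ⟨ re x * re y + a * (ci x * ci y) + b * (cj x * cj y)
               - (a * b) * (ck x * ck y)
           , re x * ci y + ci x * re y - b * (cj x * ck y) + b * (ck x * cj y)
           , re x * cj y + cj x * re y + a * (ci x * ck y) - a * (ck x * ci y)
           , re x * ck y + ck x * re y + ci x * cj y - cj x * ci y ⟩

  ι : ℚ → ℍ
  ι q = ⟨ q , 0ℚ , 0ℚ , 0ℚ ⟩

  _·H_ : ℚ → ℍ → ℍ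
  q ·H x = ⟨ q * re x , q * ci x , q * cj x , q * ck x ⟩

  conj : ℍ → ℍ
  conj x = ⟨ re x , - ci x , - cj x , - ck x ⟩

  sumH : ∀ {n} → (Fin n → ℍ) → ℍ
  sumH {zero}  f = 0H
  sumH {suc n} f = f zero +H sumH (f ∘ suc)

  -- Orders, given by a ℤ-basis e₀,…,e₃ of a full lattice in H

  Basis : Set
  Basis = Fin 4 → ℍ

  _∈ℤspan_ : ℍ → Basis → Set
  x ∈ℤspan e = ∃ λ (n : Fin 4 → ℤ) → (x ≡ sumH (λ i → ℤ→ℚ (n i) ·H e i))

  -- e is an order: ℚ-linearly independent (so its ℤ-span is a full
  -- lattice), contains 1 and closed under multiplication.
  IsOrder : Basis → Set
  IsOrder e =
      (∀ (c : Fin 4 → ℚ) → sumH (λ i → c i ·H e i) ≡ 0H → ∀ i → c i ≡ 0ℚ)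
    × (1H ∈ℤspan e)
    × (∀ i j → (e i *H e j) ∈ℤspan e)

  IsMaximalOrder : Basis → Set
  IsMaximalOrder e =
      IsOrder e
    × (∀ e′ → IsOrder e′ → (∀ x → x ∈ℤspan e → x ∈ℤspan e′)
                         → ∀ x → x ∈ℤspan e′ → x ∈ℤspan e)

  Vec : ℕ → Set
  Vec g = Fin g → ℍ

  Mat : ℕ → Set
  Mat g = Fin g → Fin g → ℍ

  _≈V_ : ∀ {g} → Vec g → Vec g → Set
  v ≈V w = ∀ i → v i ≡ w i

  _≈M_ : ∀ {g} → Mat g → Mat g → Set
  M ≈M N = ∀ i j → M i j ≡ N i j

  _⊗_ : ∀ {g} → Mat g → Mat g → Mat g
  (M ⊗ N) i j = sumH (λ k → M i k *H N k j)

  _†  : ∀ {g} → Mat g → Mat g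
  (M †) i j = conj (M j i)

  _▹_ : ∀ {g} → Mat g → Vec g → Vec g
  (M ▹ v) i = sumH (λ k → M i k *H v k)

  IdM : ∀ {g} → Mat g
  IdM i j with Data.Fin._≟_ i j
  ... | Relation.Nullary.yes _ = 1H
  ... | Relation.Nullary.no  _ = 0H

  H₀ : ∀ {g} → Vec g → Vec g → ℍ
  H₀ x y = sumH (λ k → conj (x k) *H y k)

  -- Reduced norm on Mat_g(H), via the splitting field K = ℚ(α), α² = a:
  --   x ↦ [[x₀ + x₁α , b x₂ + b x₃α], [x₂ - x₃α , x₀ - x₁α]]
  -- Nm(M) = det of the resulting 2g × 2g matrix over K (which lies in ℚ);
  -- we take its rational part.

  record K : Set where
    constructor _⊕_α
    field
      kre : ℚ
      kα  : ℚ
  open K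

  0K 1K : K
  0K = 0ℚ ⊕ 0ℚ α
  1K = 1ℚ ⊕ 0ℚ α

  _+K_ _*K_ : K → K → K
  (p ⊕ q α) +K (r ⊕ s α) = (p + r) ⊕ (q + s) α
  (p ⊕ q α) *K (r ⊕ s α) = (p * r + a * (q * s)) ⊕ (p * s + q * r) α

  -K_ : K → K
  -K (p ⊕ q α) = (- p) ⊕ (- q) α

  sumK : ∀ {n} → (Fin n → K) → K
  sumK {zero}  f = 0K
  sumK {suc n} f = f zero +K sumK (f ∘ suc)

  detK : ∀ n → (Fin n → Fin n → K) → K
  detK zero    A = 1K
  detK (suc n) A = sumK (λ j → sgn (toℕ j) (A zero j *K
                      detK n (λ r c → A (suc r) (punchIn j c))))
    where
      sgn : ℕ → K → K
      sgn zero          x = x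
      sgn (suc zero)    x = -K x
      sgn (suc (suc m)) x = sgn m x

  split : ℍ → Fin 2 → Fin 2 → K
  split x zero       zero       = re x ⊕ ci x α
  split x zero       (suc zero) = (b * cj x) ⊕ (b * ck x) α
  split x (suc zero) zero       = cj x ⊕ (- ck x) α
  split x (suc zero) (suc zero) = re x ⊕ (- ci x) α

  Nm : ∀ {g} → Mat g → ℚ
  Nm {g} M = kre (detK (g ℕ.* 2) (λ r c →
               split (M (proj₁ (remQuot {g} 2 r)) (proj₁ (remQuot {g} 2 c)))
                     (proj₂ (remQuot {g} 2 r)) (proj₂ (remQuot {g} 2 c))))

  module Over (O : Basis) where

    _∈O : ℍ → Set
    x ∈O = x ∈ℤspan O

    MatO : ∀ {g} → Mat g → Set
    MatO M = ∀ i j → M i j ∈O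

    -- Braun–Koecher Haupt norm: HNm(H) = n means n is a positive integer
    -- with n² = Nm(H)
    HNm≡ : ∀ {g} → Mat g → ℕ → Set
    HNm≡ H n = (0 ℕ.< n) × (ℤ→ℚ (ℤ.+ n) * ℤ→ℚ (ℤ.+ n) ≡ Nm H)

    IsHermitian : ∀ {g} → Mat g → Set
    IsHermitian H = (H †) ≈M H

    IsPosDef : ∀ {g} → Mat g → Set
    IsPosDef {g} H = ∀ (x : Vec g) → ¬ (x ≈V (λ _ → 0H))
                     → 0ℚ < re (H₀ x (H ▹ x))

    𝓗₁ : ℕ → Set
    𝓗₁ g = Σ (Mat g) λ H → MatO H × IsHermitian H × IsPosDef H × HNm≡ H 1

    IsSL : ∀ {g} → Mat g → Set
    IsSL M = MatO M × (Nm M ≡ 1ℚ)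

    _~SL_ : ∀ {g} → 𝓗₁ g → 𝓗₁ g → Set
    _~SL_ {g} (H , _) (H′ , _) = ∃ λ (M : Mat g) → (IsSL M × ((M †) ⊗ (H ⊗ M)) ≈M H′)

    -- L given by finitely many generators v₀,…,v_{m-1}; L = Σ v_k O
    record Lat (g : ℕ) : Set where
      field
        m    : ℕ
        gens : Fin m → Vec g
    open Lat public

    _∈L_ : ∀ {g} → Vec g → Lat g → Set
    x ∈L L = ∃ λ (o : Fin (m L) → ℍ) → ((∀ k → o k ∈O)
                     × (x ≈V (λ i → sumH (λ k → gens L k i *H o k))))

    IsPPLattice : ∀ {g} → Lat g → Set
    IsPPLattice {g} L =
        -- L ⊗ ℚ = H^g
        (∀ (x : Vec g) → ∃[ d ] ((0 ℕ.< d) ×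
                          ((λ i → ℤ→ℚ (ℤ.+ d) ·H x i) ∈L L)))
        -- c H₀ is O-valued on L and unimodular (L equals its dual)
      × ∃[ c ] (¬ (c ≡ 0ℚ)
          × (∀ x y → x ∈L L → y ∈L L → (c ·H H₀ x y) ∈O)
          × (∀ y → (∀ x → x ∈L L → (c ·H H₀ x y) ∈O) → y ∈L L))

    𝓛 : ℕ → Set
    𝓛 g = Σ (Lat g) IsPPLattice

    IsGU : ∀ {g} → Mat g → Set
    IsGU M = ∃ λ (μ : ℚ) → (¬ (μ ≡ 0ℚ) × ((M †) ⊗ M) ≈M (λ i j → μ ·H IdM i j))

    _~GU_ : ∀ {g : ℕ} → 𝓛 g → 𝓛 g → Set
    _~GU_ {g} (L , _) (L′ , _) =
      ∃ λ (M : Mat g) → (IsGU M × (∀ x → x ∈L L → (M ▹ x) ∈L L′)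
                     × (∀ y → y ∈L L′ → ∃[ x ] (x ∈L L × (M ▹ x) ≈V y)))

module Submission where

open import Defs
open import Algebra.Structures using (IsRing; IsCommutativeRing)
open import Data.Empty using (⊥; ⊥-elim)
open import Data.Fin using (Fin; zero; suc)
open import Data.List using (List; []; _∷_; _++_; map; tabulate)
open import Data.List.Membership.Propositional using (_∈_)
open import Data.List.Relation.Unary.Any using (here; there)
open import Data.Nat as ℕ using (ℕ; zero; suc; s≤s; z≤n)
import Data.Nat.Properties as ℕ
open import Data.Product using (_×_; _,_; proj₁; proj₂; ∃; ∃-syntax)
open import Data.Rational as ℚ using (ℚ; 0ℚ; 1ℚ)
import Data.Rational.Properties as ℚ
open import Data.Sum using (_⊎_; inj₁; inj₂)
open import Data.Unit using (⊤; tt)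
open import Function using (_∘_)
open import Level using (0ℓ)
open import Relation.Binary using (DecidableEquality; tri<; tri≈; tri>; Tri)
open import Relation.Binary.PropositionalEquality
open import Relation.Nullary using (¬_; Dec; yes; no)
open import Tactic.RingSolver using (solve-∀)

module StarRingSolver where
 open import Data.Bool using (Bool; T; true; false; not; _xor_; if_then_else_)
 open import Data.List using (foldr)
 open import Data.Nat using (_<ᵇ_; _≡ᵇ_)
 open import Data.Nat.Properties using (≡ᵇ⇒≡)

 -- A normaliser for rings with anti-involution and central scalars:
 -- a polynomial is a sorted list of signed monomials, a monomial a sorted list
 -- of scalars and a word in which 2i stands for the i-th variable and 2i+1 for
 -- its conjugate.
 data Order : Set where
  less same more : Order

 cmp : List ℕ → List ℕ → Order
 cmp [] [] = same
 cmp [] (_ ∷ _) = less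
 cmp (_ ∷ _) [] = more
 cmp (x ∷ xs) (y ∷ ys) = if x ≡ᵇ y then cmp xs ys else (if x <ᵇ y then less else more)

 cmp-sound : ∀ xs ys → cmp xs ys ≡ same → xs ≡ ys
 cmp-sound [] [] _ = refl
 cmp-sound (x ∷ xs) (y ∷ ys) h with x ≡ᵇ y in e
 ... | true = cong₂ _∷_ (≡ᵇ⇒≡ x y (subst T (sym e) tt)) (cmp-sound xs ys h)
 ... | false with x <ᵇ y
 cmp-sound (x ∷ xs) (y ∷ ys) () | false | true
 cmp-sound (x ∷ xs) (y ∷ ys) () | false | false

 Mono : Set
 Mono = List ℕ × List ℕ

 cmpM : Mono → Mono → Order
 cmpM (s , w) (s' , w') with cmp w w'
 ... | same = cmp s s'
 ... | o = o

 cmpM-sound : ∀ m m' → cmpM m m' ≡ same → m ≡ m'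
 cmpM-sound (s , w) (s' , w') h with cmp w w' in e
 ... | same = cong₂ _,_ (cmp-sound s s' h) (cmp-sound w w' e)

 Poly : Set
 Poly = List (Bool × Mono)

 data Expr : Set where
  V S     : ℕ → Expr
  _:+_    : Expr → Expr → Expr
  _:*_    : Expr → Expr → Expr
  :-_ :c_ : Expr → Expr
  :0 :1   : Expr

 infixl 6 _:+_ _:-_
 infixl 7 _:*_
 infix 8 :-_ :c_

 _:-_ : Expr → Expr → Expr
 x :- y = x :+ (:- y)

 insS : ℕ → List ℕ → List ℕ
 insS n [] = n ∷ []
 insS n (m ∷ ms) = if n <ᵇ m then n ∷ m ∷ ms else m ∷ insS n ms

 mulM : Mono → Mono → Mono
 mulM (s , w) (s' , w') = foldr insS s' s , w ++ w'

 addM : Bool → Mono → Poly → Poly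
 addM b m [] = (b , m) ∷ []
 addM b m ((b' , m') ∷ p) with cmpM m m'
 ... | less = (b , m) ∷ (b' , m') ∷ p
 ... | more = (b' , m') ∷ addM b m p
 ... | same with b | b'
 ... | true  | true  = (true , m) ∷ (true , m) ∷ p
 ... | false | false = (false , m) ∷ (false , m) ∷ p
 ... | true  | false = p
 ... | false | true  = p

 addP : Poly → Poly → Poly
 addP [] q = q
 addP ((b , m) ∷ p) q = addM b m (addP p q)

 scaleM : Bool → Mono → Poly → Poly
 scaleM b m [] = []
 scaleM b m ((b' , m') ∷ p) = addM (b xor b') (mulM m m') (scaleM b m p)

 mulP : Poly → Poly → Poly
 mulP [] q = []
 mulP ((b , m) ∷ p) q = addP (scaleM b m q) (mulP p q)

 negP : Poly → Poly
 negP [] = []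
 negP ((b , m) ∷ p) = (not b , m) ∷ negP p

 flip : ℕ → ℕ
 flip zero = suc zero
 flip (suc zero) = zero
 flip (suc (suc n)) = suc (suc (flip n))

 revW : List ℕ → List ℕ
 revW [] = []
 revW (x ∷ w) = revW w ++ (flip x ∷ [])

 conjP : Poly → Poly
 conjP [] = []
 conjP ((b , (s , w)) ∷ p) = addM b (s , revW w) (conjP p)

 double : ℕ → ℕ
 double zero = zero
 double (suc n) = suc (suc (double n))

 norm : Expr → Poly
 norm (V i) = (false , [] , double i ∷ []) ∷ []
 norm (S i) = (false , i ∷ [] , []) ∷ []
 norm (e :+ f) = addP (norm e) (norm f)
 norm (e :* f) = mulP (norm e) (norm f)
 norm (:- e) = negP (norm e)
 norm (:c e) = conjP (norm e)
 norm :0 = []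
 norm :1 = (false , [] , []) ∷ []

 module Solve
  {A S' : Set} {_+_ _*_ : A → A → A} { -_ : A → A} {0# 1# : A}
  (isRing : IsRing _≡_ _+_ _*_ -_ 0# 1#)
  (conj : A → A)
  (conj-+ : ∀ x y → conj (x + y) ≡ conj x + conj y)
  (conj-* : ∀ x y → conj (x * y) ≡ conj y * conj x)
  (conj-conj : ∀ x → conj (conj x) ≡ x)
  (conj-1 : conj 1# ≡ 1#)
  (ι : S' → A)
  (ι-comm : ∀ q x → ι q * x ≡ x * ι q)
  (conj-ι : ∀ q → conj (ι q) ≡ ι q)
  (s₀ : S')
  where
  open IsRing isRing using (+-assoc; +-comm; +-identityˡ; +-identityʳ; -‿inverseˡ; -‿inverseʳ; *-assoc; *-identityˡ; *-identityʳ; distribˡ; distribʳ; zeroˡ; zeroʳ)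
  open import Algebra.Bundles using (Ring)
  open import Level using (0ℓ)

  private
   R : Ring 0ℓ 0ℓ
   R = record { isRing = isRing }

  open import Algebra.Properties.Ring R using (-‿distribˡ-*; -‿distribʳ-*; -‿involutive; -‿+-comm; -0#≈0#; +-cancelˡ)

  look : {B : Set} → B → List B → ℕ → B
  look d [] _ = d
  look d (x ∷ _) zero = x
  look d (_ ∷ xs) (suc n) = look d xs n

  module _ (xs : List A) (qs : List S') where
   ⟦_⟧ : Expr → A
   ⟦ V i ⟧ = look 0# xs i
   ⟦ S i ⟧ = ι (look s₀ qs i)
   ⟦ e :+ f ⟧ = ⟦ e ⟧ + ⟦ f ⟧
   ⟦ e :* f ⟧ = ⟦ e ⟧ * ⟦ f ⟧
   ⟦ :- e ⟧ = - ⟦ e ⟧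
   ⟦ :c e ⟧ = conj ⟦ e ⟧
   ⟦ :0 ⟧ = 0#
   ⟦ :1 ⟧ = 1#

   private
    letter : List A → ℕ → A
    letter [] n = 0#
    letter (x ∷ _) zero = x
    letter (x ∷ _) (suc zero) = conj x
    letter (_ ∷ ys) (suc (suc n)) = letter ys n

    word : List ℕ → A
    word [] = 1#
    word (i ∷ w) = letter xs i * word w

    scal : List ℕ → A
    scal [] = 1#
    scal (i ∷ w) = ι (look s₀ qs i) * scal w

    mono : Mono → A
    mono (s , w) = scal s * word w

    sgn : Bool → A → A
    sgn false x = x
    sgn true x = - x

    poly : Poly → A
    poly [] = 0#
    poly ((b , m) ∷ p) = sgn b (mono m) + poly p

    conj-0 : conj 0# ≡ 0#
    conj-0 = +-cancelˡ (conj 0#) _ _ (trans (sym (conj-+ 0# 0#))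
          (trans (cong conj (+-identityʳ 0#)) (sym (+-identityʳ _))))

    conj-neg : ∀ x → conj (- x) ≡ - conj x
    conj-neg x = +-cancelˡ (conj x) _ _ (trans (sym (conj-+ x (- x)))
     (trans (cong conj (-‿inverseʳ x)) (trans conj-0 (sym (-‿inverseʳ _)))))

    letter-flip : ∀ ys i → letter ys (flip i) ≡ conj (letter ys i)
    letter-flip [] i = sym conj-0
    letter-flip (x ∷ ys) zero = refl
    letter-flip (x ∷ ys) (suc zero) = sym (conj-conj x)
    letter-flip (x ∷ ys) (suc (suc i)) = letter-flip ys i

    letter-double : ∀ ys i → letter ys (double i) ≡ look 0# ys i
    letter-double [] i = refl
    letter-double (x ∷ ys) zero = refl
    letter-double (x ∷ ys) (suc i) = letter-double ys i

    word-++ : ∀ v w → word (v ++ w) ≡ word v * word w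
    word-++ [] w = sym (*-identityˡ _)
    word-++ (i ∷ v) w = trans (cong (_ *_) (word-++ v w)) (sym (*-assoc _ _ _))

    word-rev : ∀ w → word (revW w) ≡ conj (word w)
    word-rev [] = sym conj-1
    word-rev (i ∷ w) = trans (word-++ (revW w) _)
     (trans (cong₂ _*_ (word-rev w) (trans (*-identityʳ _) (letter-flip xs i))) (sym (conj-* _ _)))

    scal-comm : ∀ s x → scal s * x ≡ x * scal s
    scal-comm [] x = trans (*-identityˡ x) (sym (*-identityʳ x))
    scal-comm (i ∷ s) x = trans (*-assoc _ _ _) (trans (cong (ι (look s₀ qs i) *_) (scal-comm s x))
     (trans (sym (*-assoc _ _ _)) (trans (cong (_* scal s) (ι-comm _ x)) (*-assoc _ _ _))))

    conj-scal : ∀ s → conj (scal s) ≡ scal s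
    conj-scal [] = conj-1
    conj-scal (i ∷ s) = trans (conj-* _ _) (trans (cong₂ _*_ (conj-scal s) (conj-ι _)) (sym (ι-comm _ _)))

    scal-ins : ∀ i s → scal (insS i s) ≡ ι (look s₀ qs i) * scal s
    scal-ins i [] = refl
    scal-ins i (j ∷ s) with i <ᵇ j
    ... | true = refl
    ... | false = trans (cong (_ *_) (scal-ins i s)) (trans (sym (*-assoc _ _ _))
        (trans (cong (_* scal s) (ι-comm _ _)) (*-assoc _ _ _)))

    scal-merge : ∀ s t → scal (foldr insS t s) ≡ scal s * scal t
    scal-merge [] t = sym (*-identityˡ _)
    scal-merge (i ∷ s) t = trans (scal-ins i (foldr insS t s))
     (trans (cong (_ *_) (scal-merge s t)) (sym (*-assoc _ _ _)))

    mono-mul : ∀ m n → mono (mulM m n) ≡ mono m * mono n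
    mono-mul (s , w) (t , v) = begin
     scal (foldr insS t s) * word (w ++ v)      ≡⟨ cong₂ _*_ (scal-merge s t) (word-++ w v) ⟩
     (scal s * scal t) * (word w * word v)      ≡⟨ *-assoc _ _ _ ⟩
     scal s * (scal t * (word w * word v))      ≡⟨ cong (scal s *_) (sym (*-assoc _ _ _)) ⟩
     scal s * ((scal t * word w) * word v)      ≡⟨ cong (λ z → scal s * (z * word v)) (scal-comm t (word w)) ⟩
     scal s * ((word w * scal t) * word v)      ≡⟨ cong (scal s *_) (*-assoc _ _ _) ⟩
     scal s * (word w * (scal t * word v))      ≡⟨ sym (*-assoc _ _ _) ⟩
     (scal s * word w) * (scal t * word v)      ∎
     where open ≡-Reasoning

    mono-conj : ∀ s w → mono (s , revW w) ≡ conj (mono (s , w))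
    mono-conj s w = trans (cong (scal s *_) (word-rev w)) (trans (scal-comm s _)
     (trans (cong (_ *_) (sym (conj-scal s))) (sym (conj-* _ _))))

    sgn-not : ∀ b x → sgn (not b) x ≡ - sgn b x
    sgn-not false x = refl
    sgn-not true x = sym (-‿involutive x)

    sgn-xor : ∀ b c x y → sgn (b xor c) (x * y) ≡ sgn b x * sgn c y
    sgn-xor false false x y = refl
    sgn-xor false true x y = -‿distribʳ-* x y
    sgn-xor true false x y = -‿distribˡ-* x y
    sgn-xor true true x y = trans (sym (-‿involutive _)) (trans (cong -_ (-‿distribˡ-* x y)) (-‿distribʳ-* (- x) y))

    sgn-conj : ∀ b x → sgn b (conj x) ≡ conj (sgn b x)
    sgn-conj false x = refl
    sgn-conj true x = sym (conj-neg x)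

    swap : ∀ x y z → x + (y + z) ≡ y + (x + z)
    swap x y z = trans (sym (+-assoc x y z)) (trans (cong (_+ z) (+-comm x y)) (+-assoc y x z))

    cancel : ∀ x y → x + ((- x) + y) ≡ y
    cancel x y = trans (sym (+-assoc x (- x) y)) (trans (cong (_+ y) (-‿inverseʳ x)) (+-identityˡ y))

    cancel' : ∀ x y → (- x) + (x + y) ≡ y
    cancel' x y = trans (sym (+-assoc (- x) x y)) (trans (cong (_+ y) (-‿inverseˡ x)) (+-identityˡ y))

    poly-addM : ∀ b m p → poly (addM b m p) ≡ sgn b (mono m) + poly p
    poly-addM b m [] = refl
    poly-addM b m ((b' , m') ∷ p) with cmpM m m' in e
    ... | less = refl
    ... | more = trans (cong (_ +_) (poly-addM b m p)) (swap _ _ _)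
    ... | same with refl ← cmpM-sound m m' e with b | b'
    ... | true  | true  = refl
    ... | false | false = refl
    ... | true  | false = sym (cancel' _ _)
    ... | false | true  = sym (cancel _ _)

    poly-addP : ∀ p q → poly (addP p q) ≡ poly p + poly q
    poly-addP [] q = sym (+-identityˡ _)
    poly-addP ((b , m) ∷ p) q = trans (poly-addM b m (addP p q))
     (trans (cong (_ +_) (poly-addP p q)) (sym (+-assoc _ _ _)))

    poly-scaleM : ∀ b m p → poly (scaleM b m p) ≡ sgn b (mono m) * poly p
    poly-scaleM b m [] = sym (zeroʳ _)
    poly-scaleM b m ((b' , m') ∷ p) = trans (poly-addM _ _ (scaleM b m p))
     (trans (cong₂ _+_ (trans (cong (sgn (b xor b')) (mono-mul m m')) (sgn-xor b b' _ _)) (poly-scaleM b m p))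
     (sym (distribˡ _ _ _)))

    poly-mulP : ∀ p q → poly (mulP p q) ≡ poly p * poly q
    poly-mulP [] q = sym (zeroˡ _)
    poly-mulP ((b , m) ∷ p) q = trans (poly-addP (scaleM b m q) (mulP p q))
     (trans (cong₂ _+_ (poly-scaleM b m q) (poly-mulP p q)) (sym (distribʳ _ _ _)))

    poly-negP : ∀ p → poly (negP p) ≡ - poly p
    poly-negP [] = sym -0#≈0#
    poly-negP ((b , m) ∷ p) = trans (cong₂ _+_ (sgn-not b _) (poly-negP p)) (-‿+-comm _ _)

    poly-conjP : ∀ p → poly (conjP p) ≡ conj (poly p)
    poly-conjP [] = sym conj-0
    poly-conjP ((b , (s , w)) ∷ p) = trans (poly-addM b (s , revW w) (conjP p))
     (trans (cong₂ _+_ (trans (cong (sgn b) (mono-conj s w)) (sgn-conj b _)) (poly-conjP p)) (sym (conj-+ _ _)))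

    poly-norm : ∀ e → poly (norm e) ≡ ⟦ e ⟧
    poly-norm (V i) = trans (+-identityʳ _) (trans (*-identityˡ _) (trans (*-identityʳ _) (letter-double xs i)))
    poly-norm (S i) = trans (+-identityʳ _) (trans (*-identityʳ _) (*-identityʳ _))
    poly-norm (e :+ f) = trans (poly-addP (norm e) (norm f)) (cong₂ _+_ (poly-norm e) (poly-norm f))
    poly-norm (e :* f) = trans (poly-mulP (norm e) (norm f)) (cong₂ _*_ (poly-norm e) (poly-norm f))
    poly-norm (:- e) = trans (poly-negP (norm e)) (cong -_ (poly-norm e))
    poly-norm (:c e) = trans (poly-conjP (norm e)) (cong conj (poly-norm e))
    poly-norm :0 = refl
    poly-norm :1 = trans (+-identityʳ _) (*-identityʳ _)

   solveH : ∀ e f → norm e ≡ norm f → ⟦ e ⟧ ≡ ⟦ f ⟧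
   solveH e f h = trans (sym (poly-norm e)) (trans (cong poly h) (poly-norm f))

module RationalAlgebra where
 open import Data.Rational using (_+_; _*_; -_; _-_; _<_; _≤_; _≟_; ≢-nonZero; 1/_; positive; nonNegative)
 open import Data.Rational.Properties using (+-*-commutativeRing)
 open import Relation.Nullary.Decidable using (dec⇒maybe)
 import Tactic.RingSolver.NonReflective as NonReflective
 open import Data.Fin using (#_)
 open import Data.Vec as Vec using ([]; _∷_)
 open import Tactic.RingSolver.Core.AlmostCommutativeRing using (AlmostCommutativeRing; fromCommutativeRing)
 open StarRingSolver using (module Solve)

 ℚ-ring : AlmostCommutativeRing 0ℓ 0ℓ
 ℚ-ring = fromCommutativeRing +-*-commutativeRing λ x → dec⇒maybe (0ℚ ≟ x)

 neg-neg : ∀ p → - (- p) ≡ p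
 neg-neg = solve-∀ ℚ-ring

 inv : ∀ q → ¬ (q ≡ 0ℚ) → ∃[ r ] (q * r ≡ 1ℚ)
 inv q q≢0 = (1/ q) {{≢-nonZero q≢0}} , ℚ.*-inverseʳ q {{≢-nonZero q≢0}}

 *-zero : ∀ {p q} → p * q ≡ 0ℚ → (p ≡ 0ℚ) ⊎ (q ≡ 0ℚ)
 *-zero {p} {q} pq≡0 with p ≟ 0ℚ
 ... | yes p≡0 = inj₁ p≡0
 ... | no p≢0 with r , pr≡1 ← inv p p≢0 = inj₂ (begin
  q              ≡⟨ sym (ℚ.*-identityˡ q) ⟩
  1ℚ * q         ≡⟨ cong (_* q) (sym pr≡1) ⟩
  p * r * q      ≡⟨ lem p q r ⟩
  r * (p * q)    ≡⟨ cong (r *_) pq≡0 ⟩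
  r * 0ℚ         ≡⟨ ℚ.*-zeroʳ r ⟩
  0ℚ             ∎)
  where
  open ≡-Reasoning
  lem : ∀ p q r → p * r * q ≡ r * (p * q)
  lem = solve-∀ ℚ-ring

 *-cancelˡ : ∀ p {q r} → ¬ (p ≡ 0ℚ) → p * q ≡ p * r → q ≡ r
 *-cancelˡ p {q} {r} p≢0 h = trans (sym (undo q)) (trans (cong (s *_) h) (undo r))
  where
  s = proj₁ (inv p p≢0)
  lem : ∀ p q s → s * (p * q) ≡ (p * s) * q
  lem = solve-∀ ℚ-ring
  undo : ∀ q → s * (p * q) ≡ q
  undo q = trans (lem p q s) (trans (cong (_* q) (proj₂ (inv p p≢0))) (ℚ.*-identityˡ q))

 *-pos : ∀ {p q} → 0ℚ < p → 0ℚ < q → 0ℚ < p * q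
 *-pos {p} {q} hp hq = ℚ.positive⁻¹ (p * q) {{ℚ.pos*pos⇒pos p {{positive hp}} q {{positive hq}}}}

 <⇒≢0 : ∀ {p} → 0ℚ < p → ¬ (p ≡ 0ℚ)
 <⇒≢0 h refl = ℚ.<-irrefl refl h

 neg-pos : ∀ {p} → p < 0ℚ → 0ℚ < - p
 neg-pos {p} h = ℚ.neg-antimono-< h

 square-nonneg : ∀ p → 0ℚ ≤ p * p
 square-nonneg p with ℚ.<-cmp p 0ℚ
 ... | tri< p<0 _ _ = subst (0ℚ ≤_) (lem p) (ℚ.<⇒≤ (*-pos (neg-pos p<0) (neg-pos p<0)))
  where
  lem : ∀ p → (- p) * (- p) ≡ p * p
  lem = solve-∀ ℚ-ring
 ... | tri≈ _ refl _ = ℚ.≤-refl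
 ... | tri> _ _ p>0 = ℚ.<⇒≤ (*-pos p>0 p>0)

 +-nonneg-zero : ∀ {p q} → 0ℚ ≤ p → 0ℚ ≤ q → p + q ≡ 0ℚ → (p ≡ 0ℚ) × (q ≡ 0ℚ)
 +-nonneg-zero {p} {q} hp hq h =
  ℚ.≤-antisym (subst (p ≤_) h (subst (_≤ p + q) (ℚ.+-identityʳ p) (ℚ.+-monoʳ-≤ p hq))) hp ,
  ℚ.≤-antisym (subst (q ≤_) h (subst (_≤ p + q) (ℚ.+-identityˡ q) (ℚ.+-monoˡ-≤ q hp))) hq

 *-nonneg : ∀ {p q} → 0ℚ < p → 0ℚ ≤ q → 0ℚ ≤ p * q
 *-nonneg {p} {q} hp hq = ℚ.nonNegative⁻¹ (p * q) {{ℚ.nonNeg*nonNeg⇒nonNeg p {{nonNegative (ℚ.<⇒≤ hp)}} q {{nonNegative hq}}}}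

 ℍ-≡ : ∀ {x y : ℍ} → re x ≡ re y → ci x ≡ ci y → cj x ≡ cj y → ck x ≡ ck y → x ≡ y
 ℍ-≡ refl refl refl refl = refl

 module Alg (a b : ℚ) where
  open Quaternion a b

  negH : ℍ → ℍ
  negH x = ⟨ - re x , - ci x , - cj x , - ck x ⟩

  nrd : ℍ → ℚ
  nrd x = re x * re x - a * (ci x * ci x) - b * (cj x * cj x) + a * b * (ck x * ck x)

  trd : ℍ → ℚ
  trd x = re x + re x

  +H-assoc : ∀ x y z → (x +H y) +H z ≡ x +H (y +H z)
  +H-assoc x y z = ℍ-≡
   (ℚ.+-assoc (re x) (re y) (re z)) (ℚ.+-assoc (ci x) (ci y) (ci z)) (ℚ.+-assoc (cj x) (cj y) (cj z)) (ℚ.+-assoc (ck x) (ck y) (ck z))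

  +H-comm : ∀ x y → x +H y ≡ y +H x
  +H-comm x y = ℍ-≡
   (ℚ.+-comm (re x) (re y)) (ℚ.+-comm (ci x) (ci y)) (ℚ.+-comm (cj x) (cj y)) (ℚ.+-comm (ck x) (ck y))

  +H-identityˡ : ∀ x → 0H +H x ≡ x
  +H-identityˡ x = ℍ-≡
   (ℚ.+-identityˡ (re x)) (ℚ.+-identityˡ (ci x)) (ℚ.+-identityˡ (cj x)) (ℚ.+-identityˡ (ck x))

  +H-inverseˡ : ∀ x → negH x +H x ≡ 0H
  +H-inverseˡ x = ℍ-≡
   (ℚ.+-inverseˡ (re x)) (ℚ.+-inverseˡ (ci x)) (ℚ.+-inverseˡ (cj x)) (ℚ.+-inverseˡ (ck x))

  -- Identities between quaternions, and between the entries of their splitting over K, are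
  -- verified coordinatewise on generic elements.
  module Polynomial where
   open NonReflective ℚ-ring public using (Expr; Κ; Ι; _⊕_; ⊝_) renaming (_⊗_ to infixl 7 _⊙_)
   open NonReflective.Ops ℚ-ring using (⟦_⟧; ⟦_⇓⟧; prove)

   record Quat : Set where
    constructor quat
    field
     q₀ q₁ q₂ q₃ : Expr ℚ 14
   open Quat public

   infixl 6 _⊞_ _⊟_
   infixl 7 _⊠_
   _⊟_ : Expr ℚ 14 → Expr ℚ 14 → Expr ℚ 14
   e ⊟ f = e ⊕ (⊝ f)

   aE bE 0E 1E : Expr ℚ 14
   aE = Ι (# 0)
   bE = Ι (# 1)
   0E = Κ 0ℚ
   1E = Κ 1ℚ

   X Y Z 1Q S : Quat
   X = quat (Ι (# 2)) (Ι (# 3)) (Ι (# 4)) (Ι (# 5))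
   Y = quat (Ι (# 6)) (Ι (# 7)) (Ι (# 8)) (Ι (# 9))
   Z = quat (Ι (# 10)) (Ι (# 11)) (Ι (# 12)) (Ι (# 13))
   1Q = quat (Κ 1ℚ) 0E 0E 0E
   S = quat (q₀ Y) 0E 0E 0E

   _⊞_ _⊠_ : Quat → Quat → Quat
   quat x₀ x₁ x₂ x₃ ⊞ quat y₀ y₁ y₂ y₃ = quat (x₀ ⊕ y₀) (x₁ ⊕ y₁) (x₂ ⊕ y₂) (x₃ ⊕ y₃)
   quat x₀ x₁ x₂ x₃ ⊠ quat y₀ y₁ y₂ y₃ = quat
    (x₀ ⊙ y₀ ⊕ aE ⊙ (x₁ ⊙ y₁) ⊕ bE ⊙ (x₂ ⊙ y₂) ⊟ (aE ⊙ bE) ⊙ (x₃ ⊙ y₃))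
    (x₀ ⊙ y₁ ⊕ x₁ ⊙ y₀ ⊟ bE ⊙ (x₂ ⊙ y₃) ⊕ bE ⊙ (x₃ ⊙ y₂))
    (x₀ ⊙ y₂ ⊕ x₂ ⊙ y₀ ⊕ aE ⊙ (x₁ ⊙ y₃) ⊟ aE ⊙ (x₃ ⊙ y₁))
    (x₀ ⊙ y₃ ⊕ x₃ ⊙ y₀ ⊕ x₁ ⊙ y₂ ⊟ x₂ ⊙ y₁)

   scale : Expr ℚ 14 → Quat → Quat
   scale q (quat x₀ x₁ x₂ x₃) = quat (q ⊙ x₀) (q ⊙ x₁) (q ⊙ x₂) (q ⊙ x₃)

   bar norm : Quat → Quat
   bar (quat x₀ x₁ x₂ x₃) = quat x₀ (⊝ x₁) (⊝ x₂) (⊝ x₃)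
   norm (quat x₀ x₁ x₂ x₃) = quat (x₀ ⊙ x₀ ⊟ aE ⊙ (x₁ ⊙ x₁) ⊟ bE ⊙ (x₂ ⊙ x₂) ⊕ aE ⊙ bE ⊙ (x₃ ⊙ x₃)) 0E 0E 0E

   env : ℍ → ℍ → ℍ → Vec.Vec ℚ 14
   env x y z = a ∷ b ∷ re x ∷ ci x ∷ cj x ∷ ck x ∷ re y ∷ ci y ∷ cj y ∷ ck y ∷ re z ∷ ci z ∷ cj z ∷ ck z ∷ []

   value : Quat → Vec.Vec ℚ 14 → ℍ
   value x ρ = ⟨ ⟦ q₀ x ⟧ ρ , ⟦ q₁ x ⟧ ρ , ⟦ q₂ x ⟧ ρ , ⟦ q₃ x ⟧ ρ ⟩

   law : ∀ x y z L R → let ρ = env x y z in ⟦ q₀ L ⇓⟧ ρ ≡ ⟦ q₀ R ⇓⟧ ρ → ⟦ q₁ L ⇓⟧ ρ ≡ ⟦ q₁ R ⇓⟧ ρ →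
    ⟦ q₂ L ⇓⟧ ρ ≡ ⟦ q₂ R ⇓⟧ ρ → ⟦ q₃ L ⇓⟧ ρ ≡ ⟦ q₃ R ⇓⟧ ρ → value L ρ ≡ value R ρ
   law x y z L R e₀ e₁ e₂ e₃ = ℍ-≡ (prove ρ (q₀ L) (q₀ R) e₀) (prove ρ (q₁ L) (q₁ R) e₁) (prove ρ (q₂ L) (q₂ R) e₂) (prove ρ (q₃ L) (q₃ R) e₃)
    where ρ = env x y z

   record Pair : Set where
    constructor pair
    field
     p₀ p₁ : Expr ℚ 14
   open Pair public

   infixl 6 _⊞K_
   infixl 7 _⊠K_
   _⊞K_ _⊠K_ : Pair → Pair → Pair
   pair p q ⊞K pair r s = pair (p ⊕ r) (q ⊕ s)
   pair p q ⊠K pair r s = pair (p ⊙ r ⊕ aE ⊙ (q ⊙ s)) (p ⊙ s ⊕ q ⊙ r)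

   0P 1P K₁ K₂ K₃ : Pair
   0P = pair 0E 0E
   1P = pair (Κ 1ℚ) 0E
   K₁ = pair (q₀ X) (q₁ X)
   K₂ = pair (q₀ Y) (q₁ Y)
   K₃ = pair (q₀ Z) (q₁ Z)

   splitP : Quat → Fin 2 → Fin 2 → Pair
   splitP (quat x₀ x₁ x₂ x₃) zero zero = pair x₀ x₁
   splitP (quat x₀ x₁ x₂ x₃) zero (suc zero) = pair (bE ⊙ x₂) (bE ⊙ x₃)
   splitP (quat x₀ x₁ x₂ x₃) (suc zero) zero = pair x₂ (⊝ x₃)
   splitP (quat x₀ x₁ x₂ x₃) (suc zero) (suc zero) = pair x₀ (⊝ x₁)

   splitXY : Fin 2 → Fin 2 → Pair
   splitXY i j = splitP X i zero ⊠K splitP Y zero j ⊞K (splitP X i (suc zero) ⊠K splitP Y (suc zero) j ⊞K 0P)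

   valueK : Pair → Vec.Vec ℚ 14 → K
   valueK x ρ = record { kre = ⟦ p₀ x ⟧ ρ ; kα = ⟦ p₁ x ⟧ ρ }

   embed : K → ℍ
   embed x = ⟨ K.kre x , K.kα x , 0ℚ , 0ℚ ⟩

   lawK : ∀ x y z L R → let ρ = env x y z in ⟦ p₀ L ⇓⟧ ρ ≡ ⟦ p₀ R ⇓⟧ ρ → ⟦ p₁ L ⇓⟧ ρ ≡ ⟦ p₁ R ⇓⟧ ρ → valueK L ρ ≡ valueK R ρ
   lawK x y z L R e₀ e₁ = cong₂ _⊕_α (prove ρ (p₀ L) (p₀ R) e₀) (prove ρ (p₁ L) (p₁ R) e₁)
    where ρ = env x y z

  open Polynomial

  *H-assoc : ∀ x y z → (x *H y) *H z ≡ x *H (y *H z)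
  *H-assoc x y z = law x y z ((X ⊠ Y) ⊠ Z) (X ⊠ (Y ⊠ Z)) refl refl refl refl

  distribˡH : ∀ x y z → x *H (y +H z) ≡ (x *H y) +H (x *H z)
  distribˡH x y z = law x y z (X ⊠ (Y ⊞ Z)) (X ⊠ Y ⊞ X ⊠ Z) refl refl refl refl

  distribʳH : ∀ x y z → (y +H z) *H x ≡ (y *H x) +H (z *H x)
  distribʳH x y z = law x y z ((Y ⊞ Z) ⊠ X) (Y ⊠ X ⊞ Z ⊠ X) refl refl refl refl

  *H-identityˡ : ∀ x → 1H *H x ≡ x
  *H-identityˡ x = law x 0H 0H (1Q ⊠ X) X refl refl refl refl

  *H-identityʳ : ∀ x → x *H 1H ≡ x
  *H-identityʳ x = law x 0H 0H (X ⊠ 1Q) X refl refl refl refl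

  ι-* : ∀ q x → ι q *H x ≡ q ·H x
  ι-* q x = law x (ι q) 0H (S ⊠ X) (scale (q₀ S) X) refl refl refl refl

  *-ι : ∀ q x → x *H ι q ≡ q ·H x
  *-ι q x = law x (ι q) 0H (X ⊠ S) (scale (q₀ S) X) refl refl refl refl

  *-conj : ∀ x → x *H conj x ≡ ι (nrd x)
  *-conj x = law x 0H 0H (X ⊠ bar X) (norm X) refl refl refl refl

  conj-*ˡ : ∀ x → conj x *H x ≡ ι (nrd x)
  conj-*ˡ x = law x 0H 0H (bar X ⊠ X) (norm X) refl refl refl refl

  conj-* : ∀ x y → conj (x *H y) ≡ conj y *H conj x
  conj-* x y = law x y 0H (bar (X ⊠ Y)) (bar Y ⊠ bar X) refl refl refl refl

  conj-+ : ∀ x y → conj (x +H y) ≡ conj x +H conj y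
  conj-+ x y = ℍ-≡ refl
   (ℚ.neg-distrib-+ (ci x) (ci y)) (ℚ.neg-distrib-+ (cj x) (cj y)) (ℚ.neg-distrib-+ (ck x) (ck y))

  conj-conj : ∀ x → conj (conj x) ≡ x
  conj-conj x = ℍ-≡ refl (neg-neg (ci x)) (neg-neg (cj x)) (neg-neg (ck x))

  conj-ι : ∀ q → conj (ι q) ≡ ι q
  conj-ι q = refl

  ι-central : ∀ q x → ι q *H x ≡ x *H ι q
  ι-central q x = trans (ι-* q x) (sym (*-ι q x))

  isRingH : IsRing _≡_ _+H_ _*H_ negH 0H 1H
  isRingH = record
   { +-isAbelianGroup = record
    { isGroup = record
     { isMonoid = record
      { isSemigroup = record
       { isMagma = record { isEquivalence = isEquivalence ; ∙-cong = cong₂ _+H_ }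
       ; assoc = +H-assoc }
      ; identity = +H-identityˡ , λ x → trans (+H-comm x 0H) (+H-identityˡ x) }
     ; inverse = +H-inverseˡ , λ x → trans (+H-comm x (negH x)) (+H-inverseˡ x)
     ; ⁻¹-cong = cong negH }
    ; comm = +H-comm }
   ; *-cong = cong₂ _*H_
   ; *-assoc = *H-assoc
   ; *-identity = *H-identityˡ , *H-identityʳ
   ; distrib = distribˡH , distribʳH }

  open Solve isRingH conj conj-+ conj-* conj-conj refl ι ι-central conj-ι 0ℚ public using (solveH)

  open IsRing isRingH public using () renaming
   (+-identityʳ to +H-identityʳ; -‿inverseʳ to +H-inverseʳ; zeroˡ to zeroˡH; zeroʳ to zeroʳH)

module Matrix
 {A : Set} {_+_ _*_ : A → A → A} { -_ : A → A} {0# 1# : A}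
 (isRing : IsRing _≡_ _+_ _*_ -_ 0# 1#)
 (Σ : ∀ {n} → (Fin n → A) → A)
 (Σ-nil : ∀ (f : Fin zero → A) → Σ f ≡ 0#)
 (Σ-suc : ∀ {n} (f : Fin (suc n) → A) → Σ f ≡ (f zero + Σ (f ∘ suc)))
 where
 open IsRing isRing using (+-assoc; +-comm; +-identityˡ; +-identityʳ; -‿inverseˡ; -‿inverseʳ; *-assoc; *-identityˡ; *-identityʳ; distribˡ; distribʳ; zeroˡ; zeroʳ)

 +L : ∀ {x y z} → y ≡ z → (x + y) ≡ (x + z)
 +L = cong (_+_ _)

 +R : ∀ {x y z} → x ≡ y → (x + z) ≡ (y + z)
 +R {z = z} = cong (_+ z)

 *L : ∀ {x y z} → y ≡ z → (x * y) ≡ (x * z)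
 *L = cong (_*_ _)

 *R : ∀ {x y z} → x ≡ y → (x * z) ≡ (y * z)
 *R {z = z} = cong (_* z)

 Σ-cong : ∀ {n} {f g : Fin n → A} → (∀ i → f i ≡ g i) → Σ f ≡ Σ g
 Σ-cong {zero} {f} {g} h = trans (Σ-nil f) (sym (Σ-nil g))
 Σ-cong {suc n} {f} {g} h = trans (Σ-suc f) (trans (cong₂ _+_ (h zero) (Σ-cong (h ∘ suc))) (sym (Σ-suc g)))

 Σ-zero : ∀ {n} {f : Fin n → A} → (∀ i → f i ≡ 0#) → Σ f ≡ 0#
 Σ-zero {zero} {f} h = Σ-nil f
 Σ-zero {suc n} {f} h = trans (Σ-suc f) (trans (cong₂ _+_ (h zero) (Σ-zero (h ∘ suc))) (+-identityˡ 0#))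

 interchange : ∀ w x y z → ((w + x) + (y + z)) ≡ ((w + y) + (x + z))
 interchange w x y z = trans (+-assoc w x (y + z)) (trans (cong (w +_)
  (trans (sym (+-assoc x y z)) (trans (cong (_+ z) (+-comm x y)) (+-assoc y x z)))) (sym (+-assoc w y (x + z))))

 Σ-+ : ∀ {n} (f g : Fin n → A) → Σ (λ i → f i + g i) ≡ (Σ f + Σ g)
 Σ-+ {zero} f g = trans (Σ-nil _) (sym (trans (cong₂ _+_ (Σ-nil f) (Σ-nil g)) (+-identityˡ 0#)))
 Σ-+ {suc n} f g = trans (Σ-suc _) (trans (+L (Σ-+ (f ∘ suc) (g ∘ suc)))
  (trans (interchange _ _ _ _) (sym (cong₂ _+_ (Σ-suc f) (Σ-suc g)))))

 Σ-*ˡ : ∀ {n} x (f : Fin n → A) → Σ (λ i → x * f i) ≡ (x * Σ f)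
 Σ-*ˡ {zero} x f = trans (Σ-nil _) (sym (trans (cong (x *_) (Σ-nil f)) (zeroʳ x)))
 Σ-*ˡ {suc n} x f = trans (Σ-suc _) (trans (+L (Σ-*ˡ x (f ∘ suc)))
  (trans (sym (distribˡ x _ _)) (cong (x *_) (sym (Σ-suc f)))))

 Σ-*ʳ : ∀ {n} x (f : Fin n → A) → Σ (λ i → f i * x) ≡ (Σ f * x)
 Σ-*ʳ {zero} x f = trans (Σ-nil _) (sym (trans (cong (_* x) (Σ-nil f)) (zeroˡ x)))
 Σ-*ʳ {suc n} x f = trans (Σ-suc _) (trans (+L (Σ-*ʳ x (f ∘ suc)))
  (trans (sym (distribʳ x _ _)) (cong (_* x) (sym (Σ-suc f)))))

 Σ-swap : ∀ {m n} (f : Fin m → Fin n → A) → Σ (λ i → Σ (f i)) ≡ Σ (λ j → Σ (λ i → f i j))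
 Σ-swap {zero} f = trans (Σ-nil _) (sym (Σ-zero (λ j → Σ-nil _)))
 Σ-swap {suc m} f = trans (Σ-suc _) (trans (+L (Σ-swap (f ∘ suc)))
  (trans (sym (Σ-+ _ _)) (Σ-cong (λ j → sym (Σ-suc _)))))

 δ : ∀ {n} → Fin n → Fin n → A
 δ zero zero = 1#
 δ zero (suc _) = 0#
 δ (suc _) zero = 0#
 δ (suc i) (suc j) = δ i j

 Σ-δˡ : ∀ {n} (i : Fin n) (f : Fin n → A) → Σ (λ k → δ i k * f k) ≡ f i
 Σ-δˡ zero f = trans (Σ-suc _) (trans (cong₂ _+_ (*-identityˡ _) (Σ-zero (λ k → zeroˡ _))) (+-identityʳ _))
 Σ-δˡ (suc i) f = trans (Σ-suc _) (trans (cong₂ _+_ (zeroˡ _) (Σ-δˡ i (f ∘ suc))) (+-identityˡ _))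

 Σ-δʳ : ∀ {n} (j : Fin n) (f : Fin n → A) → Σ (λ k → f k * δ k j) ≡ f j
 Σ-δʳ zero f = trans (Σ-suc _) (trans (cong₂ _+_ (*-identityʳ _) (Σ-zero (λ k → zeroʳ _))) (+-identityʳ _))
 Σ-δʳ (suc j) f = trans (Σ-suc _) (trans (cong₂ _+_ (zeroʳ _) (Σ-δʳ j (f ∘ suc))) (+-identityˡ _))

 Mat : ℕ → Set
 Mat n = Fin n → Fin n → A

 infix 4 _≈_
 _≈_ : ∀ {n} → Mat n → Mat n → Set
 M ≈ N = ∀ i j → M i j ≡ N i j

 infixr 7 _⊠_
 _⊠_ : ∀ {n} → Mat n → Mat n → Mat n
 (M ⊠ N) i j = Σ (λ k → M i k * N k j)

 ⊠-cong : ∀ {n} {M M' N N' : Mat n} → M ≈ M' → N ≈ N' → (M ⊠ N) ≈ (M' ⊠ N')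
 ⊠-cong h h' i j = Σ-cong (λ k → cong₂ _*_ (h i k) (h' k j))

 ⊠-assoc : ∀ {n} (L M N : Mat n) → ((L ⊠ M) ⊠ N) ≈ (L ⊠ (M ⊠ N))
 ⊠-assoc L M N i j = begin
  Σ (λ k → Σ (λ l → L i l * M l k) * N k j)      ≡⟨ Σ-cong (λ k → sym (Σ-*ʳ _ _)) ⟩
  Σ (λ k → Σ (λ l → (L i l * M l k) * N k j))    ≡⟨ Σ-swap _ ⟩
  Σ (λ l → Σ (λ k → (L i l * M l k) * N k j))    ≡⟨ Σ-cong (λ l → trans (Σ-cong (λ k → *-assoc _ _ _)) (Σ-*ˡ _ _)) ⟩
  Σ (λ l → L i l * Σ (λ k → M l k * N k j))      ∎
  where open ≡-Reasoning

 ⊠-identityˡ : ∀ {n} (M : Mat n) → (δ ⊠ M) ≈ M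
 ⊠-identityˡ M i j = Σ-δˡ i (λ k → M k j)

 ⊠-identityʳ : ∀ {n} (M : Mat n) → (M ⊠ δ) ≈ M
 ⊠-identityʳ M i j = Σ-δʳ j (M i)

 ≈-trans : ∀ {n} {L M N : Mat n} → L ≈ M → M ≈ N → L ≈ N
 ≈-trans h h' i j = trans (h i j) (h' i j)

 ≈-sym : ∀ {n} {M N : Mat n} → M ≈ N → N ≈ M
 ≈-sym h i j = sym (h i j)

 ≈-refl : ∀ {n} {M : Mat n} → M ≈ M
 ≈-refl i j = refl

 Invertible : ∀ {n} → Mat n → Set
 Invertible {n} M = ∃ λ (N : Mat n) → (M ⊠ N ≈ δ) × (N ⊠ M ≈ δ)

 ext : ∀ {n} → Mat n → Mat (suc n)
 ext M zero zero = 1#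
 ext M zero (suc _) = 0#
 ext M (suc _) zero = 0#
 ext M (suc i) (suc j) = M i j

 upper : ∀ {n} → (Fin n → A) → Mat (suc n)
 upper u zero zero = 1#
 upper u zero (suc j) = u j
 upper u (suc i) j = δ (suc i) j

 lower : ∀ {n} → (Fin n → A) → Mat (suc n)
 lower l zero j = δ zero j
 lower l (suc i) zero = l i
 lower l (suc i) (suc j) = δ i j

 diag₀ : ∀ {n} → A → Mat (suc n)
 diag₀ d zero zero = d
 diag₀ d zero (suc _) = 0#
 diag₀ d (suc i) j = δ (suc i) j

 e₀ : ∀ {n} → A → Fin n → A
 e₀ x zero = x
 e₀ x (suc _) = 0#

 ext-⊠ : ∀ {n} (X : Mat n) (N : Mat (suc n)) j →
  ((ext X ⊠ N) zero j ≡ N zero j) × (∀ i → (ext X ⊠ N) (suc i) j ≡ Σ (λ k → X i k * N (suc k) j))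
 ext-⊠ X N j =
  trans (Σ-suc _) (trans (cong₂ _+_ (*-identityˡ _) (Σ-zero (λ k → zeroˡ _))) (+-identityʳ _)) ,
  λ i → trans (Σ-suc _) (trans (+R (zeroˡ _)) (+-identityˡ _))

 -- A row vector times a matrix; (N ⊠ E) i is N i ·v E definitionally.
 _·v_ : ∀ {n} → (Fin n → A) → Mat n → Fin n → A
 (v ·v E) j = Σ (λ k → v k * E k j)

 ·v-ext : ∀ {n} (v : Fin (suc n) → A) (X : Mat n) →
  ((v ·v ext X) zero ≡ v zero) × (∀ j → (v ·v ext X) (suc j) ≡ ((v ∘ suc) ·v X) j)
 ·v-ext v X =
  trans (Σ-suc _) (trans (cong₂ _+_ (*-identityʳ _) (Σ-zero (λ k → zeroʳ _))) (+-identityʳ _)) ,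
  λ j → trans (Σ-suc _) (trans (+R (zeroʳ _)) (+-identityˡ _))

 ·v-upper : ∀ {n} (v : Fin (suc n) → A) (u : Fin n → A) →
  ((v ·v upper u) zero ≡ v zero) × (∀ j → (v ·v upper u) (suc j) ≡ ((v zero * u j) + v (suc j)))
 ·v-upper v u =
  trans (Σ-suc _) (trans (cong₂ _+_ (*-identityʳ _) (Σ-zero (λ k → zeroʳ _))) (+-identityʳ _)) ,
  λ j → trans (Σ-suc _) (+L (Σ-δʳ j (v ∘ suc)))

 ·v-lower : ∀ {n} (v : Fin (suc n) → A) (l : Fin n → A) →
  ((v ·v lower l) zero ≡ (v zero + Σ (λ k → v (suc k) * l k))) × (∀ j → (v ·v lower l) (suc j) ≡ v (suc j))
 ·v-lower v l =
  trans (Σ-suc _) (+R (*-identityʳ _)) ,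
  λ j → trans (Σ-suc _) (trans (cong₂ _+_ (zeroʳ _) (Σ-δʳ j (v ∘ suc))) (+-identityˡ _))

 ·v-diag₀ : ∀ {n} (v : Fin (suc n) → A) d →
  ((v ·v diag₀ d) zero ≡ (v zero * d)) × (∀ j → (v ·v diag₀ d) (suc j) ≡ v (suc j))
 ·v-diag₀ v d =
  trans (Σ-suc _) (trans (+L (Σ-zero (λ k → zeroʳ _))) (+-identityʳ _)) ,
  λ j → trans (Σ-suc _) (trans (cong₂ _+_ (zeroʳ _) (Σ-δʳ j (v ∘ suc))) (+-identityˡ _))

 upper-⊠ : ∀ {n} (u : Fin n → A) (N : Mat (suc n)) j →
  ((upper u ⊠ N) zero j ≡ (N zero j + Σ (λ k → u k * N (suc k) j))) × (∀ i → (upper u ⊠ N) (suc i) j ≡ N (suc i) j)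
 upper-⊠ u N j =
  trans (Σ-suc _) (+R (*-identityˡ _)) ,
  λ i → trans (Σ-suc _) (trans (cong₂ _+_ (zeroˡ _) (Σ-δˡ i (λ k → N (suc k) j))) (+-identityˡ _))

 data Elem : ∀ {n} → Mat n → Set where
  dia : ∀ {n} d → Elem (diag₀ {n} d)
  upp : ∀ {n} x → Elem (upper {suc n} (e₀ x))
  low : ∀ {n} x → Elem (lower {suc n} (e₀ x))
  sub : ∀ {n} {M : Mat n} → Elem M → Elem (ext M)

 data Gen : ∀ {n} → Mat n → Set where
  idn : ∀ {n} {M : Mat n} → M ≈ δ → Gen M
  elm : ∀ {n} {M N : Mat n} → Elem N → M ≈ N → Gen M
  mul : ∀ {n} {L M N : Mat n} → Gen M → Gen N → L ≈ (M ⊠ N) → Gen L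

 gen-ext : ∀ {n} {M : Mat n} → Gen M → Gen (ext M)
 gen-ext (idn h) = idn λ { zero zero → refl ; zero (suc _) → refl ; (suc _) zero → refl ; (suc i) (suc j) → h i j }
 gen-ext (elm e h) = elm (sub e) λ { zero zero → refl ; zero (suc _) → refl ; (suc _) zero → refl ; (suc i) (suc j) → h i j }
 gen-ext (mul {L = L} {M} {N} p q h) = mul (gen-ext p) (gen-ext q)
  λ { zero zero → sym (proj₁ (ext-⊠ M (ext N) zero))
   ; zero (suc j) → sym (proj₁ (ext-⊠ M (ext N) (suc j)))
   ; (suc i) zero → sym (trans (proj₂ (ext-⊠ M (ext N) zero) i) (Σ-zero (λ k → zeroʳ _)))
   ; (suc i) (suc j) → trans (h i j) (sym (proj₂ (ext-⊠ M (ext N) (suc j)) i)) }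

 upper-inverse : ∀ {n} (u : Fin n → A) → (upper (λ k → - u k) ⊠ upper u) ≈ δ
 upper-inverse u zero zero = proj₁ (·v-upper _ u)
 upper-inverse u zero (suc j) = trans (proj₂ (·v-upper _ u) j) (trans (+R (*-identityˡ _)) (-‿inverseʳ _))
 upper-inverse u (suc i) zero = proj₁ (·v-upper _ u)
 upper-inverse u (suc i) (suc j) = trans (proj₂ (·v-upper _ u) j) (trans (+R (zeroˡ _)) (+-identityˡ _))

 lower-inverse : ∀ {n} (l : Fin n → A) → (lower (λ k → - l k) ⊠ lower l) ≈ δ
 lower-inverse l zero zero = trans (proj₁ (·v-lower _ l)) (trans (+L (Σ-zero (λ k → zeroˡ _))) (+-identityʳ _))
 lower-inverse l zero (suc j) = proj₂ (·v-lower _ l) j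
 lower-inverse l (suc i) zero = trans (proj₁ (·v-lower _ l)) (trans (+L (Σ-δˡ i l)) (-‿inverseˡ _))
 lower-inverse l (suc i) (suc j) = proj₂ (·v-lower _ l) j

 -- Transvections between neighbouring coordinates suffice: conjugating the one
 -- between coordinates 0 and 1 by the block matrix ext X turns its row e₀ into e₀ X.
 gen-upper : ∀ {n} (u : Fin n → A) → Gen (upper u)
 gen-upper {zero} u = idn λ { zero zero → refl }
 gen-upper {suc n} u =
  mul (mul (gen-ext (gen-upper (λ k → - u (suc k)))) (mul (elm (upp 1#) ≈-refl) (gen-ext (gen-upper (u ∘ suc))) ≈-refl) ≈-refl)
    (elm (upp (u zero + (- 1#))) ≈-refl) check
  where
  X X⁻¹ : Mat (suc n)
  X = upper (u ∘ suc)
  X⁻¹ = upper (λ k → - u (suc k))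
  v : Fin (suc n) → A
  v zero = 1#
  v (suc k) = u (suc k)
  step₁ : (upper (e₀ 1#) ⊠ ext X) ≈ (λ { zero zero → 1# ; zero (suc j) → v j ; (suc i) j → ext X (suc i) j })
  step₁ zero zero = trans (proj₁ (upper-⊠ (e₀ 1#) (ext X) zero)) (trans (+L (Σ-zero (λ k → zeroʳ _))) (+-identityʳ _))
  step₁ zero (suc j) = trans (proj₁ (upper-⊠ (e₀ 1#) (ext X) (suc j))) (trans (+-identityˡ _)
   (trans (Σ-cong {g = λ k → δ zero k * X k j} λ { zero → refl ; (suc k) → refl }) (trans (Σ-δˡ zero _) (X₀ j))))
   where
   X₀ : ∀ j → X zero j ≡ v j
   X₀ zero = refl
   X₀ (suc j) = refl
  step₁ (suc i) j = proj₂ (upper-⊠ (e₀ 1#) (ext X) j) i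
  step₂ : (ext X⁻¹ ⊠ (upper (e₀ 1#) ⊠ ext X)) ≈ upper v
  step₂ zero zero = trans (proj₁ (ext-⊠ X⁻¹ (upper (e₀ 1#) ⊠ ext X) zero)) (step₁ zero zero)
  step₂ zero (suc j) = trans (proj₁ (ext-⊠ X⁻¹ (upper (e₀ 1#) ⊠ ext X) (suc j))) (step₁ zero (suc j))
  step₂ (suc i) zero = trans (proj₂ (ext-⊠ X⁻¹ (upper (e₀ 1#) ⊠ ext X) zero) i) (Σ-zero (λ k → trans (*L (step₁ (suc k) zero)) (zeroʳ _)))
  step₂ (suc i) (suc j) = trans (proj₂ (ext-⊠ X⁻¹ (upper (e₀ 1#) ⊠ ext X) (suc j)) i)
   (trans (Σ-cong (λ k → cong (X⁻¹ i k *_) (step₁ (suc k) (suc j)))) (upper-inverse (u ∘ suc) i j))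
  check : upper u ≈ ((ext X⁻¹ ⊠ (upper (e₀ 1#) ⊠ ext X)) ⊠ upper (e₀ (u zero + (- 1#))))
  check i j = sym (trans (⊠-cong step₂ (≈-refl {M = upper (e₀ (u zero + (- 1#)))}) i j) (last i j))
   where
   last : (upper v ⊠ upper (e₀ (u zero + (- 1#)))) ≈ upper u
   last zero zero = proj₁ (·v-upper (upper v zero) _)
   last zero (suc zero) = trans (proj₂ (·v-upper (upper v zero) _) zero) (trans (cong (_+ 1#) (*-identityˡ _))
    (trans (+-assoc _ _ _) (trans (+L (-‿inverseˡ 1#)) (+-identityʳ _))))
   last zero (suc (suc j)) = trans (proj₂ (·v-upper (upper v zero) _) (suc j)) (trans (+R (zeroʳ _)) (+-identityˡ _))
   last (suc i) zero = proj₁ (·v-upper (upper v (suc i)) _)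
   last (suc i) (suc j) = trans (proj₂ (·v-upper (upper v (suc i)) _) j) (trans (+R (zeroˡ _)) (+-identityˡ _))

 gen-lower : ∀ {n} (l : Fin n → A) → Gen (lower l)
 gen-lower {zero} l = idn λ { zero zero → refl }
 gen-lower {suc n} l =
  mul (mul (mul (gen-ext (gen-lower (l ∘ suc))) (elm (low 1#) ≈-refl) ≈-refl) (gen-ext (gen-lower (λ k → - l (suc k)))) ≈-refl)
    (elm (low (l zero + (- 1#))) ≈-refl) check
  where
  X X⁻¹ : Mat (suc n)
  X = lower (l ∘ suc)
  X⁻¹ = lower (λ k → - l (suc k))
  v : Fin (suc n) → A
  v zero = 1#
  v (suc k) = l (suc k)
  X-inverse : (X ⊠ X⁻¹) ≈ δ
  X-inverse zero zero = trans (proj₁ (·v-lower _ _)) (trans (+L (Σ-zero (λ k → zeroˡ _))) (+-identityʳ _))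
  X-inverse zero (suc j) = proj₂ (·v-lower _ _) j
  X-inverse (suc i) zero = trans (proj₁ (·v-lower _ (λ k → - l (suc k)))) (trans (+L (Σ-δˡ i (λ k → - l (suc k)))) (-‿inverseʳ _))
  X-inverse (suc i) (suc j) = proj₂ (·v-lower _ _) j
  X₀ : ∀ i → X i zero ≡ v i
  X₀ zero = refl
  X₀ (suc i) = refl
  step₁ : (ext X ⊠ lower (e₀ 1#)) ≈ (λ { zero j → δ zero j ; (suc i) zero → v i ; (suc i) (suc j) → X i j })
  step₁ zero zero = trans (proj₁ (·v-lower _ _)) (trans (+L (Σ-zero (λ k → zeroˡ _))) (+-identityʳ _))
  step₁ zero (suc j) = proj₂ (·v-lower _ _) j
  step₁ (suc i) zero = trans (proj₁ (·v-lower _ _)) (trans (+-identityˡ _)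
   (trans (Σ-cong {g = λ k → X i k * δ k zero} λ { zero → refl ; (suc k) → refl }) (trans (Σ-δʳ zero _) (X₀ i))))
  step₁ (suc i) (suc j) = proj₂ (·v-lower _ _) j
  step₂ : ((ext X ⊠ lower (e₀ 1#)) ⊠ ext X⁻¹) ≈ lower v
  step₂ zero zero = trans (proj₁ (·v-ext _ X⁻¹)) (step₁ zero zero)
  step₂ zero (suc j) = trans (proj₂ (·v-ext _ X⁻¹) j) (Σ-zero (λ k → trans (*R (step₁ zero (suc k))) (zeroˡ _)))
  step₂ (suc i) zero = trans (proj₁ (·v-ext _ X⁻¹)) (step₁ (suc i) zero)
  step₂ (suc i) (suc j) = trans (proj₂ (·v-ext _ X⁻¹) j)
   (trans (Σ-cong (λ k → cong (_* X⁻¹ k j) (step₁ (suc i) (suc k)))) (X-inverse i j))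
  check : lower l ≈ (((ext X ⊠ lower (e₀ 1#)) ⊠ ext X⁻¹) ⊠ lower (e₀ (l zero + (- 1#))))
  check i j = sym (trans (⊠-cong step₂ (≈-refl {M = lower (e₀ (l zero + (- 1#)))}) i j) (last i j))
   where
   t = l zero + (- 1#)
   last : (lower v ⊠ lower (e₀ t)) ≈ lower l
   last zero zero = trans (proj₁ (·v-lower _ _)) (trans (+L (Σ-zero (λ k → zeroˡ _))) (+-identityʳ _))
   last zero (suc j) = proj₂ (·v-lower _ _) j
   last (suc zero) zero = trans (proj₁ (·v-lower _ _)) (trans (cong (1# +_) (Σ-δˡ zero (e₀ t)))
    (trans (+-comm _ _) (trans (+-assoc _ _ _) (trans (+L (-‿inverseˡ 1#)) (+-identityʳ _)))))
   last (suc (suc i)) zero = trans (proj₁ (·v-lower _ _)) (trans (+L (Σ-δˡ (suc i) (e₀ t))) (+-identityʳ _))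
   last (suc i) (suc j) = proj₂ (·v-lower _ _) j

 private
  twice : ∀ x → ((1# + 1#) * x) ≡ (x + x)
  twice x = trans (distribʳ x 1# 1#) (cong₂ _+_ (*-identityˡ x) (*-identityˡ x))

  twice' : ∀ x → (x * (1# + 1#)) ≡ (x + x)
  twice' x = trans (distribˡ x 1# 1#) (cong₂ _+_ (*-identityʳ x) (*-identityʳ x))

 diag₀-row : ∀ {n} d (N : Mat (suc n)) j →
  ((diag₀ d ⊠ N) zero j ≡ (d * N zero j)) × (∀ i → (diag₀ d ⊠ N) (suc i) j ≡ N (suc i) j)
 diag₀-row d N j =
  trans (Σ-suc _) (trans (+L (Σ-zero (λ k → zeroˡ _))) (+-identityʳ _)) ,
  λ i → trans (Σ-suc _) (trans (cong₂ _+_ (zeroˡ _) (Σ-δˡ i (λ k → N (suc k) j))) (+-identityˡ _))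

 -- A transvection is conjugate to its square, so a multiplicative invariant is 1 on it.
 upper-square : ∀ {n} (u : Fin n → A) → (diag₀ (1# + 1#) ⊠ upper u) ≈ ((upper u ⊠ upper u) ⊠ diag₀ (1# + 1#))
 upper-square {n} u i zero = trans (lhs i) (sym (trans (proj₁ (·v-diag₀ ((upper u ⊠ upper u) i) (1# + 1#))) (*R (proj₁ (·v-upper (upper u i) u)))))
  where
  lhs : ∀ i → (diag₀ (1# + 1#) ⊠ upper u) i zero ≡ (upper u i zero * (1# + 1#))
  lhs zero = trans (proj₁ (diag₀-row (1# + 1#) (upper u) zero)) (trans (*-identityʳ _) (sym (*-identityˡ _)))
  lhs (suc i) = trans (proj₂ (diag₀-row (1# + 1#) (upper u) zero) i) (sym (zeroˡ _))
 upper-square {n} u i (suc j) = trans (lhs i) (sym (trans (proj₂ (·v-diag₀ ((upper u ⊠ upper u) i) (1# + 1#)) j) (proj₂ (·v-upper (upper u i) u) j)))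
  where
  lhs : ∀ i → (diag₀ (1# + 1#) ⊠ upper u) i (suc j) ≡ ((upper u i zero * u j) + upper u i (suc j))
  lhs zero = trans (proj₁ (diag₀-row (1# + 1#) (upper u) (suc j))) (trans (twice (u j)) (+R (sym (*-identityˡ _))))
  lhs (suc i) = trans (proj₂ (diag₀-row (1# + 1#) (upper u) (suc j)) i) (sym (trans (+R (zeroˡ _)) (+-identityˡ _)))

 lower-square : ∀ {n} (l : Fin n → A) → (diag₀ (1# + 1#) ⊠ (lower l ⊠ lower l)) ≈ (lower l ⊠ diag₀ (1# + 1#))
 lower-square {n} l i zero = trans (lhs i) (sym (proj₁ (·v-diag₀ (lower l i) (1# + 1#))))
  where
  sq₀ : (lower l ⊠ lower l) zero zero ≡ 1#
  sq₀ = trans (proj₁ (·v-lower (lower l zero) l)) (trans (+L (Σ-zero (λ k → zeroˡ _))) (+-identityʳ _))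
  lhs : ∀ i → (diag₀ (1# + 1#) ⊠ (lower l ⊠ lower l)) i zero ≡ (lower l i zero * (1# + 1#))
  lhs zero = trans (proj₁ (diag₀-row (1# + 1#) (lower l ⊠ lower l) zero)) (trans (cong ((1# + 1#) *_) sq₀) (trans (*-identityʳ _) (sym (*-identityˡ _))))
  lhs (suc i) = trans (proj₂ (diag₀-row (1# + 1#) (lower l ⊠ lower l) zero) i)
   (trans (proj₁ (·v-lower (lower l (suc i)) l)) (trans (+L (Σ-δˡ i l)) (sym (twice' (l i)))))
 lower-square {n} l i (suc j) = trans (lhs i) (sym (proj₂ (·v-diag₀ (lower l i) (1# + 1#)) j))
  where
  lhs : ∀ i → (diag₀ (1# + 1#) ⊠ (lower l ⊠ lower l)) i (suc j) ≡ lower l i (suc j)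
  lhs zero = trans (proj₁ (diag₀-row (1# + 1#) (lower l ⊠ lower l) (suc j)))
   (trans (cong ((1# + 1#) *_) (proj₂ (·v-lower (lower l zero) l) j)) (zeroʳ _))
  lhs (suc i) = trans (proj₂ (diag₀-row (1# + 1#) (lower l ⊠ lower l) (suc j)) i) (proj₂ (·v-lower (lower l (suc i)) l) j)

 module Elimination
  (_≟_ : DecidableEquality A)
  (inverse : ∀ x → ¬ (x ≡ 0#) → ∃[ y ] (((x * y) ≡ 1#) × ((y * x) ≡ 1#)))
  (1≢0 : ¬ (1# ≡ 0#))
  where
  private
   pivot : ∀ {n} (M : Mat (suc n)) → (∀ (N : Mat n) → Gen N) → ¬ (M zero zero ≡ 0#) → Gen M
   pivot {n} M IH M₀₀≢0 =
    mul (gen-lower l) (mul (elm (dia p) ≈-refl) (mul (gen-ext (IH M')) (gen-upper u) ≈-refl) ≈-refl) check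
    where
    p = M zero zero
    q = proj₁ (inverse p M₀₀≢0)
    pq = proj₁ (proj₂ (inverse p M₀₀≢0))
    qp = proj₂ (proj₂ (inverse p M₀₀≢0))
    l u : Fin n → A
    l i = M (suc i) zero * q
    u j = q * M zero (suc j)
    M' : Mat n
    M' i j = M (suc i) (suc j) + (- (M (suc i) zero * u j))
    E = ext M' ⊠ upper u
    E₀ : ∀ j → (diag₀ p ⊠ E) zero j ≡ M zero j
    E₀ zero = trans (Σ-suc _) (trans (cong₂ _+_ (cong (p *_) (proj₁ (·v-upper (ext M' zero) u))) (Σ-zero (λ k → zeroˡ _)))
     (trans (+-identityʳ _) (*-identityʳ p)))
    E₀ (suc j) = trans (Σ-suc _) (trans (cong₂ _+_ (cong (p *_) (proj₂ (·v-upper (ext M' zero) u) j)) (Σ-zero (λ k → zeroˡ _)))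
     (trans (+-identityʳ _) (trans (cong (p *_) (trans (+-identityʳ _) (*-identityˡ _)))
     (trans (sym (*-assoc _ _ _)) (trans (*R pq) (*-identityˡ _))))))
    Eₛ : ∀ i j → (diag₀ p ⊠ E) (suc i) j ≡ E (suc i) j
    Eₛ i j = trans (Σ-suc _) (trans (cong₂ _+_ (zeroˡ _) (Σ-δˡ i (λ k → E (suc k) j))) (+-identityˡ _))
    low-row : ∀ (N : Mat (suc n)) i j → (lower l ⊠ N) (suc i) j ≡ ((l i * N zero j) + N (suc i) j)
    low-row N i j = trans (Σ-suc _) (+L (Σ-δˡ i (λ k → N (suc k) j)))
    top-row : ∀ (N : Mat (suc n)) j → (lower l ⊠ N) zero j ≡ N zero j
    top-row N j = Σ-δˡ zero (λ k → N k j)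
    check : M ≈ (lower l ⊠ (diag₀ p ⊠ E))
    check zero j = sym (trans (top-row (diag₀ p ⊠ E) j) (E₀ j))
    check (suc i) zero = sym (trans (low-row (diag₀ p ⊠ E) i zero) (trans (cong₂ _+_ (cong (l i *_) (E₀ zero))
     (trans (Eₛ i zero) (proj₁ (·v-upper (ext M' (suc i)) u)))) (trans (+-identityʳ _)
     (trans (*-assoc _ _ _) (trans (*L qp) (*-identityʳ _))))))
    check (suc i) (suc j) = sym (trans (low-row (diag₀ p ⊠ E) i (suc j)) (trans (cong₂ _+_
     (trans (cong (l i *_) (E₀ (suc j))) (*-assoc _ _ _))
     (trans (Eₛ i (suc j)) (trans (proj₂ (·v-upper (ext M' (suc i)) u) j) (trans (+R (zeroˡ _)) (+-identityˡ _)))))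
     (trans (+-comm _ _) (trans (+-assoc _ _ _) (trans (+L (-‿inverseˡ _)) (+-identityʳ _))))))

   search : ∀ {n} (f : Fin n → A) → (∃[ i ] ¬ (f i ≡ 0#)) ⊎ (∀ i → f i ≡ 0#)
   search {zero} f = inj₂ λ ()
   search {suc n} f with f zero ≟ 0#
   ... | no h = inj₁ (zero , h)
   ... | yes h with search (f ∘ suc)
   ...   | inj₁ (i , k) = inj₁ (suc i , k)
   ...   | inj₂ k = inj₂ λ { zero → h ; (suc i) → k i }

  gen : ∀ {n} (M : Mat n) → Gen M
  gen {zero} M = idn λ ()
  gen {suc n} M with search (λ i → M i zero)
  ... | inj₁ (zero , h) = pivot M gen h
  ... | inj₁ (suc i , h) with M zero zero ≟ 0#
  ...   | no k = pivot M gen k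
  ...   | yes k = mul (gen-upper (λ j → - δ i j)) (pivot (upper (δ i) ⊠ M) gen
    λ e → h (trans (sym (trans (cong₂ _+_ k (Σ-δˡ i (λ j → M (suc j) zero))) (+-identityˡ _)))
         (trans (sym (proj₁ (upper-⊠ (δ i) M zero))) e)))
    λ r c → sym (trans (sym (⊠-assoc (upper (λ j → - δ i j)) (upper (δ i)) M r c)) (trans (⊠-cong (upper-inverse (δ i)) (≈-refl {M = M}) r c) (⊠-identityˡ M r c)))
  gen {suc n} M | inj₂ h = mul (pivot M₁ gen 1≢0) (elm (dia 0#) ≈-refl) check
   where
   M₁ : Mat (suc n)
   M₁ zero zero = 1#
   M₁ (suc i) zero = 0#
   M₁ i (suc j) = M i (suc j)
   col : ∀ i j → M₁ i (suc j) ≡ M i (suc j)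
   col zero j = refl
   col (suc i) j = refl
   check : M ≈ (M₁ ⊠ diag₀ 0#)
   check i zero = sym (trans (proj₁ (·v-diag₀ (M₁ i) 0#)) (trans (zeroʳ _) (sym (h i))))
   check i (suc j) = sym (trans (proj₂ (·v-diag₀ (M₁ i) 0#) j) (col i j))

  ext-cong : ∀ {n} {M N : Mat n} → M ≈ N → ext M ≈ ext N
  ext-cong h zero zero = refl
  ext-cong h zero (suc _) = refl
  ext-cong h (suc _) zero = refl
  ext-cong h (suc i) (suc j) = h i j

  ext-δ : ∀ {n} → ext (δ {n}) ≈ δ
  ext-δ zero zero = refl
  ext-δ zero (suc _) = refl
  ext-δ (suc _) zero = refl
  ext-δ (suc i) (suc j) = refl

  ext-mul : ∀ {n} (M N : Mat n) → ext (M ⊠ N) ≈ (ext M ⊠ ext N)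
  ext-mul M N zero zero = sym (proj₁ (ext-⊠ M (ext N) zero))
  ext-mul M N zero (suc j) = sym (proj₁ (ext-⊠ M (ext N) (suc j)))
  ext-mul M N (suc i) zero = sym (trans (proj₂ (ext-⊠ M (ext N) zero) i) (Σ-zero (λ k → zeroʳ _)))
  ext-mul M N (suc i) (suc j) = sym (proj₂ (ext-⊠ M (ext N) (suc j)) i)

  open import Algebra.Bundles using (Ring)
  open import Level using (0ℓ)
  private
   R : Ring 0ℓ 0ℓ
   R = record { isRing = isRing }
  open import Algebra.Properties.Ring R using (-‿involutive)

  upper-cong : ∀ {n} {u v : Fin n → A} → (∀ k → u k ≡ v k) → upper u ≈ upper v
  upper-cong h zero zero = refl
  upper-cong h zero (suc j) = h j
  upper-cong h (suc i) j = refl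

  lower-cong : ∀ {n} {u v : Fin n → A} → (∀ k → u k ≡ v k) → lower u ≈ lower v
  lower-cong h zero j = refl
  lower-cong h (suc i) zero = h i
  lower-cong h (suc i) (suc j) = refl

  upper-invertible : ∀ {n} (u : Fin n → A) → Invertible (upper u)
  upper-invertible u = upper (λ k → - u k) ,
   ≈-trans (⊠-cong {M = upper u} (upper-cong (λ k → sym (-‿involutive (u k)))) ≈-refl) (upper-inverse (λ k → - u k)) ,
   upper-inverse u

  lower-invertible : ∀ {n} (u : Fin n → A) → Invertible (lower u)
  lower-invertible u = lower (λ k → - u k) ,
   ≈-trans (⊠-cong {M = lower u} (lower-cong (λ k → sym (-‿involutive (u k)))) ≈-refl) (lower-inverse (λ k → - u k)) ,
   lower-inverse u

  diag₀-mul : ∀ {n} x y → (diag₀ {n} x ⊠ diag₀ y) ≈ diag₀ (x * y)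
  diag₀-mul x y zero zero = proj₁ (·v-diag₀ _ y)
  diag₀-mul x y zero (suc j) = proj₂ (·v-diag₀ _ y) j
  diag₀-mul x y (suc i) zero = trans (proj₁ (·v-diag₀ _ y)) (zeroˡ y)
  diag₀-mul x y (suc i) (suc j) = proj₂ (·v-diag₀ _ y) j

  diag₀-cong : ∀ {n x y} → x ≡ y → diag₀ {n} x ≈ diag₀ y
  diag₀-cong refl = ≈-refl

  diag₀-1 : ∀ {n} → diag₀ {n} 1# ≈ δ
  diag₀-1 zero zero = refl
  diag₀-1 zero (suc j) = refl
  diag₀-1 (suc i) j = refl

  inv-mul : ∀ {n} {M N : Mat n} → Invertible M → Invertible N → Invertible (M ⊠ N)
  inv-mul {n} {M} {N} (M' , p , p') (N' , q , q') = (N' ⊠ M') , go M N N' M' p q , go N' M' M N q' p'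
   where
   go : ∀ (X Y Y' X' : Mat n) → X ⊠ X' ≈ δ → Y ⊠ Y' ≈ δ → ((X ⊠ Y) ⊠ (Y' ⊠ X')) ≈ δ
   go X Y Y' X' h k = ≈-trans (⊠-assoc X Y (Y' ⊠ X')) (≈-trans (⊠-cong (≈-refl {M = X})
    (≈-trans (≈-sym (⊠-assoc Y Y' X')) (≈-trans (⊠-cong k (≈-refl {M = X'})) (⊠-identityˡ X')))) h)

  inv-≈ : ∀ {n} {M N : Mat n} → M ≈ N → Invertible N → Invertible M
  inv-≈ h (N' , p , p') = N' , ≈-trans (⊠-cong h (≈-refl {M = N'})) p , ≈-trans (⊠-cong (≈-refl {M = N'}) h) p'

  ext-invertible : ∀ {n} {M : Mat n} → Invertible M → Invertible (ext M)
  ext-invertible {M = M} (M' , p , p') = ext M' ,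
   ≈-trans (≈-sym (ext-mul M M')) (≈-trans (ext-cong p) ext-δ) ,
   ≈-trans (≈-sym (ext-mul M' M)) (≈-trans (ext-cong p') ext-δ)

  module Dichotomy
   (Sing : ∀ {n} → Mat n → Set)
   (sing-≈ : ∀ {n} {M N : Mat n} → M ≈ N → Sing N → Sing M)
   (sing-diag : ∀ {n} → Sing (diag₀ {n} 0#))
   (sing-ext : ∀ {n} {M : Mat n} → Sing M → Sing (ext M))
   (sing-left : ∀ {n} {M N : Mat n} → Sing M → Invertible N → Sing (M ⊠ N))
   (sing-right : ∀ {n} {M N : Mat n} → Sing N → Sing (M ⊠ N))
   where
   elem-dichotomy : ∀ {n} {E : Mat n} → Elem E → Invertible E ⊎ Sing E
   elem-dichotomy (dia d) with d ≟ 0#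
   ... | yes refl = inj₂ sing-diag
   ... | no h = inj₁ (diag₀ d' ,
     ≈-trans (diag₀-mul d d') (≈-trans (diag₀-cong dd') diag₀-1) ,
     ≈-trans (diag₀-mul d' d) (≈-trans (diag₀-cong d'd) diag₀-1))
    where
    d' = proj₁ (inverse d h)
    dd' = proj₁ (proj₂ (inverse d h))
    d'd = proj₂ (proj₂ (inverse d h))
   elem-dichotomy (upp x) = inj₁ (upper-invertible (e₀ x))
   elem-dichotomy (low x) = inj₁ (lower-invertible (e₀ x))
   elem-dichotomy (sub e) with elem-dichotomy e
   ... | inj₁ h = inj₁ (ext-invertible h)
   ... | inj₂ h = inj₂ (sing-ext h)

   gen-dichotomy : ∀ {n} {M : Mat n} → Gen M → Invertible M ⊎ Sing M
   gen-dichotomy (idn h) = inj₁ (inv-≈ h (δ , ⊠-identityˡ δ , ⊠-identityˡ δ))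
   gen-dichotomy (elm e h) with elem-dichotomy e
   ... | inj₁ k = inj₁ (inv-≈ h k)
   ... | inj₂ k = inj₂ (sing-≈ h k)
   gen-dichotomy (mul {M = M} {N} p q h) with gen-dichotomy p | gen-dichotomy q
   ... | _ | inj₂ k = inj₂ (sing-≈ h (sing-right {M = M} k))
   ... | inj₁ i | inj₁ j = inj₁ (inv-≈ h (inv-mul i j))
   ... | inj₂ k | inj₁ j = inj₂ (sing-≈ h (sing-left k j))

   dichotomy : ∀ {n} (M : Mat n) → Invertible M ⊎ Sing M
   dichotomy M = gen-dichotomy (gen M)

  Kernel : ∀ {n} → Mat n → Set
  Kernel {n} M = ∃ λ (v : Fin n → A) → (∃[ i ] ¬ (v i ≡ 0#)) × (∀ i → Σ (λ k → M i k * v k) ≡ 0#)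

  ⊠-vec : ∀ {n} (M N : Mat n) (v : Fin n → A) i → Σ (λ k → (M ⊠ N) i k * v k) ≡ Σ (λ l → M i l * Σ (λ k → N l k * v k))
  ⊠-vec M N v i = trans (Σ-cong (λ k → sym (Σ-*ʳ _ _))) (trans (Σ-swap _)
   (Σ-cong (λ l → trans (Σ-cong (λ k → *-assoc _ _ _)) (Σ-*ˡ _ _))))

  invertible⊎kernel : ∀ {n} (M : Mat n) → Invertible M ⊎ Kernel M
  invertible⊎kernel = dichotomy
   where
   left : ∀ {n} {M N : Mat n} → Kernel M → Invertible N → Kernel (M ⊠ N)
   left {n} {M} {N} (v , (i , vᵢ≢0) , h) (N' , p , _) = w , nonzero (search w) ,
     λ r → trans (⊠-vec M N w r) (trans (Σ-cong (λ l → *L (Nw l))) (h r))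
    where
    w : Fin n → A
    w k = Σ (λ l → N' k l * v l)
    Nw : ∀ l → Σ (λ k → N l k * w k) ≡ v l
    Nw l = trans (sym (⊠-vec N N' v l)) (trans (Σ-cong (λ k → *R (p l k))) (Σ-δˡ l v))
    nonzero : (∃[ i ] ¬ (w i ≡ 0#)) ⊎ (∀ i → w i ≡ 0#) → ∃[ i ] ¬ (w i ≡ 0#)
    nonzero (inj₁ k) = k
    nonzero (inj₂ k) = ⊥-elim (vᵢ≢0 (trans (sym (Nw i)) (Σ-zero (λ l → trans (*L (k l)) (zeroʳ _)))))
   right : ∀ {n} {M N : Mat n} → Kernel N → Kernel (M ⊠ N)
   right {n} {M} {N} (v , nz , h) = v , nz , λ i → trans (⊠-vec M N v i) (Σ-zero (λ l → trans (*L (h l)) (zeroʳ _)))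
   extend : ∀ {n} {M : Mat n} → Kernel M → Kernel (ext M)
   extend {n} {M} (v , (i , k) , h) = w , (suc i , k) , λ
     { zero → trans (Σ-suc _) (trans (cong₂ _+_ (zeroʳ _) (Σ-zero (λ _ → zeroˡ _))) (+-identityˡ _))
     ; (suc r) → trans (Σ-suc _) (trans (cong₂ _+_ (zeroʳ _) (h r)) (+-identityˡ _)) }
    where
    w : Fin (suc n) → A
    w zero = 0#
    w (suc j) = v j
   base : ∀ {n} → Kernel (diag₀ {n} 0#)
   base = δ zero , (zero , 1≢0) , λ
    { zero → trans (Σ-suc _) (trans (cong₂ _+_ (zeroˡ _) (Σ-zero (λ _ → zeroˡ _))) (+-identityˡ _))
    ; (suc r) → trans (Σ-suc _) (trans (cong₂ _+_ (zeroˡ _) (Σ-zero (λ _ → zeroʳ _))) (+-identityˡ _)) }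
   respects : ∀ {n} {M N : Mat n} → M ≈ N → Kernel N → Kernel M
   respects h (v , nz , k) = v , nz , λ i → trans (Σ-cong (λ l → *R (h i l))) (k i)
   open Dichotomy Kernel
    respects base extend left right

module Determinant
 {A : Set} {_+_ _*_ : A → A → A} { -_ : A → A} {0# 1# : A}
 (isCommutativeRing : IsCommutativeRing _≡_ _+_ _*_ -_ 0# 1#)
 (Σ : ∀ {n} → (Fin n → A) → A)
 (Σ-nil : ∀ (f : Fin zero → A) → Σ f ≡ 0#)
 (Σ-suc : ∀ {n} (f : Fin (suc n) → A) → Σ f ≡ (f zero + Σ (f ∘ suc)))
 where
 open import Algebra.Bundles using (Ring)
 open import Data.Fin using (punchIn; punchOut; inject₁; toℕ)
 open import Data.Fin.Properties using (_≟_; punchIn-punchOut; punchInᵢ≢i; punchIn-injective; suc-injective)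
 isRing : IsRing _≡_ _+_ _*_ -_ 0# 1#
 isRing = IsCommutativeRing.isRing isCommutativeRing

 open IsCommutativeRing isCommutativeRing using (+-assoc; +-comm; +-identityˡ; +-identityʳ; -‿inverseˡ; -‿inverseʳ; *-assoc; *-comm; *-identityˡ; *-identityʳ; distribˡ; distribʳ; zeroˡ; zeroʳ)
 open Matrix isRing Σ Σ-nil Σ-suc public

 private
  R : Ring 0ℓ 0ℓ
  R = record { isRing = isRing }

 open import Algebra.Properties.Ring R using (-‿distribˡ-*; -‿distribʳ-*; -‿+-comm; -0#≈0#)

 sgn : ℕ → A → A
 sgn zero x = x
 sgn (suc zero) x = - x
 sgn (suc (suc m)) x = sgn m x

 det : ∀ n → Mat n → A
 det zero M = 1#
 det (suc n) M = Σ (λ j → sgn (toℕ j) (M zero j * det n (λ r c → M (suc r) (punchIn j c))))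

 minor : ∀ {n} → Fin (suc n) → Mat (suc n) → Mat n
 minor j M r c = M (suc r) (punchIn j c)

 det-cong : ∀ n {M N : Mat n} → M ≈ N → det n M ≡ det n N
 det-cong zero h = refl
 det-cong (suc n) h = Σ-cong λ j → cong (sgn (toℕ j))
  (cong₂ _*_ (h zero j) (det-cong n (λ r c → h (suc r) (punchIn j c))))

 sgn-zero : ∀ m → sgn m 0# ≡ 0#
 sgn-zero zero = refl
 sgn-zero (suc zero) = -0#≈0#
 sgn-zero (suc (suc m)) = sgn-zero m

 sgn-comb : ∀ m y z u v → sgn m ((y * u) + (z * v)) ≡ ((y * sgn m u) + (z * sgn m v))
 sgn-comb zero y z u v = refl
 sgn-comb (suc zero) y z u v = trans (sym (-‿+-comm _ _)) (cong₂ _+_ (-‿distribʳ-* y u) (-‿distribʳ-* z v))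
 sgn-comb (suc (suc m)) y z u v = sgn-comb m y z u v

 sgn-suc : ∀ m x → (sgn m x + sgn (suc m) x) ≡ 0#
 sgn-suc zero x = -‿inverseʳ x
 sgn-suc (suc zero) x = -‿inverseˡ x
 sgn-suc (suc (suc m)) x = sgn-suc m x

 swap-* : ∀ x y z → (x * (y * z)) ≡ (y * (x * z))
 swap-* x y z = trans (sym (*-assoc x y z)) (trans (cong (_* z) (*-comm x y)) (*-assoc y x z))

 det-linear : ∀ n (k : Fin n) y z {X Y Z : Mat n} →
  (∀ i → X i k ≡ ((y * Y i k) + (z * Z i k))) →
  (∀ i j → ¬ (j ≡ k) → X i j ≡ Y i j) → (∀ i j → ¬ (j ≡ k) → X i j ≡ Z i j) →
  det n X ≡ ((y * det n Y) + (z * det n Z))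
 det-linear (suc n) k y z {X} {Y} {Z} hk hY hZ = begin
  Σ (term X)                                               ≡⟨ Σ-cong step ⟩
  Σ (λ j → (y * term Y j) + (z * term Z j))                ≡⟨ Σ-+ _ _ ⟩
  (Σ (λ j → y * term Y j) + Σ (λ j → z * term Z j))        ≡⟨ cong₂ _+_ (Σ-*ˡ y _) (Σ-*ˡ z _) ⟩
  ((y * det (suc n) Y) + (z * det (suc n) Z))              ∎
  where
  open ≡-Reasoning
  term : Mat (suc n) → Fin (suc n) → A
  term M j = sgn (toℕ j) (M zero j * det n (minor j M))
  step : ∀ j → term X j ≡ ((y * term Y j) + (z * term Z j))
  step j with j ≟ k
  ... | yes refl = trans (cong (sgn (toℕ j)) (trans (cong (_* det n (minor j X)) (hk zero))
      (trans (distribʳ _ _ _) (cong₂ _+_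
       (trans (*-assoc _ _ _) (*L (*L (det-cong n λ r c → hY (suc r) (punchIn j c) (punchInᵢ≢i j c)))))
       (trans (*-assoc _ _ _) (*L (*L (det-cong n λ r c → hZ (suc r) (punchIn j c) (punchInᵢ≢i j c)))))))))
      (sgn-comb (toℕ j) y z _ _)
  ... | no j≢k = trans (cong (sgn (toℕ j)) (trans (*L IH) (trans (distribˡ _ _ _) (cong₂ _+_
       (trans (swap-* _ _ _) (*L (*R (hY zero j j≢k))))
       (trans (swap-* _ _ _) (*L (*R (hZ zero j j≢k))))))))
      (sgn-comb (toℕ j) y z _ _)
   where
   k' : Fin n
   k' = punchOut j≢k
   at : ∀ (M : Mat (suc n)) i → M (suc i) (punchIn j k') ≡ M (suc i) k
   at M i = cong (M (suc i)) (punchIn-punchOut j≢k)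
   off : ∀ c → ¬ (c ≡ k') → ¬ (punchIn j c ≡ k)
   off c c≢k' e = c≢k' (punchIn-injective j c k' (trans e (sym (punchIn-punchOut j≢k))))
   IH : det n (minor j X) ≡ ((y * det n (minor j Y)) + (z * det n (minor j Z)))
   IH = det-linear n k' y z
    (λ i → trans (at X i) (trans (hk (suc i)) (sym (cong₂ _+_ (*L (at Y i)) (*L (at Z i))))))
    (λ i c c≢k' → hY (suc i) (punchIn j c) (off c c≢k')) (λ i c c≢k' → hZ (suc i) (punchIn j c) (off c c≢k'))

 det-zero-column : ∀ n (k : Fin n) (M : Mat n) → (∀ i → M i k ≡ 0#) → det n M ≡ 0#
 det-zero-column n k M h = trans
  (det-linear n k 0# 0# {M} {M} {M} (λ i → trans (h i) (sym (trans (cong₂ _+_ (zeroˡ _) (zeroˡ _)) (+-identityˡ _))))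
   (λ _ _ _ → refl) (λ _ _ _ → refl))
  (trans (cong₂ _+_ (zeroˡ _) (zeroˡ _)) (+-identityˡ _))

 Σ-adjacent : ∀ {n} (k : Fin n) (f : Fin (suc n) → A) →
  (∀ j → ¬ (j ≡ inject₁ k) → ¬ (j ≡ suc k) → f j ≡ 0#) → Σ f ≡ (f (inject₁ k) + f (suc k))
 Σ-adjacent zero f h = trans (Σ-suc f) (+L (trans (Σ-suc _)
  (trans (+L (Σ-zero (λ i → h (suc (suc i)) (λ ()) (λ ())))) (+-identityʳ _))))
 Σ-adjacent (suc k) f h = trans (Σ-suc f) (trans (cong₂ _+_ (h zero (λ ()) (λ ()))
  (Σ-adjacent k (f ∘ suc) (λ j p q → h (suc j) (p ∘ suc-injective) (q ∘ suc-injective)))) (+-identityˡ _))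

 punch-adjacent : ∀ {n} (k : Fin (suc n)) j → ¬ (j ≡ inject₁ k) → ¬ (j ≡ suc k) →
  ∃ λ k' → (punchIn j (inject₁ k') ≡ inject₁ k) × (punchIn j (suc k') ≡ suc k)
 punch-adjacent zero zero p q = ⊥-elim (p refl)
 punch-adjacent (suc k) zero p q = k , refl , refl
 punch-adjacent {suc n} zero (suc zero) p q = ⊥-elim (q refl)
 punch-adjacent {suc n} zero (suc (suc j)) p q = zero , refl , refl
 punch-adjacent {suc n} (suc k) (suc j) p q with punch-adjacent k j (p ∘ cong suc) (q ∘ cong suc)
 ... | k' , e , e' = suc k' , cong suc e , cong suc e'
 punch-adjacent {zero} zero (suc zero) p q = ⊥-elim (q refl)

 punch-swap : ∀ {n} (k : Fin n) c →
  (punchIn (inject₁ k) c ≡ punchIn (suc k) c) ⊎ ((punchIn (inject₁ k) c ≡ suc k) × (punchIn (suc k) c ≡ inject₁ k))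
 punch-swap zero zero = inj₂ (refl , refl)
 punch-swap zero (suc c) = inj₁ refl
 punch-swap (suc k) zero = inj₁ refl
 punch-swap (suc k) (suc c) with punch-swap k c
 ... | inj₁ e = inj₁ (cong suc e)
 ... | inj₂ (e , e') = inj₂ (cong suc e , cong suc e')

 toℕ-inject₁ : ∀ {n} (k : Fin n) → toℕ (inject₁ k) ≡ toℕ k
 toℕ-inject₁ zero = refl
 toℕ-inject₁ (suc k) = cong suc (toℕ-inject₁ k)

 det-alternating : ∀ n (k : Fin n) (M : Mat (suc n)) → (∀ i → M i (inject₁ k) ≡ M i (suc k)) → det (suc n) M ≡ 0#
 det-alternating (suc n) k M h = trans (Σ-adjacent k term off) (trans (+R same) (sgn-suc (toℕ k) _))
  where
  term : Fin (suc (suc n)) → A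
  term j = sgn (toℕ j) (M zero j * det (suc n) (minor j M))
  off : ∀ j → ¬ (j ≡ inject₁ k) → ¬ (j ≡ suc k) → term j ≡ 0#
  off j p q with punch-adjacent k j p q
  ... | k' , e , e' = trans (cong (sgn (toℕ j)) (trans (*L (det-alternating n k' (minor j M)
      (λ i → trans (cong (M (suc i)) e) (trans (h (suc i)) (cong (M (suc i)) (sym e')))))) (zeroʳ _))) (sgn-zero (toℕ j))
  same : term (inject₁ k) ≡ sgn (toℕ k) (M zero (suc k) * det (suc n) (minor (suc k) M))
  same = cong₂ sgn (toℕ-inject₁ k) (cong₂ _*_ (h zero) (det-cong (suc n) λ r c → eq r c (punch-swap k c)))
   where
   eq : ∀ r c → _ → M (suc r) (punchIn (inject₁ k) c) ≡ M (suc r) (punchIn (suc k) c)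
   eq r c (inj₁ e) = cong (M (suc r)) e
   eq r c (inj₂ (e , e')) = trans (cong (M (suc r)) e) (trans (sym (h (suc r))) (cong (M (suc r)) (sym e')))

 -- The effect of right multiplication by an elementary matrix on every row:
 -- it scales one entry, or adds to one entry a multiple of a neighbouring one.
 data Column {n} (E : Mat n) : Set where
  scale : ∀ k d → (∀ v → (v ·v E) k ≡ (v k * d)) → (∀ v j → ¬ (j ≡ k) → (v ·v E) j ≡ v j) → Column E
  add : ∀ k l x → (∀ v → (v ·v E) k ≡ (v k + (v l * x))) → (∀ v j → ¬ (j ≡ k) → (v ·v E) j ≡ v j) →
   (∀ (M : Mat n) → (∀ i → M i k ≡ M i l) → det n M ≡ 0#) → ¬ (l ≡ k) → Column E

 data Column' : ∀ {n} → Mat n → Set where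
  scale : ∀ {n} {E : Mat n} k d → (∀ v → (v ·v E) k ≡ (v k * d)) → (∀ v j → ¬ (j ≡ k) → (v ·v E) j ≡ v j) → Column' E
  addʳ : ∀ {n} {E : Mat (suc n)} (k : Fin n) x → (∀ v → (v ·v E) (suc k) ≡ (v (suc k) + (v (inject₁ k) * x))) →
   (∀ v j → ¬ (j ≡ suc k) → (v ·v E) j ≡ v j) → Column' E
  addˡ : ∀ {n} {E : Mat (suc n)} (k : Fin n) x → (∀ v → (v ·v E) (inject₁ k) ≡ (v (inject₁ k) + (v (suc k) * x))) →
   (∀ v j → ¬ (j ≡ inject₁ k) → (v ·v E) j ≡ v j) → Column' E

 column' : ∀ {n} {E : Mat n} → Elem E → Column' E
 column' (dia d) = scale zero d (λ v → proj₁ (·v-diag₀ v d)) λ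
  { v zero h → ⊥-elim (h refl) ; v (suc j) h → proj₂ (·v-diag₀ v d) j }
 column' (upp x) = addʳ zero x (λ v → trans (proj₂ (·v-upper v (e₀ x)) zero) (+-comm _ _)) λ
  { v zero h → proj₁ (·v-upper v (e₀ x)) ; v (suc zero) h → ⊥-elim (h refl)
  ; v (suc (suc j)) h → trans (proj₂ (·v-upper v (e₀ x)) (suc j)) (trans (+R (zeroʳ _)) (+-identityˡ _)) }
 column' (low x) = addˡ zero x (λ v → trans (proj₁ (·v-lower v (e₀ x))) (+L (trans (Σ-suc _)
   (trans (+L (Σ-zero (λ k → zeroʳ _))) (+-identityʳ _))))) λ
  { v zero h → ⊥-elim (h refl) ; v (suc j) h → proj₂ (·v-lower v (e₀ x)) j }
 column' (sub {M = X} e) with column' e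
 ... | scale k d h h' = scale (suc k) d (λ v → trans (proj₂ (·v-ext v X) k) (h _)) λ
  { v zero _ → proj₁ (·v-ext v X) ; v (suc j) q → trans (proj₂ (·v-ext v X) j) (h' _ j (q ∘ cong suc)) }
 ... | addʳ k x h h' = addʳ (suc k) x (λ v → trans (proj₂ (·v-ext v X) (suc k)) (h _)) λ
  { v zero _ → proj₁ (·v-ext v X) ; v (suc j) q → trans (proj₂ (·v-ext v X) j) (h' _ j (q ∘ cong suc)) }
 ... | addˡ k x h h' = addˡ (suc k) x (λ v → trans (proj₂ (·v-ext v X) (inject₁ k)) (h _)) λ
  { v zero _ → proj₁ (·v-ext v X) ; v (suc j) q → trans (proj₂ (·v-ext v X) j) (h' _ j (q ∘ cong suc)) }

 inject₁≢suc : ∀ {n} (k : Fin n) → ¬ (inject₁ k ≡ suc k)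
 inject₁≢suc zero ()
 inject₁≢suc (suc k) e = inject₁≢suc k (suc-injective e)

 column : ∀ {n} {E : Mat n} → Elem E → Column E
 column e with column' e
 ... | scale k d h h' = scale k d h h'
 ... | addʳ {n} k x h h' = add (suc k) (inject₁ k) x h h' (λ M q → det-alternating n k M (λ i → sym (q i))) (inject₁≢suc k)
 ... | addˡ {n} k x h h' = add (inject₁ k) (suc k) x h h' (λ M q → det-alternating n k M q) (λ e → inject₁≢suc k (sym e))

 det-elem : ∀ {n} {E : Mat n} → Elem E → ∃[ c ] (∀ M → det n (M ⊠ E) ≡ (det n M * c))
 det-elem {n} {E} e with column e
 ... | scale k d h h' = d , λ M → trans (det-linear n k d 0# {M ⊠ E} {M} {M}
   (λ i → trans (h (M i)) (trans (*-comm _ _) (sym (trans (+L (zeroˡ _)) (+-identityʳ _)))))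
   (λ i j q → h' (M i) j q) (λ i j q → h' (M i) j q))
   (trans (+L (zeroˡ _)) (trans (+-identityʳ _) (*-comm _ _)))
 ... | add k l x h h' alt l≢k = 1# , λ M → trans (det-linear n k 1# x {M ⊠ E} {M} {copy M}
   (λ i → trans (h (M i)) (cong₂ _+_ (sym (*-identityˡ _)) (trans (*-comm _ _) (*L (sym (copy-at M i))))))
   (λ i j q → h' (M i) j q) (λ i j q → trans (h' (M i) j q) (sym (copy-off M i j q))))
   (trans (cong₂ _+_ (*-identityˡ _) (trans (*L (alt (copy M) (λ i → trans (copy-at M i) (sym (copy-off M i l l≢k))))) (zeroʳ _)))
   (trans (+-identityʳ _) (sym (*-identityʳ _))))
  where
  copy : Mat n → Mat n
  copy M i j with j ≟ k
  ... | yes _ = M i l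
  ... | no _ = M i j
  copy-at : ∀ M i → copy M i k ≡ M i l
  copy-at M i with k ≟ k
  ... | yes _ = refl
  ... | no q = ⊥-elim (q refl)
  copy-off : ∀ M i j → ¬ (j ≡ k) → copy M i j ≡ M i j
  copy-off M i j q with j ≟ k
  ... | yes r = ⊥-elim (q r)
  ... | no _ = refl

 det-δ : ∀ n → det n δ ≡ 1#
 det-δ zero = refl
 det-δ (suc n) = trans (Σ-suc _) (trans (cong₂ _+_ (trans (*-identityˡ _) (det-δ n))
  (Σ-zero (λ j → trans (cong (sgn (toℕ (suc j))) (zeroˡ _)) (sgn-zero (toℕ (suc j)))))) (+-identityʳ _))

 det-gen : ∀ {n} {N : Mat n} → Gen N → ∃[ c ] (∀ M → det n (M ⊠ N) ≡ (det n M * c))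
 det-gen {n} (idn h) = 1# , λ M → trans (det-cong n (≈-trans (⊠-cong (≈-refl {M = M}) h) (⊠-identityʳ M))) (sym (*-identityʳ _))
 det-gen {n} (elm e h) with det-elem e
 ... | c , k = c , λ M → trans (det-cong n (⊠-cong (≈-refl {M = M}) h)) (k M)
 det-gen {n} (mul {M = X} {Y} p q h) with det-gen p | det-gen q
 ... | c , k | d , l = c * d , λ M → trans (det-cong n (≈-trans (⊠-cong (≈-refl {M = M}) h) (≈-sym (⊠-assoc M X Y))))
     (trans (l (M ⊠ X)) (trans (*R (k M)) (*-assoc _ _ _)))

 det-first : ∀ n (M : Mat (suc n)) → (∀ j → M zero (suc j) ≡ 0#) → det (suc n) M ≡ (M zero zero * det n (minor zero M))
 det-first n M h = trans (Σ-suc _) (trans (+L (Σ-zero (λ j →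
  trans (cong (sgn (toℕ (suc j))) (trans (*R (h j)) (zeroˡ _))) (sgn-zero (toℕ (suc j)))))) (+-identityʳ _))

 replace : ∀ {n} → Fin n → (Fin n → A) → Mat n → Mat n
 replace k x M i j with j ≟ k
 ... | yes _ = x i
 ... | no _ = M i j

 replace-cong : ∀ {n} (k : Fin n) {x y} M → (∀ i → x i ≡ y i) → replace k x M ≈ replace k y M
 replace-cong k M h i j with j ≟ k
 ... | yes _ = h i
 ... | no _ = refl

 replace-all : ∀ {n} (P : A → Set) (k : Fin n) {x} {M : Mat n} → (∀ i → P (x i)) → (∀ i j → P (M i j)) → ∀ i j → P (replace k x M i j)
 replace-all P k h h' i j with j ≟ k
 ... | yes _ = h i
 ... | no _ = h' i j

 det-replace-δ : ∀ n (k : Fin n) x → det n (replace k x δ) ≡ x k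
 det-replace-δ (suc n) zero x = trans (det-first n (replace zero x δ) (λ j → refl))
  (trans (*L (trans (det-cong n (λ r c → refl)) (det-δ n))) (*-identityʳ _))
 det-replace-δ (suc (suc n)) (suc k) x = trans (Σ-suc _) (trans (cong₂ _+_
  (trans (*-identityˡ _) (trans (det-cong (suc n) eq) (det-replace-δ (suc n) k (x ∘ suc))))
  (Σ-zero λ j → trans (cong (sgn (toℕ (suc j))) (trans (*L (det-zero-column (suc n) zero (minor (suc j) (replace (suc k) x δ)) λ i → refl)) (zeroʳ _)))
   (sgn-zero (toℕ (suc j))))) (+-identityʳ _))
  where
  eq : minor zero (replace (suc k) x δ) ≈ replace k (x ∘ suc) δ
  eq r c with c ≟ k
  ... | yes _ = refl
  ... | no _ = refl

 ⊠-replace : ∀ {n} (M : Mat n) k x → (M ⊠ replace k x δ) ≈ replace k (λ i → Σ (λ l → M i l * x l)) M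
 ⊠-replace M k x i j with j ≟ k
 ... | yes _ = refl
 ... | no _ = Σ-δʳ j (M i)

 module Field
  (_≟A_ : DecidableEquality A)
  (inverse : ∀ x → ¬ (x ≡ 0#) → ∃[ y ] ((x * y) ≡ 1#))
  (1≢0 : ¬ (1# ≡ 0#))
  where
  open Elimination _≟A_ (λ x h → proj₁ (inverse x h) , proj₂ (inverse x h) , trans (*-comm _ _) (proj₂ (inverse x h))) 1≢0 public

  det-⊠ : ∀ n (M N : Mat n) → det n (M ⊠ N) ≡ (det n M * det n N)
  det-⊠ n M N with det-gen (gen N)
  ... | c , h = trans (h M) (*L (sym (trans (det-cong n (≈-sym (⊠-identityˡ N))) (trans (h δ) (trans (*R (det-δ n)) (*-identityˡ c))))))

  cramer : ∀ n (M : Mat n) (k : Fin n) x → det n (replace k (λ i → Σ (λ l → M i l * x l)) M) ≡ (det n M * x k)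
  cramer n M k x = trans (det-cong n (≈-sym (⊠-replace M k x))) (trans (det-⊠ n M _) (*L (det-replace-δ n k x)))

module RationalVectors where
 import Data.Fin.Properties as Fin
 open import Data.Rational using (_+_; _*_; -_; _-_)
 open StarRingSolver
 open RationalAlgebra

 sumℚ : ∀ {n} → (Fin n → ℚ) → ℚ
 sumℚ {zero} f = 0ℚ
 sumℚ {suc n} f = f zero + sumℚ (f ∘ suc)

 isCommutativeRingℚ : IsCommutativeRing _≡_ _+_ _*_ -_ 0ℚ 1ℚ
 isCommutativeRingℚ = ℚ.+-*-isCommutativeRing

 1≢0ℚ : ¬ (1ℚ ≡ 0ℚ)
 1≢0ℚ ()

module Integrality where
 open import Data.Integer as ℤ using (ℤ; +_; -[1+_])
 import Data.Integer.Properties as ℤ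
 open import Data.Nat.Coprimality as Coprime using (Coprime; coprime-divisor; 1-coprimeTo)
 open import Data.Nat.Divisibility as ℕ using (_∣_; divides; ∣-refl)
 open import Data.Nat.GCD using (module Bézout; module GCD)
 open import Data.Rational using (mkℚ; _+_; _*_; -_; _-_; _<_; _≟_; _/_; ↥_; ↧ₙ_; *<*)
 open import Data.Rational.Properties using (↥p/↧p≡p; /-cong; drop-*<*)
 open RationalAlgebra

 ℤ→ℚ-mk : ∀ z → ℤ→ℚ z ≡ mkℚ z 0 (Coprime.sym (1-coprimeTo ℤ.∣ z ∣))
 ℤ→ℚ-mk z = ↥p/↧p≡p (mkℚ z 0 (Coprime.sym (1-coprimeTo ℤ.∣ z ∣)))

 ℤ→ℚ-+ : ∀ x y → ℤ→ℚ (x ℤ.+ y) ≡ ℤ→ℚ x + ℤ→ℚ y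
 ℤ→ℚ-+ x y = sym (trans (cong₂ _+_ (ℤ→ℚ-mk x) (ℤ→ℚ-mk y)) (/-cong (cong₂ ℤ._+_ (ℤ.*-identityʳ x) (ℤ.*-identityʳ y)) refl))

 ℤ→ℚ-* : ∀ x y → ℤ→ℚ (x ℤ.* y) ≡ ℤ→ℚ x * ℤ→ℚ y
 ℤ→ℚ-* x y = sym (cong₂ _*_ (ℤ→ℚ-mk x) (ℤ→ℚ-mk y))

 ℤ→ℚ-neg : ∀ x → ℤ→ℚ (ℤ.- x) ≡ - ℤ→ℚ x
 ℤ→ℚ-neg x = trans (ℤ→ℚ-mk (ℤ.- x)) (trans (go x) (cong -_ (sym (ℤ→ℚ-mk x))))
  where
  go : ∀ x → mkℚ (ℤ.- x) 0 (Coprime.sym (1-coprimeTo ℤ.∣ ℤ.- x ∣)) ≡ - mkℚ x 0 (Coprime.sym (1-coprimeTo ℤ.∣ x ∣))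
  go (+ zero) = refl
  go (+ suc n) = refl
  go -[1+ n ] = refl

 ↥-ℤ→ℚ : ∀ z → ↥ ℤ→ℚ z ≡ z
 ↥-ℤ→ℚ z = cong ↥_ (ℤ→ℚ-mk z)

 ℤ→ℚ-injective : ∀ {x y} → ℤ→ℚ x ≡ ℤ→ℚ y → x ≡ y
 ℤ→ℚ-injective {x} {y} h = trans (sym (↥-ℤ→ℚ x)) (trans (cong ↥_ h) (↥-ℤ→ℚ y))

 ℤ→ℚ-mono-< : ∀ {x y} → x ℤ.< y → ℤ→ℚ x < ℤ→ℚ y
 ℤ→ℚ-mono-< {x} {y} h = subst₂ _<_ (sym (ℤ→ℚ-mk x)) (sym (ℤ→ℚ-mk y))
  (*<* (subst₂ ℤ._<_ (sym (ℤ.*-identityʳ x)) (sym (ℤ.*-identityʳ y)) h))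

 ℤ→ℚ-cancel-< : ∀ {x y} → ℤ→ℚ x < ℤ→ℚ y → x ℤ.< y
 ℤ→ℚ-cancel-< {x} {y} h = subst₂ ℤ._<_ (ℤ.*-identityʳ x) (ℤ.*-identityʳ y)
  (drop-*<* (subst₂ _<_ (ℤ→ℚ-mk x) (ℤ→ℚ-mk y) h))

 Int : ℚ → Set
 Int q = ∃[ z ] (q ≡ ℤ→ℚ z)

 abstract
  fromℕ : ℕ → ℚ
  fromℕ n = ℤ→ℚ (+ n)

  fromℕ≡ : ∀ n → fromℕ n ≡ ℤ→ℚ (+ n)
  fromℕ≡ n = refl

  fromℕ-0 : fromℕ 0 ≡ 0ℚ
  fromℕ-0 = refl

  fromℕ-1 : fromℕ 1 ≡ 1ℚ
  fromℕ-1 = refl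

  fromℕ-+ : ∀ m n → fromℕ (m ℕ.+ n) ≡ fromℕ m + fromℕ n
  fromℕ-+ m n = ℤ→ℚ-+ (+ m) (+ n)

  fromℕ-* : ∀ m n → fromℕ (m ℕ.* n) ≡ fromℕ m * fromℕ n
  fromℕ-* m n = trans (cong ℤ→ℚ (ℤ.pos-* m n)) (ℤ→ℚ-* (+ m) (+ n))

  fromℕ-mono-< : ∀ {m n} → m ℕ.< n → fromℕ m < fromℕ n
  fromℕ-mono-< h = ℤ→ℚ-mono-< (ℤ.+<+ h)

  fromℕ-injective : ∀ {m n} → fromℕ m ≡ fromℕ n → m ≡ n
  fromℕ-injective h = ℤ.+-injective (ℤ→ℚ-injective h)

 int-ℕ : ∀ n → Int (fromℕ n)
 int-ℕ n = + n , fromℕ≡ n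

 int-0 : Int 0ℚ
 int-0 = + 0 , refl

 int-1 : Int 1ℚ
 int-1 = + 1 , refl

 int-+ : ∀ {p q} → Int p → Int q → Int (p + q)
 int-+ (x , refl) (y , refl) = x ℤ.+ y , sym (ℤ→ℚ-+ x y)

 int-* : ∀ {p q} → Int p → Int q → Int (p * q)
 int-* (x , refl) (y , refl) = x ℤ.* y , sym (ℤ→ℚ-* x y)

 int-neg : ∀ {p} → Int p → Int (- p)
 int-neg (x , refl) = ℤ.- x , sym (ℤ→ℚ-neg x)

 int-- : ∀ {p q} → Int p → Int q → Int (p - q)
 int-- h k = int-+ h (int-neg k)

 int? : ∀ q → Dec (Int q)
 int? q with q ≟ ℤ→ℚ (↥ q)
 ... | yes h = yes (↥ q , h)
 ... | no h = no λ { (z , refl) → h (cong ℤ→ℚ (sym (↥-ℤ→ℚ z))) }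

 fromℕ-pos : ∀ {n} → 0 ℕ.< n → 0ℚ < fromℕ n
 fromℕ-pos {n} h = subst (_< fromℕ n) fromℕ-0 (fromℕ-mono-< h)

 natural : ∀ {q} → Int q → 0ℚ < q → ∃[ n ] ((0 ℕ.< n) × (q ≡ fromℕ n))
 natural (+ n , refl) h with ℤ→ℚ-cancel-< {+ 0} {+ n} h
 ... | ℤ.+<+ k = n , k , sym (fromℕ≡ n)
 natural (-[1+ n ] , refl) h with ℤ→ℚ-cancel-< {+ 0} { -[1+ n ] } h
 ... | ()

 denominator : ∀ q → ∃[ d ] ((0 ℕ.< d) × Int (fromℕ d * q))
 denominator q = ↧ₙ q , ℕ.>-nonZero⁻¹ (↧ₙ q) , ↥ q , trans (cong (_* q) (fromℕ≡ (↧ₙ q))) (den q)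
  where
  den : ∀ q → ℤ→ℚ (+ (↧ₙ q)) * q ≡ ℤ→ℚ (↥ q)
  den q@(mkℚ n d c) = trans (cong (_* q) (ℤ→ℚ-mk (+ suc d)))
   (trans (/-cong {q₂ = suc d ℕ.* 1} (ℤ.*-comm (+ suc d) n) (trans (ℕ.+-identityʳ (suc d)) (sym (ℕ.*-identityʳ (suc d))))) (cancel n d))
   where
   cancel : ∀ n d → (n ℤ.* (+ suc d)) / (suc d ℕ.* 1) ≡ ℤ→ℚ n
   cancel n d = trans (/-cong {n ℤ.* (+ suc d)} {suc d ℕ.* 1} {n ℤ.* (+ suc d)} {suc d} refl (ℕ.*-identityʳ (suc d))) (ℚ.fromℚᵘ-cong {Data.Rational.Unnormalised.mkℚᵘ (n ℤ.* (+ suc d)) d} {Data.Rational.Unnormalised.mkℚᵘ n 0}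
    (Data.Rational.Unnormalised.*≡* (ℤ.*-identityʳ (n ℤ.* (+ suc d)))))
    where import Data.Rational.Unnormalised

 int-square-root : ∀ q → Int (q * q) → Int q
 int-square-root q (z , h) = ↥ q , trans (sym (↥p/↧p≡p q)) (/-cong {↥ q} {↧ₙ q} {↥ q} {1} refl d≡1)
  where
  n = ℤ.∣ ↥ q ∣
  d = ↧ₙ q
  c : Coprime n d
  c = Coprime.recompute (ℚ-coprime q)
   where
   ℚ-coprime : ∀ q → Coprime ℤ.∣ ↥ q ∣ (↧ₙ q)
   ℚ-coprime (mkℚ n d c) = Coprime.recompute c
  open import Data.Rational.Unnormalised as ℚᵘ using (mkℚᵘ; *≡*)
  cross : (↥ q ℤ.* ↥ q) ℤ.* + 1 ≡ z ℤ.* (+ (d ℕ.* d))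
  cross = go q z h
   where
   go : ∀ q z → q * q ≡ ℤ→ℚ z → (↥ q ℤ.* ↥ q) ℤ.* + 1 ≡ z ℤ.* (+ (↧ₙ q ℕ.* ↧ₙ q))
   go (mkℚ n d c) z h with ℚ.fromℚᵘ-injective {mkℚᵘ (n ℤ.* n) (ℕ.pred (suc d ℕ.* suc d))} {mkℚᵘ z 0} h
   ... | *≡* e = e
  d∣nn : d ∣ n ℕ.* n
  d∣nn = divides (ℤ.∣ z ∣ ℕ.* d) (trans (sym (ℤ.abs-* (↥ q) (↥ q))) (trans (cong ℤ.∣_∣ (trans (sym (ℤ.*-identityʳ (↥ q ℤ.* ↥ q))) cross))
   (trans (ℤ.abs-* z (+ (d ℕ.* d))) (sym (ℕ.*-assoc ℤ.∣ z ∣ d d)))))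
  d≡1 : d ≡ 1
  d≡1 = c (coprime-divisor (Coprime.sym c) d∣nn , ∣-refl)

 int-bezout : ∀ m n → ∃[ d ] ∃[ u ] ∃[ v ] (Int u × Int v × (fromℕ d ≡ u * fromℕ m + v * fromℕ n) × (d ∣ m) × (d ∣ n))
 int-bezout m n with Bézout.lemma m n
 ... | Bézout.result d g (Bézout.+- x y eq) = d , fromℕ x , - fromℕ y , int-ℕ x , int-neg (int-ℕ y) ,
    trans (lem (fromℕ d) (fromℕ y * fromℕ n)) (trans (cong (_- fromℕ y * fromℕ n)
     (trans (sym (trans (fromℕ-+ d (y ℕ.* n)) (cong (_+_ (fromℕ d)) (fromℕ-* y n)))) (trans (cong fromℕ eq) (fromℕ-* x m))))
     (lem' (fromℕ x * fromℕ m) (fromℕ y) (fromℕ n))) , GCD.gcd∣m g , GCD.gcd∣n g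
  where
  lem : ∀ p q → p ≡ (p + q) - q
  lem = solve-∀ ℚ-ring
  lem' : ∀ p q r → p - q * r ≡ p + (- q) * r
  lem' = solve-∀ ℚ-ring
 ... | Bézout.result d g (Bézout.-+ x y eq) = d , - fromℕ x , fromℕ y , int-neg (int-ℕ x) , int-ℕ y ,
    trans (lem (fromℕ d) (fromℕ x * fromℕ m)) (trans (cong (_- fromℕ x * fromℕ m)
     (trans (sym (trans (fromℕ-+ d (x ℕ.* m)) (cong (_+_ (fromℕ d)) (fromℕ-* x m)))) (trans (cong fromℕ eq) (fromℕ-* y n))))
     (lem' (fromℕ y * fromℕ n) (fromℕ x) (fromℕ m))) , GCD.gcd∣m g , GCD.gcd∣n g
  where
  lem : ∀ p q → p ≡ (p + q) - q
  lem = solve-∀ ℚ-ring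
  lem' : ∀ p q r → p - q * r ≡ (- q) * r + p
  lem' = solve-∀ ℚ-ring

 abs-unit : ∀ q → Int q → ∃[ n ] ((q ≡ fromℕ n) ⊎ (q ≡ - fromℕ n))
 abs-unit q (+ n , h) = n , inj₁ (trans h (sym (fromℕ≡ n)))
 abs-unit q (-[1+ n ] , h) = suc n , inj₂ (trans h (trans (ℤ→ℚ-neg (+ suc n)) (cong -_ (sym (fromℕ≡ (suc n))))))

module IntegralDeterminants where
 open import Data.Fin using (punchIn; toℕ)
 open import Data.Rational using (_+_; _*_; -_; _-_; _≤_)
 open StarRingSolver
 open RationalAlgebra
 open RationalVectors
 open Integrality

 module DetInt = Determinant isCommutativeRingℚ sumℚ (λ f → refl) (λ f → refl)

 int-sum : ∀ {n} {f : Fin n → ℚ} → (∀ i → Int (f i)) → Int (sumℚ f)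
 int-sum {zero} h = int-0
 int-sum {suc n} h = int-+ (h zero) (int-sum (h ∘ suc))

 int-det : ∀ n (M : DetInt.Mat n) → (∀ i j → Int (M i j)) → Int (DetInt.det n M)
 int-det zero M h = int-1
 int-det (suc n) M h = int-sum λ j → int-sgn (toℕ j) (int-* (h zero j) (int-det n (λ r c → M (suc r) (punchIn j c)) (λ r c → h (suc r) (punchIn j c))))
  where
  int-sgn : ∀ m {x} → Int x → Int (DetInt.sgn m x)
  int-sgn zero k = k
  int-sgn (suc zero) k = int-neg k
  int-sgn (suc (suc m)) k = int-sgn m k

 unit-square : ∀ {p q} → Int p → Int q → p * q ≡ 1ℚ → p * p ≡ 1ℚ
 unit-square (x , refl) (y , refl) h = trans (sym (ℤ→ℚ-* x x)) (cong ℤ→ℚ (go x y (ℤ→ℚ-injective (trans (ℤ→ℚ-* x y) h))))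
  where
  open import Data.Integer as ℤ using (ℤ; +_; -[1+_])
  import Data.Integer.Properties as ℤ
  import Data.Nat.Properties as ℕ
  abs-one : ∀ x → ℤ.∣ x ∣ ≡ 1 → x ℤ.* x ≡ + 1
  abs-one (+ .1) refl = refl
  abs-one -[1+ zero ] refl = refl
  go : ∀ x y → x ℤ.* y ≡ + 1 → x ℤ.* x ≡ + 1
  go x y e = abs-one x (ℕ.m*n≡1⇒m≡1 ℤ.∣ x ∣ ℤ.∣ y ∣ (trans (sym (ℤ.abs-* x y)) (cong ℤ.∣_∣ e)))

 sqrt-one : ∀ {p} → 0ℚ ≤ p → p * p ≡ 1ℚ → p ≡ 1ℚ
 sqrt-one {p} p≥0 h = go (*-zero {p - 1ℚ} {p + 1ℚ} (trans (lem p) (trans (cong (_- 1ℚ) h) (ℚ.+-inverseʳ 1ℚ))))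
  where
  lem : ∀ p → (p - 1ℚ) * (p + 1ℚ) ≡ p * p - 1ℚ
  lem = solve-∀ ℚ-ring
  lem' : ∀ p → p ≡ (p - 1ℚ) + 1ℚ
  lem' = solve-∀ ℚ-ring
  go : (p - 1ℚ ≡ 0ℚ) ⊎ (p + 1ℚ ≡ 0ℚ) → p ≡ 1ℚ
  go (inj₁ e) = trans (lem' p) (trans (cong (_+ 1ℚ) e) (ℚ.+-identityˡ 1ℚ))
  go (inj₂ e) = ⊥-elim (ℚ.<-irrefl (sym e) (ℚ.<-≤-trans (ℚ.positive⁻¹ 1ℚ)
   (subst (_≤ p + 1ℚ) (ℚ.+-identityˡ 1ℚ) (ℚ.+-monoˡ-≤ 1ℚ p≥0))))

module PrimeResidues where
 open import Data.Fin as Fin using (toℕ; fromℕ<)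
 import Data.Fin.Properties as Fin
 open import Data.Integer as ℤ using (ℤ; +_)
 import Data.Integer.DivMod as ℤ
 import Data.Integer.Properties as ℤ
 open import Data.Nat.Divisibility as ℕ using (_∣_; divides)
 open import Data.Nat.Primality using (Prime; prime⇒irreducible)
 open import Data.Rational using (_+_; _*_; -_; _-_; _<_; _≤_; _≟_)
 open import Relation.Nullary.Decidable using (map′)
 open RationalAlgebra
 open Integrality

 record Dv (p : ℕ) (x : ℚ) : Set where
  constructor dv
  field
   quotient : ℚ
   int-quotient : Int quotient
   quotient-* : x ≡ fromℕ p * quotient

 pos≢0 : ∀ {p} → 0 ℕ.< p → ¬ (fromℕ p ≡ 0ℚ)
 pos≢0 h = <⇒≢0 (fromℕ-pos h)

 dv? : ∀ {p} → 0 ℕ.< p → ∀ x → Dec (Dv p x)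
 dv? {p} h x = map′ to from (int? (r * x))
  where
  r = proj₁ (inv (fromℕ p) (pos≢0 h))
  pr≡1 = proj₂ (inv (fromℕ p) (pos≢0 h))
  lem : ∀ p r x → p * (r * x) ≡ (p * r) * x
  lem = solve-∀ ℚ-ring
  lem' : ∀ p r x → r * (p * x) ≡ (p * r) * x
  lem' = solve-∀ ℚ-ring
  to : Int (r * x) → Dv p x
  to k = dv (r * x) k (sym (trans (lem (fromℕ p) r x) (trans (cong (_* x) pr≡1) (ℚ.*-identityˡ x))))
  from : Dv p x → Int (r * x)
  from (dv t k e) = subst Int (sym (trans (cong (r *_) e) (trans (lem' (fromℕ p) r t) (trans (cong (_* t) pr≡1) (ℚ.*-identityˡ t))))) k

 ∣⇒dv : ∀ {d m} → d ∣ m → Dv d (fromℕ m)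
 ∣⇒dv {d} (divides q refl) = dv (fromℕ q) (int-ℕ q) (trans (fromℕ-* q d) (ℚ.*-comm (fromℕ q) (fromℕ d)))

 dv⇒∣ : ∀ {d m} → 0 ℕ.< d → Dv d (fromℕ m) → d ∣ m
 dv⇒∣ {d} {m} d>0 (dv t int-t e) with m ℕ.≟ 0
 ... | yes refl = d ℕ.∣0
 ... | no m≢0 = go (natural int-t t>0)
  where
  t>0 : 0ℚ < t
  t>0 with ℚ.<-cmp 0ℚ t
  ... | tri< h _ _ = h
  ... | tri≈ _ refl _ = ⊥-elim (m≢0 (fromℕ-injective (trans e (trans (ℚ.*-zeroʳ (fromℕ d)) (sym fromℕ-0)))))
  ... | tri> _ _ h = ⊥-elim (ℚ.<-irrefl refl (ℚ.<-trans (fromℕ-pos (ℕ.n≢0⇒n>0 m≢0)) (subst₂ _<_ (sym e) (ℚ.*-zeroʳ (fromℕ d))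
      (ℚ.*-monoʳ-<-pos (fromℕ d) {{Data.Rational.positive (fromℕ-pos d>0)}} h))))
   where import Data.Rational
  go : ∃[ n ] ((0 ℕ.< n) × (t ≡ fromℕ n)) → d ∣ m
  go (n , _ , refl) = divides n (fromℕ-injective (trans e (trans (ℚ.*-comm (fromℕ d) (fromℕ n)) (sym (fromℕ-* n d)))))

 -- The only arithmetic property of a prime that is needed below.
 prime-dichotomy : ∀ {p} → Prime p → ∀ x → Int x → Dv p x ⊎ (∃[ u ] ∃[ v ] (Int u × Int v × (u * x + v * fromℕ p ≡ 1ℚ)))
 prime-dichotomy {p} pr x int-x = go (abs-unit x int-x)
  where
  nat : ∀ n → (p ∣ n) ⊎ (∃[ u ] ∃[ v ] (Int u × Int v × (u * fromℕ n + v * fromℕ p ≡ 1ℚ)))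
  nat n = pick (int-bezout n p)
   where
   pick : (∃[ d ] ∃[ u ] ∃[ v ] (Int u × Int v × (fromℕ d ≡ u * fromℕ n + v * fromℕ p) × (d ∣ n) × (d ∣ p))) → _
   pick (d , u , v , iu , iv , e , d∣n , d∣p) with prime⇒irreducible pr d∣p
   ... | inj₁ refl = inj₂ (u , v , iu , iv , trans (sym e) fromℕ-1)
   ... | inj₂ refl = inj₁ d∣n
  go : (∃[ n ] ((x ≡ fromℕ n) ⊎ (x ≡ - fromℕ n))) → _
  go (n , inj₁ refl) with nat n
  ... | inj₁ h = inj₁ (∣⇒dv h)
  ... | inj₂ h = inj₂ h
  go (n , inj₂ refl) with nat n
  ... | inj₁ h = inj₁ (neg (∣⇒dv h))
   where
   neg : Dv p (fromℕ n) → Dv p (- fromℕ n)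
   neg (dv t i e) = dv (- t) (int-neg i) (trans (cong -_ e) (lem (fromℕ p) t))
    where
    lem : ∀ p t → - (p * t) ≡ p * (- t)
    lem = solve-∀ ℚ-ring
  ... | inj₂ (u , v , iu , iv , e) = inj₂ (- u , v , int-neg iu , iv , trans (lem u (fromℕ n) v (fromℕ p)) e)
   where
   lem : ∀ u n v p → (- u) * (- n) + v * p ≡ u * n + v * p
   lem = solve-∀ ℚ-ring

 dv-+ : ∀ {p x y} → Dv p x → Dv p y → Dv p (x + y)
 dv-+ {p} (dv t i refl) (dv s j refl) = dv (t + s) (int-+ i j) (sym (ℚ.*-distribˡ-+ (fromℕ p) t s))

 dv-* : ∀ {p x y} → Int x → Dv p y → Dv p (x * y)
 dv-* {p} {x} i (dv s j refl) = dv (x * s) (int-* i j) (lem (fromℕ p) x s)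
  where
  lem : ∀ p x s → x * (p * s) ≡ p * (x * s)
  lem = solve-∀ ℚ-ring

 dv-self : ∀ {p x} → Int x → Dv p (x * fromℕ p)
 dv-self {p} {x} i = dv x i (ℚ.*-comm x (fromℕ p))

 dv-neg : ∀ {p x} → Dv p x → Dv p (- x)
 dv-neg {p} (dv t i refl) = dv (- t) (int-neg i) (lem (fromℕ p) t)
  where
  lem : ∀ p t → - (p * t) ≡ p * (- t)
  lem = solve-∀ ℚ-ring

 euclid : ∀ {p} → Prime p → ∀ {x y} → Int x → Int y → Dv p (x * y) → Dv p x ⊎ Dv p y
 euclid {p} pr {x} {y} ix iy h = go (prime-dichotomy pr x ix)
  where
  lem : ∀ u v x y p → u * (x * y) + y * (v * p) ≡ (u * x + v * p) * y
  lem = solve-∀ ℚ-ring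
  eq : ∀ u v → u * x + v * fromℕ p ≡ 1ℚ → u * (x * y) + y * (v * fromℕ p) ≡ y
  eq u v e = trans (lem u v x y (fromℕ p)) (trans (cong (_* y) e) (ℚ.*-identityˡ y))
  go : Dv p x ⊎ (∃[ u ] ∃[ v ] (Int u × Int v × (u * x + v * fromℕ p ≡ 1ℚ))) → Dv p x ⊎ Dv p y
  go (inj₁ k) = inj₁ k
  go (inj₂ (u , v , iu , iv , e)) = inj₂ (subst (Dv p) (eq u v e) (dv-+ (dv-* iu h) (dv-* iy (dv-self {p} iv))))

 ¬dv-small : ∀ {p n} → 0 ℕ.< n → n ℕ.< p → ¬ Dv p (fromℕ n)
 ¬dv-small {p} {n} n>0 n<p h = ℕ.<⇒≱ n<p (ℕ.∣⇒≤ {{ℕ.>-nonZero n>0}} (dv⇒∣ (ℕ.<-trans n>0 n<p) h))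

 residue : ∀ {p} → 0 ℕ.< p → ∀ x → Int x → ∃[ m ] ((m ℕ.< p) × Dv p (x - fromℕ m))
 residue {p} p>0 x (z , refl) = z ℤ.%ℕ p , ℤ.n%ℕd<d z p , dv (ℤ→ℚ (z ℤ./ℕ p)) (z ℤ./ℕ p , refl)
   (trans (cong (_- fromℕ (z ℤ.%ℕ p)) (trans (cong ℤ→ℚ (ℤ.a≡a%ℕn+[a/ℕn]*n z p)) (trans (ℤ→ℚ-+ (+ (z ℤ.%ℕ p)) ((z ℤ./ℕ p) ℤ.* + p))
    (cong₂ _+_ (sym (fromℕ≡ (z ℤ.%ℕ p))) (trans (ℤ→ℚ-* (z ℤ./ℕ p) (+ p)) (cong (ℤ→ℚ (z ℤ./ℕ p) *_) (sym (fromℕ≡ p))))))))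
    (lem (fromℕ (z ℤ.%ℕ p)) (ℤ→ℚ (z ℤ./ℕ p)) (fromℕ p)))
  where
  instance nz = ℕ.>-nonZero p>0
  lem : ∀ r q p → (r + q * p) - r ≡ p * q
  lem = solve-∀ ℚ-ring

 Res : ℕ → ℚ → Set
 Res p z = ∃[ m ] ((m ℕ.< p) × Dv p (fromℕ m * fromℕ m - z))

 res? : ∀ {p} → 0 ℕ.< p → ∀ z → Dec (Res p z)
 res? {p} p>0 z = map′ (λ { (i , h) → toℕ i , Fin.toℕ<n i , h })
  (λ { (m , m<p , h) → fromℕ< m<p , subst (λ k → Dv p (fromℕ k * fromℕ k - z)) (sym (Fin.toℕ-fromℕ< m<p)) h })
  (Fin.any? (λ i → dv? p>0 (fromℕ (toℕ i) * fromℕ (toℕ i) - z)))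

 res-square : ∀ {p} → 0 ℕ.< p → ∀ x z → Int x → Dv p (x * x - z) → Res p z
 res-square {p} p>0 x z ix h = go (residue p>0 x ix)
  where
  go : ∃[ m ] ((m ℕ.< p) × Dv p (x - fromℕ m)) → Res p z
  go (m , m<p , k) = m , m<p , subst (Dv p) (lem x (fromℕ m) z) (dv-+ h (dv-neg (dv-* (int-+ ix (int-ℕ m)) k)))
   where
   lem : ∀ x m z → (x * x - z) + (- ((x + m) * (x - m))) ≡ m * m - z
   lem = solve-∀ ℚ-ring

 module OddPrime {h : ℕ} (pr : Prime (suc (h ℕ.+ h))) where
  p : ℕ
  p = suc (h ℕ.+ h)

  p>0 : 0 ℕ.< p
  p>0 = s≤s z≤n

  no-square-collision : ∀ {i j} → i ℕ.< j → j ℕ.≤ h → ¬ Dv p (fromℕ i * fromℕ i - fromℕ j * fromℕ j)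
  no-square-collision {i} {j} i<j j≤h d = go (euclid pr {fromℕ (j ℕ.∸ i)} {fromℕ (j ℕ.+ i)} (int-ℕ (j ℕ.∸ i)) (int-ℕ (j ℕ.+ i)) (subst (Dv p) eq (dv-neg d)))
   where
   lem : ∀ i e → - (i * i - (e + i) * (e + i)) ≡ e * ((e + i) + i)
   lem = solve-∀ ℚ-ring
   j≡ : fromℕ j ≡ fromℕ (j ℕ.∸ i) + fromℕ i
   j≡ = trans (cong fromℕ (sym (ℕ.m∸n+n≡m (ℕ.<⇒≤ i<j)))) (fromℕ-+ (j ℕ.∸ i) i)
   eq : - (fromℕ i * fromℕ i - fromℕ j * fromℕ j) ≡ fromℕ (j ℕ.∸ i) * fromℕ (j ℕ.+ i)
   eq = trans (cong (λ z → - (fromℕ i * fromℕ i - z * z)) j≡) (trans (lem (fromℕ i) (fromℕ (j ℕ.∸ i)))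
    (cong (fromℕ (j ℕ.∸ i) *_) (trans (cong (_+ fromℕ i) (sym j≡)) (sym (fromℕ-+ j i)))))
   go : Dv p (fromℕ (j ℕ.∸ i)) ⊎ Dv p (fromℕ (j ℕ.+ i)) → ⊥
   go (inj₁ k) = ¬dv-small (ℕ.m<n⇒0<n∸m i<j) (s≤s (ℕ.≤-trans (ℕ.m∸n≤m j i) (ℕ.≤-trans j≤h (ℕ.m≤m+n h h)))) k
   go (inj₂ k) = ¬dv-small (ℕ.≤-trans (ℕ.<-≤-trans (s≤s z≤n) i<j) (ℕ.m≤m+n j i)) (s≤s (ℕ.+-mono-≤ j≤h (ℕ.≤-trans (ℕ.<⇒≤ i<j) j≤h))) k

  -- Pigeonhole on the h + 1 squares i², the h multiples u k² and v: p + 1 values modulo p.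
  nonresidue-product : ∀ u v → Int u → Int v → ¬ Dv p u → ¬ Res p u → ¬ Res p v → Res p (u * v)
  nonresidue-product u v iu iv p∤u ¬u ¬v = go (Fin.pigeonhole {p} {suc p} (ℕ.n<1+n p) f)
   where
   data Kind : Set where
    sq : (i : ℕ) → i ℕ.≤ h → Kind
    mu : (k : ℕ) → 0 ℕ.< k → k ℕ.≤ h → Kind
    vv : Kind
   kind : ℕ → Kind
   kind i with i ℕ.≤? h
   ... | yes q = sq i q
   ... | no q with (i ℕ.∸ h) ℕ.≤? h
   ...   | yes r = mu (i ℕ.∸ h) (ℕ.m<n⇒0<n∸m (ℕ.≰⇒> q)) r
   ...   | no r = vv
   value : Kind → ℚ
   value (sq i _) = fromℕ i * fromℕ i
   value (mu k _ _) = u * (fromℕ k * fromℕ k)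
   value vv = v
   int-value : ∀ k → Int (value k)
   int-value (sq i _) = int-* (int-ℕ i) (int-ℕ i)
   int-value (mu k _ _) = int-* iu (int-* (int-ℕ k) (int-ℕ k))
   int-value vv = iv
   r : ∀ (i : Fin (suc p)) → ∃[ m ] ((m ℕ.< p) × Dv p (value (kind (toℕ i)) - fromℕ m))
   r i = residue p>0 (value (kind (toℕ i))) (int-value (kind (toℕ i)))
   f : Fin (suc p) → Fin p
   f i = fromℕ< (proj₁ (proj₂ (r i)))
   f-sound : ∀ i j → f i ≡ f j → Dv p (value (kind (toℕ i)) - value (kind (toℕ j)))
   f-sound i j e = subst (Dv p) eq (dv-+ (proj₂ (proj₂ (r i))) (dv-neg (proj₂ (proj₂ (r j)))))
    where
    m≡ : proj₁ (r i) ≡ proj₁ (r j)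
    m≡ = trans (sym (Fin.toℕ-fromℕ< _)) (trans (cong toℕ e) (Fin.toℕ-fromℕ< _))
    lem : ∀ x y m → (x - m) + (- (y - m)) ≡ x - y
    lem = solve-∀ ℚ-ring
    eq : (value (kind (toℕ i)) - fromℕ (proj₁ (r i))) + (- (value (kind (toℕ j)) - fromℕ (proj₁ (r j)))) ≡ value (kind (toℕ i)) - value (kind (toℕ j))
    eq = trans (cong (λ m → (value (kind (toℕ i)) - fromℕ m) + (- (value (kind (toℕ j)) - fromℕ (proj₁ (r j))))) m≡)
        (lem (value (kind (toℕ i))) (value (kind (toℕ j))) (fromℕ (proj₁ (r j))))
   no-sq-mu : ∀ i k → 0 ℕ.< k → k ℕ.≤ h → Dv p (fromℕ i * fromℕ i - u * (fromℕ k * fromℕ k)) → ⊥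
   no-sq-mu i k k>0 k≤h d = go (prime-dichotomy pr (fromℕ k) (int-ℕ k))
    where
    lem : ∀ i s u k w → (s * s) * (i * i - u * (k * k)) + (u * ((- s) * k - 1ℚ)) * w ≡
        ((i * s) * (i * s) - u) + u * ((1ℚ + s * k) * (1ℚ - (s * k + w)))
    lem = solve-∀ ℚ-ring
    lem' : ∀ x u y → x + u * (y * (1ℚ - 1ℚ)) ≡ x
    lem' = solve-∀ ℚ-ring
    eq : ∀ s t → s * fromℕ k + t * fromℕ p ≡ 1ℚ →
     (s * s) * (fromℕ i * fromℕ i - u * (fromℕ k * fromℕ k)) + (u * ((- s) * fromℕ k - 1ℚ)) * (t * fromℕ p) ≡ (fromℕ i * s) * (fromℕ i * s) - u
    eq s t e = trans (lem (fromℕ i) s u (fromℕ k) (t * fromℕ p)) (trans (cong (λ z → ((fromℕ i * s) * (fromℕ i * s) - u) + u * ((1ℚ + s * fromℕ k) * (1ℚ - z))) e)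
     (lem' ((fromℕ i * s) * (fromℕ i * s) - u) u (1ℚ + s * fromℕ k)))
    go : Dv p (fromℕ k) ⊎ (∃[ s ] ∃[ t ] (Int s × Int t × (s * fromℕ k + t * fromℕ p ≡ 1ℚ))) → ⊥
    go (inj₁ bad) = ¬dv-small k>0 (s≤s (ℕ.≤-trans k≤h (ℕ.m≤m+n h h))) bad
    go (inj₂ (s , t , is , it , e)) = ¬u (res-square p>0 (fromℕ i * s) u (int-* (int-ℕ i) is)
      (subst (Dv p) (eq s t e) (dv-+ (dv-* (int-* is is) d) (dv-* (int-* iu (int-- (int-* (int-neg is) (int-ℕ k)) int-1)) (dv-self {p} it)))))
   data Before : Kind → Kind → Set where
    sq-sq : ∀ {i j q r} → i ℕ.< j → Before (sq i q) (sq j r)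
    sq-mu : ∀ {i k q r s} → Before (sq i q) (mu k r s)
    sq-vv : ∀ {i q} → Before (sq i q) vv
    mu-mu : ∀ {k l q r s t} → k ℕ.< l → Before (mu k q r) (mu l s t)
    mu-vv : ∀ {k q r} → Before (mu k q r) vv
   before : ∀ i j → i ℕ.< j → j ℕ.< suc p → Before (kind i) (kind j)
   before i j i<j j≤p with i ℕ.≤? h | j ℕ.≤? h
   ... | yes _ | yes _ = sq-sq i<j
   ... | no q | yes j≤h = ⊥-elim (q (ℕ.≤-trans (ℕ.<⇒≤ i<j) j≤h))
   ... | yes i≤h | no _ with (j ℕ.∸ h) ℕ.≤? h
   ...   | yes _ = sq-mu
   ...   | no _ = sq-vv
   before i j i<j j≤p | no q | no q' with (i ℕ.∸ h) ℕ.≤? h | (j ℕ.∸ h) ℕ.≤? h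
   ...   | yes _ | yes _ = mu-mu (ℕ.∸-monoˡ-< i<j (ℕ.<⇒≤ (ℕ.≰⇒> q)))
   ...   | yes _ | no _ = mu-vv
   ...   | no r | _ = ⊥-elim (r (ℕ.≤-trans (ℕ.∸-monoˡ-≤ h (ℕ.≤-pred (ℕ.≤-trans i<j (ℕ.≤-pred j≤p)))) (ℕ.≤-reflexive (ℕ.m+n∸n≡m h h))))
   collide : ∀ {x y} → Before x y → Dv p (value x - value y) → Res p (u * v)
   collide (sq-sq {i} {j} {r = j≤h} i<j) d = ⊥-elim (no-square-collision i<j j≤h d)
   collide (sq-mu {i} {k} {r = k>0} {k≤h}) d = ⊥-elim (no-sq-mu i k k>0 k≤h d)
   collide (sq-vv {i} {i≤h}) d = ⊥-elim (¬v (i , s≤s (ℕ.≤-trans i≤h (ℕ.m≤m+n h h)) , d))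
   collide (mu-mu {k} {l} {t = l≤h} k<l) d = ⊥-elim (both (euclid pr iu (int-- (int-* (int-ℕ k) (int-ℕ k)) (int-* (int-ℕ l) (int-ℕ l))) (subst (Dv p) (lem u (fromℕ k) (fromℕ l)) d)))
    where
    lem : ∀ u k l → u * (k * k) - u * (l * l) ≡ u * (k * k - l * l)
    lem = solve-∀ ℚ-ring
    both : Dv p u ⊎ Dv p (fromℕ k * fromℕ k - fromℕ l * fromℕ l) → ⊥
    both (inj₁ x) = p∤u x
    both (inj₂ x) = no-square-collision k<l l≤h x
   collide (mu-vv {k}) d = res-square p>0 (u * fromℕ k) (u * v) (int-* iu (int-ℕ k))
     (subst (Dv p) (lem u (fromℕ k) v) (dv-* iu d))
    where
    lem : ∀ u k v → u * (u * (k * k) - v) ≡ (u * k) * (u * k) - u * v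
    lem = solve-∀ ℚ-ring
   go : (∃[ i ] ∃[ j ] (i Fin.< j × f i ≡ f j)) → Res p (u * v)
   go (i , j , i<j , e) = collide (before (toℕ i) (toℕ j) i<j (Fin.toℕ<n j)) (f-sound i j e)

module NormForm where
 open import Data.Nat.Primality using (Prime; prime?; prime⇒irreducible; ¬prime[0]; ¬prime[1])
 open import Data.Nat.Primality.Factorisation using (factorise; PrimeFactorisation)
 open import Data.Nat.ListAction using (product)
 open import Data.List.Relation.Unary.All using (All; []; _∷_)
 open import Data.Rational using (_+_; _*_; -_; _-_; _<_; _≤_; _≟_)
 open RationalAlgebra
 open Integrality
 open PrimeResidues

 -- Rep a b c says that c is a reduced norm from (a, b).  As a predicate of three
 -- square classes it is symmetric and multiplicative in each argument; it is shown to
 -- hold for a, b < 0 < c by induction on the largest prime involved, in the manner of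
 -- Tate's computation of the Milnor K-theory of ℚ.
 record Rep (a b c : ℚ) : Set where
  constructor rep
  field
   x₀ x₁ x₂ x₃ : ℚ
   norm≡ : x₀ * x₀ - a * (x₁ * x₁) - b * (x₂ * x₂) + a * b * (x₃ * x₃) ≡ c

 rep-* : ∀ {a b c d} → Rep a b c → Rep a b d → Rep a b (c * d)
 rep-* {a} {b} (rep x₀ x₁ x₂ x₃ refl) (rep y₀ y₁ y₂ y₃ refl) = rep
   (x₀ * y₀ + a * (x₁ * y₁) + b * (x₂ * y₂) - (a * b) * (x₃ * y₃))
   (x₀ * y₁ + x₁ * y₀ - b * (x₂ * y₃) + b * (x₃ * y₂))
   (x₀ * y₂ + x₂ * y₀ + a * (x₁ * y₃) - a * (x₃ * y₁))
   (x₀ * y₃ + x₃ * y₀ + x₁ * y₂ - x₂ * y₁) (lem a b x₀ x₁ x₂ x₃ y₀ y₁ y₂ y₃)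
  where
  lem : ∀ a b x₀ x₁ x₂ x₃ y₀ y₁ y₂ y₃ → let n = λ p q r s → p * p - a * (q * q) - b * (r * r) + a * b * (s * s) in
    n (x₀ * y₀ + a * (x₁ * y₁) + b * (x₂ * y₂) - (a * b) * (x₃ * y₃))
     (x₀ * y₁ + x₁ * y₀ - b * (x₂ * y₃) + b * (x₃ * y₂))
     (x₀ * y₂ + x₂ * y₀ + a * (x₁ * y₃) - a * (x₃ * y₁))
     (x₀ * y₃ + x₃ * y₀ + x₁ * y₂ - x₂ * y₁) ≡ n x₀ x₁ x₂ x₃ * n y₀ y₁ y₂ y₃
  lem = solve-∀ ℚ-ring

 rep-scale : ∀ {a b c} t → Rep a b c → Rep a b (c * (t * t))
 rep-scale {a} {b} t (rep x₀ x₁ x₂ x₃ refl) = rep (t * x₀) (t * x₁) (t * x₂) (t * x₃) (lem a b t x₀ x₁ x₂ x₃)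
  where
  lem : ∀ a b t x₀ x₁ x₂ x₃ → let n = λ p q r s → p * p - a * (q * q) - b * (r * r) + a * b * (s * s) in
   n (t * x₀) (t * x₁) (t * x₂) (t * x₃) ≡ n x₀ x₁ x₂ x₃ * (t * t)
  lem = solve-∀ ℚ-ring

 rep-unscale : ∀ {a b c} t → ¬ (t ≡ 0ℚ) → Rep a b (c * (t * t)) → Rep a b c
 rep-unscale {a} {b} {c} t t≢0 h = subst (Rep a b) eq (rep-scale r h)
  where
  r = proj₁ (inv t t≢0)
  lem : ∀ c t r → (c * (t * t)) * (r * r) ≡ c * ((t * r) * (t * r))
  lem = solve-∀ ℚ-ring
  eq : (c * (t * t)) * (r * r) ≡ c
  eq = trans (lem c t r) (trans (cong (λ z → c * (z * z)) (proj₂ (inv t t≢0))) (ℚ.*-identityʳ c))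

 rep-/ : ∀ {a b c d} → ¬ (c ≡ 0ℚ) → Rep a b c → Rep a b (c * d) → Rep a b d
 rep-/ {a} {b} {c} {d} c≢0 h k = rep-unscale c c≢0 (subst (Rep a b) (lem c d) (rep-* h k))
  where
  lem : ∀ c d → c * (c * d) ≡ d * (c * c)
  lem = solve-∀ ℚ-ring

 rep-swap₁₂ : ∀ {a b c} → Rep a b c → Rep b a c
 rep-swap₁₂ {a} {b} (rep x₀ x₁ x₂ x₃ refl) = rep x₀ x₂ x₁ x₃ (lem a b x₀ x₁ x₂ x₃)
  where
  lem : ∀ a b x₀ x₁ x₂ x₃ → x₀ * x₀ - b * (x₂ * x₂) - a * (x₁ * x₁) + b * a * (x₃ * x₃) ≡ x₀ * x₀ - a * (x₁ * x₁) - b * (x₂ * x₂) + a * b * (x₃ * x₃)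
  lem = solve-∀ ℚ-ring

 -- The norm form of (a , c) is isotropic, hence universal, when c is a norm from ℚ(√a).
 rep-binary : ∀ {a c} x y d → ¬ (c ≡ 0ℚ) → x * x - a * (y * y) ≡ c → Rep a c d
 rep-binary {a} {c} x y d c≢0 h = rep ((d + 1ℚ) * ½) 0ℚ (t * x * r) (t * y * r)
   (trans (lem a c d x y r ½) (trans (cong (λ z → ((d + 1ℚ) * ½) * ((d + 1ℚ) * ½) - c * ((t * t) * (z * (r * r)))) h)
    (trans (lem' c d t r) (trans (cong (λ z → ((d + 1ℚ) * ½) * ((d + 1ℚ) * ½) - (t * t) * (z * z)) (proj₂ (inv c c≢0)))
     (lem″ d)))))
  where
  open import Data.Rational using (½)
  r = proj₁ (inv c c≢0)
  t = (d - 1ℚ) * ½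
  lem : ∀ a c d x y r h → let s = (d + 1ℚ) * h ; t = (d - 1ℚ) * h in
   s * s - a * (0ℚ * 0ℚ) - c * ((t * x * r) * (t * x * r)) + a * c * ((t * y * r) * (t * y * r)) ≡ s * s - c * ((t * t) * ((x * x - a * (y * y)) * (r * r)))
  lem = solve-∀ ℚ-ring
  lem' : ∀ c d t r → ((d + 1ℚ) * ½) * ((d + 1ℚ) * ½) - c * ((t * t) * (c * (r * r))) ≡ ((d + 1ℚ) * ½) * ((d + 1ℚ) * ½) - (t * t) * ((c * r) * (c * r))
  lem' = solve-∀ ℚ-ring
  lem″ : ∀ d → ((d + 1ℚ) * ½) * ((d + 1ℚ) * ½) - (((d - 1ℚ) * ½) * ((d - 1ℚ) * ½)) * (1ℚ * 1ℚ) ≡ d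
  lem″ = solve-∀ ℚ-ring

 rep-swap₂₃ : ∀ {a b c} → ¬ (c ≡ 0ℚ) → Rep a b c → Rep a c b
 rep-swap₂₃ {a} {b} {c} c≢0 (rep x₀ x₁ x₂ x₃ h) with (x₂ * x₂ - a * (x₃ * x₃)) ≟ 0ℚ
 ... | yes B≡0 = rep-binary x₀ x₁ b c≢0 (trans (lem a b x₀ x₁ x₂ x₃) (trans (cong₂ (λ z w → z + b * w) h B≡0) (lem' b c)))
  where
  lem : ∀ a b x₀ x₁ x₂ x₃ → x₀ * x₀ - a * (x₁ * x₁) ≡ (x₀ * x₀ - a * (x₁ * x₁) - b * (x₂ * x₂) + a * b * (x₃ * x₃)) + b * (x₂ * x₂ - a * (x₃ * x₃))
  lem = solve-∀ ℚ-ring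
  lem' : ∀ b c → c + b * 0ℚ ≡ c
  lem' = solve-∀ ℚ-ring
 ... | no B≢0 = rep ((x₀ * x₂ + a * (x₁ * x₃)) * r) ((x₀ * x₃ + x₁ * x₂) * r) (x₂ * r) (x₃ * r)
   (trans (lem a b c x₀ x₁ x₂ x₃ r) (trans (cong (λ z → (r * r) * (B * ((z + b * B) - c))) h) (trans (lem' b c B r)
    (trans (cong (λ z → b * (z * z)) (proj₂ (inv B B≢0))) (ℚ.*-identityʳ b)))))
  where
  B = x₂ * x₂ - a * (x₃ * x₃)
  r = proj₁ (inv B B≢0)
  lem : ∀ a b c x₀ x₁ x₂ x₃ r → let n = λ p q r s → p * p - a * (q * q) - c * (r * r) + a * c * (s * s) ; B = x₂ * x₂ - a * (x₃ * x₃) in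
   n ((x₀ * x₂ + a * (x₁ * x₃)) * r) ((x₀ * x₃ + x₁ * x₂) * r) (x₂ * r) (x₃ * r) ≡
   (r * r) * (B * (((x₀ * x₀ - a * (x₁ * x₁) - b * (x₂ * x₂) + a * b * (x₃ * x₃)) + b * B) - c))
  lem = solve-∀ ℚ-ring
  lem' : ∀ b c B r → (r * r) * (B * ((c + b * B) - c)) ≡ b * ((B * r) * (B * r))
  lem' = solve-∀ ℚ-ring

 rep-swap₁₃ : ∀ {a b c} → ¬ (c ≡ 0ℚ) → Rep a b c → Rep c b a
 rep-swap₁₃ c≢0 h = rep-swap₁₂ (rep-swap₂₃ c≢0 (rep-swap₁₂ h))

 rep-*₂ : ∀ {a b b' c} → ¬ (b ≡ 0ℚ) → ¬ (b' ≡ 0ℚ) → ¬ (c ≡ 0ℚ) → Rep a b c → Rep a b' c → Rep a (b * b') c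
 rep-*₂ {a} {b} {b'} b≢0 b'≢0 c≢0 h k = rep-swap₂₃ bb'≢0 (rep-* (rep-swap₂₃ c≢0 h) (rep-swap₂₃ c≢0 k))
  where
  bb'≢0 : ¬ (b * b' ≡ 0ℚ)
  bb'≢0 e with *-zero {b} {b'} e
  ... | inj₁ z = b≢0 z
  ... | inj₂ z = b'≢0 z

 rep-*₁ : ∀ {a a' b c} → ¬ (a ≡ 0ℚ) → ¬ (a' ≡ 0ℚ) → ¬ (c ≡ 0ℚ) → Rep a b c → Rep a' b c → Rep (a * a') b c
 rep-*₁ a≢0 a'≢0 c≢0 h k = rep-swap₁₂ (rep-*₂ a≢0 a'≢0 c≢0 (rep-swap₁₂ h) (rep-swap₁₂ k))

 rep-/₂ : ∀ {a b b' c} → ¬ (b ≡ 0ℚ) → ¬ (b' ≡ 0ℚ) → ¬ (c ≡ 0ℚ) → Rep a b c → Rep a (b * b') c → Rep a b' c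
 rep-/₂ b≢0 b'≢0 c≢0 h k = rep-swap₂₃ b'≢0 (rep-/ b≢0 (rep-swap₂₃ c≢0 h) (rep-swap₂₃ c≢0 k))

 rep-/₁ : ∀ {a a' b c} → ¬ (a ≡ 0ℚ) → ¬ (a' ≡ 0ℚ) → ¬ (c ≡ 0ℚ) → Rep a b c → Rep (a * a') b c → Rep a' b c
 rep-/₁ a≢0 a'≢0 c≢0 h k = rep-swap₁₂ (rep-/₂ a≢0 a'≢0 c≢0 (rep-swap₁₂ h) (rep-swap₁₂ k))

 rep-one : ∀ a b → Rep a b 1ℚ
 rep-one a b = rep 1ℚ 0ℚ 0ℚ 0ℚ (lem a b)
  where
  lem : ∀ a b → 1ℚ * 1ℚ - a * (0ℚ * 0ℚ) - b * (0ℚ * 0ℚ) + a * b * (0ℚ * 0ℚ) ≡ 1ℚ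
  lem = solve-∀ ℚ-ring

 rep-square₂ : ∀ a m c → ¬ (m * m ≡ 0ℚ) → Rep a (m * m) c
 rep-square₂ a m c h = rep-binary m 0ℚ c h (lem a m)
  where
  lem : ∀ a m → m * m - a * (0ℚ * 0ℚ) ≡ m * m
  lem = solve-∀ ℚ-ring

 rep-opposite : ∀ a c → ¬ (a ≡ 0ℚ) → Rep a (- a) c
 rep-opposite a c a≢0 = rep-binary 0ℚ 1ℚ c (λ e → a≢0 (trans (sym (neg-neg a)) (cong -_ e))) (lem a)
  where
  lem : ∀ a → 0ℚ * 0ℚ - a * (1ℚ * 1ℚ) ≡ - a
  lem = solve-∀ ℚ-ring

 -1ℚ : ℚ
 -1ℚ = - 1ℚ

 -1≢0 : ¬ (-1ℚ ≡ 0ℚ)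
 -1≢0 ()

 -- {a , a} = {a , -1} in the notation of Milnor K-theory.
 rep-diagonal : ∀ a c → ¬ (a ≡ 0ℚ) → ¬ (c ≡ 0ℚ) → Rep a -1ℚ c → Rep a a c
 rep-diagonal a c a≢0 c≢0 h = subst (λ z → Rep a z c) (lem a)
   (rep-*₂ {b = -1ℚ} -1≢0 (λ e → a≢0 (trans (sym (neg-neg a)) (cong -_ e))) c≢0 h (rep-opposite a c a≢0))
  where
  lem : ∀ a → (- 1ℚ) * (- a) ≡ a
  lem = solve-∀ ℚ-ring

 -- If z is a square m² modulo p, with m² − z = p t, then p can be traded for t.
 rep-residue : ∀ {z v p t} m → ¬ (z ≡ 0ℚ) → ¬ (v ≡ 0ℚ) → ¬ (p ≡ 0ℚ) → m * m - z ≡ p * t → (¬ (t ≡ 0ℚ) → Rep z t v) → Rep z p v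
 rep-residue {z} {v} {p} {t} m z≢0 v≢0 p≢0 h k = go (t ≟ 0ℚ)
  where
  lem : ∀ m z → m * m ≡ (m * m - z) + z
  lem = solve-∀ ℚ-ring
  lem' : ∀ m z → m * m - z * (1ℚ * 1ℚ) ≡ m * m - z
  lem' = solve-∀ ℚ-ring
  go : Dec (t ≡ 0ℚ) → Rep z p v
  go (yes t≡0) = rep-swap₁₂ (subst (λ w → Rep p w v) mm≡z (rep-square₂ p m v (λ e → z≢0 (trans (sym mm≡z) e))))
   where
   mm≡z : m * m ≡ z
   mm≡z = trans (lem m z) (trans (cong (_+ z) (trans h (trans (cong (p *_) t≡0) (ℚ.*-zeroʳ p)))) (ℚ.+-identityˡ z))
  go (no t≢0) = rep-/₂ t≢0 p≢0 v≢0 (k t≢0) (rep-binary m 1ℚ v tp≢0 (trans (lem' m z) (trans h (ℚ.*-comm p t))))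
   where
   tp≢0 : ¬ (t * p ≡ 0ℚ)
   tp≢0 e with *-zero {t} {p} e
   ... | inj₁ x = t≢0 x
   ... | inj₂ x = p≢0 x

 data Atom (p : ℕ) : ℚ → Set where
  minus : Atom p -1ℚ
  prime : ∀ {q} → Prime q → q ℕ.< p → Atom p (fromℕ q)

 prime>0 : ∀ {q} → Prime q → 0 ℕ.< q
 prime>0 {zero} pr = ⊥-elim (¬prime[0] pr)
 prime>0 {suc q} pr = s≤s z≤n

 prime≢0 : ∀ {q} → Prime q → ¬ (fromℕ q ≡ 0ℚ)
 prime≢0 pr = pos≢0 (prime>0 pr)

 atom≢0 : ∀ {p x} → Atom p x → ¬ (x ≡ 0ℚ)
 atom≢0 minus = -1≢0
 atom≢0 (prime pr _) = prime≢0 pr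

 Below : ℕ → Set
 Below p = ∀ {u v r} → Atom p u → Atom p v → Prime r → r ℕ.< p → Rep u v (fromℕ r)

 -- Natural numbers below p are products of primes below p.
 nat-induction : ∀ p (P : ℕ → Set) → P 1 → (∀ {q m} → Prime q → q ℕ.< p → 0 ℕ.< m → P m → P (q ℕ.* m)) → ∀ n → 0 ℕ.< n → n ℕ.< p → P n
 nat-induction p P one step n n>0 n<p = subst P (sym (PrimeFactorisation.isFactorisation f)) (go (PrimeFactorisation.factors f)
   (subst (ℕ._< p) (PrimeFactorisation.isFactorisation f) n<p) (subst (0 ℕ.<_) (PrimeFactorisation.isFactorisation f) n>0) (PrimeFactorisation.factorsPrime f))
  where
  f = factorise n {{ℕ.>-nonZero n>0}}
  go : ∀ qs → product qs ℕ.< p → 0 ℕ.< product qs → All Prime qs → P (product qs)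
  go [] _ _ _ = one
  go (q ∷ qs) lt gt (pr ∷ prs) = step pr (ℕ.≤-<-trans (ℕ.m≤m*n q (product qs) {{ℕ.>-nonZero m>0}}) lt) m>0
    (go qs (ℕ.≤-<-trans (ℕ.m≤n*m (product qs) q {{ℕ.>-nonZero (prime>0 pr)}}) lt) m>0 prs)
   where
   m>0 : 0 ℕ.< product qs
   m>0 = pos (product qs) gt
    where
    pos : ∀ m → 0 ℕ.< q ℕ.* m → 0 ℕ.< m
    pos zero h = ⊥-elim (ℕ.<-irrefl refl (subst (0 ℕ.<_) (ℕ.*-zeroʳ q) h))
    pos (suc m) h = s≤s z≤n

 data Unit± : ℚ → Set where
  plus  : Unit± 1ℚ
  minus : Unit± -1ℚ

 module Extend {p : ℕ} (below : Below p) where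
  rep-nat₃ : ∀ {u v} → Atom p u → Atom p v → ∀ n → 0 ℕ.< n → n ℕ.< p → Rep u v (fromℕ n)
  rep-nat₃ {u} {v} au av = nat-induction p (λ n → Rep u v (fromℕ n)) (subst (Rep u v) (sym fromℕ-1) (rep-one u v))
   (λ {q} {m} pr q<p m>0 h → subst (Rep u v) (sym (fromℕ-* q m)) (rep-* (below au av pr q<p) h))

  rep-nat₂ : ∀ {u} → Atom p u → ∀ m n → 0 ℕ.< m → m ℕ.< p → 0 ℕ.< n → n ℕ.< p → Rep u (fromℕ m) (fromℕ n)
  rep-nat₂ {u} au m n m>0 m<p n>0 n<p = nat-induction p (λ m → Rep u (fromℕ m) (fromℕ n))
   (rep-swap₂₃ {b = fromℕ n} (subst (λ z → ¬ (z ≡ 0ℚ)) (sym fromℕ-1) (λ ())) (subst (Rep u (fromℕ n)) (sym fromℕ-1) (rep-one u (fromℕ n))))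
   (λ {q} {m} pr q<p m>0 h → subst (λ z → Rep u z (fromℕ n)) (sym (fromℕ-* q m))
    (rep-*₂ (prime≢0 pr) (pos≢0 m>0) (pos≢0 n>0) (rep-nat₃ au (prime pr q<p) n n>0 n<p) h)) m m>0 m<p

  rep-nat₁ : ∀ l m n → 0 ℕ.< l → l ℕ.< p → 0 ℕ.< m → m ℕ.< p → 0 ℕ.< n → n ℕ.< p → Rep (fromℕ l) (fromℕ m) (fromℕ n)
  rep-nat₁ l m n l>0 l<p m>0 m<p n>0 n<p = nat-induction p (λ l → Rep (fromℕ l) (fromℕ m) (fromℕ n))
   (rep-swap₁₃ (subst (λ z → ¬ (z ≡ 0ℚ)) (sym fromℕ-1) (λ ())) (subst (Rep (fromℕ n) (fromℕ m)) (sym fromℕ-1) (rep-one (fromℕ n) (fromℕ m))))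
   (λ {q} {l} pr q<p l>0 h → subst (λ z → Rep z (fromℕ m) (fromℕ n)) (sym (fromℕ-* q l))
    (rep-*₁ (prime≢0 pr) (pos≢0 l>0) (pos≢0 n>0) (rep-nat₂ (prime pr q<p) m n m>0 m<p n>0 n<p) h)) l l>0 l<p

  neg≡ : ∀ x → - x ≡ -1ℚ * x
  neg≡ = solve-∀ ℚ-ring

  -- Signed numbers below p, at least one of the three arguments being positive.
  rep-mixed : ∀ {u} → Unit± u → ∀ l m n → 0 ℕ.< l → l ℕ.< p → 0 ℕ.< m → m ℕ.< p → 0 ℕ.< n → n ℕ.< p →
   ∀ {v} → Unit± v → Rep (u * fromℕ l) (v * fromℕ m) (fromℕ n)
  rep-mixed {u} su l m n l>0 l<p m>0 m<p n>0 n<p {v} sv =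
   rep-*₁ (unit≢0 su) (pos≢0 l>0) (pos≢0 n>0)
    (rep-*₂ (unit≢0 sv) (pos≢0 m>0) (pos≢0 n>0) (units su sv) (unit-nat su))
    (rep-*₂ (unit≢0 sv) (pos≢0 m>0) (pos≢0 n>0) (rep-swap₁₂ (unit-nat' sv)) (rep-nat₁ l m n l>0 l<p m>0 m<p n>0 n<p))
   where
   unit≢0 : ∀ {u} → Unit± u → ¬ (u ≡ 0ℚ)
   unit≢0 plus = λ ()
   unit≢0 minus = -1≢0
   one₁ : ∀ w → Rep 1ℚ w (fromℕ n)
   one₁ w = rep-swap₁₂ (rep-square₂ w 1ℚ (fromℕ n) (λ ()))
   units : ∀ {u v} → Unit± u → Unit± v → Rep u v (fromℕ n)
   units {v = v} plus _ = one₁ v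
   units {u} minus plus = rep-swap₁₂ (one₁ u)
   units minus minus = rep-nat₃ minus minus n n>0 n<p
   unit-nat : ∀ {u} → Unit± u → Rep u (fromℕ m) (fromℕ n)
   unit-nat plus = one₁ (fromℕ m)
   unit-nat minus = rep-nat₂ minus m n m>0 m<p n>0 n<p
   unit-nat' : ∀ {v} → Unit± v → Rep v (fromℕ l) (fromℕ n)
   unit-nat' plus = one₁ (fromℕ l)
   unit-nat' minus = rep-nat₂ minus l n l>0 l<p n>0 n<p

 SignedQuotient : ℕ → ℚ → Set
 SignedQuotient p t = ∃[ s ] ∃[ k ] (Unit± s × (0 ℕ.< k) × (k ℕ.< p) × (t ≡ s * fromℕ k))

 -- A residue followed by a nonresidue.
 NonresidueAfter : ℕ → Set
 NonresidueAfter p = ∃[ k ] ((0 ℕ.< k) × (suc k ℕ.< p) × Res p (fromℕ k) × ¬ Res p (fromℕ (suc k)))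

 private
  ≤-product : ∀ {p k n} → 0 ℕ.< p → p ℕ.* k ℕ.≤ n → n ℕ.< p ℕ.* p → k ℕ.< p
  ≤-product {p} {k} p>0 h h' = ℕ.*-cancelˡ-< p k p (ℕ.≤-<-trans h h')

 signed-quotient : ∀ {p} m n t → 0 ℕ.< p → m ℕ.< p → n ℕ.< p ℕ.* p → Int t → fromℕ m * fromℕ m - fromℕ n ≡ fromℕ p * t → ¬ (t ≡ 0ℚ) →
  SignedQuotient p t
 signed-quotient {p} m n t p>0 m<p n<pp it h t≢0 = go (abs-unit t it)
  where
  positive : ∀ k → ¬ (fromℕ k ≡ 0ℚ) → 0 ℕ.< k
  positive zero h = ⊥-elim (h fromℕ-0)
  positive (suc k) h = s≤s z≤n
  lem₁ : ∀ x n → x ≡ n + (x - n)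
  lem₁ = solve-∀ ℚ-ring
  lem₂ : ∀ x n → x + (- (x - n)) ≡ n
  lem₂ = solve-∀ ℚ-ring
  lem₃ : ∀ p k → - (p * (- k)) ≡ p * k
  lem₃ = solve-∀ ℚ-ring
  go : (∃[ k ] ((t ≡ fromℕ k) ⊎ (t ≡ - fromℕ k))) → SignedQuotient p t
  go (k , inj₁ e) = 1ℚ , k , plus , positive k (λ z → t≢0 (trans e z)) , ≤-product p>0 (ℕ.≤-trans (ℕ.m≤n+m (p ℕ.* k) n) (ℕ.≤-reflexive (sym mm≡))) (ℕ.*-mono-< m<p m<p) ,
    trans e (sym (ℚ.*-identityˡ (fromℕ k)))
   where
   mm≡ : m ℕ.* m ≡ n ℕ.+ p ℕ.* k
   mm≡ = fromℕ-injective (trans (fromℕ-* m m) (trans (lem₁ (fromℕ m * fromℕ m) (fromℕ n))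
    (trans (cong (_+_ (fromℕ n)) (trans h (trans (cong (fromℕ p *_) e) (sym (fromℕ-* p k))))) (sym (fromℕ-+ n (p ℕ.* k))))))
  go (k , inj₂ e) = -1ℚ , k , minus , positive k (λ z → t≢0 (trans e (cong -_ z))) , ≤-product p>0 (ℕ.≤-trans (ℕ.m≤n+m (p ℕ.* k) (m ℕ.* m)) (ℕ.≤-reflexive eq)) n<pp ,
    trans e (lem (fromℕ k))
   where
   lem : ∀ k → - k ≡ (- 1ℚ) * k
   lem = solve-∀ ℚ-ring
   eq : m ℕ.* m ℕ.+ p ℕ.* k ≡ n
   eq = fromℕ-injective (trans (fromℕ-+ (m ℕ.* m) (p ℕ.* k)) (trans (cong₂ _+_ (fromℕ-* m m) (trans (fromℕ-* p k) (sym (trans (cong -_ (trans h (cong (fromℕ p *_) e))) (lem₃ (fromℕ p) (fromℕ k))))))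
    (lem₂ (fromℕ m * fromℕ m) (fromℕ n))))

 positive-quotient : ∀ {p} m n t → m ℕ.< p → 0 ℕ.< n → n ℕ.< p → Int t → fromℕ m * fromℕ m - (- fromℕ n) ≡ fromℕ p * t →
  ∃[ k ] ((0 ℕ.< k) × (k ℕ.< p) × (t ≡ fromℕ k))
 positive-quotient {p} m n t m<p n>0 n<p it h = go (abs-unit t it)
  where
  p>0 : 0 ℕ.< p
  p>0 = ℕ.<-trans n>0 n<p
  lem₁ : ∀ x n → x - (- n) ≡ x + n
  lem₁ = solve-∀ ℚ-ring
  lem₂ : ∀ p k → p * (- k) + p * k ≡ 0ℚ
  lem₂ = solve-∀ ℚ-ring
  mm+n : fromℕ (m ℕ.* m ℕ.+ n) ≡ fromℕ p * t
  mm+n = trans (fromℕ-+ (m ℕ.* m) n) (trans (cong (_+ fromℕ n) (fromℕ-* m m)) (trans (sym (lem₁ (fromℕ m * fromℕ m) (fromℕ n))) h))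
  mm+n<pp : m ℕ.* m ℕ.+ n ℕ.< p ℕ.* p
  mm+n<pp = bound p m<p n<p
   where
   bound : ∀ p → m ℕ.< p → n ℕ.< p → m ℕ.* m ℕ.+ n ℕ.< p ℕ.* p
   bound (suc k) (s≤s m≤k) (s≤s n≤k) = s≤s (ℕ.≤-trans (ℕ.+-mono-≤ (ℕ.*-mono-≤ m≤k m≤k) n≤k)
    (ℕ.≤-trans (ℕ.≤-reflexive (ℕ.+-comm (k ℕ.* k) k)) (ℕ.+-monoʳ-≤ k (ℕ.*-monoʳ-≤ k (ℕ.n≤1+n k)))))
  go : (∃[ k ] ((t ≡ fromℕ k) ⊎ (t ≡ - fromℕ k))) → ∃[ k ] ((0 ℕ.< k) × (k ℕ.< p) × (t ≡ fromℕ k))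
  go (k , inj₁ e) = k , pos k e , ≤-product p>0 (ℕ.≤-reflexive (sym pk)) mm+n<pp , e
   where
   pk : m ℕ.* m ℕ.+ n ≡ p ℕ.* k
   pk = fromℕ-injective (trans mm+n (trans (cong (fromℕ p *_) e) (sym (fromℕ-* p k))))
   pos : ∀ k → t ≡ fromℕ k → 0 ℕ.< k
   pos zero e = ⊥-elim (ℕ.<⇒≢ (ℕ.<-≤-trans n>0 (ℕ.m≤n+m n (m ℕ.* m))) (sym (fromℕ-injective (trans mm+n (trans (cong (fromℕ p *_) (trans e fromℕ-0)) (trans (ℚ.*-zeroʳ (fromℕ p)) (sym fromℕ-0)))))))
   pos (suc k) e = s≤s z≤n
  go (k , inj₂ e) = ⊥-elim (ℕ.<⇒≢ (ℕ.<-≤-trans n>0 (ℕ.≤-trans (ℕ.m≤n+m n (m ℕ.* m)) (ℕ.m≤m+n (m ℕ.* m ℕ.+ n) (p ℕ.* k))))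
   (sym (fromℕ-injective (trans (fromℕ-+ (m ℕ.* m ℕ.+ n) (p ℕ.* k)) (trans (cong₂ _+_ (trans mm+n (cong (fromℕ p *_) e)) (fromℕ-* p k))
    (trans (lem₂ (fromℕ p) (fromℕ k)) (sym fromℕ-0)))))))

 module Step {h : ℕ} (pr : Prime (suc (h ℕ.+ h))) (below : Below (suc (h ℕ.+ h))) where
  open OddPrime {h} pr
  open Extend below

  private
   P : ℚ
   P = fromℕ p

   P≢0 : ¬ (P ≡ 0ℚ)
   P≢0 = pos≢0 p>0

   1<p : 1 ℕ.< p
   1<p = go p pr
    where
    go : ∀ p → Prime p → 1 ℕ.< p
    go zero pr = ⊥-elim (¬prime[0] pr)
    go (suc zero) pr = ⊥-elim (¬prime[1] pr)
    go (suc (suc p)) pr = s≤s (s≤s z≤n)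

   int--1 : Int -1ℚ
   int--1 = int-neg int-1

   mul1 : ∀ s → s * fromℕ 1 ≡ s
   mul1 s = trans (cong (s *_) fromℕ-1) (ℚ.*-identityʳ s)

   neg* : ∀ x → x * -1ℚ ≡ - x
   neg* = solve-∀ ℚ-ring

   *neg : ∀ x → -1ℚ * x ≡ - x
   *neg = solve-∀ ℚ-ring

  by-residue⁺ : ∀ {n s l} → 0 ℕ.< n → n ℕ.< p → Res p (fromℕ n) → Unit± s → 0 ℕ.< l → l ℕ.< p → ¬ (s * fromℕ l ≡ 0ℚ) →
   Rep (fromℕ n) P (s * fromℕ l)
  by-residue⁺ {n} {s} {l} n>0 n<p (m , m<p , dv t it e) us l>0 l<p v≢0 = rep-residue (fromℕ m) (pos≢0 n>0) v≢0 P≢0 e k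
   where
   k : ¬ (t ≡ 0ℚ) → Rep (fromℕ n) t (s * fromℕ l)
   k t≢0 = go (signed-quotient m n t p>0 m<p (ℕ.<-≤-trans n<p (ℕ.m≤m*n p p)) it e t≢0)
    where
    go : SignedQuotient p t → Rep (fromℕ n) t (s * fromℕ l)
    go (s' , k , us' , k>0 , k<p , e') = subst (λ z → Rep (fromℕ n) z (s * fromℕ l)) (sym e')
     (rep-swap₁₃ (pos≢0 n>0) (rep-mixed us l k n l>0 l<p k>0 k<p n>0 n<p us'))

  by-residue⁻ : ∀ {n s l} → 0 ℕ.< n → n ℕ.< p → Res p (- fromℕ n) → Unit± s → 0 ℕ.< l → l ℕ.< p → ¬ (s * fromℕ l ≡ 0ℚ) →
   Rep (- fromℕ n) P (s * fromℕ l)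
  by-residue⁻ {n} {s} {l} n>0 n<p (m , m<p , dv t it e) us l>0 l<p v≢0 =
    rep-residue (fromℕ m) (λ z → pos≢0 n>0 (trans (sym (neg-neg (fromℕ n))) (cong -_ z))) v≢0 P≢0 e (λ _ → go (positive-quotient m n t m<p n>0 n<p it e))
   where
   go : ∃[ k ] ((0 ℕ.< k) × (k ℕ.< p) × (t ≡ fromℕ k)) → Rep (- fromℕ n) t (s * fromℕ l)
   go (k , k>0 , k<p , e') = subst (λ z → Rep (- fromℕ n) z (s * fromℕ l)) (sym e')
    (rep-swap₂₃ (pos≢0 k>0) (subst (λ z → Rep z (s * fromℕ l) (fromℕ k)) (*neg (fromℕ n)) (rep-mixed minus n l k n>0 n<p l>0 l<p k>0 k<p us)))

  by-residue⁺₋₁ : ∀ {n} → 0 ℕ.< n → n ℕ.< p → Res p (fromℕ n) → Rep (fromℕ n) P -1ℚ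
  by-residue⁺₋₁ {n} n>0 n<p h = subst (Rep (fromℕ n) P) (mul1 -1ℚ) (by-residue⁺ n>0 n<p h minus (s≤s z≤n) 1<p (λ e → -1≢0 (trans (sym (mul1 -1ℚ)) e)))

  by-residue⁻₋₁ : ∀ {n} → 0 ℕ.< n → n ℕ.< p → Res p (- fromℕ n) → Rep (- fromℕ n) P -1ℚ
  by-residue⁻₋₁ {n} n>0 n<p h = subst (Rep (- fromℕ n) P) (mul1 -1ℚ) (by-residue⁻ n>0 n<p h minus (s≤s z≤n) 1<p (λ e → -1≢0 (trans (sym (mul1 -1ℚ)) e)))

  by-residue⁺ₙ : ∀ {n l} → 0 ℕ.< n → n ℕ.< p → Res p (fromℕ n) → 0 ℕ.< l → l ℕ.< p → Rep (fromℕ n) P (fromℕ l)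
  by-residue⁺ₙ {n} {l} n>0 n<p h l>0 l<p = subst (Rep (fromℕ n) P) (ℚ.*-identityˡ (fromℕ l)) (by-residue⁺ n>0 n<p h plus l>0 l<p (λ e → pos≢0 l>0 (trans (sym (ℚ.*-identityˡ (fromℕ l))) e)))

  by-residue⁻ₙ : ∀ {n l} → 0 ℕ.< n → n ℕ.< p → Res p (- fromℕ n) → 0 ℕ.< l → l ℕ.< p → Rep (- fromℕ n) P (fromℕ l)
  by-residue⁻ₙ {n} {l} n>0 n<p h l>0 l<p = subst (Rep (- fromℕ n) P) (ℚ.*-identityˡ (fromℕ l)) (by-residue⁻ n>0 n<p h plus l>0 l<p (λ e → pos≢0 l>0 (trans (sym (ℚ.*-identityˡ (fromℕ l))) e)))

  -1≡ : - fromℕ 1 ≡ -1ℚ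
  -1≡ = cong -_ fromℕ-1

  least-nonresidue : ¬ Res p -1ℚ → NonresidueAfter p
  least-nonresidue ¬r = find (h ℕ.+ h ℕ.∸ 1) 1 (s≤s z≤n) (trans (ℕ.+-comm 1 _) (ℕ.m∸n+n≡m (ℕ.≤-pred 1<p)))
    (1 , 1<p , dv 0ℚ int-0 (trans (cong (λ z → z * z - z) fromℕ-1) (sym (ℚ.*-zeroʳ P))))
   where
   find : ∀ d i → 0 ℕ.< i → i ℕ.+ d ≡ h ℕ.+ h → Res p (fromℕ i) → NonresidueAfter p
   find zero i i>0 e (m , m<p , d) = ⊥-elim (¬r (m , m<p , subst (Dv p) eq (dv-+ d (dv-self {p} int-1))))
    where
    lem : ∀ x i → (x - i) + 1ℚ * (1ℚ + i) ≡ x - (- 1ℚ)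
    lem = solve-∀ ℚ-ring
    P≡ : P ≡ 1ℚ + fromℕ i
    P≡ = trans (cong (fromℕ ∘ suc) (trans (sym e) (ℕ.+-identityʳ i))) (trans (fromℕ-+ 1 i) (cong (_+ fromℕ i) fromℕ-1))
    eq : (fromℕ m * fromℕ m - fromℕ i) + 1ℚ * P ≡ fromℕ m * fromℕ m - -1ℚ
    eq = trans (cong (λ z → (fromℕ m * fromℕ m - fromℕ i) + 1ℚ * z) P≡) (lem (fromℕ m * fromℕ m) (fromℕ i))
   find (suc d) i i>0 e r = try (res? p>0 (fromℕ (suc i)))
    where
    try : Dec (Res p (fromℕ (suc i))) → NonresidueAfter p
    try (yes r') = find d (suc i) (s≤s z≤n) (trans (sym (ℕ.+-suc i d)) e) r'
    try (no ¬r') = i , i>0 , s≤s (ℕ.≤-trans (ℕ.≤-trans (ℕ.m≤m+n (suc i) d) (ℕ.≤-reflexive (sym (ℕ.+-suc i d)))) (ℕ.≤-reflexive e)) , r , ¬r'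

  key₋₁₋₁ : Rep -1ℚ P -1ℚ
  key₋₁₋₁ = go (res? p>0 -1ℚ)
   where
   go : Dec (Res p -1ℚ) → Rep -1ℚ P -1ℚ
   go (yes r) = subst (λ z → Rep z P -1ℚ) -1≡ (by-residue⁻₋₁ (s≤s z≤n) 1<p (subst (Res p) (sym -1≡) r))
   go (no ¬r) = use (least-nonresidue ¬r)
    where
    use : NonresidueAfter p → Rep -1ℚ P -1ℚ
    use (k , k>0 , n<p , rk , ¬rn) = rep-/₁ n≢0 -1≢0 -1≢0 (rep-swap₂₃ P≢0 n,-1) (subst (λ z → Rep z P -1ℚ) (sym (neg* n)) (by-residue⁻₋₁ (s≤s z≤n) n<p
      (subst (Res p) (neg* n) (nonresidue-product n -1ℚ (int-ℕ (suc k)) int--1 (¬dv-small (s≤s z≤n) n<p) ¬rn ¬r))))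
     where
     n = fromℕ (suc k)
     n≢0 : ¬ (n ≡ 0ℚ)
     n≢0 = pos≢0 (s≤s z≤n)
     k<p = ℕ.<-trans (ℕ.n<1+n k) n<p
     n,k : Rep n (fromℕ k) P
     n,k = rep-swap₂₃ (pos≢0 k>0) (rep-swap₁₃ n≢0 (by-residue⁺ₙ k>0 k<p rk (s≤s z≤n) n<p))
     lem : ∀ k → 1ℚ * 1ℚ - (1ℚ + k) * (1ℚ * 1ℚ) ≡ k * (- 1ℚ)
     lem = solve-∀ ℚ-ring
     steinberg : Rep n (fromℕ k * -1ℚ) P
     steinberg = rep-binary 1ℚ 1ℚ P (λ e → pos≢0 k>0 (trans (sym (trans (cong -_ (neg* (fromℕ k))) (neg-neg (fromℕ k)))) (cong -_ e)))
      (trans (cong (λ z → 1ℚ * 1ℚ - z * (1ℚ * 1ℚ)) (trans (fromℕ-+ 1 k) (cong (_+ fromℕ k) fromℕ-1))) (lem (fromℕ k)))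
     n,-1 : Rep n -1ℚ P
     n,-1 = rep-/₂ (pos≢0 k>0) -1≢0 P≢0 n,k steinberg

  key₋₁ : ∀ {q} → Prime q → q ℕ.< p → Rep (fromℕ q) P -1ℚ
  key₋₁ {q} qr q<p = go (res? p>0 -1ℚ) (res? p>0 (fromℕ q))
   where
   go : Dec (Res p -1ℚ) → Dec (Res p (fromℕ q)) → Rep (fromℕ q) P -1ℚ
   go (yes r) _ = rep-swap₁₃ (prime≢0 qr) (subst (λ z → Rep z P (fromℕ q)) -1≡ (by-residue⁻ₙ (s≤s z≤n) 1<p (subst (Res p) (sym -1≡) r) (prime>0 qr) q<p))
   go (no _) (yes r) = by-residue⁺₋₁ (prime>0 qr) q<p r
   go (no ¬r) (no ¬rq) = rep-/₁ -1≢0 (prime≢0 qr) -1≢0 key₋₁₋₁ (subst (λ z → Rep z P -1ℚ) (sym (*neg (fromℕ q)))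
    (by-residue⁻₋₁ (prime>0 qr) q<p (subst (Res p) (neg* (fromℕ q)) (nonresidue-product (fromℕ q) -1ℚ (int-ℕ q) int--1 (¬dv-small (prime>0 qr) q<p) ¬rq ¬r))))

  key₂ : ∀ {q r} → Prime q → q ℕ.< p → Prime r → r ℕ.< p → Rep (fromℕ q) P (fromℕ r)
  key₂ {q} {r} qr q<p rr r<p = go (res? p>0 (fromℕ q)) (res? p>0 (fromℕ r))
   where
   Q = fromℕ q
   R = fromℕ r
   Q≢0 = prime≢0 qr
   R≢0 = prime≢0 rr
   QR≢0 : ¬ (Q * R ≡ 0ℚ)
   QR≢0 e with *-zero {Q} {R} e
   ... | inj₁ z = Q≢0 z
   ... | inj₂ z = R≢0 z
   product-case : Res p (Q * R) → Rep (Q * R) P Q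
   product-case (m , m<p , dv t it e) = rep-residue (fromℕ m) QR≢0 Q≢0 P≢0 e (λ t≢0 → use (signed-quotient m (q ℕ.* r) t p>0 m<p (ℕ.*-mono-< q<p r<p) it (trans (cong (λ z → fromℕ m * fromℕ m - z) (fromℕ-* q r)) e) t≢0))
    where
    use : SignedQuotient p t → Rep (Q * R) t Q
    use (s , k , us , k>0 , k<p , e') = subst (λ z → Rep (Q * R) z Q) (sym e') (rep-*₁ Q≢0 R≢0 Q≢0 (at qr q<p) (at rr r<p))
     where
     at : ∀ {l} → Prime l → l ℕ.< p → Rep (fromℕ l) (s * fromℕ k) Q
     at {l} lr l<p = subst (λ z → Rep z (s * fromℕ k) Q) (ℚ.*-identityˡ (fromℕ l)) (rep-mixed plus l k q (prime>0 lr) l<p k>0 k<p (prime>0 qr) q<p us)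
   go : Dec (Res p Q) → Dec (Res p R) → Rep Q P R
   go (yes h) _ = by-residue⁺ₙ (prime>0 qr) q<p h (prime>0 rr) r<p
   go (no _) (yes h) = rep-swap₁₃ Q≢0 (by-residue⁺ₙ (prime>0 rr) r<p h (prime>0 qr) q<p)
   go (no h) (no h') = rep-/ Q≢0
    (rep-swap₂₃ P≢0 (rep-diagonal Q P Q≢0 P≢0 (rep-swap₂₃ -1≢0 (key₋₁ qr q<p))))
    (rep-swap₁₃ Q≢0 (product-case (nonresidue-product Q R (int-ℕ q) (int-ℕ r) (¬dv-small (prime>0 qr) q<p) h h')))

  key : ∀ {u v} → Atom p u → Atom p v → Rep u v P
  key minus minus = rep-swap₂₃ -1≢0 key₋₁₋₁
  key minus (prime qr q<p) = rep-swap₁₂ (rep-swap₂₃ -1≢0 (key₋₁ qr q<p))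
  key (prime qr q<p) minus = rep-swap₂₃ -1≢0 (key₋₁ qr q<p)
  key (prime qr q<p) (prime rr r<p) = rep-swap₂₃ (prime≢0 rr) (key₂ qr q<p rr r<p)

 parity : ∀ n → ∃[ h ] ((n ≡ h ℕ.+ h) ⊎ (n ≡ suc (h ℕ.+ h)))
 parity zero = 0 , inj₁ refl
 parity (suc n) with parity n
 ... | h , inj₁ refl = h , inj₂ refl
 ... | h , inj₂ refl = suc h , inj₁ (cong suc (sym (ℕ.+-suc h h)))

 key-all : ∀ {p} → Prime p → Below p → ∀ {u v} → Atom p u → Atom p v → Rep u v (fromℕ p)
 key-all {p} pr below with parity p
 ... | h , inj₂ refl = Step.key {h} pr below
 ... | h , inj₁ e = even (prime⇒irreducible pr {2} (Data.Nat.Divisibility.divides h (trans e (trans (cong (h ℕ.+_) (sym (ℕ.+-identityʳ h))) (ℕ.*-comm 2 h)))))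
  where
  import Data.Nat.Divisibility
  two : Rep -1ℚ -1ℚ (fromℕ 2)
  two = rep 1ℚ 1ℚ 0ℚ 0ℚ (trans refl (sym (trans (fromℕ-+ 1 1) (cong₂ _+_ fromℕ-1 fromℕ-1))))
  small : ∀ {q} → Prime q → ¬ (q ℕ.< 2)
  small {zero} qr _ = ¬prime[0] qr
  small {suc zero} qr _ = ¬prime[1] qr
  small {suc (suc q)} qr (s≤s (s≤s ()))
  even : (2 ≡ 1) ⊎ (2 ≡ p) → ∀ {u v} → Atom p u → Atom p v → Rep u v (fromℕ p)
  even (inj₂ refl) minus minus = two
  even (inj₂ refl) (prime qr q<2) _ = ⊥-elim (small qr q<2)
  even (inj₂ refl) _ (prime qr q<2) = ⊥-elim (small qr q<2)

 below-suc : ∀ {p} → Prime p → Below p → Below (suc p)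
 below-suc {p} pr below = go
  where
  P = fromℕ p
  P≢0 : ¬ (P ≡ 0ℚ)
  P≢0 = prime≢0 pr
  K : ∀ {u v} → Atom p u → Atom p v → Rep u v P
  K = key-all pr below
  data View : ℚ → Set where
   old : ∀ {u} → Atom p u → View u
   new : View P
  view-prime : ∀ {q} → Prime q → q ℕ.< suc p → View (fromℕ q)
  view-prime {q} qr q<p with ℕ.m≤n⇒m<n∨m≡n (ℕ.≤-pred q<p)
  ... | inj₁ lt = old (prime qr lt)
  ... | inj₂ refl = new
  view : ∀ {u} → Atom (suc p) u → View u
  view minus = old minus
  view (prime qr q<p) = view-prime qr q<p
  P-1 : ∀ {u} → Atom p u → Rep P -1ℚ u
  P-1 au = rep-swap₁₃ P≢0 (K au minus)
  PPu : ∀ {u} → Atom p u → Rep P P u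
  PPu au = rep-diagonal P _ P≢0 (atom≢0 au) (P-1 au)
  PuP : ∀ {u} → Atom p u → Rep P u P
  PuP au = rep-swap₂₃ (atom≢0 au) (PPu au)
  main : ∀ {u v r} → View u → View v → Prime r → r ℕ.< p → Rep u v (fromℕ r)
  main (old au) (old av) rr r<p = below au av rr r<p
  main new (old av) rr r<p = rep-swap₁₃ P≢0 (K (prime rr r<p) av)
  main (old au) new rr r<p = rep-swap₂₃ P≢0 (K au (prime rr r<p))
  main new new rr r<p = PPu (prime rr r<p)
  top : ∀ {u v} → View u → View v → Rep u v P
  top (old au) (old av) = K au av
  top new (old av) = PuP av
  top (old au) new = rep-swap₁₂ (PuP au)
  top new new = rep-diagonal P P P≢0 P≢0 (PuP minus)
  go : Below (suc p)
  go au av rr r<p with ℕ.m≤n⇒m<n∨m≡n (ℕ.≤-pred r<p)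
  ... | inj₁ lt = main (view au) (view av) rr lt
  ... | inj₂ refl = top (view au) (view av)

 below-all : ∀ p → Below p
 below-all zero _ _ _ ()
 below-all (suc p) with prime? p
 ... | yes pr = below-suc pr (below-all p)
 ... | no ¬pr = λ au av rr r<p → below-all p (lower au) (lower av) rr (strict rr r<p)
  where
  strict : ∀ {r} → Prime r → r ℕ.< suc p → r ℕ.< p
  strict rr (s≤s r≤p) = ℕ.≤∧≢⇒< r≤p λ { refl → ¬pr rr }
  lower : ∀ {u} → Atom (suc p) u → Atom p u
  lower minus = minus
  lower (prime qr q<p) = prime qr (strict qr q<p)

 SquareClass : ℚ → Set
 SquareClass q = ∃[ n ] ∃[ d ] ((0 ℕ.< n) × ¬ (d ≡ 0ℚ) × (q * (d * d) ≡ fromℕ n))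

 square-class : ∀ q → 0ℚ < q → SquareClass q
 square-class q q>0 = go (denominator q)
  where
  go : ∃[ d ] ((0 ℕ.< d) × Int (fromℕ d * q)) → SquareClass q
  go (d , d>0 , i) = use (natural i (*-pos (fromℕ-pos d>0) q>0))
   where
   lem : ∀ q d → q * (d * d) ≡ d * (d * q)
   lem = solve-∀ ℚ-ring
   use : ∃[ n ] ((0 ℕ.< n) × (fromℕ d * q ≡ fromℕ n)) → SquareClass q
   use (n , n>0 , e) = d ℕ.* n , fromℕ d , ℕ.*-mono-< d>0 n>0 , pos≢0 d>0 ,
    trans (lem q (fromℕ d)) (trans (cong (fromℕ d *_) e) (sym (fromℕ-* d n)))

 rep-unscale₁ : ∀ {a b c} t → Rep (a * (t * t)) b c → Rep a b c
 rep-unscale₁ {a} {b} t (rep x₀ x₁ x₂ x₃ h) = rep x₀ (t * x₁) x₂ (t * x₃) (trans (lem a b t x₀ x₁ x₂ x₃) h)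
  where
  lem : ∀ a b t x₀ x₁ x₂ x₃ → x₀ * x₀ - a * ((t * x₁) * (t * x₁)) - b * (x₂ * x₂) + a * b * ((t * x₃) * (t * x₃)) ≡
   x₀ * x₀ - (a * (t * t)) * (x₁ * x₁) - b * (x₂ * x₂) + (a * (t * t)) * b * (x₃ * x₃)
  lem = solve-∀ ℚ-ring

 norm-surjective : ∀ {a b c} → a < 0ℚ → b < 0ℚ → 0ℚ < c → Rep a b c
 norm-surjective {a} {b} {c} a<0 b<0 c>0 = go (square-class (- a) (neg-pos a<0)) (square-class (- b) (neg-pos b<0)) (square-class c c>0)
  where
  lem : ∀ a d → a * (d * d) ≡ (- 1ℚ) * ((- a) * (d * d))
  lem = solve-∀ ℚ-ring
  go : SquareClass (- a) → SquareClass (- b) → SquareClass c → Rep a b c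
  go (l , d , l>0 , d≢0 , e) (m , d' , m>0 , d'≢0 , e') (n , d″ , n>0 , d″≢0 , e″) =
    rep-unscale₁ {a} {b} {c} d (rep-swap₁₂ {b} {a * (d * d)} {c} (rep-unscale₁ {b} {a * (d * d)} {c} d' (rep-swap₁₂ {a * (d * d)} {b * (d' * d')} {c} (rep-unscale {a * (d * d)} {b * (d' * d')} {c} d″ d″≢0
     (subst (Rep (a * (d * d)) (b * (d' * d'))) (sym e″) (subst₂ (λ u v → Rep u v (fromℕ n)) { -1ℚ * fromℕ l} {a * (d * d)} { -1ℚ * fromℕ m} {b * (d' * d')} (sym (trans (lem a d) (cong (-1ℚ *_) e))) (sym (trans (lem b d') (cong (-1ℚ *_) e')))
      (Extend.rep-mixed (below-all p) minus l m n l>0 l<p m>0 m<p n>0 n<p minus)))))))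
   where
   p = suc (l ℕ.+ m ℕ.+ n)
   l<p : l ℕ.< p
   l<p = s≤s (ℕ.≤-trans (ℕ.m≤m+n l m) (ℕ.m≤m+n (l ℕ.+ m) n))
   m<p : m ℕ.< p
   m<p = s≤s (ℕ.≤-trans (ℕ.m≤n+m m l) (ℕ.m≤m+n (l ℕ.+ m) n))
   n<p : n ℕ.< p
   n<p = s≤s (ℕ.m≤n+m n (l ℕ.+ m))

open import Data.List.Membership.Propositional.Properties using (∈-++⁺ˡ; ∈-++⁺ʳ)
open RationalAlgebra using (ℚ-ring)
open RationalVectors using (sumℚ)
open Integrality
open IntegralDeterminants using (module DetInt)
open import Data.List.Membership.Propositional.Properties using (∈-++⁺ˡ; ∈-++⁺ʳ; ∈-++⁻; ∈-map⁻)
open RationalAlgebra using (ℚ-ring; inv; <⇒≢0; *-pos)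
open PrimeResidues using (dv; Dv; ∣⇒dv)
open import Data.Nat.Divisibility using (_∣_; divides)
open RationalAlgebra using (ℚ-ring; inv; <⇒≢0; *-pos; *-cancelˡ)
open RationalVectors using (sumℚ; 1≢0ℚ)
open PrimeResidues using (pos≢0)
open import Data.List using (cartesianProductWith)
open import Data.List.Membership.Propositional.Properties using (∈-++⁺ˡ; ∈-++⁺ʳ; ∈-++⁻; ∈-cartesianProductWith⁺; ∈-cartesianProductWith⁻)
open import Relation.Nullary.Decidable using (map′)
open import Data.Fin.Properties using (all?; ¬∀⟶∃¬)
open import Data.Nat.Divisibility using (_∣_; divides; ∣⇒≤)
open import Data.Nat.Primality using (Prime; prime⇒irreducible; euclidsLemma; ¬prime[0]; ¬prime[1])
open RationalAlgebra using (ℚ-ring; inv)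
open PrimeResidues using (pos≢0; dv; Dv; dv⇒∣; prime-dichotomy; euclid; dv-+; dv-*; dv-self; ¬dv-small)
open NormForm using (prime>0; prime≢0)
open import Data.Nat.ListAction using (product)
open import Data.List.Relation.Unary.All using (All; []; _∷_)
open import Data.Nat.Induction using (<-wellFounded)
open import Data.Nat.Primality using (Prime)
open import Data.Nat.Primality.Factorisation using (factorise; PrimeFactorisation)
open import Induction.WellFounded using (Acc; acc)
open RationalAlgebra using (inv; *-pos; *-cancelˡ)
open RationalVectors using (1≢0ℚ)
open NormForm using (prime>0)
open RationalAlgebra using (ℚ-ring; inv; <⇒≢0; *-zero; *-cancelˡ)
open PrimeResidues using (dv; Dv; prime-dichotomy; dv-+; dv-*; dv-self)
open RationalAlgebra using (inv)
open import Algebra.Bundles using (Monoid)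
import Relation.Binary.Reasoning.Setoid as SetoidReasoning
open RationalAlgebra using (inv; <⇒≢0)

IntegerSpan : {H : Set} (_+_ : H → H → H) (0# : H) (_·_ : ℚ → H → H) → List H → H → Set
IntegerSpan _+_ 0# _·_ [] x = x ≡ 0#
IntegerSpan _+_ 0# _·_ (l ∷ ls) x = ∃[ z ] ∃[ y ] (Int z × IntegerSpan _+_ 0# _·_ ls y × (x ≡ ((z · l) + y)))

-- A definite rational quaternion algebra H with a maximal order InO.  Keeping it
-- abstract prevents the type checker from unfolding the multiplication.
record Setup : Set₁ where
 infixl 6 _+_
 infixl 7 _*_
 infix 8 -_
 field
  H : Set
  _+_ _*_ : H → H → H
  -_ : H → H
  0# 1# : H
  isRing : IsRing _≡_ _+_ _*_ -_ 0# 1#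
  _≟_ : DecidableEquality H
  conj : H → H
  conj-+ : ∀ x y → conj (x + y) ≡ conj x + conj y
  conj-* : ∀ x y → conj (x * y) ≡ conj y * conj x
  conj-conj : ∀ x → conj (conj x) ≡ x
  conj-1 : conj 1# ≡ 1#
  ι : ℚ → H
  ι-comm : ∀ q x → ι q * x ≡ x * ι q
  conj-ι : ∀ q → conj (ι q) ≡ ι q
  ι-+ : ∀ p q → ι (p ℚ.+ q) ≡ ι p + ι q
  ι-* : ∀ p q → ι (p ℚ.* q) ≡ ι p * ι q
  ι-0 : ι 0ℚ ≡ 0#
  ι-1 : ι 1ℚ ≡ 1#
  ι-injective : ∀ {p q} → ι p ≡ ι q → p ≡ q
  nrd trd : H → ℚ
  *-conj : ∀ x → x * conj x ≡ ι (nrd x)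
  conj-*ˡ : ∀ x → conj x * x ≡ ι (nrd x)
  +-conj : ∀ x → x + conj x ≡ ι (trd x)
  nrd-pos : ∀ x → ¬ (x ≡ 0#) → 0ℚ ℚ.< nrd x
  nrd-surjective : ∀ q → 0ℚ ℚ.< q → ∃[ x ] (nrd x ≡ q)
  InO : H → Set
  InO? : ∀ x → Dec (InO x)
  O-0 : InO 0#
  O-1 : InO 1#
  O-+ : ∀ {x y} → InO x → InO y → InO (x + y)
  O-neg : ∀ {x} → InO x → InO (- x)
  O-* : ∀ {x y} → InO x → InO y → InO (x * y)
  O-conj : ∀ {x} → InO x → InO (conj x)
  O-ι : ∀ {q} → Int q → InO (ι q)
  O-int : ∀ {q} → InO (ι q) → Int q
  basis : Fin 4 → H
  O-basis : ∀ i → InO (basis i)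
  O-coord : ∀ {x} → InO x → ∃ λ (n : Fin 4 → ℚ) → (∀ i → Int (n i)) ×
   (x ≡ ι (n zero) * basis zero + (ι (n (suc zero)) * basis (suc zero) +
    (ι (n (suc (suc zero))) * basis (suc (suc zero)) + ι (n (suc (suc (suc zero)))) * basis (suc (suc (suc zero))))))
  O-denominator : ∀ x → ∃[ d ] ((0 ℕ.< d) × InO (ι (fromℕ d) * x))

  coordinate : Fin 4 → H → ℚ
  coordinate-+ : ∀ r x y → coordinate r (x + y) ≡ coordinate r x ℚ.+ coordinate r y
  coordinate-ι : ∀ r q x → coordinate r (ι q * x) ≡ q ℚ.* coordinate r x
  coordinate-≡ : ∀ {x y} → (∀ r → coordinate r x ≡ coordinate r y) → x ≡ y
  unit : Fin 4 → H
  coordinate-unit : ∀ r s → coordinate r (unit s) ≡ DetInt.δ r s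
  O-maximal : ∀ (e : Fin 4 → H) → let Z = IntegerSpan _+_ 0# (λ z x → ι z * x) (tabulate e) in
   (∀ (c : Fin 4 → ℚ) → (∀ r → sumℚ (λ i → c i ℚ.* coordinate r (e i)) ≡ 0ℚ) → ∀ i → c i ≡ 0ℚ) →
   (∀ x → InO x → Z x) → (∀ x y → Z x → Z y → Z (x * y)) → ∀ x → Z x → InO x
  O-noncommutative : ∀ q → (∀ x → InO x → x * q ≡ q * x) → ∃[ r ] (q ≡ ι r)

-- An integral unimodular matrix (s t ; -w u) annihilating the second entry of (p , q).
Bezout : ℚ → ℚ → Set
Bezout p q = ∃[ s ] ∃[ t ] ∃[ u ] ∃[ w ] (Int s × Int t × Int u × Int w × (u ℚ.* q ≡ w ℚ.* p) × (s ℚ.* u ℚ.+ t ℚ.* w ≡ 1ℚ))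

bezout : ∀ p q → Bezout p q
bezout p q = clear (denominator p) (denominator q)
 where
 nat : ∀ m n → Bezout (fromℕ m) (fromℕ n)
 nat m n = go (int-bezout m n)
  where
  go : ∃[ d ] ∃[ s ] ∃[ t ] (Int s × Int t × (fromℕ d ≡ s ℚ.* fromℕ m ℚ.+ t ℚ.* fromℕ n) × (d ∣ m) × (d ∣ n)) → Bezout (fromℕ m) (fromℕ n)
  go (d , s , t , is , it , e , divides k refl , divides l refl) = zero? d refl
   where
   dl : ∀ k → fromℕ (k ℕ.* d) ≡ fromℕ k ℚ.* fromℕ d
   dl k = fromℕ-* k d
   zero? : ∀ d' → d ≡ d' → Bezout (fromℕ (k ℕ.* d)) (fromℕ (l ℕ.* d))
   zero? zero refl = 1ℚ , 0ℚ , 1ℚ , 0ℚ , int-1 , int-0 , int-1 , int-0 ,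
    trans (cong (1ℚ ℚ.*_) (trans (cong fromℕ (ℕ.*-zeroʳ l)) fromℕ-0)) (trans (ℚ.*-zeroʳ 1ℚ) (sym (ℚ.*-zeroˡ (fromℕ (k ℕ.* 0))))) , refl
   zero? (suc d') refl = s , t , fromℕ k , fromℕ l , is , it , int-ℕ k , int-ℕ l ,
     trans (cong (fromℕ k ℚ.*_) (dl l)) (trans (swap (fromℕ k) (fromℕ l) (fromℕ d)) (cong (fromℕ l ℚ.*_) (sym (dl k)))) ,
     *-cancelˡ (fromℕ d) (pos≢0 {d} (ℕ.s≤s ℕ.z≤n)) (trans (factor (fromℕ d) s (fromℕ k) t (fromℕ l)) (trans (cong₂ (λ x y → s ℚ.* x ℚ.+ t ℚ.* y) (sym (dl k)) (sym (dl l))) (trans (sym e) (sym (ℚ.*-identityʳ (fromℕ d))))))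
    where
    swap : ∀ k l d → k ℚ.* (l ℚ.* d) ≡ l ℚ.* (k ℚ.* d)
    swap = solve-∀ ℚ-ring
    factor : ∀ d s k t l → d ℚ.* (s ℚ.* k ℚ.+ t ℚ.* l) ≡ s ℚ.* (k ℚ.* d) ℚ.+ t ℚ.* (l ℚ.* d)
    factor = solve-∀ ℚ-ring
 neg² : ∀ s u → (ℚ.- s) ℚ.* (ℚ.- u) ≡ s ℚ.* u
 neg² = solve-∀ ℚ-ring
 negˡ : ∀ u q → (ℚ.- u) ℚ.* q ≡ ℚ.- (u ℚ.* q)
 negˡ = solve-∀ ℚ-ring
 negʳ : ∀ w p → ℚ.- (w ℚ.* p) ≡ w ℚ.* (ℚ.- p)
 negʳ = solve-∀ ℚ-ring
 flipˡ : ∀ {p q} → Bezout p q → Bezout (ℚ.- p) q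
 flipˡ {p} {q} (s , t , u , w , is , it , iu , iw , e , f) = ℚ.- s , t , ℚ.- u , w , int-neg is , it , int-neg iu , iw ,
  trans (negˡ u q) (trans (cong ℚ.-_ e) (negʳ w p)) , trans (cong (ℚ._+ t ℚ.* w) (neg² s u)) f
 flipʳ : ∀ {p q} → Bezout p q → Bezout p (ℚ.- q)
 flipʳ {p} {q} (s , t , u , w , is , it , iu , iw , e , f) = s , ℚ.- t , u , ℚ.- w , is , int-neg it , iu , int-neg iw ,
  trans (sym (negʳ u q)) (trans (cong ℚ.-_ e) (sym (negˡ w p))) , trans (cong (s ℚ.* u ℚ.+_) (neg² t w)) f
 int : ∀ {p q} → Int p → Int q → Bezout p q
 int {p} {q} ip iq = go (abs-unit p ip) (abs-unit q iq)
  where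
  go : ∃[ m ] ((p ≡ fromℕ m) ⊎ (p ≡ ℚ.- fromℕ m)) → ∃[ n ] ((q ≡ fromℕ n) ⊎ (q ≡ ℚ.- fromℕ n)) → Bezout p q
  go (m , inj₁ refl) (n , inj₁ refl) = nat m n
  go (m , inj₁ refl) (n , inj₂ refl) = flipʳ (nat m n)
  go (m , inj₂ refl) (n , inj₁ refl) = flipˡ (nat m n)
  go (m , inj₂ refl) (n , inj₂ refl) = flipʳ (flipˡ (nat m n))
 clear : ∃[ d ] ((0 ℕ.< d) × Int (fromℕ d ℚ.* p)) → ∃[ d ] ((0 ℕ.< d) × Int (fromℕ d ℚ.* q)) → Bezout p q
 clear (d , d>0 , ip) (d' , d'>0 , iq) = use (int (int-* (int-ℕ d') ip) (int-* (int-ℕ d) iq))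
  where
  D = fromℕ d
  D' = fromℕ d'
  l₁ : ∀ D D' u q → (D ℚ.* D') ℚ.* (u ℚ.* q) ≡ u ℚ.* (D ℚ.* (D' ℚ.* q))
  l₁ = solve-∀ ℚ-ring
  l₂ : ∀ D D' w p → w ℚ.* (D' ℚ.* (D ℚ.* p)) ≡ (D ℚ.* D') ℚ.* (w ℚ.* p)
  l₂ = solve-∀ ℚ-ring
  use : Bezout (D' ℚ.* (D ℚ.* p)) (D ℚ.* (D' ℚ.* q)) → Bezout p q
  use (s , t , u , w , is , it , iu , iw , e , f) = s , t , u , w , is , it , iu , iw ,
   *-cancelˡ (D ℚ.* D') (<⇒≢0 (*-pos (fromℕ-pos d>0) (fromℕ-pos d'>0))) (trans (l₁ D D' u q) (trans e (l₂ D D' w p))) , f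

Coprime : ℚ → ℚ → Set
Coprime x y = ∃[ u ] ∃[ v ] (Int u × Int v × (u ℚ.* x ℚ.+ v ℚ.* y ≡ 1ℚ))

coprime-sym : ∀ {x y} → Coprime x y → Coprime y x
coprime-sym {x} {y} (u , v , iu , iv , e) = v , u , iv , iu , trans (ℚ.+-comm (v ℚ.* y) (u ℚ.* x)) e

coprime-* : ∀ {x y z} → Int x → Int z → Coprime x z → Coprime y z → Coprime (x ℚ.* y) z
coprime-* {x} {y} {z} ix iz (u , v , iu , iv , e) (u' , v' , iu' , iv' , e') =
  u ℚ.* u' , v ℚ.+ u ℚ.* x ℚ.* v' , int-* iu iu' , int-+ iv (int-* (int-* iu ix) iv') ,
  trans (lem u u' v v' x y z) (trans (cong (λ w → u ℚ.* x ℚ.* w ℚ.+ v ℚ.* z) e') (trans (cong (ℚ._+ v ℚ.* z) (ℚ.*-identityʳ (u ℚ.* x))) e))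
 where
 lem : ∀ u u' v v' x y z → u ℚ.* u' ℚ.* (x ℚ.* y) ℚ.+ (v ℚ.+ u ℚ.* x ℚ.* v') ℚ.* z ≡ u ℚ.* x ℚ.* (u' ℚ.* y ℚ.+ v' ℚ.* z) ℚ.+ v ℚ.* z
 lem = solve-∀ ℚ-ring

coprime-+ : ∀ {x z w} → Int w → Coprime x z → Coprime (x ℚ.+ w ℚ.* z) z
coprime-+ {x} {z} {w} iw (u , v , iu , iv , e) = u , v ℚ.- u ℚ.* w , iu , int-- iv (int-* iu iw) , trans (lem u v x z w) e
 where
 lem : ∀ u v x z w → u ℚ.* (x ℚ.+ w ℚ.* z) ℚ.+ (v ℚ.- u ℚ.* w) ℚ.* z ≡ u ℚ.* x ℚ.+ v ℚ.* z
 lem = solve-∀ ℚ-ring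

module Star (M : Monoid 0ℓ 0ℓ) (_† : Monoid.Carrier M → Monoid.Carrier M)
 (†-cong : ∀ {x y} → Monoid._≈_ M x y → Monoid._≈_ M (x †) (y †))
 (†-∙ : ∀ x y → Monoid._≈_ M ((Monoid._∙_ M x y) †) (Monoid._∙_ M (y †) (x †)))
 (†-ε : Monoid._≈_ M (Monoid.ε M †) (Monoid.ε M)) where
 open Monoid M using (_≈_; _∙_; ε; assoc; identityˡ; identityʳ; ∙-cong; ∙-congˡ; ∙-congʳ) renaming (sym to symᴹ; trans to transᴹ)
 open SetoidReasoning (Monoid.setoid M)

 left-cancel : ∀ {a b} → a ∙ b ≈ ε → ∀ x → a ∙ (b ∙ x) ≈ x
 left-cancel {a} {b} e x = begin
  a ∙ (b ∙ x) ≈⟨ assoc a b x ⟨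
  (a ∙ b) ∙ x ≈⟨ ∙-congʳ e ⟩
  ε ∙ x       ≈⟨ identityˡ x ⟩
  x           ∎

 dagger-cancel : ∀ {v w} → v ∙ w ≈ ε → ∀ x → (w †) ∙ ((v †) ∙ x) ≈ x
 dagger-cancel {v} {w} e = left-cancel (transᴹ (symᴹ (†-∙ v w)) (transᴹ (†-cong e) †-ε))

 conjugate-back : ∀ {v w h k} → (v †) ∙ (h ∙ v) ≈ k → v ∙ w ≈ ε → (w †) ∙ (k ∙ w) ≈ h
 conjugate-back {v} {w} {h} {k} e vw = begin
  (w †) ∙ (k ∙ w)                   ≈⟨ ∙-congˡ (∙-congʳ (symᴹ e)) ⟩
  (w †) ∙ (((v †) ∙ (h ∙ v)) ∙ w)   ≈⟨ ∙-congˡ (transᴹ (assoc (v †) (h ∙ v) w) (∙-congˡ (transᴹ (assoc h v w) (transᴹ (∙-congˡ vw) (identityʳ h))))) ⟩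
  (w †) ∙ ((v †) ∙ h)               ≈⟨ dagger-cancel vw h ⟩
  h                                 ∎

 gram : ∀ m u → ((m ∙ u) †) ∙ (m ∙ u) ≈ (u †) ∙ (((m †) ∙ m) ∙ u)
 gram m u = begin
  ((m ∙ u) †) ∙ (m ∙ u)             ≈⟨ ∙-congʳ (†-∙ m u) ⟩
  ((u †) ∙ (m †)) ∙ (m ∙ u)         ≈⟨ assoc (u †) (m †) (m ∙ u) ⟩
  (u †) ∙ ((m †) ∙ (m ∙ u))         ≈⟨ ∙-congˡ (assoc (m †) m u) ⟨
  (u †) ∙ (((m †) ∙ m) ∙ u)         ∎

 isometry : ∀ {m n m' h h' v w u} → (m †) ∙ m ≈ h → m ∙ n ≈ ε → (m' †) ∙ m' ≈ h' → (v †) ∙ (h ∙ v) ≈ h' → v ∙ w ≈ ε → u ≈ m' ∙ (w ∙ n) → (u †) ∙ u ≈ ε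
 isometry {m} {n} {m'} {h} {h'} {v} {w} {u} mm mn mm' vhv vw e = begin
  (u †) ∙ u                                  ≈⟨ ∙-cong (†-cong e) e ⟩
  ((m' ∙ (w ∙ n)) †) ∙ (m' ∙ (w ∙ n))        ≈⟨ gram m' (w ∙ n) ⟩
  ((w ∙ n) †) ∙ (((m' †) ∙ m') ∙ (w ∙ n))    ≈⟨ ∙-cong (†-∙ w n) (∙-congʳ mm') ⟩
  ((n †) ∙ (w †)) ∙ (h' ∙ (w ∙ n))           ≈⟨ transᴹ (assoc (n †) (w †) _) (∙-congˡ (∙-congˡ (symᴹ (assoc h' w n)))) ⟩
  (n †) ∙ ((w †) ∙ ((h' ∙ w) ∙ n))           ≈⟨ ∙-congˡ (assoc (w †) (h' ∙ w) n) ⟨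
  (n †) ∙ (((w †) ∙ (h' ∙ w)) ∙ n)           ≈⟨ ∙-congˡ (∙-congʳ (conjugate-back vhv vw)) ⟩
  (n †) ∙ (h ∙ n)                            ≈⟨ conjugate-back (transᴹ (∙-congˡ (identityˡ m)) mm) mn ⟩
  ε                                          ∎

 similitude : ∀ {m m' n' h h' u v s} → (m †) ∙ m ≈ h → m' ∙ n' ≈ ε → (m' †) ∙ m' ≈ h' → (u †) ∙ u ≈ s → s ∙ m ≈ m ∙ s →
  v ≈ n' ∙ (u ∙ m) → (v †) ∙ (h' ∙ v) ≈ h ∙ s
 similitude {m} {m'} {n'} {h} {h'} {u} {v} {s} mm mn' mm' uu sm e = begin
  (v †) ∙ (h' ∙ v)                    ≈⟨ ∙-congˡ (∙-congʳ (symᴹ mm')) ⟩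
  (v †) ∙ (((m' †) ∙ m') ∙ v)         ≈⟨ gram m' v ⟨
  ((m' ∙ v) †) ∙ (m' ∙ v)             ≈⟨ ∙-cong (†-cong mv) mv ⟩
  ((u ∙ m) †) ∙ (u ∙ m)               ≈⟨ gram u m ⟩
  (m †) ∙ (((u †) ∙ u) ∙ m)           ≈⟨ ∙-congˡ (transᴹ (∙-congʳ uu) sm) ⟩
  (m †) ∙ (m ∙ s)                     ≈⟨ assoc (m †) m s ⟨
  ((m †) ∙ m) ∙ s                     ≈⟨ ∙-congʳ mm ⟩
  h ∙ s                               ∎
  where
  mv : m' ∙ v ≈ u ∙ m
  mv = transᴹ (∙-congˡ e) (left-cancel mn' (u ∙ m))

 similitude-back : ∀ {h h' v w s t} → (v †) ∙ (h' ∙ v) ≈ h ∙ s → v ∙ w ≈ ε → s ∙ t ≈ ε → (∀ x → s ∙ x ≈ x ∙ s) → (w †) ∙ (h ∙ w) ≈ h' ∙ t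
 similitude-back {h} {h'} {v} {w} {s} {t} e vw st central = begin
  (w †) ∙ (h ∙ w)                     ≈⟨ transᴹ (symᴹ (identityʳ _)) (∙-congˡ (symᴹ st)) ⟩
  ((w †) ∙ (h ∙ w)) ∙ (s ∙ t)         ≈⟨ assoc _ s t ⟨
  (((w †) ∙ (h ∙ w)) ∙ s) ∙ t         ≈⟨ ∙-congʳ (assoc (w †) (h ∙ w) s) ⟩
  ((w †) ∙ ((h ∙ w) ∙ s)) ∙ t         ≈⟨ ∙-congʳ (∙-congˡ (transᴹ (assoc h w s) (transᴹ (∙-congˡ (symᴹ (central w))) (symᴹ (assoc h s w))))) ⟩
  ((w †) ∙ ((h ∙ s) ∙ w)) ∙ t         ≈⟨ ∙-congʳ (conjugate-back e vw) ⟩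
  h' ∙ t                              ∎

 rescaled-isometry : ∀ {m m₁ n₁ s t u} → (m₁ †) ∙ m₁ ≈ s ∙ ((m †) ∙ m) → m₁ ∙ n₁ ≈ ε → t ∙ s ≈ ε → (∀ x → s ∙ x ≈ x ∙ s) →
  u ≈ m ∙ n₁ → (u †) ∙ u ≈ t
 rescaled-isometry {m} {m₁} {n₁} {s} {t} {u} mm mn ts central e = begin
  (u †) ∙ u                                    ≈⟨ ∙-cong (†-cong e) e ⟩
  ((m ∙ n₁) †) ∙ (m ∙ n₁)                      ≈⟨ gram m n₁ ⟩
  (n₁ †) ∙ (((m †) ∙ m) ∙ n₁)                  ≈⟨ left-cancel ts _ ⟨
  t ∙ (s ∙ ((n₁ †) ∙ (((m †) ∙ m) ∙ n₁)))      ≈⟨ ∙-congˡ (transᴹ (symᴹ (assoc s (n₁ †) _)) (transᴹ (∙-congʳ (central (n₁ †))) (assoc (n₁ †) s _))) ⟩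
  t ∙ ((n₁ †) ∙ (s ∙ (((m †) ∙ m) ∙ n₁)))      ≈⟨ ∙-congˡ (∙-congˡ (symᴹ (assoc s ((m †) ∙ m) n₁))) ⟩
  t ∙ ((n₁ †) ∙ ((s ∙ ((m †) ∙ m)) ∙ n₁))      ≈⟨ ∙-congˡ (∙-congˡ (∙-congʳ (symᴹ mm))) ⟩
  t ∙ ((n₁ †) ∙ (((m₁ †) ∙ m₁) ∙ n₁))          ≈⟨ ∙-congˡ (symᴹ (gram m₁ n₁)) ⟩
  t ∙ (((m₁ ∙ n₁) †) ∙ (m₁ ∙ n₁))              ≈⟨ ∙-congˡ (∙-cong (transᴹ (†-cong mn) †-ε) mn) ⟩
  t ∙ (ε ∙ ε)                                  ≈⟨ transᴹ (∙-congˡ (identityˡ ε)) (identityʳ t) ⟩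
  t                                            ∎

module StarMatrix
 {A : Set} {_+_ _*_ : A → A → A} { -_ : A → A} {0# 1# : A}
 (isRing : IsRing _≡_ _+_ _*_ -_ 0# 1#)
 (Σ : ∀ {n} → (Fin n → A) → A)
 (Σ-nil : ∀ (f : Fin zero → A) → Σ f ≡ 0#)
 (Σ-suc : ∀ {n} (f : Fin (suc n) → A) → Σ f ≡ (f zero + Σ (f ∘ suc)))
 (conj : A → A)
 (conj-+ : ∀ x y → conj (x + y) ≡ (conj x + conj y))
 (conj-* : ∀ x y → conj (x * y) ≡ (conj y * conj x))
 (conj-0 : conj 0# ≡ 0#)
 (conj-1 : conj 1# ≡ 1#)
 where
 open Matrix isRing Σ Σ-nil Σ-suc public
 open IsRing isRing using (*-assoc)

 conj-Σ : ∀ {n} (f : Fin n → A) → conj (Σ f) ≡ Σ (λ i → conj (f i))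
 conj-Σ {zero} f = trans (cong conj (Σ-nil f)) (trans conj-0 (sym (Σ-nil (λ i → conj (f i)))))
 conj-Σ {suc n} f = trans (cong conj (Σ-suc f)) (trans (conj-+ _ _) (trans (cong (conj (f zero) +_) (conj-Σ (f ∘ suc))) (sym (Σ-suc (λ i → conj (f i))))))

 _† : ∀ {n} → Mat n → Mat n
 (M †) i j = conj (M j i)

 †-cong : ∀ {n} {M N : Mat n} → M ≈ N → (M †) ≈ (N †)
 †-cong h i j = cong conj (h j i)

 †-⊠ : ∀ {n} (M N : Mat n) → ((M ⊠ N) †) ≈ ((N †) ⊠ (M †))
 †-⊠ M N i j = trans (conj-Σ (λ k → M j k * N k i)) (Σ-cong (λ k → conj-* (M j k) (N k i)))

 †-δ : ∀ {n} → ((δ {n}) †) ≈ δ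
 †-δ zero zero = conj-1
 †-δ zero (suc j) = conj-0
 †-δ (suc i) zero = conj-0
 †-δ (suc i) (suc j) = †-δ i j

 monoid : ℕ → Monoid 0ℓ 0ℓ
 monoid n = record { Carrier = Mat n ; _≈_ = _≈_ ; _∙_ = _⊠_ ; ε = δ ; isMonoid = record
  { isSemigroup = record { isMagma = record
    { isEquivalence = record { refl = λ {M} → ≈-refl {M = M} ; sym = λ {M} {N} → ≈-sym {M = M} {N} ; trans = λ {L} {M} {N} → ≈-trans {L = L} {M} {N} }
    ; ∙-cong = λ {M} {M'} {N} {N'} → ⊠-cong {M = M} {M'} {N} {N'} } ; assoc = ⊠-assoc }
  ; identity = ⊠-identityˡ , ⊠-identityʳ } }

 module StarLemmas n = Star (monoid n) _† (λ {M} {N} → †-cong {M = M} {N}) †-⊠ †-δ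

 infixr 6 _▹_
 _▹_ : ∀ {n} → Mat n → (Fin n → A) → Fin n → A
 (M ▹ v) i = Σ (λ k → M i k * v k)

 ▹-cong : ∀ {n} {M N : Mat n} {v w} → M ≈ N → (∀ i → v i ≡ w i) → ∀ i → (M ▹ v) i ≡ (N ▹ w) i
 ▹-cong h k i = Σ-cong (λ j → cong₂ _*_ (h i j) (k j))

 ▹-congʳ : ∀ {n} (M : Mat n) {v w} → (∀ i → v i ≡ w i) → ∀ i → (M ▹ v) i ≡ (M ▹ w) i
 ▹-congʳ M = ▹-cong {M = M} (λ _ _ → refl)

 ▹-⊠ : ∀ {n} (M N : Mat n) v i → ((M ⊠ N) ▹ v) i ≡ (M ▹ N ▹ v) i
 ▹-⊠ M N v i = trans (Σ-cong (λ k → sym (Σ-*ʳ (v k) (λ l → M i l * N l k)))) (trans (Σ-swap (λ k l → (M i l * N l k) * v k))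
  (Σ-cong (λ l → trans (Σ-cong (λ k → *-assoc (M i l) (N l k) (v k))) (Σ-*ˡ (M i l) (λ k → N l k * v k)))))

 ▹-δ : ∀ {n} (v : Fin n → A) i → (δ ▹ v) i ≡ v i
 ▹-δ v i = Σ-δˡ i v

 ▹-inverse : ∀ {n} {M N : Mat n} → (M ⊠ N) ≈ δ → ∀ v i → (M ▹ N ▹ v) i ≡ v i
 ▹-inverse {M = M} {N} h v i = trans (sym (▹-⊠ M N v i)) (trans (▹-cong {v = v} h (λ _ → refl) i) (▹-δ v i))

 form : ∀ {n} → (Fin n → A) → (Fin n → A) → A
 form x y = Σ (λ k → conj (x k) * y k)

 form-cong : ∀ {n} {x x' y y' : Fin n → A} → (∀ i → x i ≡ x' i) → (∀ i → y i ≡ y' i) → form x y ≡ form x' y'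
 form-cong h k = Σ-cong (λ i → cong₂ (λ a b → conj a * b) (h i) (k i))

 form-adjoint : ∀ {n} (M : Mat n) x y → form (M ▹ x) y ≡ form x ((M †) ▹ y)
 form-adjoint M x y = trans (Σ-cong (λ k → trans (cong (_* y k) (trans (conj-Σ (λ l → M k l * x l)) (Σ-cong (λ l → conj-* (M k l) (x l)))))
   (trans (sym (Σ-*ʳ (y k) (λ l → conj (x l) * conj (M k l)))) (Σ-cong (λ l → *-assoc (conj (x l)) (conj (M k l)) (y k))))))
  (trans (Σ-swap (λ k l → conj (x l) * (conj (M k l) * y k))) (Σ-cong (λ l → Σ-*ˡ (conj (x l)) (λ k → conj (M k l) * y k))))

 form-gram : ∀ {n} (M : Mat n) x y → form (M ▹ x) (M ▹ y) ≡ form x (((M †) ⊠ M) ▹ y)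
 form-gram M x y = trans (form-adjoint M x (M ▹ y)) (form-cong {x = x} (λ _ → refl) (λ i → sym (▹-⊠ (M †) M y i)))

module IdealTheory (𝕊 : Setup) where
 open StarRingSolver

 open Setup 𝕊 public
 open IsRing isRing public using (+-assoc; +-comm; +-identityˡ; +-identityʳ; -‿inverseˡ; -‿inverseʳ; *-assoc; *-identityˡ; *-identityʳ; distribˡ; distribʳ; zeroˡ; zeroʳ)
 open Solve isRing conj conj-+ conj-* conj-conj conj-1 ι ι-comm conj-ι 0ℚ public using (solveH)

 ZSpan : List H → H → Set
 ZSpan = IntegerSpan _+_ 0# (λ z x → ι z * x)

 conj-0 : conj 0# ≡ 0#
 conj-0 = trans (cong conj (sym ι-0)) (trans (conj-ι 0ℚ) ι-0)

 module _ {P : H → Set} (P-0 : P 0#) (P-+ : ∀ {x y} → P x → P y → P (x + y)) (P-ι : ∀ {z x} → Int z → P x → P (ι z * x)) where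
  ZSpan-least : ∀ ls → (∀ {l} → l ∈ ls → P l) → ∀ {x} → ZSpan ls x → P x
  ZSpan-least [] h refl = P-0
  ZSpan-least (l ∷ ls) h (z , y , iz , hy , refl) = P-+ (P-ι iz (h (here refl))) (ZSpan-least ls (h ∘ there) hy)

 ZSpan-0 : ∀ ls → ZSpan ls 0#
 ZSpan-0 [] = refl
 ZSpan-0 (l ∷ ls) = 0ℚ , 0# , int-0 , ZSpan-0 ls , sym (trans (+-identityʳ _) (trans (cong (_* l) ι-0) (zeroˡ l)))

 ZSpan-+ : ∀ ls {x y} → ZSpan ls x → ZSpan ls y → ZSpan ls (x + y)
 ZSpan-+ [] refl refl = +-identityʳ 0#
 ZSpan-+ (l ∷ ls) (z , y , iz , hy , refl) (z' , y' , iz' , hy' , refl) = z ℚ.+ z' , y + y' , int-+ iz iz' , ZSpan-+ ls hy hy' ,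
  trans (solveH (l ∷ y ∷ y' ∷ []) (z ∷ z' ∷ []) ((S 0 :* V 0 :+ V 1) :+ (S 1 :* V 0 :+ V 2)) ((S 0 :+ S 1) :* V 0 :+ (V 1 :+ V 2)) refl)
   (cong (λ w → w * l + (y + y')) (sym (ι-+ z z')))

 ZSpan-ι : ∀ ls {z x} → Int z → ZSpan ls x → ZSpan ls (ι z * x)
 ZSpan-ι [] {z} iz refl = zeroʳ (ι z)
 ZSpan-ι (l ∷ ls) {z} iz (z' , y , iz' , hy , refl) = z ℚ.* z' , ι z * y , int-* iz iz' , ZSpan-ι ls iz hy ,
  trans (solveH (l ∷ y ∷ []) (z ∷ z' ∷ []) (S 0 :* (S 1 :* V 0 :+ V 1)) ((S 0 :* S 1) :* V 0 :+ S 0 :* V 1) refl)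
   (cong (λ w → w * l + ι z * y) (sym (ι-* z z')))

 ZSpan-∈ : ∀ {ls l} → l ∈ ls → ZSpan ls l
 ZSpan-∈ {l ∷ ls} (here refl) = 1ℚ , 0# , int-1 , ZSpan-0 ls , sym (trans (+-identityʳ _) (trans (cong (_* l) ι-1) (*-identityˡ l)))
 ZSpan-∈ {l ∷ ls} {m} (there h) = 0ℚ , m , int-0 , ZSpan-∈ h , sym (trans (cong (_+ m) (trans (cong (_* l) ι-0) (zeroˡ l))) (+-identityˡ m))

 -- The right O-module generated by a list.
 Span : List H → H → Set
 Span [] x = x ≡ 0#
 Span (g ∷ gs) x = ∃[ o ] ∃[ y ] (InO o × Span gs y × (x ≡ g * o + y))

 record IsIdeal (I : H → Set) : Set where
  field
   i-0 : I 0#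
   i-+ : ∀ {x y} → I x → I y → I (x + y)
   i-* : ∀ {x o} → I x → InO o → I (x * o)

  i-ι : ∀ {z x} → Int z → I x → I (ι z * x)
  i-ι {z} {x} iz h = subst I (sym (ι-comm z x)) (i-* h (O-ι iz))

  i-neg : ∀ {x} → I x → I (- x)
  i-neg {x} h = subst I (solveH (x ∷ []) [] (V 0 :* (:- :1)) (:- V 0) refl) (i-* h (O-neg O-1))

  i-- : ∀ {x y} → I x → I y → I (x + - y)
  i-- h k = i-+ h (i-neg k)

 Span-ideal : ∀ gs → IsIdeal (Span gs)
 Span-ideal gs = record { i-0 = zero-in gs ; i-+ = add gs ; i-* = mul gs }
  where
  zero-in : ∀ gs → Span gs 0#
  zero-in [] = refl
  zero-in (g ∷ gs) = 0# , 0# , O-0 , zero-in gs , sym (trans (+-identityʳ _) (zeroʳ g))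
  add : ∀ gs {x y} → Span gs x → Span gs y → Span gs (x + y)
  add [] refl refl = +-identityʳ 0#
  add (g ∷ gs) (o , y , io , hy , refl) (o' , y' , io' , hy' , refl) = o + o' , y + y' , O-+ io io' , add gs hy hy' ,
   solveH (g ∷ o ∷ y ∷ o' ∷ y' ∷ []) [] ((V 0 :* V 1 :+ V 2) :+ (V 0 :* V 3 :+ V 4)) (V 0 :* (V 1 :+ V 3) :+ (V 2 :+ V 4)) refl
  mul : ∀ gs {x o} → Span gs x → InO o → Span gs (x * o)
  mul [] {o = o} refl io = zeroˡ o
  mul (g ∷ gs) {o = p} (o , y , io , hy , refl) ip = o * p , y * p , O-* io ip , mul gs hy ip ,
   solveH (g ∷ o ∷ y ∷ p ∷ []) [] ((V 0 :* V 1 :+ V 2) :* V 3) (V 0 :* (V 1 :* V 3) :+ V 2 :* V 3) refl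

 open IsIdeal

 O-ideal : IsIdeal InO
 O-ideal = record { i-0 = O-0 ; i-+ = O-+ ; i-* = O-* }

 Span-∈ : ∀ {gs g} → g ∈ gs → Span gs g
 Span-∈ {g ∷ gs} (here refl) = 1# , 0# , O-1 , i-0 (Span-ideal gs) , sym (trans (+-identityʳ _) (*-identityʳ g))
 Span-∈ {g ∷ gs} {h} (there k) = 0# , h , O-0 , Span-∈ k , sym (trans (cong (_+ h) (zeroʳ g)) (+-identityˡ h))

 Span-least : ∀ {I} → IsIdeal I → ∀ gs → (∀ {g} → g ∈ gs → I g) → ∀ {x} → Span gs x → I x
 Span-least i [] h refl = i-0 i
 Span-least i (g ∷ gs) h (o , y , io , hy , refl) = i-+ i (i-* i (h (here refl)) io) (Span-least i gs (h ∘ there) hy)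

 Span-++ˡ : ∀ gs hs {x} → Span gs x → Span (gs ++ hs) x
 Span-++ˡ gs hs = Span-least (Span-ideal (gs ++ hs)) gs (Span-∈ ∘ ∈-++⁺ˡ)

 Span-++ʳ : ∀ gs hs {x} → Span hs x → Span (gs ++ hs) x
 Span-++ʳ gs hs = Span-least (Span-ideal (gs ++ hs)) hs (Span-∈ ∘ ∈-++⁺ʳ gs)

 Span-split : ∀ gs hs {x} → Span (gs ++ hs) x → ∃[ y ] ∃[ z ] (Span gs y × Span hs z × (x ≡ y + z))
 Span-split [] hs {x} h = 0# , x , refl , h , sym (+-identityˡ x)
 Span-split (g ∷ gs) hs (o , y , io , hy , refl) with Span-split gs hs hy
 ... | y' , z , hy' , hz , refl = g * o + y' , z , (o , y' , io , hy' , refl) , hz , sym (+-assoc _ _ _)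

 Span-map : ∀ α gs {x} → Span gs x → Span (map (α *_) gs) (α * x)
 Span-map α [] refl = zeroʳ α
 Span-map α (g ∷ gs) (o , y , io , hy , refl) = o , α * y , io , Span-map α gs hy ,
  solveH (α ∷ g ∷ o ∷ y ∷ []) [] (V 0 :* (V 1 :* V 2 :+ V 3)) ((V 0 :* V 1) :* V 2 :+ V 0 :* V 3) refl

 Span-unmap : ∀ α gs {x} → Span (map (α *_) gs) x → ∃[ y ] (Span gs y × (x ≡ α * y))
 Span-unmap α [] refl = 0# , refl , sym (zeroʳ α)
 Span-unmap α (g ∷ gs) (o , y , io , hy , refl) with Span-unmap α gs hy
 ... | y' , hy' , refl = g * o + y' , (o , y' , io , hy' , refl) ,
  solveH (α ∷ g ∷ o ∷ y' ∷ []) [] ((V 0 :* V 1) :* V 2 :+ V 0 :* V 3) (V 0 :* (V 1 :* V 2 :+ V 3)) refl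

 data NormSum (I : H → Set) (r : ℚ) : Set where
  nil : r ≡ 0ℚ → NormSum I r
  cons : ∀ {q} c x → Int c → I x → NormSum I q → r ≡ q ℚ.+ c ℚ.* nrd x → NormSum I r

 sum-ι : ∀ {I r c} → Int c → NormSum I r → NormSum I (c ℚ.* r)
 sum-ι {c = c} ic (nil refl) = nil (ℚ.*-zeroʳ c)
 sum-ι {c = c} ic (cons {q} d x id h s refl) = cons (c ℚ.* d) x (int-* ic id) h (sum-ι ic s) (lem c q d (nrd x))
  where
  lem : ∀ c q d n → c ℚ.* (q ℚ.+ d ℚ.* n) ≡ c ℚ.* q ℚ.+ c ℚ.* d ℚ.* n
  lem = solve-∀ ℚ-ring

 record _∣ℚ_ (N r : ℚ) : Set where
  constructor mult
  field
   factor : ℚ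
   int-factor : Int factor
   factor-* : r ≡ N ℚ.* factor

 ∣-+ : ∀ {N p q} → N ∣ℚ p → N ∣ℚ q → N ∣ℚ (p ℚ.+ q)
 ∣-+ {N} (mult k ik refl) (mult l il refl) = mult (k ℚ.+ l) (int-+ ik il) (sym (ℚ.*-distribˡ-+ N k l))

 ∣-* : ∀ {N p c} → Int c → N ∣ℚ p → N ∣ℚ (c ℚ.* p)
 ∣-* {N} {c = c} ic (mult k ik refl) = mult (c ℚ.* k) (int-* ic ik) (lem c N k)
  where
  lem : ∀ c N k → c ℚ.* (N ℚ.* k) ≡ N ℚ.* (c ℚ.* k)
  lem = solve-∀ ℚ-ring

 ∣-trans : ∀ {M N p} → M ∣ℚ N → N ∣ℚ p → M ∣ℚ p
 ∣-trans {M} (mult k ik refl) (mult l il refl) = mult (k ℚ.* l) (int-* ik il) (ℚ.*-assoc M k l)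

 sum-∣ : ∀ {I N r} → (∀ {x} → I x → N ∣ℚ nrd x) → NormSum I r → N ∣ℚ r
 sum-∣ {N = N} f (nil refl) = mult 0ℚ int-0 (sym (ℚ.*-zeroʳ N))
 sum-∣ f (cons c x ic h s refl) = ∣-+ (sum-∣ f s) (∣-* ic (f h))

 -- An element of the ideal I divided by N, and similarly for O.
 record _/∈_ (x : H) (N : ℚ) : Set where
  constructor quo
  field
   quotient : H
   in-O : InO quotient
   quotient-* : x ≡ ι N * quotient

 record NIdeal (I : H → Set) (N : ℚ) : Set where
  field
   ideal : IsIdeal I
   pos : 0ℚ ℚ.< N
   integral : ∀ {x y} → I x → I y → (conj x * y) /∈ N
   rep : NormSum I N

  open IsIdeal ideal public

 open IsIdeal

 ι-product : ∀ {p q} → p ℚ.* q ≡ 1ℚ → ι p * ι q ≡ 1#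
 ι-product {p} {q} h = trans (sym (ι-* p q)) (trans (cong ι h) ι-1)

 ι-undo : ∀ {r N} → N ℚ.* r ≡ 1ℚ → ∀ x → ι r * (ι N * x) ≡ x
 ι-undo {r} {N} e x = trans (sym (*-assoc _ _ _)) (trans (cong (_* x) (ι-product {r} {N} (trans (ℚ.*-comm r N) e))) (*-identityˡ x))

 ι-cancel : ∀ {N x y} → ¬ (N ≡ 0ℚ) → ι N * x ≡ ι N * y → x ≡ y
 ι-cancel {N} {x} {y} N≢0 h = trans (sym (undo x)) (trans (cong (ι r *_) h) (undo y))
  where
  r = proj₁ (inv N N≢0)
  undo : ∀ x → ι r * (ι N * x) ≡ x
  undo x = trans (sym (*-assoc (ι r) (ι N) x)) (trans (cong (_* x) (trans (ι-comm r (ι N)) (ι-product {N} {r} (proj₂ (inv N N≢0))))) (*-identityˡ x))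

 nrd-0 : nrd 0# ≡ 0ℚ
 nrd-0 = ι-injective (trans (sym (*-conj 0#)) (trans (zeroˡ _) (sym ι-0)))

 nrd-nonneg : ∀ x → 0ℚ ℚ.≤ nrd x
 nrd-nonneg x with x ≟ 0#
 ... | yes refl = ℚ.≤-reflexive (sym nrd-0)
 ... | no h = ℚ.<⇒≤ (nrd-pos x h)

 nrd-conj : ∀ x → nrd (conj x) ≡ nrd x
 nrd-conj x = ι-injective (trans (sym (*-conj (conj x))) (trans (cong (conj x *_) (conj-conj x)) (conj-*ˡ x)))

 nrd-* : ∀ x y → nrd (x * y) ≡ nrd x ℚ.* nrd y
 nrd-* x y = ι-injective (begin
  ι (nrd (x * y))              ≡⟨ sym (*-conj (x * y)) ⟩
  (x * y) * conj (x * y)       ≡⟨ solveH (x ∷ y ∷ []) [] ((V 0 :* V 1) :* :c (V 0 :* V 1)) (V 0 :* (V 1 :* :c V 1) :* :c V 0) refl ⟩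
  x * (y * conj y) * conj x    ≡⟨ cong (λ z → x * z * conj x) (*-conj y) ⟩
  x * ι (nrd y) * conj x       ≡⟨ solveH (x ∷ []) (nrd y ∷ []) (V 0 :* S 0 :* :c V 0) (V 0 :* :c V 0 :* S 0) refl ⟩
  x * conj x * ι (nrd y)       ≡⟨ cong (_* ι (nrd y)) (*-conj x) ⟩
  ι (nrd x) * ι (nrd y)        ≡⟨ sym (ι-* (nrd x) (nrd y)) ⟩
  ι (nrd x ℚ.* nrd y)          ∎)
  where open ≡-Reasoning

 nrd-ι : ∀ q → nrd (ι q) ≡ q ℚ.* q
 nrd-ι q = ι-injective (trans (sym (*-conj (ι q))) (trans (cong (ι q *_) (conj-ι q)) (sym (ι-* q q))))

 nrd-int : ∀ {x} → InO x → Int (nrd x)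
 nrd-int {x} h = O-int (subst InO (*-conj x) (O-* h (O-conj h)))

 trd-int : ∀ {x} → InO x → Int (trd x)
 trd-int {x} h = O-int (subst InO (+-conj x) (O-+ h (O-conj h)))

 polar : H → H → ℚ
 polar x y = nrd (x + y) ℚ.- nrd x ℚ.- nrd y

 ι-neg : ∀ q → ι (ℚ.- q) ≡ - ι q
 ι-neg q = trans (sym (+-identityʳ _)) (trans (cong (ι (ℚ.- q) +_) (sym (-‿inverseʳ (ι q)))) (trans (sym (+-assoc _ _ _))
  (trans (cong (_+ - ι q) (trans (sym (ι-+ (ℚ.- q) q)) (trans (cong ι (ℚ.+-inverseˡ q)) ι-0))) (+-identityˡ _))))

 ι-polar : ∀ x y → ι (polar x y) ≡ ι (nrd (x + y)) + - ι (nrd x) + - ι (nrd y)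
 ι-polar x y = trans (ι-+ _ _) (cong₂ _+_ (trans (ι-+ _ _) (cong (ι (nrd (x + y)) +_) (ι-neg (nrd x)))) (ι-neg (nrd y)))

 polarˡ : ∀ x y → conj x * y ≡ ι (polar x y) + - (conj y * x)
 polarˡ x y = sym (trans (cong (_+ - (conj y * x)) (trans (ι-polar x y) (cong₂ _+_ (cong₂ _+_ (sym (conj-*ˡ (x + y))) (cong -_ (sym (conj-*ˡ x)))) (cong -_ (sym (conj-*ˡ y))))))
  (solveH (x ∷ y ∷ []) [] ((:c (V 0 :+ V 1) :* (V 0 :+ V 1) :- (:c V 0 :* V 0) :- (:c V 1 :* V 1)) :- (:c V 1 :* V 0)) (:c V 0 :* V 1) refl))

 polarʳ : ∀ x y → x * conj y ≡ ι (polar x y) + - (y * conj x)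
 polarʳ x y = sym (trans (cong (_+ - (y * conj x)) (trans (ι-polar x y) (cong₂ _+_ (cong₂ _+_ (sym (*-conj (x + y))) (cong -_ (sym (*-conj x)))) (cong -_ (sym (*-conj y))))))
  (solveH (x ∷ y ∷ []) [] (((V 0 :+ V 1) :* :c (V 0 :+ V 1) :- (V 0 :* :c V 0) :- (V 1 :* :c V 1)) :- (V 1 :* :c V 0)) (V 0 :* :c V 1) refl))

 rational-gcd : ∀ p q → ∃[ d ] ∃[ u ] ∃[ v ] ((0ℚ ℚ.≤ d) × Int u × Int v × (d ≡ u ℚ.* p ℚ.+ v ℚ.* q) × d ∣ℚ p × d ∣ℚ q)
 rational-gcd p q = go (denominator p) (denominator q)
  where
  Goal = ∃[ d ] ∃[ u ] ∃[ v ] ((0ℚ ℚ.≤ d) × Int u × Int v × (d ≡ u ℚ.* p ℚ.+ v ℚ.* q) × d ∣ℚ p × d ∣ℚ q)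
  scaled : ∀ (D : ℚ) (D>0 : 0ℚ ℚ.< D) → (∃[ m ] ((D ℚ.* p ≡ fromℕ m) ⊎ (D ℚ.* p ≡ ℚ.- fromℕ m))) → (∃[ n ] ((D ℚ.* q ≡ fromℕ n) ⊎ (D ℚ.* q ≡ ℚ.- fromℕ n))) → Goal
  scaled D D>0 (m , em) (n , en) = use (int-bezout m n)
   where
   D≢0 = <⇒≢0 D>0
   r = proj₁ (inv D D≢0)
   Dr≡1 = proj₂ (inv D D≢0)
   r≥0 : 0ℚ ℚ.≤ r
   r≥0 with ℚ.≤-total 0ℚ r
   ... | inj₁ h = h
   ... | inj₂ h = ⊥-elim (ℚ.<-irrefl refl (ℚ.<-≤-trans (ℚ.positive⁻¹ 1ℚ) (subst₂ ℚ._≤_ Dr≡1 (ℚ.*-zeroʳ D) (ℚ.*-monoˡ-≤-nonNeg D {{ℚ.nonNegative (ℚ.<⇒≤ D>0)}} h))))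
   sign : ∀ {x k} → (x ≡ fromℕ k) ⊎ (x ≡ ℚ.- fromℕ k) → ∃[ s ] (Int s × (x ≡ s ℚ.* fromℕ k) × (fromℕ k ≡ s ℚ.* x))
   sign {k = k} (inj₁ refl) = 1ℚ , int-1 , sym (ℚ.*-identityˡ (fromℕ k)) , sym (ℚ.*-identityˡ (fromℕ k))
   sign {k = k} (inj₂ refl) = ℚ.- 1ℚ , int-neg int-1 , lem (fromℕ k) , lem' (fromℕ k)
    where
    lem : ∀ k → ℚ.- k ≡ (ℚ.- 1ℚ) ℚ.* k
    lem = solve-∀ ℚ-ring
    lem' : ∀ k → k ≡ (ℚ.- 1ℚ) ℚ.* (ℚ.- k)
    lem' = solve-∀ ℚ-ring
   use : _ → Goal
   use (g , u , v , iu , iv , e , g∣m , g∣n) = fromℕ g ℚ.* r , u ℚ.* s , v ℚ.* t , nn , int-* iu is , int-* iv it , comb , divs s em' (∣⇒dv g∣m) is , divs t en' (∣⇒dv g∣n) it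
    where
    s = proj₁ (sign em)
    is = proj₁ (proj₂ (sign em))
    em' = proj₁ (proj₂ (proj₂ (sign em)))
    t = proj₁ (sign en)
    it = proj₁ (proj₂ (sign en))
    en' = proj₁ (proj₂ (proj₂ (sign en)))
    nn : 0ℚ ℚ.≤ fromℕ g ℚ.* r
    nn = subst (ℚ._≤ fromℕ g ℚ.* r) (ℚ.*-zeroʳ (fromℕ g)) (ℚ.*-monoˡ-≤-nonNeg (fromℕ g) {{ℚ.nonNegative g≥0}} r≥0)
     where
     g≥0 : 0ℚ ℚ.≤ fromℕ g
     g≥0 with g ℕ.≟ 0
     ... | yes refl = ℚ.≤-reflexive (sym fromℕ-0)
     ... | no h = ℚ.<⇒≤ (fromℕ-pos (ℕ.n≢0⇒n>0 h))
    lem : ∀ u s D p v t q r → (u ℚ.* (s ℚ.* (D ℚ.* p)) ℚ.+ v ℚ.* (t ℚ.* (D ℚ.* q))) ℚ.* r ≡ (D ℚ.* r) ℚ.* (u ℚ.* s ℚ.* p ℚ.+ v ℚ.* t ℚ.* q)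
    lem = solve-∀ ℚ-ring
    comb : fromℕ g ℚ.* r ≡ u ℚ.* s ℚ.* p ℚ.+ v ℚ.* t ℚ.* q
    comb = trans (cong (ℚ._* r) (trans e (cong₂ (λ x y → u ℚ.* x ℚ.+ v ℚ.* y) (proj₂ (proj₂ (proj₂ (sign em)))) (proj₂ (proj₂ (proj₂ (sign en)))))))
     (trans (lem u s D p v t q r) (trans (cong (ℚ._* (u ℚ.* s ℚ.* p ℚ.+ v ℚ.* t ℚ.* q)) Dr≡1) (ℚ.*-identityˡ _)))
    divs : ∀ {p k} s → D ℚ.* p ≡ s ℚ.* fromℕ k → Dv g (fromℕ k) → Int s → (fromℕ g ℚ.* r) ∣ℚ p
    divs {p} {k} s e (dv z iz ez) is = mult (s ℚ.* z) (int-* is iz) (trans (trans (sym (ℚ.*-identityˡ p)) (trans (cong (ℚ._* p) (sym Dr≡1)) (lem₁ D r p)))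
      (trans (cong (r ℚ.*_) (trans e (cong (s ℚ.*_) ez))) (lem₂ r s (fromℕ g) z)))
     where
     lem₁ : ∀ D r p → D ℚ.* r ℚ.* p ≡ r ℚ.* (D ℚ.* p)
     lem₁ = solve-∀ ℚ-ring
     lem₂ : ∀ r s g z → r ℚ.* (s ℚ.* (g ℚ.* z)) ≡ g ℚ.* r ℚ.* (s ℚ.* z)
     lem₂ = solve-∀ ℚ-ring
  go : ∃[ d ] ((0 ℕ.< d) × Int (fromℕ d ℚ.* p)) → ∃[ d ] ((0 ℕ.< d) × Int (fromℕ d ℚ.* q)) → Goal
  go (c , c>0 , ic) (d , d>0 , id) = scaled (fromℕ c ℚ.* fromℕ d) (*-pos (fromℕ-pos c>0) (fromℕ-pos d>0))
    (abs-unit _ (subst Int (lem (fromℕ c) (fromℕ d) p) (int-* (int-ℕ d) ic))) (abs-unit _ (subst Int (lem' (fromℕ c) (fromℕ d) q) (int-* (int-ℕ c) id)))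
   where
   lem : ∀ c d p → d ℚ.* (c ℚ.* p) ≡ c ℚ.* d ℚ.* p
   lem = solve-∀ ℚ-ring
   lem' : ∀ c d p → c ℚ.* (d ℚ.* p) ≡ c ℚ.* d ℚ.* p
   lem' = solve-∀ ℚ-ring

 norm-gcd : ∀ {I : H → Set} vs → (∀ {v} → v ∈ vs → I v) → ∃[ N ] ((0ℚ ℚ.≤ N) × (∀ {v} → v ∈ vs → N ∣ℚ nrd v) × NormSum I N)
 norm-gcd [] h = 0ℚ , ℚ.≤-refl , (λ ()) , nil refl
 norm-gcd {I} (v ∷ vs) h = go (norm-gcd vs (h ∘ there))
  where
  go : ∃[ N ] ((0ℚ ℚ.≤ N) × (∀ {v} → v ∈ vs → N ∣ℚ nrd v) × NormSum I N) → ∃[ N ] ((0ℚ ℚ.≤ N) × (∀ {w} → w ∈ (v ∷ vs) → N ∣ℚ nrd w) × NormSum I N)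
  go (N , _ , d , s) = use (rational-gcd N (nrd v))
   where
   use : ∃[ e ] ∃[ k ] ∃[ l ] ((0ℚ ℚ.≤ e) × Int k × Int l × (e ≡ k ℚ.* N ℚ.+ l ℚ.* nrd v) × e ∣ℚ N × e ∣ℚ nrd v) → _
   use (e , k , l , e≥0 , ik , il , eq , e∣N , e∣v) = e , e≥0 , (λ { (here refl) → e∣v ; (there m) → ∣-trans e∣N (d m) }) ,
    cons l v il (h (here refl)) (sum-ι ik s) eq

 module Clifford (ts : List H) (r : ℚ)
  (int-norm : ∀ {t} → t ∈ ts → Int (nrd t ℚ.* r))
  (int-polar : ∀ {t u} → t ∈ ts → u ∈ ts → Int (polar t u ℚ.* r)) where
  -- Even and odd Clifford words t̄₁t₂t̄₃⋯ in the letters of a list, each letter used at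
  -- most once, scaled by r for every pair of letters.
  mutual
   Even : List H → H → Set
   Even [] h = ∃[ z ] (Int z × (h ≡ ι z))
   Even (b ∷ bs) h = ∃[ u ] ∃[ v ] (Even bs u × Odd bs v × (h ≡ u + v * b * ι r))

   Odd : List H → H → Set
   Odd [] h = h ≡ 0#
   Odd (b ∷ bs) h = ∃[ u ] ∃[ v ] (Odd bs u × Even bs v × (h ≡ u + v * conj b))

  mutual
   even-+ : ∀ bs {x y} → Even bs x → Even bs y → Even bs (x + y)
   even-+ [] (z , iz , refl) (z' , iz' , refl) = z ℚ.+ z' , int-+ iz iz' , sym (ι-+ z z')
   even-+ (b ∷ bs) (u , v , hu , hv , refl) (u' , v' , hu' , hv' , refl) = u + u' , v + v' , even-+ bs hu hu' , odd-+ bs hv hv' ,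
    solveH (b ∷ u ∷ v ∷ u' ∷ v' ∷ []) (r ∷ []) ((V 1 :+ V 2 :* V 0 :* S 0) :+ (V 3 :+ V 4 :* V 0 :* S 0)) ((V 1 :+ V 3) :+ (V 2 :+ V 4) :* V 0 :* S 0) refl

   odd-+ : ∀ bs {x y} → Odd bs x → Odd bs y → Odd bs (x + y)
   odd-+ [] refl refl = +-identityʳ 0#
   odd-+ (b ∷ bs) (u , v , hu , hv , refl) (u' , v' , hu' , hv' , refl) = u + u' , v + v' , odd-+ bs hu hu' , even-+ bs hv hv' ,
    solveH (b ∷ u ∷ v ∷ u' ∷ v' ∷ []) [] ((V 1 :+ V 2 :* :c V 0) :+ (V 3 :+ V 4 :* :c V 0)) ((V 1 :+ V 3) :+ (V 2 :+ V 4) :* :c V 0) refl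

  mutual
   even-ι : ∀ bs {z x} → Int z → Even bs x → Even bs (ι z * x)
   even-ι [] {z} iz (z' , iz' , refl) = z ℚ.* z' , int-* iz iz' , sym (ι-* z z')
   even-ι (b ∷ bs) {z} iz (u , v , hu , hv , refl) = ι z * u , ι z * v , even-ι bs iz hu , odd-ι bs iz hv ,
    solveH (b ∷ u ∷ v ∷ []) (r ∷ z ∷ []) (S 1 :* (V 1 :+ V 2 :* V 0 :* S 0)) (S 1 :* V 1 :+ (S 1 :* V 2) :* V 0 :* S 0) refl

   odd-ι : ∀ bs {z x} → Int z → Odd bs x → Odd bs (ι z * x)
   odd-ι [] {z} iz refl = zeroʳ (ι z)
   odd-ι (b ∷ bs) {z} iz (u , v , hu , hv , refl) = ι z * u , ι z * v , odd-ι bs iz hu , even-ι bs iz hv ,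
    solveH (b ∷ u ∷ v ∷ []) (z ∷ []) (S 0 :* (V 1 :+ V 2 :* :c V 0)) (S 0 :* V 1 :+ (S 0 :* V 2) :* :c V 0) refl

  even-0 : ∀ bs → Even bs 0#
  odd-0 : ∀ bs → Odd bs 0#
  even-0 [] = 0ℚ , int-0 , sym ι-0
  even-0 (b ∷ bs) = 0# , 0# , even-0 bs , odd-0 bs , sym (trans (+-identityˡ _) (trans (cong (_* ι r) (zeroˡ b)) (zeroˡ (ι r))))
  odd-0 [] = refl
  odd-0 (b ∷ bs) = 0# , 0# , odd-0 bs , even-0 bs , sym (trans (+-identityˡ _) (zeroˡ (conj b)))

  neg≡ : ∀ x → - x ≡ ι (ℚ.- 1ℚ) * x
  neg≡ x = sym (trans (cong (_* x) (trans (ι-neg 1ℚ) (cong -_ ι-1))) (solveH (x ∷ []) [] ((:- :1) :* V 0) (:- V 0) refl))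

  odd-neg : ∀ bs {x} → Odd bs x → Odd bs (- x)
  odd-neg bs {x} h = subst (Odd bs) (sym (neg≡ x)) (odd-ι bs (int-neg int-1) h)

  even-neg : ∀ bs {x} → Even bs x → Even bs (- x)
  even-neg bs {x} h = subst (Even bs) (sym (neg≡ x)) (even-ι bs (int-neg int-1) h)

  even-1 : ∀ bs → Even bs 1#
  even-1 [] = 1ℚ , int-1 , sym ι-1
  even-1 (b ∷ bs) = 1# , 0# , even-1 bs , odd-0 bs , sym (trans (cong (1# +_) (trans (cong (_* ι r) (zeroˡ b)) (zeroˡ (ι r)))) (+-identityʳ 1#))

  even-cons : ∀ {b} bs {x} → Even bs x → Even (b ∷ bs) x
  even-cons {b} bs {x} h = x , 0# , h , odd-0 bs , sym (trans (cong (x +_) (trans (cong (_* ι r) (zeroˡ b)) (zeroˡ (ι r)))) (+-identityʳ x))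

  odd-cons : ∀ {b} bs {x} → Odd bs x → Odd (b ∷ bs) x
  odd-cons {b} bs {x} h = x , 0# , h , even-0 bs , sym (trans (cong (x +_) (zeroˡ (conj b))) (+-identityʳ x))

  -- A new letter is moved to its place by x̄y = T(x , y) − ȳx.
  mutual
   odd-letter : ∀ bs → (∀ {b} → b ∈ bs → b ∈ ts) → ∀ {c x} → c ∈ bs → Odd bs x → Even bs (x * c * ι r)
   odd-letter (b ∷ bs) sub (here refl) (u , v , hu , hv , refl) = ι (nrd b ℚ.* r) * v , u , even-ι bs (int-norm (sub (here refl))) hv , hu ,
    trans (solveH (b ∷ u ∷ v ∷ []) (r ∷ []) ((V 1 :+ V 2 :* :c V 0) :* V 0 :* S 0) (V 2 :* (:c V 0 :* V 0) :* S 0 :+ V 1 :* V 0 :* S 0) refl)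
     (cong (_+ u * b * ι r) (trans (cong (λ z → v * z * ι r) (conj-*ˡ b)) (trans (solveH (v ∷ []) (nrd b ∷ r ∷ []) (V 0 :* S 0 :* S 1) ((S 0 :* S 1) :* V 0) refl)
      (cong (_* v) (sym (ι-* (nrd b) r))))))
   odd-letter (b ∷ bs) sub {c} (there m) (u , v , hu , hv , refl) = u * c * ι r + ι (polar b c ℚ.* r) * v , - (v * conj c) ,
    even-+ bs (odd-letter bs (sub ∘ there) m hu) (even-ι bs (int-polar (sub (here refl)) (sub (there m))) hv) ,
    odd-neg bs (even-letter bs (sub ∘ there) m hv) ,
    trans (solveH (b ∷ u ∷ v ∷ c ∷ []) (r ∷ []) ((V 1 :+ V 2 :* :c V 0) :* V 3 :* S 0) (V 1 :* V 3 :* S 0 :+ V 2 :* (:c V 0 :* V 3) :* S 0) refl)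
     (trans (cong (λ z → u * c * ι r + v * z * ι r) (polarˡ b c))
      (trans (solveH (b ∷ u ∷ v ∷ c ∷ []) (r ∷ polar b c ∷ []) (V 1 :* V 3 :* S 0 :+ V 2 :* (S 1 :- :c V 3 :* V 0) :* S 0)
        ((V 1 :* V 3 :* S 0 :+ (S 1 :* S 0) :* V 2) :+ (:- (V 2 :* :c V 3)) :* V 0 :* S 0) refl)
       (cong (λ z → (u * c * ι r + z * v) + (- (v * conj c)) * b * ι r) (sym (ι-* (polar b c) r)))))

   even-letter : ∀ bs → (∀ {b} → b ∈ bs → b ∈ ts) → ∀ {c x} → c ∈ bs → Even bs x → Odd bs (x * conj c)
   even-letter (b ∷ bs) sub (here refl) (u , v , hu , hv , refl) = ι (nrd b ℚ.* r) * v , u , odd-ι bs (int-norm (sub (here refl))) hv , hu ,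
    trans (solveH (b ∷ u ∷ v ∷ []) (r ∷ []) ((V 1 :+ V 2 :* V 0 :* S 0) :* :c V 0) (V 2 :* (V 0 :* :c V 0) :* S 0 :+ V 1 :* :c V 0) refl)
     (cong (_+ u * conj b) (trans (cong (λ z → v * z * ι r) (*-conj b)) (trans (solveH (v ∷ []) (nrd b ∷ r ∷ []) (V 0 :* S 0 :* S 1) ((S 0 :* S 1) :* V 0) refl)
      (cong (_* v) (sym (ι-* (nrd b) r))))))
   even-letter (b ∷ bs) sub {c} (there m) (u , v , hu , hv , refl) = u * conj c + ι (polar b c ℚ.* r) * v , - (v * c * ι r) ,
    odd-+ bs (even-letter bs (sub ∘ there) m hu) (odd-ι bs (int-polar (sub (here refl)) (sub (there m))) hv) ,
    even-neg bs (odd-letter bs (sub ∘ there) m hv) ,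
    trans (solveH (b ∷ u ∷ v ∷ c ∷ []) (r ∷ []) ((V 1 :+ V 2 :* V 0 :* S 0) :* :c V 3) (V 1 :* :c V 3 :+ V 2 :* (V 0 :* :c V 3) :* S 0) refl)
     (trans (cong (λ z → u * conj c + v * z * ι r) (polarʳ b c))
      (trans (solveH (b ∷ u ∷ v ∷ c ∷ []) (r ∷ polar b c ∷ []) (V 1 :* :c V 3 :+ V 2 :* (S 1 :- V 3 :* :c V 0) :* S 0)
        ((V 1 :* :c V 3 :+ (S 1 :* S 0) :* V 2) :+ (:- (V 2 :* V 3 :* S 0)) :* :c V 0) refl)
       (cong (λ z → (u * conj c + z * v) + (- (v * c * ι r)) * conj b) (sym (ι-* (polar b c) r)))))

  mutual
   even-even : ∀ bs → (∀ {b} → b ∈ bs → b ∈ ts) → ∀ {x y} → Even ts x → Even bs y → Even ts (x * y)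
   even-even [] sub {x} hx (z , iz , refl) = subst (Even ts) (ι-comm z x) (even-ι ts iz hx)
   even-even (b ∷ bs) sub {x} hx (u , v , hu , hv , refl) = subst (Even ts)
    (solveH (x ∷ u ∷ v ∷ b ∷ []) (r ∷ []) (V 0 :* V 1 :+ (V 0 :* V 2) :* V 3 :* S 0) (V 0 :* (V 1 :+ V 2 :* V 3 :* S 0)) refl)
    (even-+ ts (even-even bs (sub ∘ there) hx hu) (odd-letter ts (λ m → m) (sub (here refl)) (even-odd bs (sub ∘ there) hx hv)))

   even-odd : ∀ bs → (∀ {b} → b ∈ bs → b ∈ ts) → ∀ {x y} → Even ts x → Odd bs y → Odd ts (x * y)
   even-odd [] sub {x} hx refl = subst (Odd ts) (sym (zeroʳ x)) (odd-0 ts)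
   even-odd (b ∷ bs) sub {x} hx (u , v , hu , hv , refl) = subst (Odd ts)
    (solveH (x ∷ u ∷ v ∷ b ∷ []) [] (V 0 :* V 1 :+ (V 0 :* V 2) :* :c V 3) (V 0 :* (V 1 :+ V 2 :* :c V 3)) refl)
    (odd-+ ts (even-odd bs (sub ∘ there) hx hu) (even-letter ts (λ m → m) (sub (here refl)) (even-even bs (sub ∘ there) hx hv)))

  mutual
   evenGens : List H → List H
   evenGens [] = 1# ∷ []
   evenGens (b ∷ bs) = evenGens bs ++ map (λ v → v * b * ι r) (oddGens bs)

   oddGens : List H → List H
   oddGens [] = []
   oddGens (b ∷ bs) = oddGens bs ++ map (λ v → v * conj b) (evenGens bs)

  ZSpan-++ˡ : ∀ gs hs {x} → ZSpan gs x → ZSpan (gs ++ hs) x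
  ZSpan-++ˡ gs hs = ZSpan-least (ZSpan-0 (gs ++ hs)) (ZSpan-+ (gs ++ hs)) (ZSpan-ι (gs ++ hs)) gs (ZSpan-∈ ∘ ∈-++⁺ˡ)

  ZSpan-++ʳ : ∀ gs hs {x} → ZSpan hs x → ZSpan (gs ++ hs) x
  ZSpan-++ʳ gs hs = ZSpan-least (ZSpan-0 (gs ++ hs)) (ZSpan-+ (gs ++ hs)) (ZSpan-ι (gs ++ hs)) hs (ZSpan-∈ ∘ ∈-++⁺ʳ gs)

  ZSpan-map : ∀ (f : H → H) → f 0# ≡ 0# → (∀ x y → f (x + y) ≡ f x + f y) → (∀ z x → f (ι z * x) ≡ ι z * f x) →
   ∀ gs {x} → ZSpan gs x → ZSpan (map f gs) (f x)
  ZSpan-map f f0 f+ fι [] refl = f0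
  ZSpan-map f f0 f+ fι (g ∷ gs) (z , y , iz , hy , refl) = z , f y , iz , ZSpan-map f f0 f+ fι gs hy , trans (f+ _ _) (cong (_+ f y) (fι z g))

  mutual
   even-gens : ∀ bs {x} → Even bs x → ZSpan (evenGens bs) x
   even-gens [] (z , iz , refl) = z , 0# , iz , refl , sym (trans (+-identityʳ _) (*-identityʳ _))
   even-gens (b ∷ bs) (u , v , hu , hv , refl) = ZSpan-+ (evenGens bs ++ _) (ZSpan-++ˡ (evenGens bs) _ (even-gens bs hu))
    (ZSpan-++ʳ (evenGens bs) _ (ZSpan-map (λ v → v * b * ι r) (trans (cong (_* ι r) (zeroˡ b)) (zeroˡ (ι r)))
     (λ x y → solveH (b ∷ x ∷ y ∷ []) (r ∷ []) ((V 1 :+ V 2) :* V 0 :* S 0) (V 1 :* V 0 :* S 0 :+ V 2 :* V 0 :* S 0) refl)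
     (λ z x → solveH (b ∷ x ∷ []) (r ∷ z ∷ []) ((S 1 :* V 1) :* V 0 :* S 0) (S 1 :* (V 1 :* V 0 :* S 0)) refl) (oddGens bs) (odd-gens bs hv)))

   odd-gens : ∀ bs {x} → Odd bs x → ZSpan (oddGens bs) x
   odd-gens [] refl = refl
   odd-gens (b ∷ bs) (u , v , hu , hv , refl) = ZSpan-+ (oddGens bs ++ _) (ZSpan-++ˡ (oddGens bs) _ (odd-gens bs hu))
    (ZSpan-++ʳ (oddGens bs) _ (ZSpan-map (λ v → v * conj b) (zeroˡ (conj b)) (λ x y → distribʳ (conj b) x y) (λ z x → *-assoc (ι z) x (conj b)) (evenGens bs) (even-gens bs hv)))

  mutual
   gens-even : ∀ bs {g} → g ∈ evenGens bs → Even bs g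
   gens-even [] (here refl) = even-1 []
   gens-even (b ∷ bs) m with ∈-++⁻ (evenGens bs) m
   ... | inj₁ k = even-cons bs (gens-even bs k)
   ... | inj₂ k with ∈-map⁻ (λ v → v * b * ι r) k
   ...   | v , hv , refl = 0# , v , even-0 bs , gens-odd bs hv , sym (+-identityˡ _)

   gens-odd : ∀ bs {g} → g ∈ oddGens bs → Odd bs g
   gens-odd (b ∷ bs) m with ∈-++⁻ (oddGens bs) m
   ... | inj₁ k = odd-cons bs (gens-odd bs k)
   ... | inj₂ k with ∈-map⁻ (λ v → v * conj b) k
   ...   | v , hv , refl = 0# , v , odd-0 bs , gens-even bs hv , sym (+-identityˡ _)

  span-even : ∀ bs {x} → ZSpan (evenGens bs) x → Even bs x
  span-even bs = ZSpan-least (even-0 bs) (even-+ bs) (even-ι bs) (evenGens bs) (gens-even bs)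

  pair-even : ∀ {x y} → ZSpan ts x → ZSpan ts y → Even ts (conj x * y * ι r)
  pair-even {x} {y} hx hy = ZSpan-least {P = λ x → Even ts (conj x * y * ι r)}
    (subst (Even ts) (sym (trans (cong (λ z → z * y * ι r) conj-0) (trans (cong (_* ι r) (zeroˡ y)) (zeroˡ (ι r))))) (even-0 ts))
    (λ {x} {x'} h k → subst (Even ts) (solveH (x ∷ x' ∷ y ∷ []) (r ∷ []) (:c V 0 :* V 2 :* S 0 :+ :c V 1 :* V 2 :* S 0) (:c (V 0 :+ V 1) :* V 2 :* S 0) refl) (even-+ ts h k))
    (λ {z} {x} iz h → subst (Even ts) (solveH (x ∷ y ∷ []) (r ∷ z ∷ []) (S 1 :* (:c V 0 :* V 1 :* S 0)) (:c (S 1 :* V 0) :* V 1 :* S 0) refl) (even-ι ts iz h))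
    ts letter hx
   where
   letter : ∀ {t} → t ∈ ts → Even ts (conj t * y * ι r)
   letter {t} m = ZSpan-least {P = λ y → Even ts (conj t * y * ι r)}
    (subst (Even ts) (sym (trans (cong (_* ι r) (zeroʳ (conj t))) (zeroˡ (ι r)))) (even-0 ts))
    (λ {x} {x'} h k → subst (Even ts) (solveH (x ∷ x' ∷ t ∷ []) (r ∷ []) (:c V 2 :* V 0 :* S 0 :+ :c V 2 :* V 1 :* S 0) (:c V 2 :* (V 0 :+ V 1) :* S 0) refl) (even-+ ts h k))
    (λ {z} {x} iz h → subst (Even ts) (solveH (x ∷ t ∷ []) (r ∷ z ∷ []) (S 1 :* (:c V 1 :* V 0 :* S 0)) (:c V 1 :* (S 1 :* V 0) :* S 0) refl) (even-ι ts iz h))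
    ts (λ k → odd-letter ts (λ m → m) k (subst (Odd ts) (*-identityˡ (conj t)) (even-letter ts (λ m → m) m (even-1 ts)))) hy

 ZSpan-⊆ : ∀ {ls ms} → (∀ {l} → l ∈ ls → ZSpan ms l) → ∀ {x} → ZSpan ls x → ZSpan ms x
 ZSpan-⊆ {ls} {ms} = ZSpan-least (ZSpan-0 ms) (ZSpan-+ ms) (ZSpan-ι ms) ls

 ZSpan-mono : ∀ {ls ms} → (∀ {x} → ZSpan ls x → ZSpan ms x) → ∀ {v x} → ZSpan (v ∷ ls) x → ZSpan (v ∷ ms) x
 ZSpan-mono f (z , y , iz , hy , e) = z , y , iz , f hy , e

 ZSpan-there : ∀ {ls v x} → ZSpan ls x → ZSpan (v ∷ ls) x
 ZSpan-there {ls} = ZSpan-⊆ {ls} (λ m → ZSpan-∈ (there m))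

 coordinate-0 : ∀ r → coordinate r 0# ≡ 0ℚ
 coordinate-0 r = trans (cong (coordinate r) (trans (sym (zeroˡ 0#)) (cong (_* 0#) (sym ι-0)))) (trans (coordinate-ι r 0ℚ 0#) (ℚ.*-zeroˡ (coordinate r 0#)))

 vanish : ∀ r ls → (∀ {l} → l ∈ ls → coordinate r l ≡ 0ℚ) → ∀ {x} → ZSpan ls x → coordinate r x ≡ 0ℚ
 vanish r = ZSpan-least (coordinate-0 r) (λ {x} {y} h k → trans (coordinate-+ r x y) (cong₂ ℚ._+_ h k))
  (λ {z} {x} _ h → trans (coordinate-ι r z x) (trans (cong (z ℚ.*_) h) (ℚ.*-zeroʳ z)))

 Reduction : Fin 4 → List H → Set
 Reduction r ls = ∃[ v ] ∃[ ls' ] ((∀ {l} → l ∈ ls' → coordinate r l ≡ 0ℚ) × (∀ {x} → ZSpan ls x → ZSpan (v ∷ ls') x) × (∀ {x} → ZSpan (v ∷ ls') x → ZSpan ls x))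

 reduce : ∀ r ls → Reduction r ls
 reduce r [] = 0# , [] , (λ ()) , ZSpan-there {[]} , (ZSpan-⊆ {0# ∷ []} {[]} λ { (here refl) → refl })
 reduce r (l ∷ ls) = next (reduce r ls)
  where
  next : Reduction r ls → Reduction r (l ∷ ls)
  next (v , ls' , zs , to , from) = use (bezout (coordinate r l) (coordinate r v))
   where
   use : Bezout (coordinate r l) (coordinate r v) → Reduction r (l ∷ ls)
   use (s , t , u , w , is , it , iu , iw , e , f) = x , y ∷ ls' , (λ { (here refl) → y-0 ; (there m) → zs m }) ,
     (ZSpan-⊆ {l ∷ ls} λ { (here refl) → subst Z (sym l≡) (ZSpan-+ _ (ZSpan-ι _ iu x∈) (ZSpan-ι _ (int-neg it) y∈)) ; (there m) → up (to (ZSpan-∈ m)) }) ,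
     (ZSpan-⊆ {x ∷ y ∷ ls'} λ { (here refl) → ZSpan-+ _ (ZSpan-ι _ is l∈) (ZSpan-ι _ it v∈) ; (there (here refl)) → ZSpan-+ _ (ZSpan-ι _ iu v∈) (ZSpan-ι _ (int-neg iw) l∈)
                  ; (there (there m)) → ZSpan-there {ls} (from (ZSpan-∈ (there m))) })
    where
    x = ι s * l + ι t * v
    y = ι u * v + ι (ℚ.- w) * l
    Z = ZSpan (x ∷ y ∷ ls')
    x∈ : Z x
    x∈ = ZSpan-∈ (here refl)
    y∈ : Z y
    y∈ = ZSpan-∈ (there (here refl))
    l∈ : ZSpan (l ∷ ls) l
    l∈ = ZSpan-∈ (here refl)
    v∈ : ZSpan (l ∷ ls) v
    v∈ = ZSpan-there {ls} (from (ZSpan-∈ (here refl)))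
    one : ι s * ι u + ι t * ι w ≡ 1#
    one = trans (cong₂ _+_ (sym (ι-* s u)) (sym (ι-* t w))) (trans (sym (ι-+ _ _)) (trans (cong ι f) ι-1))
    l≡ : l ≡ ι u * x + ι (ℚ.- t) * y
    l≡ = sym (trans (cong₂ (λ a b → ι u * x + a * (ι u * v + b * l)) (ι-neg t) (ι-neg w))
     (trans (solveH (l ∷ v ∷ []) (s ∷ t ∷ u ∷ w ∷ []) (S 2 :* (S 0 :* V 0 :+ S 1 :* V 1) :+ (:- S 1) :* (S 2 :* V 1 :+ (:- S 3) :* V 0)) ((S 0 :* S 2 :+ S 1 :* S 3) :* V 0) refl)
      (trans (cong (_* l) one) (*-identityˡ l))))
    v≡ : v ≡ ι w * x + ι s * y
    v≡ = sym (trans (cong (λ b → ι w * x + ι s * (ι u * v + b * l)) (ι-neg w))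
     (trans (solveH (l ∷ v ∷ []) (s ∷ t ∷ u ∷ w ∷ []) (S 3 :* (S 0 :* V 0 :+ S 1 :* V 1) :+ S 0 :* (S 2 :* V 1 :+ (:- S 3) :* V 0)) ((S 0 :* S 2 :+ S 1 :* S 3) :* V 1) refl)
      (trans (cong (_* v) one) (*-identityˡ v))))
    up : ∀ {z} → ZSpan (v ∷ ls') z → Z z
    up = ZSpan-⊆ {v ∷ ls'} λ { (here refl) → subst Z (sym v≡) (ZSpan-+ _ (ZSpan-ι _ iw x∈) (ZSpan-ι _ is y∈)) ; (there m) → ZSpan-∈ (there (there m)) }
    y-0 : coordinate r y ≡ 0ℚ
    y-0 = trans (coordinate-+ r _ _) (trans (cong₂ ℚ._+_ (coordinate-ι r u v) (coordinate-ι r (ℚ.- w) l)) (trans (cong (ℚ._+ (ℚ.- w) ℚ.* coordinate r l) e) (cancel w (coordinate r l))))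
     where
     cancel : ∀ w p → w ℚ.* p ℚ.+ (ℚ.- w) ℚ.* p ≡ 0ℚ
     cancel = solve-∀ ℚ-ring

 Echelon : ∀ n → (Fin n → Fin 4) → List H → Set
 Echelon n r ls = ∃ λ (e : Fin n → H) → ∃ λ (rest : List H) → (∀ i {x} → ZSpan rest x → coordinate (r i) x ≡ 0ℚ) ×
  (∀ {x} → ZSpan ls x → ZSpan (tabulate e ++ rest) x) × (∀ {x} → ZSpan (tabulate e ++ rest) x → ZSpan ls x)

 ZSpan-++ʳ : ∀ vs {ls x} → ZSpan ls x → ZSpan (vs ++ ls) x
 ZSpan-++ʳ [] h = h
 ZSpan-++ʳ (v ∷ vs) {ls} h = ZSpan-there {vs ++ ls} (ZSpan-++ʳ vs h)

 echelon : ∀ n r ls → Echelon n r ls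
 echelon zero r ls = (λ ()) , ls , (λ ()) , (λ h → h) , (λ h → h)
 echelon (suc n) r ls = step (reduce (r zero) ls)
  where
  step : Reduction (r zero) ls → Echelon (suc n) r ls
  step (v , ls' , zs , to , from) = next (echelon n (r ∘ suc) ls')
   where
   next : Echelon n (r ∘ suc) ls' → Echelon (suc n) r ls
   next (e , rest , van , to' , from') = (λ { zero → v ; (suc i) → e i }) , rest ,
    (λ { zero h → vanish (r zero) ls' zs (from' (ZSpan-++ʳ (tabulate e) h)) ; (suc i) h → van i h }) ,
    (λ h → ZSpan-mono {ls'} to' (to h)) , (λ h → from (ZSpan-mono {_} {ls'} from' h))

 ZSpan-++-zero : ∀ vs rest → (∀ {x} → ZSpan rest x → x ≡ 0#) → (∀ {x} → ZSpan (vs ++ rest) x → ZSpan vs x) × (∀ {x} → ZSpan vs x → ZSpan (vs ++ rest) x)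
 ZSpan-++-zero [] rest z = z , λ { refl → ZSpan-0 rest }
 ZSpan-++-zero (v ∷ vs) rest z = ZSpan-mono {vs ++ rest} {vs} (proj₁ ih) , ZSpan-mono {vs} (proj₂ ih)
  where ih = ZSpan-++-zero vs rest z

 module Q = DetInt.Field ℚ._≟_ inv 1≢0ℚ

 span-coordinate : ∀ n (e : Fin n → H) {x} → ZSpan (tabulate e) x → ∃ λ (c : Fin n → ℚ) → ∀ r → coordinate r x ≡ sumℚ (λ i → coordinate r (e i) ℚ.* c i)
 span-coordinate zero e refl = (λ ()) , coordinate-0
 span-coordinate (suc n) e (z , y , iz , hy , refl) = next (span-coordinate n (e ∘ suc) hy)
  where
  next : (∃ λ (c : Fin n → ℚ) → ∀ r → coordinate r y ≡ sumℚ (λ i → coordinate r (e (suc i)) ℚ.* c i)) →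
   ∃ λ (c : Fin (suc n) → ℚ) → ∀ r → coordinate r (ι z * e zero + y) ≡ sumℚ (λ i → coordinate r (e i) ℚ.* c i)
  next (c , h) = (λ { zero → z ; (suc i) → c i }) , λ r → trans (coordinate-+ r _ y) (cong₂ ℚ._+_ (trans (coordinate-ι r z _) (ℚ.*-comm z _)) (h r))

 independent : ∀ (e : Fin 4 → H) → (∀ x → InO x → ZSpan (tabulate e) x) → (c : Fin 4 → ℚ) → (∀ r → sumℚ (λ i → c i ℚ.* coordinate r (e i)) ≡ 0ℚ) → ∀ i → c i ≡ 0ℚ
 independent e cover c h = zero-c (Q.invertible⊎kernel B)
  where
  A B : DetInt.Mat 4
  A r i = coordinate r (e i)
  col : ∀ s → ∃ λ (k : Fin 4 → ℚ) → ∀ r → sumℚ (λ i → A r i ℚ.* k i) ≡ DetInt.δ r s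
  col s = go (O-denominator (unit s))
   where
   go : ∃[ d ] ((0 ℕ.< d) × InO (ι (fromℕ d) * unit s)) → ∃ λ (k : Fin 4 → ℚ) → ∀ r → sumℚ (λ i → A r i ℚ.* k i) ≡ DetInt.δ r s
   go (d , d>0 , io) = scale (span-coordinate 4 e (cover _ io))
    where
    ρ = proj₁ (inv (fromℕ d) (pos≢0 d>0))
    undo : ∀ D ρ x → (D ℚ.* x) ℚ.* ρ ≡ (D ℚ.* ρ) ℚ.* x
    undo = solve-∀ ℚ-ring
    scale : (∃ λ (k : Fin 4 → ℚ) → ∀ r → coordinate r (ι (fromℕ d) * unit s) ≡ sumℚ (λ i → A r i ℚ.* k i)) → ∃ λ (k : Fin 4 → ℚ) → ∀ r → sumℚ (λ i → A r i ℚ.* k i) ≡ DetInt.δ r s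
    scale (k , hk) = (λ i → k i ℚ.* ρ) , λ r → trans (DetInt.Σ-cong {f = λ i → A r i ℚ.* (k i ℚ.* ρ)} (λ i → sym (ℚ.*-assoc (A r i) (k i) ρ))) (trans (DetInt.Σ-*ʳ ρ (λ i → A r i ℚ.* k i))
     (trans (cong (ℚ._* ρ) (trans (sym (hk r)) (coordinate-ι r _ _))) (trans (undo (fromℕ d) ρ _) (trans (cong (ℚ._* coordinate r (unit s)) (proj₂ (inv (fromℕ d) (pos≢0 d>0))))
      (trans (ℚ.*-identityˡ _) (coordinate-unit r s))))))
  B i s = proj₁ (col s) i
  AB : DetInt._≈_ (DetInt._⊠_ A B) DetInt.δ
  AB r s = proj₂ (col s) r
  Ac : ∀ r → sumℚ (λ i → A r i ℚ.* c i) ≡ 0ℚ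
  Ac r = trans (DetInt.Σ-cong {f = λ i → A r i ℚ.* c i} (λ i → ℚ.*-comm (A r i) (c i))) (h r)
  zero-c : DetInt.Invertible B ⊎ Q.Kernel B → ∀ i → c i ≡ 0ℚ
  zero-c (inj₂ (v , (i , vi) , k)) = ⊥-elim (vi (trans (sym (DetInt.Σ-δˡ i v)) (trans (DetInt.Σ-cong {f = λ j → DetInt.δ i j ℚ.* v j} (λ j → cong (ℚ._* v j) (sym (AB i j))))
   (trans (Q.⊠-vec A B v i) (DetInt.Σ-zero {f = λ l → A i l ℚ.* sumℚ (λ j → B l j ℚ.* v j)} (λ l → trans (cong (A i l ℚ.*_) (k l)) (ℚ.*-zeroʳ (A i l))))))))
  zero-c (inj₁ (C , BC , CB)) i = trans (sym (DetInt.Σ-δˡ i c)) (trans (DetInt.Σ-cong {f = λ j → DetInt.δ i j ℚ.* c j} (λ j → cong (ℚ._* c j) (sym (BA i j))))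
   (trans (Q.⊠-vec B A c i) (DetInt.Σ-zero {f = λ l → B i l ℚ.* sumℚ (λ j → A l j ℚ.* c j)} (λ l → trans (cong (B i l ℚ.*_) (Ac l)) (ℚ.*-zeroʳ (B i l))))))
   where
   BA : DetInt._≈_ (DetInt._⊠_ B A) DetInt.δ
   BA = DetInt.≈-trans (DetInt.⊠-cong {M = B} (DetInt.≈-refl {M = B}) (DetInt.≈-trans (DetInt.≈-sym (DetInt.⊠-identityʳ A)) (DetInt.≈-trans (DetInt.⊠-cong {M = A} (DetInt.≈-refl {M = A}) (DetInt.≈-sym BC))
    (DetInt.≈-trans (DetInt.≈-sym (DetInt.⊠-assoc A B C)) (DetInt.≈-trans (DetInt.⊠-cong {N = C} AB (DetInt.≈-refl {M = C})) (DetInt.⊠-identityˡ C)))))) BC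

 maximal-span : ∀ ls → (∀ x → InO x → ZSpan ls x) → (∀ x y → ZSpan ls x → ZSpan ls y → ZSpan ls (x * y)) → ∀ x → ZSpan ls x → InO x
 maximal-span ls cover closed = go (echelon 4 (λ i → i) ls)
  where
  go : Echelon 4 (λ i → i) ls → ∀ x → ZSpan ls x → InO x
  go (e , rest , van , to , from) x hx = O-maximal e (independent e cover') cover' (λ x y h k → to' (closed x y (from' h) (from' k))) x (to' hx)
   where
   rest-0 : ∀ {x} → ZSpan rest x → x ≡ 0#
   rest-0 h = coordinate-≡ λ r → trans (van r h) (sym (coordinate-0 r))
   both = ZSpan-++-zero (tabulate e) rest rest-0
   to' : ∀ {x} → ZSpan ls x → ZSpan (tabulate e) x
   to' h = proj₁ both (to h)
   from' : ∀ {x} → ZSpan (tabulate e) x → ZSpan ls x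
   from' h = from (proj₂ both h)
   cover' : ∀ x → InO x → ZSpan (tabulate e) x
   cover' x io = to' (cover x io)

 nonneg-pos : ∀ {p} → 0ℚ ℚ.≤ p → ¬ (p ≡ 0ℚ) → 0ℚ ℚ.< p
 nonneg-pos {p} h k with ℚ.<-cmp 0ℚ p
 ... | tri< q _ _ = q
 ... | tri≈ _ q _ = ⊥-elim (k (sym q))
 ... | tri> _ _ q = ⊥-elim (ℚ.<-irrefl refl (ℚ.<-≤-trans q h))

 letters : List H → List H
 letters [] = []
 letters (g ∷ gs) = g * basis zero ∷ g * basis (suc zero) ∷ g * basis (suc (suc zero)) ∷ g * basis (suc (suc (suc zero))) ∷ letters gs

 letters-span : ∀ gs {t} → t ∈ letters gs → Span gs t
 letters-span (g ∷ gs) (here refl) = i-* (Span-ideal (g ∷ gs)) (Span-∈ {g ∷ gs} (here refl)) (O-basis _)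
 letters-span (g ∷ gs) (there (here refl)) = i-* (Span-ideal (g ∷ gs)) (Span-∈ {g ∷ gs} (here refl)) (O-basis _)
 letters-span (g ∷ gs) (there (there (here refl))) = i-* (Span-ideal (g ∷ gs)) (Span-∈ {g ∷ gs} (here refl)) (O-basis _)
 letters-span (g ∷ gs) (there (there (there (here refl)))) = i-* (Span-ideal (g ∷ gs)) (Span-∈ {g ∷ gs} (here refl)) (O-basis _)
 letters-span (g ∷ gs) (there (there (there (there m)))) = Span-++ʳ (g ∷ []) gs (letters-span gs m)

 span-letters : ∀ gs {x} → Span gs x → ZSpan (letters gs) x
 span-letters [] refl = refl
 span-letters (g ∷ gs) (o , y , io , hy , refl) with O-coord io
 ... | n , ni , refl = n zero , _ , ni zero , (n (suc zero) , _ , ni (suc zero) , (n (suc (suc zero)) , _ , ni (suc (suc zero)) ,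
     (n (suc (suc (suc zero))) , y , ni (suc (suc (suc zero))) , span-letters gs hy , refl) , refl) , refl) ,
     solveH (g ∷ basis zero ∷ basis (suc zero) ∷ basis (suc (suc zero)) ∷ basis (suc (suc (suc zero))) ∷ y ∷ [])
      (n zero ∷ n (suc zero) ∷ n (suc (suc zero)) ∷ n (suc (suc (suc zero))) ∷ [])
      (V 0 :* (S 0 :* V 1 :+ (S 1 :* V 2 :+ (S 2 :* V 3 :+ S 3 :* V 4))) :+ V 5)
      (S 0 :* (V 0 :* V 1) :+ (S 1 :* (V 0 :* V 2) :+ (S 2 :* (V 0 :* V 3) :+ (S 3 :* (V 0 :* V 4) :+ V 5)))) refl

 nonzero? : ∀ ts → (∃[ t ] (t ∈ ts × ¬ (t ≡ 0#))) ⊎ (∀ {t} → t ∈ ts → t ≡ 0#)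
 nonzero? [] = inj₂ λ ()
 nonzero? (t ∷ ts) with t ≟ 0#
 ... | no h = inj₁ (t , here refl , h)
 ... | yes h with nonzero? ts
 ...   | inj₁ (u , m , k) = inj₁ (u , there m , k)
 ...   | inj₂ k = inj₂ λ { (here refl) → h ; (there m) → k m }

 NonZeroIdeal : (H → Set) → Set
 NonZeroIdeal I = ∃[ x ] (I x × ¬ (x ≡ 0#))

 -- By maximality the even Clifford order of the form nrd / N on I is contained in O,
 -- which makes every ideal invertible: conj I · I = N O.
 ideal-norm : ∀ gs → NonZeroIdeal (Span gs) → ∃[ N ] NIdeal (Span gs) N
 ideal-norm gs (x₀ , hx₀ , x₀≢0) = build (norm-gcd vs vs-span)
  where
  I = Span gs
  ts = letters gs
  vs = ts ++ cartesianProductWith _+_ ts ts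
  vs-span : ∀ {v} → v ∈ vs → I v
  vs-span m with ∈-++⁻ ts m
  ... | inj₁ k = letters-span gs k
  ... | inj₂ k with ∈-cartesianProductWith⁻ _+_ ts ts k
  ...   | t , u , ht , hu , refl = i-+ (Span-ideal gs) (letters-span gs ht) (letters-span gs hu)
  build : ∃[ N ] ((0ℚ ℚ.≤ N) × (∀ {v} → v ∈ vs → N ∣ℚ nrd v) × NormSum I N) → ∃[ N ] NIdeal I N
  build (N , N≥0 , N∣ , s) = N , record { ideal = Span-ideal gs ; pos = N>0 ; integral = integral ; rep = s }
   where
   N≢0 : ¬ (N ≡ 0ℚ)
   N≢0 N≡0 = bad (nonzero? ts)
    where
    bad : (∃[ t ] (t ∈ ts × ¬ (t ≡ 0#))) ⊎ (∀ {t} → t ∈ ts → t ≡ 0#) → ⊥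
    bad (inj₁ (t , m , h)) with N∣ (∈-++⁺ˡ m)
    ... | mult k _ e = <⇒≢0 (nrd-pos t h) (trans e (trans (cong (ℚ._* k) N≡0) (ℚ.*-zeroˡ k)))
    bad (inj₂ h) = x₀≢0 (ZSpan-least {P = _≡ 0#} refl (λ { refl refl → +-identityʳ 0# }) (λ { {z} _ refl → zeroʳ (ι z) }) ts h (span-letters gs hx₀))
   N>0 : 0ℚ ℚ.< N
   N>0 = nonneg-pos N≥0 N≢0
   r = proj₁ (inv N N≢0)
   Nr≡1 = proj₂ (inv N N≢0)
   int-/ : ∀ {q} → N ∣ℚ q → Int (q ℚ.* r)
   int-/ (mult k ik refl) = subst Int (sym (trans (lem N k r) (trans (cong (k ℚ.*_) Nr≡1) (ℚ.*-identityʳ k)))) ik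
    where
    lem : ∀ N k r → N ℚ.* k ℚ.* r ≡ k ℚ.* (N ℚ.* r)
    lem = solve-∀ ℚ-ring
   ∣-neg : ∀ {q} → N ∣ℚ q → N ∣ℚ (ℚ.- q)
   ∣-neg (mult k ik refl) = mult (ℚ.- k) (int-neg ik) (ℚ.neg-distribʳ-* N k)
   open Clifford ts r (λ m → int-/ (N∣ (∈-++⁺ˡ m)))
    (λ m m' → int-/ (∣-+ (∣-+ (N∣ (∈-++⁺ʳ ts (∈-cartesianProductWith⁺ _+_ m m'))) (∣-neg (N∣ (∈-++⁺ˡ m)))) (∣-neg (N∣ (∈-++⁺ˡ m')))))
   pair : ∀ {x y} → I x → I y → Even ts (conj x * y * ι r)
   pair hx hy = pair-even (span-letters gs hx) (span-letters gs hy)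
   absorb : ∀ {q o} → NormSum I q → InO o → Even ts (ι (q ℚ.* r) * o)
   absorb {o = o} (nil refl) io = subst (Even ts) (sym (trans (cong (_* o) (trans (cong ι (ℚ.*-zeroˡ r)) ι-0)) (zeroˡ o))) (even-0 ts)
   absorb {o = o} (cons {q} c x ic hx s refl) io = subst (Even ts) eq
     (even-+ ts (absorb s io) (even-ι ts ic (pair hx (i-* (Span-ideal gs) hx io))))
    where
    lem : ∀ q c n r → (q ℚ.+ c ℚ.* n) ℚ.* r ≡ q ℚ.* r ℚ.+ c ℚ.* (n ℚ.* r)
    lem = solve-∀ ℚ-ring
    eq : ι (q ℚ.* r) * o + ι c * (conj x * (x * o) * ι r) ≡ ι ((q ℚ.+ c ℚ.* nrd x) ℚ.* r) * o
    eq = sym (trans (cong (_* o) (trans (cong ι (lem q c (nrd x) r)) (trans (ι-+ _ _) (cong (ι (q ℚ.* r) +_) (trans (ι-* c _) (cong (ι c *_) (trans (ι-* (nrd x) r) (cong (_* ι r) (sym (conj-*ˡ x))))))))))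
     (solveH (x ∷ o ∷ []) (q ℚ.* r ∷ c ∷ r ∷ []) ((S 0 :+ S 1 :* ((:c V 0 :* V 0) :* S 2)) :* V 1) (S 0 :* V 1 :+ S 1 :* (:c V 0 :* (V 0 :* V 1) :* S 2)) refl))
   max : ∀ {x} → Even ts x → InO x
   max h = maximal-span (evenGens ts)
    (λ x hx → even-gens ts (subst (Even ts) (trans (cong (_* x) (trans (cong ι Nr≡1) ι-1)) (*-identityˡ x)) (absorb s hx)))
    (λ x y hx hy → even-gens ts (even-even ts (λ m → m) (span-even ts hx) (span-even ts hy))) _ (even-gens ts h)
   integral : ∀ {x y} → I x → I y → (conj x * y) /∈ N
   integral {x} {y} hx hy = quo (conj x * y * ι r) (max (pair hx hy))
    (trans (sym (*-identityˡ _)) (trans (cong (_* (conj x * y)) (sym (ι-product {N} {r} Nr≡1)))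
     (solveH (x ∷ y ∷ []) (N ∷ r ∷ []) ((S 0 :* S 1) :* (:c V 0 :* V 1)) (S 0 :* (:c V 0 :* V 1 :* S 1)) refl)))

 module _ {I : H → Set} {N : ℚ} (i : NIdeal I N) where
  open NIdeal i

  N≢0 : ¬ (N ≡ 0ℚ)
  N≢0 = <⇒≢0 pos

  dual-mem : ∀ {x} → (∀ {y} → I y → (conj y * x) /∈ N) → I x
  dual-mem {x} f = use (go rep)
   where
   go : ∀ {q} → NormSum I q → ∃[ z ] (I z × (ι q * x ≡ ι N * z))
   go (nil refl) = 0# , IsIdeal.i-0 ideal , trans (cong (_* x) ι-0) (trans (zeroˡ x) (sym (zeroʳ (ι N))))
   go (cons {q} c y ic hy s refl) = next (go s) (f hy)
    where
    next : ∃[ z ] (I z × (ι q * x ≡ ι N * z)) → (conj y * x) /∈ N → ∃[ z ] (I z × (ι (q ℚ.+ c ℚ.* nrd y) * x ≡ ι N * z))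
    next (z , hz , e) (quo o io eo) = z + y * (ι c * o) , IsIdeal.i-+ ideal hz (IsIdeal.i-* ideal hy (O-* (O-ι ic) io)) ,
     (begin
      ι (q ℚ.+ c ℚ.* nrd y) * x              ≡⟨ cong (_* x) (trans (ι-+ q _) (cong (ι q +_) (trans (ι-* c (nrd y)) (cong (ι c *_) (sym (*-conj y)))))) ⟩
      (ι q + ι c * (y * conj y)) * x         ≡⟨ solveH (x ∷ y ∷ []) (q ∷ c ∷ []) ((S 0 :+ S 1 :* (V 1 :* :c V 1)) :* V 0) (S 0 :* V 0 :+ S 1 :* (V 1 :* (:c V 1 :* V 0))) refl ⟩
      ι q * x + ι c * (y * (conj y * x))     ≡⟨ cong₂ (λ v w → v + ι c * (y * w)) e eo ⟩
      ι N * z + ι c * (y * (ι N * o))        ≡⟨ solveH (y ∷ z ∷ o ∷ []) (N ∷ c ∷ []) (S 0 :* V 1 :+ S 1 :* (V 0 :* (S 0 :* V 2))) (S 0 :* (V 1 :+ V 0 :* (S 1 :* V 2))) refl ⟩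
      ι N * (z + y * (ι c * o))              ∎)
     where open ≡-Reasoning
   use : ∃[ z ] (I z × (ι N * x ≡ ι N * z)) → I x
   use (z , hz , e) = subst I (sym (ι-cancel N≢0 e)) hz

  norm-mem : (∀ {x} → I x → InO x) → I (ι N)
  norm-mem sub = go rep
   where
   go : ∀ {q} → NormSum I q → I (ι q)
   go (nil refl) = subst I (sym ι-0) (IsIdeal.i-0 ideal)
   go (cons {q} c y ic hy s refl) = subst I (sym (trans (ι-+ q _) (cong (ι q +_) (trans (ι-* c (nrd y)) (cong (ι c *_) (sym (*-conj y)))))))
    (IsIdeal.i-+ ideal (go s) (IsIdeal.i-ι ideal ic (IsIdeal.i-* ideal hy (O-conj (sub hy)))))

  norm-divides : ∀ {x} → I x → N ∣ℚ nrd x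
  norm-divides {x} hx = use (integral hx hx)
   where
   r = proj₁ (inv N N≢0)
   Nr≡1 = proj₂ (inv N N≢0)
   use : (conj x * x) /∈ N → N ∣ℚ nrd x
   use (quo o io e) = mult (r ℚ.* nrd x) (O-int (subst InO o≡ io)) (sym (trans (sym (ℚ.*-assoc N r (nrd x))) (trans (cong (ℚ._* nrd x) Nr≡1) (ℚ.*-identityˡ (nrd x)))))
    where
    o≡ : o ≡ ι (r ℚ.* nrd x)
    o≡ = sym (trans (ι-* r (nrd x)) (trans (cong (ι r *_) (trans (sym (conj-*ˡ x)) e))
     (ι-undo {r} {N} Nr≡1 o)))

  norm-int : (∀ {x} → I x → InO x) → Int N
  norm-int sub = O-int (sub (norm-mem sub))

 sub-norm : ∀ {I J : H → Set} {M N} → NIdeal I M → NIdeal J N → (∀ {x} → I x → J x) → N ∣ℚ M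
 sub-norm i j sub = sum-∣ (λ h → norm-divides j (sub h)) (NIdeal.rep i)

 equal-norm : ∀ {I J : H → Set} {N} → NIdeal I N → NIdeal J N → (∀ {x} → I x → J x) → ∀ {x} → J x → I x
 equal-norm i j sub hx = dual-mem i (λ hy → NIdeal.integral j (sub hy) hx)

 nideal-≡ : ∀ {I M N} → M ≡ N → NIdeal I M → NIdeal I N
 nideal-≡ refl i = i

 scale-nideal : ∀ {I J : H → Set} {N} α → ¬ (α ≡ 0#) → NIdeal I N → IsIdeal J → (∀ {x} → I x → J (α * x)) → (∀ {y} → J y → ∃[ x ] (I x × (y ≡ α * x))) →
  NIdeal J (nrd α ℚ.* N)
 scale-nideal {I} {J} {N} α α≢0 i j to from = record { ideal = j ; pos = *-pos (nrd-pos α α≢0) (NIdeal.pos i) ; integral = int ; rep = reps (NIdeal.rep i) }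
  where
  int : ∀ {x y} → J x → J y → (conj x * y) /∈ (nrd α ℚ.* N)
  int hx hy = go (from hx) (from hy)
   where
   go : ∀ {x y} → ∃[ x' ] (I x' × (x ≡ α * x')) → ∃[ y' ] (I y' × (y ≡ α * y')) → (conj x * y) /∈ (nrd α ℚ.* N)
   go (x , hx , refl) (y , hy , refl) = use (NIdeal.integral i hx hy)
    where
    use : (conj x * y) /∈ N → (conj (α * x) * (α * y)) /∈ (nrd α ℚ.* N)
    use (quo o io e) = quo o io (begin
     conj (α * x) * (α * y)           ≡⟨ solveH (α ∷ x ∷ y ∷ []) [] (:c (V 0 :* V 1) :* (V 0 :* V 2)) (:c V 1 :* (:c V 0 :* V 0) :* V 2) refl ⟩
     conj x * (conj α * α) * y        ≡⟨ cong (λ z → conj x * z * y) (conj-*ˡ α) ⟩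
     conj x * ι (nrd α) * y           ≡⟨ solveH (x ∷ y ∷ []) (nrd α ∷ []) (:c V 0 :* S 0 :* V 1) (S 0 :* (:c V 0 :* V 1)) refl ⟩
     ι (nrd α) * (conj x * y)         ≡⟨ cong (ι (nrd α) *_) e ⟩
     ι (nrd α) * (ι N * o)            ≡⟨ sym (*-assoc _ _ _) ⟩
     ι (nrd α) * ι N * o              ≡⟨ cong (_* o) (sym (ι-* (nrd α) N)) ⟩
     ι (nrd α ℚ.* N) * o              ∎)
     where open ≡-Reasoning
  reps : ∀ {q} → NormSum I q → NormSum J (nrd α ℚ.* q)
  reps (nil refl) = nil (ℚ.*-zeroʳ (nrd α))
  reps (cons {q} c x ic hx s refl) = cons c (α * x) ic (to hx) (reps s)
    (trans (lem (nrd α) q c (nrd x)) (cong (λ z → nrd α ℚ.* q ℚ.+ c ℚ.* z) (sym (nrd-* α x))))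
   where
   lem : ∀ a q c n → a ℚ.* (q ℚ.+ c ℚ.* n) ≡ a ℚ.* q ℚ.+ c ℚ.* (a ℚ.* n)
   lem = solve-∀ ℚ-ring

 span-scale : ∀ {gs N} α → ¬ (α ≡ 0#) → NIdeal (Span gs) N → NIdeal (Span (map (α *_) gs)) (nrd α ℚ.* N)
 span-scale {gs} α α≢0 i = scale-nideal α α≢0 i (Span-ideal _) (Span-map α gs) (Span-unmap α gs)

 -- Decidable membership through the dual description of an ideal.
 span? : ∀ {gs N} → NIdeal (Span gs) N → ∀ x → Dec (Span gs x)
 span? {gs} {N} i x = map′ to from (all-in gs)
  where
  r = proj₁ (inv N (N≢0 i))
  Nr≡1 = proj₂ (inv N (N≢0 i))
  Test : H → Set
  Test g = InO (ι r * (conj g * x))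
  all-in : ∀ hs → Dec (∀ {g} → g ∈ hs → Test g)
  all-in [] = yes λ ()
  all-in (g ∷ hs) with InO? (ι r * (conj g * x)) | all-in hs
  ... | yes p | yes q = yes λ { (here refl) → p ; (there m) → q m }
  ... | no p | _ = no λ f → p (f (here refl))
  ... | _ | no q = no λ f → q (f ∘ there)
  undo : ∀ y → y ≡ ι N * (ι r * y)
  undo y = sym (trans (sym (*-assoc _ _ _)) (trans (cong (_* y) (ι-product {N} {r} Nr≡1)) (*-identityˡ y)))
  to : (∀ {g} → g ∈ gs → Test g) → Span gs x
  to f = dual-mem i λ {y} hy → quo _ (at hy) (undo (conj y * x))
   where
   -- y ↦ conj x · y / N is O-linear on the right, so it suffices to test generators.
   functional : IsIdeal (λ y → InO (ι r * (conj x * y)))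
   functional = record
    { i-0 = subst InO (sym (trans (cong (ι r *_) (zeroʳ (conj x))) (zeroʳ (ι r)))) O-0
    ; i-+ = λ {y} {z} h k → subst InO (solveH (x ∷ y ∷ z ∷ []) (r ∷ []) (S 0 :* (:c V 0 :* V 1) :+ S 0 :* (:c V 0 :* V 2)) (S 0 :* (:c V 0 :* (V 1 :+ V 2))) refl) (O-+ h k)
    ; i-* = λ {y} {o} h k → subst InO (solveH (x ∷ y ∷ o ∷ []) (r ∷ []) ((S 0 :* (:c V 0 :* V 1)) :* V 2) (S 0 :* (:c V 0 :* (V 1 :* V 2))) refl) (O-* h k) }
   swap : ∀ y z → InO (ι r * (conj y * z)) → InO (ι r * (conj z * y))
   swap y z h = subst InO (solveH (y ∷ z ∷ []) (r ∷ []) (:c (S 0 :* (:c V 0 :* V 1))) (S 0 :* (:c V 1 :* V 0)) refl) (O-conj h)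
   at : ∀ {y} → Span gs y → InO (ι r * (conj y * x))
   at {y} hy = swap x y (Span-least functional gs (λ {g} m → swap g x (f m)) hy)
  from : Span gs x → ∀ {g} → g ∈ gs → Test g
  from hx m = use (NIdeal.integral i (Span-∈ m) hx)
   where
   use : ∀ {g} → (conj g * x) /∈ N → Test g
   use (quo o io e) = subst InO (sym (trans (cong (ι r *_) e) (ι-undo {r} {N} Nr≡1 o))) io

 /∈-ideal : ∀ N → IsIdeal (_/∈ N)
 /∈-ideal N = record
  { i-0 = quo 0# O-0 (sym (zeroʳ (ι N)))
  ; i-+ = λ { (quo o io refl) (quo o' io' refl) → quo (o + o') (O-+ io io') (sym (distribˡ (ι N) o o')) }
  ; i-* = λ { {o = o'} (quo o io refl) io' → quo (o * o') (O-* io io') (*-assoc (ι N) o o') } }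

 /∈-left : ∀ {N o x} → InO o → x /∈ N → (o * x) /∈ N
 /∈-left {N} {o} io (quo o' io' refl) = quo (o * o') (O-* io io') (solveH (o ∷ o' ∷ []) (N ∷ []) (V 0 :* (S 0 :* V 1)) (S 0 :* (V 0 :* V 1)) refl)

 /∈-ι : ∀ {N o} → InO o → (ι N * o) /∈ N
 /∈-ι io = quo _ io refl

 /∈? : ∀ {N} → ¬ (N ≡ 0ℚ) → ∀ x → Dec (x /∈ N)
 /∈? {N} N≢0 x = map′ (λ h → quo (ι r * x) h (sym (undo x (proj₂ (inv N N≢0))))) (λ { (quo o io refl) → subst InO (sym (undo' o)) io }) (InO? (ι r * x))
  where
  r = proj₁ (inv N N≢0)
  undo : ∀ x → N ℚ.* r ≡ 1ℚ → ι N * (ι r * x) ≡ x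
  undo x h = trans (sym (*-assoc _ _ _)) (trans (cong (_* x) (ι-product {N} {r} h)) (*-identityˡ x))
  undo' : ∀ o → ι r * (ι N * o) ≡ o
  undo' o = ι-undo {r} {N} (proj₂ (inv N N≢0)) o

 trd-+ : ∀ x y → trd (x + y) ≡ trd x ℚ.+ trd y
 trd-+ x y = ι-injective (trans (sym (+-conj (x + y))) (trans (solveH (x ∷ y ∷ []) [] ((V 0 :+ V 1) :+ :c (V 0 :+ V 1)) ((V 0 :+ :c V 0) :+ (V 1 :+ :c V 1)) refl)
  (trans (cong₂ _+_ (+-conj x) (+-conj y)) (sym (ι-+ (trd x) (trd y))))))

 trd-ι : ∀ z x → trd (ι z * x) ≡ z ℚ.* trd x
 trd-ι z x = ι-injective (trans (sym (+-conj (ι z * x))) (trans (solveH (x ∷ []) (z ∷ []) (S 0 :* V 0 :+ :c (S 0 :* V 0)) (S 0 :* (V 0 :+ :c V 0)) refl)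
  (trans (cong (ι z *_) (+-conj x)) (sym (ι-* z (trd x))))))

 trd-neg : ∀ x → trd (- x) ≡ ℚ.- trd x
 trd-neg x = ι-injective (trans (sym (+-conj (- x))) (trans (solveH (x ∷ []) [] ((:- V 0) :+ :c (:- V 0)) (:- (V 0 :+ :c V 0)) refl)
  (trans (cong -_ (+-conj x)) (sym (ι-neg (trd x))))))

 trd-conj : ∀ x → trd (conj x) ≡ trd x
 trd-conj x = ι-injective (trans (sym (+-conj (conj x))) (trans (cong (conj x +_) (conj-conj x)) (trans (+-comm _ _) (+-conj x))))

 conj≡ : ∀ x → conj x ≡ ι (trd x) + - x
 conj≡ x = sym (trans (cong (_+ - x) (sym (+-conj x))) (solveH (x ∷ []) [] ((V 0 :+ :c V 0) :- V 0) (:c V 0) refl))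

 O-induction : ∀ {P : H → Set} → (∀ {x y} → P x → P y → P (x + y)) → (∀ {z x} → Int z → P x → P (ι z * x)) → (∀ i → P (basis i)) → ∀ {o} → InO o → P o
 O-induction P+ Pι Pb io with O-coord io
 ... | n , ni , refl = P+ (Pι (ni _) (Pb _)) (P+ (Pι (ni _) (Pb _)) (P+ (Pι (ni _) (Pb _)) (Pι (ni _) (Pb _))))

 ∣-nat : ∀ {p n} → 0 ℕ.< n → fromℕ n ∣ℚ fromℕ p → n ∣ p
 ∣-nat n>0 (mult k ik e) = dv⇒∣ n>0 (dv k ik e)

 prime-divisor : ∀ {p N} → Prime p → Int N → 0ℚ ℚ.< N → N ∣ℚ fromℕ p → (N ≡ 1ℚ) ⊎ (N ≡ fromℕ p)
 prime-divisor {p} {N} pr iN N>0 h = go (natural iN N>0)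
  where
  go : ∃[ n ] ((0 ℕ.< n) × (N ≡ fromℕ n)) → (N ≡ 1ℚ) ⊎ (N ≡ fromℕ p)
  go (n , n>0 , refl) with prime⇒irreducible pr (∣-nat n>0 h)
  ... | inj₁ refl = inj₁ fromℕ-1
  ... | inj₂ refl = inj₂ refl

 prime²-divisor : ∀ {p N} → Prime p → Int N → 0ℚ ℚ.< N → N ∣ℚ (fromℕ p ℚ.* fromℕ p) → (N ≡ 1ℚ) ⊎ ((N ≡ fromℕ p) ⊎ (N ≡ fromℕ p ℚ.* fromℕ p))
 prime²-divisor {p} {N} pr iN N>0 h = go (natural iN N>0)
  where
  irr : ∀ {n} → n ∣ p → (n ≡ 1) ⊎ (n ≡ p)
  irr = prime⇒irreducible pr
  instance _ = ℕ.>-nonZero (prime>0 pr)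
  square : ∀ n → n ∣ p ℕ.* p → (n ≡ 1) ⊎ ((n ≡ p) ⊎ (n ≡ p ℕ.* p))
  square n (divides k e) with euclidsLemma k n pr (divides p (sym e))
  ... | inj₁ (divides j refl) with irr {n} (divides j (ℕ.*-cancelʳ-≡ p (j ℕ.* n) p (trans e (trans (ℕ.*-assoc j p n) (trans (cong (j ℕ.*_) (ℕ.*-comm p n)) (sym (ℕ.*-assoc j n p)))))))
  ...   | inj₁ q = inj₁ q
  ...   | inj₂ q = inj₂ (inj₁ q)
  square n (divides k e) | inj₂ (divides j refl) with irr {j} (divides k (ℕ.*-cancelʳ-≡ p (k ℕ.* j) p (trans e (sym (ℕ.*-assoc k j p)))))
  ...   | inj₁ refl = inj₂ (inj₁ (ℕ.+-identityʳ p))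
  ...   | inj₂ refl = inj₂ (inj₂ refl)
  go : ∃[ n ] ((0 ℕ.< n) × (N ≡ fromℕ n)) → _
  go (n , n>0 , refl) with square n (∣-nat n>0 (subst (fromℕ n ∣ℚ_) (sym (fromℕ-* p p)) h))
  ... | inj₁ refl = inj₁ fromℕ-1
  ... | inj₂ (inj₁ refl) = inj₂ (inj₁ refl)
  ... | inj₂ (inj₂ refl) = inj₂ (inj₂ (fromℕ-* p p))

 module AtPrime {p : ℕ} (pr : Prime p) where
  P : ℚ
  P = fromℕ p

  P≢0 : ¬ (P ≡ 0ℚ)
  P≢0 = prime≢0 pr

  int-P : Int P
  int-P = int-ℕ p

  ιP≢0 : ¬ (ι P ≡ 0#)
  ιP≢0 e = P≢0 (ι-injective (trans e (sym ι-0)))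

  p>1 : 1 ℕ.< p
  p>1 = go p pr
   where
   go : ∀ p → Prime p → 1 ℕ.< p
   go zero pr = ⊥-elim (¬prime[0] pr)
   go (suc zero) pr = ⊥-elim (¬prime[1] pr)
   go (suc (suc p)) pr = s≤s (s≤s z≤n)

  ¬dv-1 : ¬ Dv p 1ℚ
  ¬dv-1 h = ¬dv-small (s≤s z≤n) p>1 (subst (Dv p) (sym fromℕ-1) h)

  prime-norm : ∀ {zs z} → (∀ {x} → Span zs x → InO x) → Span zs (ι P) → ¬ Span zs 1# → Span zs z → ¬ (z /∈ P) → NIdeal (Span zs) P
  prime-norm {zs} {z} sub hP ¬1 hz z∉ = go (ideal-norm zs (ι P , hP , ιP≢0))
   where
   go : ∃[ N ] NIdeal (Span zs) N → NIdeal (Span zs) P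
   go (N , i) = pick (prime²-divisor pr (norm-int i sub) (NIdeal.pos i) (subst (N ∣ℚ_) (nrd-ι P) (norm-divides i hP)))
    where
    pick : (N ≡ 1ℚ) ⊎ ((N ≡ P) ⊎ (N ≡ P ℚ.* P)) → NIdeal (Span zs) P
    pick (inj₁ e) = ⊥-elim (¬1 (subst (Span zs) (trans (cong ι e) ι-1) (norm-mem i sub)))
    pick (inj₂ (inj₁ e)) = nideal-≡ e i
    pick (inj₂ (inj₂ e)) = ⊥-elim (bad (NIdeal.integral i hP hz))
     where
     bad : (conj (ι P) * z) /∈ N → ⊥
     bad (quo o io eo) = z∉ (quo o io (ι-cancel P≢0 (trans (cong (_* z) (sym (conj-ι P))) (trans eo (trans (cong (λ n → ι n * o) e) (trans (cong (_* o) (ι-* P P)) (*-assoc _ _ _)))))))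

  simple : ∀ {qs h} → NIdeal (Span qs) P → (∀ {x} → Span qs x → InO x) → InO h → ¬ Span qs h → ∃[ o ] ∃[ q ] (InO o × Span qs q × (1# ≡ h * o + q))
  simple {qs} {h} i sub ih h∉ = go (ideal-norm (h ∷ qs) (ι P , inc (norm-mem i sub) , ιP≢0))
   where
   inc : ∀ {x} → Span qs x → Span (h ∷ qs) x
   inc = Span-++ʳ (h ∷ []) qs
   sub' : ∀ {x} → Span (h ∷ qs) x → InO x
   sub' (o , y , io , hy , refl) = O-+ (O-* ih io) (sub hy)
   go : ∃[ N ] NIdeal (Span (h ∷ qs)) N → _
   go (N , j) = pick (prime-divisor pr (norm-int j sub') (NIdeal.pos j) (sub-norm i j inc))
    where
    pick : (N ≡ 1ℚ) ⊎ (N ≡ P) → ∃[ o ] ∃[ q ] (InO o × Span qs q × (1# ≡ h * o + q))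
    pick (inj₁ e) = subst (Span (h ∷ qs)) (trans (cong ι e) ι-1) (norm-mem j sub')
    pick (inj₂ e) = ⊥-elim (h∉ (equal-norm i (nideal-≡ e j) inc (Span-∈ (here refl))))

  trace-kills : ∀ {I} → NIdeal I P → (∀ {x} → I x → InO x) → ∀ {w x} → I w → I x → Dv p (trd w) → (w * x) /∈ P
  trace-kills i sub {w} {x} hw hx (dv k ik e) = subst (_/∈ P) eq
    (i-- (/∈-ideal P) (/∈-ι (O-* (O-ι ik) (sub hx))) (NIdeal.integral i hw hx))
   where
   eq : ι P * (ι k * x) + - (conj w * x) ≡ w * x
   eq = trans (cong (λ z → ι P * (ι k * x) + - (z * x)) (trans (conj≡ w) (cong (_+ - w) (trans (cong ι e) (ι-* P k)))))
    (solveH (w ∷ x ∷ []) (P ∷ k ∷ []) (S 0 :* (S 1 :* V 1) :- (S 0 :* S 1 :- V 0) :* V 1) (V 0 :* V 1) refl)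

  dv-trd : ∀ {x} → x /∈ P → Dv p (trd x)
  dv-trd (quo o io refl) = dv (trd o) (trd-int io) (trd-ι P o)

  dv-unit : ∀ {τ u v} → Int u → Int v → u ℚ.* τ ℚ.+ v ℚ.* P ≡ 1ℚ → ∀ {x} → Int x → Dv p (τ ℚ.* x) → Dv p x
  dv-unit {τ} {u} {v} iu iv e {x} ix h = subst (Dv p) (trans (lem u v τ x P) (trans (cong (ℚ._* x) e) (ℚ.*-identityˡ x))) (dv-+ (dv-* iu h) (dv-* ix (dv-self {p} iv)))
   where
   lem : ∀ u v τ x P → u ℚ.* (τ ℚ.* x) ℚ.+ x ℚ.* (v ℚ.* P) ≡ (u ℚ.* τ ℚ.+ v ℚ.* P) ℚ.* x
   lem = solve-∀ ℚ-ring

  /∈-unit : ∀ {τ u v} → Int u → Int v → u ℚ.* τ ℚ.+ v ℚ.* P ≡ 1ℚ → ∀ {x} → InO x → (ι τ * x) /∈ P → x /∈ P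
  /∈-unit {τ} {u} {v} iu iv e {x} ix h = subst (_/∈ P) eq (i-+ (/∈-ideal P) (/∈-left (O-ι iu) h) (/∈-ι (O-* (O-ι iv) ix)))
   where
   eq : ι u * (ι τ * x) + ι P * (ι v * x) ≡ x
   eq = trans (solveH (x ∷ []) (u ∷ τ ∷ P ∷ v ∷ []) (S 0 :* (S 1 :* V 0) :+ S 2 :* (S 3 :* V 0)) ((S 0 :* S 1 :+ S 3 :* S 2) :* V 0) refl)
    (trans (cong (_* x) (trans (sym (trans (ι-+ _ _) (cong₂ _+_ (ι-* u τ) (ι-* v P)))) (trans (cong ι e) ι-1))) (*-identityˡ x))

  powP : ℕ → ℚ
  powP k = fromℕ (p ℕ.^ k)

  powP-suc : ∀ k → powP (suc k) ≡ P ℚ.* powP k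
  powP-suc k = fromℕ-* p (p ℕ.^ k)

  n<p^n : ∀ n → n ℕ.< p ℕ.^ n
  n<p^n zero = s≤s z≤n
  n<p^n (suc n) = ℕ.≤-trans (s≤s (n<p^n n)) (ℕ.≤-trans (ℕ.≤-trans (ℕ.≤-reflexive (ℕ.+-comm 1 (p ℕ.^ n))) (ℕ.+-monoʳ-≤ (p ℕ.^ n) (ℕ.≤-trans (s≤s z≤n) (n<p^n n))))
   (ℕ.≤-trans (ℕ.≤-reflexive (cong (p ℕ.^ n ℕ.+_) (sym (ℕ.+-identityʳ (p ℕ.^ n))))) (ℕ.*-monoˡ-≤ (p ℕ.^ n) p>1)))

  infinitely-divisible : ∀ {x} → InO x → (∀ k → x /∈ powP k) → x ≡ 0#
  infinitely-divisible {x} ix h with x ≟ 0#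
  ... | yes e = e
  ... | no x≢0 = ⊥-elim (go (natural (nrd-int ix) (nrd-pos x x≢0)))
   where
   go : ∃[ n ] ((0 ℕ.< n) × (nrd x ≡ fromℕ n)) → ⊥
   go (n , n>0 , e) = bad (h n)
    where
    bad : x /∈ powP n → ⊥
    bad (quo o io eo) = ℕ.<⇒≱ (n<p^n n) (∣⇒≤ {{ℕ.>-nonZero n>0}} (dv⇒∣ (ℕ.≤-<-trans z≤n (n<p^n n))
     (dv (powP n ℚ.* nrd o) (int-* (int-ℕ _) (nrd-int io)) (trans (sym e) (trans (cong nrd eo) (trans (nrd-* (ι (powP n)) o)
      (trans (cong (ℚ._* nrd o) (nrd-ι (powP n))) (ℚ.*-assoc (powP n) (powP n) (nrd o)))))))))

  -- If qO ⊆ ℤq + pO and conj q O ⊆ ℤ conj q + pO modulo a unit τ = trd q, then O = ℤ + ℤq + pO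
  -- (up to τ²), so that commutators with q are infinitely p-divisible.
  central : ∀ {q u v} → InO q → (let τ = trd q) → Int u → Int v → u ℚ.* τ ℚ.+ v ℚ.* P ≡ 1ℚ →
   (∀ {o} → InO o → ∃[ α ] ∃[ β ] (ι τ * (ι τ * o) + - (ι α * q) + - (ι β * conj q)) /∈ P) → ∀ o → InO o → o * q ≡ q * o
  central {q} {u} {v} iq iu iv e h o io = trans (sym (+-identityʳ _)) (trans (cong (o * q +_) (sym (-‿inverseˡ (q * o))))
    (trans (sym (+-assoc _ _ _)) (trans (cong (_+ q * o) (infinitely-divisible (com-O io) (λ k → divisible k io))) (+-identityˡ _))))
   where
   τ = trd q
   com : H → H
   com o = o * q + - (q * o)
   com-O : ∀ {o} → InO o → InO (com o)
   com-O io = O-+ (O-* io iq) (O-neg (O-* iq io))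
   divisible : ∀ k {o} → InO o → com o /∈ powP k
   divisible zero io = quo _ (com-O io) (sym (trans (cong (_* _) (trans (cong ι fromℕ-1) ι-1)) (*-identityˡ _)))
   divisible (suc k) {o} io = use (divisible k io) (h io)
    where
    powP≢0 : ¬ (powP k ≡ 0ℚ)
    powP≢0 = pos≢0 (ℕ.≤-<-trans z≤n (n<p^n k))
    use : com o /∈ powP k → ∃[ α ] ∃[ β ] (ι τ * (ι τ * o) + - (ι α * q) + - (ι β * conj q)) /∈ P → com o /∈ powP (suc k)
    use (quo c ic ec) (α , β , quo o' io' e') = finish (divisible k io')
     where
     key : ι τ * (ι τ * com o) ≡ ι P * com o'
     key = trans (solveH (q ∷ o ∷ conj q ∷ []) (τ ∷ α ∷ β ∷ [])
       (S 0 :* (S 0 :* (V 1 :* V 0 :- V 0 :* V 1)))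
       ((S 0 :* (S 0 :* V 1) :- S 1 :* V 0 :- S 2 :* V 2) :* V 0 :- V 0 :* (S 0 :* (S 0 :* V 1) :- S 1 :* V 0 :- S 2 :* V 2) :+ S 2 :* (V 2 :* V 0 :- V 0 :* V 2)) refl)
      (trans (cong₂ _+_ (cong₂ (λ x y → x * q + - (q * y)) e' e') (trans (cong (ι β *_) (trans (cong₂ (λ x y → x + - y) (conj-*ˡ q) (*-conj q)) (-‿inverseʳ _))) (zeroʳ (ι β))))
       (trans (+-identityʳ _) (solveH (q ∷ o' ∷ []) (P ∷ []) ((S 0 :* V 1) :* V 0 :- V 0 :* (S 0 :* V 1)) (S 0 :* (V 1 :* V 0 :- V 0 :* V 1)) refl)))
     finish : com o' /∈ powP k → com o /∈ powP (suc k)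
     finish (quo c' ic' ec') = up (/∈-unit iu iv e ic (/∈-unit iu iv e (O-* (O-ι (trd-int iq)) ic) (quo c' ic' (ι-cancel powP≢0 eq))))
      where
      eq : ι (powP k) * (ι τ * (ι τ * c)) ≡ ι (powP k) * (ι P * c')
      eq = trans (solveH (c ∷ []) (powP k ∷ τ ∷ []) (S 0 :* (S 1 :* (S 1 :* V 0))) (S 1 :* (S 1 :* (S 0 :* V 0))) refl)
       (trans (cong (λ z → ι τ * (ι τ * z)) (sym ec)) (trans key (trans (cong (ι P *_) ec') (solveH (c' ∷ []) (P ∷ powP k ∷ []) (S 0 :* (S 1 :* V 0)) (S 1 :* (S 0 :* V 0)) refl))))
      up : c /∈ P → com o /∈ powP (suc k)
      up (quo d id ed) = quo d id (trans ec (trans (cong (ι (powP k) *_) ed) (trans (solveH (d ∷ []) (powP k ∷ P ∷ []) (S 0 :* (S 1 :* V 0)) ((S 1 :* S 0) :* V 0) refl)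
       (cong (_* d) (sym (trans (cong ι (powP-suc k)) (ι-* P (powP k))))))))

  basis-or : ∀ {R : H → Set} → (∀ i → Dec (R (basis i))) → (∀ i → R (basis i)) ⊎ (∃[ i ] ¬ R (basis i))
  basis-or {R} d with all? d
  ... | yes h = inj₁ h
  ... | no h = inj₂ (¬∀⟶∃¬ 4 (λ i → R (basis i)) d h)

  -- An element of an ideal of norm p, not divisible by p, of trace divisible by p.
  TraceZero : (H → Set) → Set
  TraceZero I = ∃[ w ] (I w × ¬ (w /∈ P) × Dv p (trd w))

  module Defect (q : H) where
   τ : ℚ
   τ = trd q

   defect : H → H
   defect o = ι τ * (q * o) + - (ι (trd (q * o)) * q)

   defect-trd : ∀ o → trd (defect o) ≡ 0ℚ
   defect-trd o = trans (trd-+ _ _) (trans (cong₂ ℚ._+_ (trd-ι τ (q * o)) (trans (trd-neg _) (cong ℚ.-_ (trd-ι (trd (q * o)) q))))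
    (lem τ (trd (q * o))))
    where
    lem : ∀ t s → t ℚ.* s ℚ.+ (ℚ.- (s ℚ.* t)) ≡ 0ℚ
    lem = solve-∀ ℚ-ring

   defect-all : (∀ i → defect (basis i) /∈ P) → ∀ {o} → InO o → defect o /∈ P
   defect-all h = O-induction {λ o → defect o /∈ P}
    (λ {x} {y} a b → subst (_/∈ P) (trans (solveH (q ∷ x ∷ y ∷ []) (τ ∷ trd (q * x) ∷ trd (q * y) ∷ [])
      ((S 0 :* (V 0 :* V 1) :- S 1 :* V 0) :+ (S 0 :* (V 0 :* V 2) :- S 2 :* V 0)) (S 0 :* (V 0 :* (V 1 :+ V 2)) :- (S 1 :+ S 2) :* V 0) refl)
      (cong (λ z → ι τ * (q * (x + y)) + - (z * q)) (trans (sym (ι-+ _ _)) (cong ι (trans (sym (trd-+ _ _)) (cong trd (sym (distribˡ q x y)))))))) (i-+ (/∈-ideal P) a b))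
    (λ {z} {x} iz a → subst (_/∈ P) (trans (solveH (q ∷ x ∷ []) (τ ∷ trd (q * x) ∷ z ∷ [])
      (S 2 :* (S 0 :* (V 0 :* V 1) :- S 1 :* V 0)) (S 0 :* (V 0 :* (S 2 :* V 1)) :- (S 2 :* S 1) :* V 0) refl)
      (cong (λ w → ι τ * (q * (ι z * x)) + - (w * q)) (trans (sym (ι-* _ _)) (cong ι (trans (sym (trd-ι z (q * x))) (cong trd (solveH (q ∷ x ∷ []) (z ∷ []) (S 0 :* (V 0 :* V 1)) (V 0 :* (S 0 :* V 1)) refl)))))))
      (/∈-left (O-ι iz) a))
    h

   defect-in : ∀ {I} → IsIdeal I → InO q → I q → ∀ {o} → InO o → I (defect o)
   defect-in i iq hq {o} io = i-- i (i-ι i (trd-int iq) (i-* i hq io)) (i-ι i (trd-int (O-* iq io)) hq)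

  trace-zero : ∀ {qs q} → NIdeal (Span qs) P → (∀ {x} → Span qs x → InO x) → Span qs q → ¬ (q /∈ P) → TraceZero (Span qs)
  trace-zero {qs} {q} i sub hq q∉ = start (prime-dichotomy pr (trd q) (trd-int iq))
   where
   iq = sub hq
   q̄ = conj q
   iq̄ = O-conj iq
   τ = trd q
   module D = Defect q
   module D̄ = Defect q̄
   τ̄≡ : D̄.τ ≡ τ
   τ̄≡ = trd-conj q
   N∣ : Dv p (nrd q)
   N∣ with norm-divides i hq
   ... | mult k ik e = dv k ik e
   q̄∉ : ¬ (q̄ /∈ P)
   q̄∉ (quo o io e) = q∉ (quo (conj o) (O-conj io) (trans (sym (conj-conj q)) (trans (cong conj e) (solveH (o ∷ []) (P ∷ []) (:c (S 0 :* V 0)) (S 0 :* :c V 0) refl))))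

   module NoTrace {u v} (iu : Int u) (iv : Int v) (e : u ℚ.* τ ℚ.+ v ℚ.* P ≡ 1ℚ) (h₁ : ∀ {o} → InO o → D.defect o /∈ P) where
    ¬dv-τ : ¬ Dv p τ
    ¬dv-τ h = ¬dv-1 (dv-unit iu iv e int-1 (subst (Dv p) (sym (ℚ.*-identityʳ τ)) h))

    rs = q̄ ∷ ι P ∷ []

    rs-sub : ∀ {x} → Span rs x → InO x
    rs-sub = Span-least O-ideal rs λ { (here refl) → iq̄ ; (there (here refl)) → O-ι int-P }

    -- conj x · y for generators x of rs.
    rs-kill : ∀ {y} → InO y → (q * y) /∈ P → ∀ {x} → Span rs x → (conj x * y) /∈ P
    rs-kill {y} iy h {x} (o , _ , io , (o' , _ , io' , refl , refl) , refl) = subst (_/∈ P)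
     (solveH (q ∷ y ∷ o ∷ o' ∷ []) (P ∷ []) (:c V 2 :* (V 0 :* V 1) :+ S 0 :* (:c V 3 :* V 1)) (:c (:c V 0 :* V 2 :+ (S 0 :* V 3 :+ :0)) :* V 1) refl)
     (i-+ (/∈-ideal P) (/∈-left (O-conj io) h) (/∈-ι (O-* (O-conj io') iy)))

    rs-nrd : ∀ {x} → Span rs x → Dv p (nrd x)
    rs-nrd {x} hx@(o , _ , io , (o' , _ , io' , refl , refl) , refl) = out (rs-kill (rs-sub hx) qx hx)
     where
     qx : (q * x) /∈ P
     qx = subst (_/∈ P) (trans (cong (λ z → z * o + q * (ι P * o' + 0#)) (sym (*-conj q)))
       (solveH (q ∷ o ∷ o' ∷ []) (P ∷ []) ((V 0 :* :c V 0) :* V 1 :+ V 0 :* (S 0 :* V 2 :+ :0)) (V 0 :* (:c V 0 :* V 1 :+ (S 0 :* V 2 :+ :0))) refl))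
      (i-+ (/∈-ideal P) (first N∣) (subst (_/∈ P) (solveH (q ∷ o' ∷ []) (P ∷ []) (S 0 :* (V 0 :* V 1)) (V 0 :* (S 0 :* V 1 :+ :0)) refl) (/∈-ι (O-* iq io'))))
      where
      first : Dv p (nrd q) → (ι (nrd q) * o) /∈ P
      first (dv k ik ek) = quo (ι k * o) (O-* (O-ι ik) io) (trans (cong (_* o) (trans (cong ι ek) (ι-* P k))) (*-assoc _ _ _))
     out : (conj x * x) /∈ P → Dv p (nrd x)
     out (quo c ic ec) = dv (r ℚ.* nrd x) (O-int (subst InO c≡ ic)) (sym (trans (sym (ℚ.*-assoc P r (nrd x))) (trans (cong (ℚ._* nrd x) Pr≡1) (ℚ.*-identityˡ (nrd x)))))
      where
      r = proj₁ (inv P P≢0)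
      Pr≡1 = proj₂ (inv P P≢0)
      c≡ : c ≡ ι (r ℚ.* nrd x)
      c≡ = sym (trans (ι-* r (nrd x)) (trans (cong (ι r *_) (trans (sym (conj-*ˡ x)) ec))
       (trans (sym (*-assoc _ _ _)) (trans (cong (_* c) (ι-product {r} {P} (trans (ℚ.*-comm r P) Pr≡1))) (*-identityˡ c)))))

    rs-1 : ¬ Span rs 1#
    rs-1 h = ¬dv-1 (subst (Dv p) (ι-injective (trans (sym (*-conj 1#)) (trans (*-identityˡ _) (trans conj-1 (sym ι-1))))) (rs-nrd h))

    rs-ideal : NIdeal (Span rs) P
    rs-ideal = prime-norm {rs} {q̄} rs-sub (Span-∈ (there (here refl))) rs-1 (Span-∈ (here refl)) q̄∉

    no-defect : ∀ {z} → Span rs z → trd z ≡ 0ℚ → ¬ (z /∈ P) → ⊥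
    no-defect {z} hz tz z∉ = contradict (equal-norm zs-ideal rs-ideal zs-sub (Span-∈ {rs} (here refl)))
     where
     iz = rs-sub hz
     zs = z ∷ ι P ∷ []
     zs-sub : ∀ {x} → Span zs x → Span rs x
     zs-sub = Span-least (Span-ideal rs) zs λ { (here refl) → hz ; (there (here refl)) → Span-∈ (there (here refl)) }
     zs-ideal : NIdeal (Span zs) P
     zs-ideal = prime-norm {zs} {z} (rs-sub ∘ zs-sub) (Span-∈ (there (here refl))) (rs-1 ∘ zs-sub) (Span-∈ (here refl)) z∉
     trace : ∀ {o} → InO o → Dv p (trd (z * o))
     trace {o} io = dv-unit iu iv e (trd-int (O-* iz io)) (subst (Dv p) eq (dv-trd (trace-kills rs-ideal rs-sub hz hy (subst (Dv p) (sym tz) (dv 0ℚ int-0 (sym (ℚ.*-zeroʳ P)))))))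
      where
      y = ι τ * o + - ι (trd (q * o))
      iy : InO y
      iy = O-+ (O-* (O-ι (trd-int iq)) io) (O-neg (O-ι (trd-int (O-* iq io))))
      hy : Span rs y
      hy = dual-mem rs-ideal (rs-kill iy (subst (_/∈ P) (solveH (q ∷ o ∷ []) (τ ∷ trd (q * o) ∷ []) (S 0 :* (V 0 :* V 1) :- S 1 :* V 0) (V 0 :* (S 0 :* V 1 :- S 1)) refl) (h₁ io)))
      lem : ∀ t s → t ℚ.+ (ℚ.- (s ℚ.* 0ℚ)) ≡ t
      lem = solve-∀ ℚ-ring
      eq : trd (z * y) ≡ τ ℚ.* trd (z * o)
      eq = trans (cong trd (solveH (z ∷ o ∷ []) (τ ∷ trd (q * o) ∷ []) (V 0 :* (S 0 :* V 1 :- S 1)) (S 0 :* (V 0 :* V 1) :- S 1 :* V 0) refl))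
       (trans (trd-+ _ _) (trans (cong₂ ℚ._+_ (trd-ι τ (z * o)) (trans (trd-neg _) (cong ℚ.-_ (trans (trd-ι (trd (q * o)) z) (cong (trd (q * o) ℚ.*_) tz)))))
        (lem (τ ℚ.* trd (z * o)) (trd (q * o)))))
     contradict : Span zs q̄ → ⊥
     contradict (o , _ , io , (o' , _ , io' , refl , refl) , eq) = ¬dv-τ (subst (Dv p) (trans (sym (trd-+ _ _)) (trans (cong trd (sym eq)) (trd-conj q)))
      (dv-+ (trace io) (dv-trd (subst (_/∈ P) (sym (+-identityʳ _)) (/∈-ι io')))))

    all-defects : (∀ {o} → InO o → D̄.defect o /∈ P) → ⊥
    all-defects h₂ = finish (O-noncommutative q (central iq iu iv e combine))
     where
     combine : ∀ {o} → InO o → ∃[ α ] ∃[ β ] (ι τ * (ι τ * o) + - (ι α * q) + - (ι β * conj q)) /∈ P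
     combine {o} io = trd (q * o) , trd (q̄ * o) , subst (_/∈ P) eq (i-+ (/∈-ideal P) (h₁ io) (h₂ io))
      where
      eq : D.defect o + D̄.defect o ≡ ι τ * (ι τ * o) + - (ι (trd (q * o)) * q) + - (ι (trd (q̄ * o)) * conj q)
      eq = trans (cong (λ t → D.defect o + (ι t * (q̄ * o) + - (ι (trd (q̄ * o)) * q̄))) τ̄≡)
       (trans (solveH (q ∷ o ∷ []) (τ ∷ trd (q * o) ∷ trd (q̄ * o) ∷ [])
        ((S 0 :* (V 0 :* V 1) :- S 1 :* V 0) :+ (S 0 :* (:c V 0 :* V 1) :- S 2 :* :c V 0)) (S 0 :* ((V 0 :+ :c V 0) :* V 1) :- S 1 :* V 0 :- S 2 :* :c V 0) refl)
        (cong (λ t → ι τ * (t * o) + - (ι (trd (q * o)) * q) + - (ι (trd (q̄ * o)) * conj q)) (+-conj q)))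
     finish : ∃[ r ] (q ≡ ι r) → ⊥
     finish (r , refl) = ¬dv-τ (both (euclid pr (trd-int iq) (trd-int iq) (subst (Dv p) eq (dv-* (int-+ (int-+ int-1 int-1) (int-+ int-1 int-1)) N∣))))
      where
      both : Dv p τ ⊎ Dv p τ → Dv p τ
      both (inj₁ h) = h
      both (inj₂ h) = h
      τ≡ : τ ≡ r ℚ.+ r
      τ≡ = ι-injective (trans (sym (+-conj (ι r))) (trans (cong (ι r +_) (conj-ι r)) (sym (ι-+ r r))))
      lem : ∀ r → ((1ℚ ℚ.+ 1ℚ) ℚ.+ (1ℚ ℚ.+ 1ℚ)) ℚ.* (r ℚ.* r) ≡ (r ℚ.+ r) ℚ.* (r ℚ.+ r)
      lem = solve-∀ ℚ-ring
      eq : ((1ℚ ℚ.+ 1ℚ) ℚ.+ (1ℚ ℚ.+ 1ℚ)) ℚ.* nrd q ≡ τ ℚ.* τ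
      eq = trans (cong (((1ℚ ℚ.+ 1ℚ) ℚ.+ (1ℚ ℚ.+ 1ℚ)) ℚ.*_) (nrd-ι r)) (trans (lem r) (sym (cong₂ ℚ._*_ τ≡ τ≡)))

    contradiction : ⊥
    contradiction = go (basis-or {λ o → D̄.defect o /∈ P} (λ i → /∈? P≢0 (D̄.defect (basis i))))
     where
     go : (∀ i → D̄.defect (basis i) /∈ P) ⊎ (∃[ i ] ¬ (D̄.defect (basis i) /∈ P)) → ⊥
     go (inj₁ h) = all-defects (D̄.defect-all h)
     go (inj₂ (i , h)) = no-defect (D̄.defect-in (Span-ideal rs) iq̄ (Span-∈ (here refl)) (O-basis i)) (D̄.defect-trd (basis i)) h

   start : Dv p (trd q) ⊎ (∃[ u ] ∃[ v ] (Int u × Int v × (u ℚ.* trd q ℚ.+ v ℚ.* P ≡ 1ℚ))) → TraceZero (Span qs)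
   start (inj₁ h) = q , hq , q∉ , h
   start (inj₂ (u , v , iu , iv , e)) = go (basis-or {λ o → D.defect o /∈ P} (λ i → /∈? P≢0 (D.defect (basis i))))
    where
    go : (∀ i → D.defect (basis i) /∈ P) ⊎ (∃[ i ] ¬ (D.defect (basis i) /∈ P)) → TraceZero (Span qs)
    go (inj₁ h) = ⊥-elim (NoTrace.contradiction iu iv e (D.defect-all h))
    go (inj₂ (i , h)) = D.defect (basis i) , D.defect-in (Span-ideal qs) iq hq (O-basis i) , h , subst (Dv p) (sym (D.defect-trd (basis i))) (dv 0ℚ int-0 (sym (ℚ.*-zeroʳ P)))

 Tuple : ℕ → Set
 Tuple zero = ⊤
 Tuple (suc n) = H × Tuple n

 infixl 6 _+V_
 infixl 7 _·V_

 _+V_ : ∀ {n} → Tuple n → Tuple n → Tuple n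
 _+V_ {zero} _ _ = tt
 _+V_ {suc n} (x , v) (y , w) = x + y , v +V w

 _·V_ : ∀ {n} → Tuple n → H → Tuple n
 _·V_ {zero} _ _ = tt
 _·V_ {suc n} (x , v) h = x * h , v ·V h

 record LinIso {n} (L M : Tuple n → Set) : Set where
  field
   to from : Tuple n → Tuple n
   to-+ : ∀ v w → to (v +V w) ≡ to v +V to w
   to-· : ∀ v h → to (v ·V h) ≡ to v ·V h
   from-+ : ∀ v w → from (v +V w) ≡ from v +V from w
   from-· : ∀ v h → from (v ·V h) ≡ from v ·V h
   to-from : ∀ v → to (from v) ≡ v
   from-to : ∀ v → from (to v) ≡ v
   to-∈ : ∀ {v} → L v → M (to v)
   from-∈ : ∀ {v} → M v → L (from v)

 iso-id : ∀ {n} {L M : Tuple n → Set} → (∀ {v} → L v → M v) → (∀ {v} → M v → L v) → LinIso L M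
 iso-id f g = record
  { to = λ v → v ; from = λ v → v ; to-+ = λ _ _ → refl ; to-· = λ _ _ → refl ; from-+ = λ _ _ → refl ; from-· = λ _ _ → refl
  ; to-from = λ _ → refl ; from-to = λ _ → refl ; to-∈ = f ; from-∈ = g }

 iso-sym : ∀ {n} {L M : Tuple n → Set} → LinIso L M → LinIso M L
 iso-sym i = record
  { to = from ; from = to ; to-+ = from-+ ; to-· = from-· ; from-+ = to-+ ; from-· = to-·
  ; to-from = from-to ; from-to = to-from ; to-∈ = from-∈ ; from-∈ = to-∈ }
  where open LinIso i

 iso-trans : ∀ {n} {L M N : Tuple n → Set} → LinIso L M → LinIso M N → LinIso L N
 iso-trans i j = record
  { to = J.to ∘ I.to ; from = I.from ∘ J.from
  ; to-+ = λ v w → trans (cong J.to (I.to-+ v w)) (J.to-+ _ _) ; to-· = λ v h → trans (cong J.to (I.to-· v h)) (J.to-· _ _)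
  ; from-+ = λ v w → trans (cong I.from (J.from-+ v w)) (I.from-+ _ _) ; from-· = λ v h → trans (cong I.from (J.from-· v h)) (I.from-· _ _)
  ; to-from = λ v → trans (cong J.to (I.to-from _)) (J.to-from v) ; from-to = λ v → trans (cong I.from (J.from-to _)) (I.from-to v)
  ; to-∈ = J.to-∈ ∘ I.to-∈ ; from-∈ = I.from-∈ ∘ J.from-∈ }
  where
  module I = LinIso i
  module J = LinIso j

 infixr 5 _⊞_
 _⊞_ : ∀ {n} → (H → Set) → (Tuple n → Set) → Tuple (suc n) → Set
 (I ⊞ L) (x , v) = I x × L v

 iso-cons : ∀ {n} {I : H → Set} {L M : Tuple n → Set} → LinIso L M → LinIso (I ⊞ L) (I ⊞ M)
 iso-cons i = record
  { to = λ { (x , v) → x , to v } ; from = λ { (x , v) → x , from v }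
  ; to-+ = λ { (x , v) (y , w) → cong (x + y ,_) (to-+ v w) } ; to-· = λ { (x , v) h → cong (x * h ,_) (to-· v h) }
  ; from-+ = λ { (x , v) (y , w) → cong (x + y ,_) (from-+ v w) } ; from-· = λ { (x , v) h → cong (x * h ,_) (from-· v h) }
  ; to-from = λ { (x , v) → cong (x ,_) (to-from v) } ; from-to = λ { (x , v) → cong (x ,_) (from-to v) }
  ; to-∈ = λ { (h , k) → h , to-∈ k } ; from-∈ = λ { (h , k) → h , from-∈ k } }
  where open LinIso i

 iso-swap : ∀ {n} {I J : H → Set} {L : Tuple n → Set} → LinIso (I ⊞ J ⊞ L) (J ⊞ I ⊞ L)
 iso-swap = record
  { to = λ { (x , y , v) → y , x , v } ; from = λ { (x , y , v) → y , x , v }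
  ; to-+ = λ _ _ → refl ; to-· = λ _ _ → refl ; from-+ = λ _ _ → refl ; from-· = λ _ _ → refl
  ; to-from = λ _ → refl ; from-to = λ _ → refl ; to-∈ = λ { (h , k , l) → k , h , l } ; from-∈ = λ { (h , k , l) → k , h , l } }

 iso-scale : ∀ {n} {I J : H → Set} {L : Tuple n → Set} α α' → α * α' ≡ 1# → α' * α ≡ 1# → (∀ {x} → I x → J (α * x)) → (∀ {x} → J x → I (α' * x)) →
  LinIso (I ⊞ L) (J ⊞ L)
 iso-scale α α' p q f g = record
  { to = λ { (x , v) → α * x , v } ; from = λ { (x , v) → α' * x , v }
  ; to-+ = λ { (x , v) (y , w) → cong (_, v +V w) (distribˡ α x y) } ; to-· = λ { (x , v) h → cong (_, v ·V h) (sym (*-assoc α x h)) }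
  ; from-+ = λ { (x , v) (y , w) → cong (_, v +V w) (distribˡ α' x y) } ; from-· = λ { (x , v) h → cong (_, v ·V h) (sym (*-assoc α' x h)) }
  ; to-from = λ { (x , v) → cong (_, v) (trans (sym (*-assoc α α' x)) (trans (cong (_* x) p) (*-identityˡ x))) }
  ; from-to = λ { (x , v) → cong (_, v) (trans (sym (*-assoc α' α x)) (trans (cong (_* x) q) (*-identityˡ x))) }
  ; to-∈ = λ { (h , k) → f h , k } ; from-∈ = λ { (h , k) → g h , k } }

 iso-shear : ∀ {n} {L M : Tuple (suc (suc n)) → Set} β →
  (∀ {x y v} → L (x , y , v) → M (x + β * y , y , v)) → (∀ {x y v} → M (x , y , v) → L (x + - (β * y) , y , v)) → LinIso L M
 iso-shear β f g = record
  { to = λ { (x , y , v) → x + β * y , y , v } ; from = λ { (x , y , v) → x + - (β * y) , y , v }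
  ; to-+ = λ { (x , y , v) (x' , y' , v') → cong (_, y + y' , v +V v')
    (solveH (β ∷ x ∷ y ∷ x' ∷ y' ∷ []) [] ((V 1 :+ V 3) :+ V 0 :* (V 2 :+ V 4)) ((V 1 :+ V 0 :* V 2) :+ (V 3 :+ V 0 :* V 4)) refl) }
  ; to-· = λ { (x , y , v) h → cong (_, y * h , v ·V h) (solveH (β ∷ x ∷ y ∷ h ∷ []) [] (V 1 :* V 3 :+ V 0 :* (V 2 :* V 3)) ((V 1 :+ V 0 :* V 2) :* V 3) refl) }
  ; from-+ = λ { (x , y , v) (x' , y' , v') → cong (_, y + y' , v +V v')
    (solveH (β ∷ x ∷ y ∷ x' ∷ y' ∷ []) [] ((V 1 :+ V 3) :- V 0 :* (V 2 :+ V 4)) ((V 1 :- V 0 :* V 2) :+ (V 3 :- V 0 :* V 4)) refl) }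
  ; from-· = λ { (x , y , v) h → cong (_, y * h , v ·V h) (solveH (β ∷ x ∷ y ∷ h ∷ []) [] (V 1 :* V 3 :- V 0 :* (V 2 :* V 3)) ((V 1 :- V 0 :* V 2) :* V 3) refl) }
  ; to-from = λ { (x , y , v) → cong (_, y , v) (solveH (β ∷ x ∷ y ∷ []) [] ((V 1 :- V 0 :* V 2) :+ V 0 :* V 2) (V 1) refl) }
  ; from-to = λ { (x , y , v) → cong (_, y , v) (solveH (β ∷ x ∷ y ∷ []) [] ((V 1 :+ V 0 :* V 2) :- V 0 :* V 2) (V 1) refl) }
  ; to-∈ = f ; from-∈ = g }

 -- A section of X ⊕ O → B, (x , o) ↦ x + β o.
 section : ∀ {B X : H → Set} {N} β → NIdeal B N → IsIdeal X → (∀ {b} → B b → ∃[ x ] ∃[ o ] (X x × InO o × (b ≡ x + β * o))) →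
  ∃[ σ ] (∀ {b} → B b → InO (σ * b) × X (b + - (β * (σ * b))))
 section {B} {X} {N} β i xi cover = done (go (NIdeal.rep i))
  where
  Good : ℚ → H → Set
  Good q s = ∀ {b} → B b → ∃[ o ] ∃[ x ] (InO o × X x × (s * b ≡ ι N * o) × (ι q * b + - (β * (s * b)) ≡ ι N * x))
  go : ∀ {q} → NormSum B q → ∃[ s ] Good q s
  go (nil refl) = 0# , λ {b} hb → 0# , 0# , O-0 , i-0 xi , trans (zeroˡ b) (sym (zeroʳ (ι N))) ,
   trans (cong₂ (λ z w → z * b + - (β * w)) ι-0 (zeroˡ b)) (trans (solveH (β ∷ b ∷ []) [] (:0 :* V 1 :- V 0 :* :0) :0 refl) (sym (zeroʳ (ι N))))
  go (cons {q} c y ic hy s refl) = next (go s) (cover hy)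
   where
   next : ∃[ s ] Good q s → ∃[ x ] ∃[ o ] (X x × InO o × (y ≡ x + β * o)) → ∃[ s ] Good (q ℚ.+ c ℚ.* nrd y) s
   next (s , good) (x' , o' , hx' , io' , ey) = s + ι c * o' * conj y , λ {b} hb → step hb (good hb) (NIdeal.integral i hy hb)
    where
    step : ∀ {b} → B b → ∃[ o ] ∃[ x ] (InO o × X x × (s * b ≡ ι N * o) × (ι q * b + - (β * (s * b)) ≡ ι N * x)) → (conj y * b) /∈ N →
     ∃[ o ] ∃[ x ] (InO o × X x × ((s + ι c * o' * conj y) * b ≡ ι N * o) × (ι (q ℚ.+ c ℚ.* nrd y) * b + - (β * ((s + ι c * o' * conj y) * b)) ≡ ι N * x))
    step {b} hb (o , x , io , hx , e₁ , e₂) (quo w iw ew) = o + ι c * o' * w , x + x' * (ι c * w) ,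
      O-+ io (O-* (O-* (O-ι ic) io') iw) , i-+ xi hx (i-* xi hx' (O-* (O-ι ic) iw)) ,
      trans (solveH (s ∷ o' ∷ y ∷ b ∷ []) (c ∷ []) ((V 0 :+ S 0 :* V 1 :* :c V 2) :* V 3) (V 0 :* V 3 :+ S 0 :* V 1 :* (:c V 2 :* V 3)) refl)
       (trans (cong₂ (λ z w → z + ι c * o' * w) e₁ ew) (solveH (o ∷ o' ∷ w ∷ []) (N ∷ c ∷ []) (S 0 :* V 0 :+ S 1 :* V 1 :* (S 0 :* V 2)) (S 0 :* (V 0 :+ S 1 :* V 1 :* V 2)) refl)) ,
      (begin
       ι (q ℚ.+ c ℚ.* nrd y) * b + - (β * ((s + ι c * o' * conj y) * b))
        ≡⟨ cong (λ z → z * b + - (β * ((s + ι c * o' * conj y) * b))) (trans (ι-+ q _) (cong (ι q +_) (trans (ι-* c (nrd y)) (cong (ι c *_) (sym (*-conj y)))))) ⟩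
       (ι q + ι c * (y * conj y)) * b + - (β * ((s + ι c * o' * conj y) * b))
        ≡⟨ solveH (s ∷ o' ∷ y ∷ b ∷ β ∷ []) (q ∷ c ∷ []) ((S 0 :+ S 1 :* (V 2 :* :c V 2)) :* V 3 :- V 4 :* ((V 0 :+ S 1 :* V 1 :* :c V 2) :* V 3))
           ((S 0 :* V 3 :- V 4 :* (V 0 :* V 3)) :+ S 1 :* ((V 2 :- V 4 :* V 1) :* (:c V 2 :* V 3))) refl ⟩
       (ι q * b + - (β * (s * b))) + ι c * ((y + - (β * o')) * (conj y * b))
        ≡⟨ cong₂ (λ z u → z + ι c * u) e₂ (cong₂ _*_ (trans (cong (_+ - (β * o')) ey) (solveH (x' ∷ β ∷ o' ∷ []) [] ((V 0 :+ V 1 :* V 2) :- V 1 :* V 2) (V 0) refl)) ew) ⟩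
       ι N * x + ι c * (x' * (ι N * w))
        ≡⟨ solveH (x ∷ x' ∷ w ∷ []) (N ∷ c ∷ []) (S 0 :* V 0 :+ S 1 :* (V 1 :* (S 0 :* V 2))) (S 0 :* (V 0 :+ V 1 :* (S 1 :* V 2))) refl ⟩
       ι N * (x + x' * (ι c * w)) ∎)
     where open ≡-Reasoning
  N0 = N≢0 i
  r = proj₁ (inv N N0)
  rN : ∀ x → ι r * (ι N * x) ≡ x
  rN x = ι-undo {r} {N} (proj₂ (inv N N0)) x
  done : ∃[ s ] Good N s → ∃[ σ ] (∀ {b} → B b → InO (σ * b) × X (b + - (β * (σ * b))))
  done (s , good) = ι r * s , λ {b} hb → fin (good hb)
   where
   fin : ∀ {b} → ∃[ o ] ∃[ x ] (InO o × X x × (s * b ≡ ι N * o) × (ι N * b + - (β * (s * b)) ≡ ι N * x)) → InO (ι r * s * b) × X (b + - (β * (ι r * s * b)))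
   fin {b} (o , x , io , hx , e₁ , e₂) = subst InO (sym (trans (*-assoc _ _ _) (trans (cong (ι r *_) e₁) (rN o)))) io ,
    subst X (trans (sym (rN x)) (trans (cong (ι r *_) (sym e₂)) (trans
     (solveH (b ∷ β ∷ s ∷ []) (r ∷ N ∷ []) (S 0 :* (S 1 :* V 0 :- V 1 :* (V 2 :* V 0))) (S 0 :* (S 1 :* V 0) :- V 1 :* (S 0 :* V 2 :* V 0)) refl)
     (cong (_+ - (β * (ι r * s * b))) (rN b))))) hx

 -- Schanuel's lemma for B / X ≅ O / Q.
 schanuel : ∀ {n} {L : Tuple n → Set} {B X Q : H → Set} {N} β → NIdeal B N → IsIdeal X → B β → (∀ {x} → X x → B x) →
  (∀ {b} → B b → ∃[ x ] ∃[ o ] (X x × InO o × (b ≡ x + β * o))) →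
  (∀ {o} → Q o → InO o × X (β * o)) → (∀ {o} → InO o → X (β * o) → Q o) → LinIso (X ⊞ InO ⊞ L) (B ⊞ Q ⊞ L)
 schanuel {L = L} {B} {X} {Q} β i xi hβ X⊂B cover to-X from-X = build (section β i xi cover)
  where
  bi = NIdeal.ideal i
  build : ∃[ σ ] (∀ {b} → B b → InO (σ * b) × X (b + - (β * (σ * b)))) → LinIso (X ⊞ InO ⊞ L) (B ⊞ Q ⊞ L)
  build (σ , split) = iso-trans {M = P₁} (iso-shear β f₁ g₁) (iso-trans {M = P₂} (iso-swap' P₁) (iso-trans {M = P₃} (iso-shear (- σ) f₂ g₂) iso-swap))
   where
   P₁ P₂ P₃ : Tuple _ → Set
   P₁ (b , o , v) = B b × InO o × X (b + - (β * o)) × L v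
   P₂ (o , b , v) = P₁ (b , o , v)
   P₃ = Q ⊞ B ⊞ L
   iso-swap' : ∀ {n} (P : Tuple (suc (suc n)) → Set) → LinIso P (λ { (o , b , v) → P (b , o , v) })
   iso-swap' P = record
    { to = λ { (x , y , v) → y , x , v } ; from = λ { (x , y , v) → y , x , v }
    ; to-+ = λ _ _ → refl ; to-· = λ _ _ → refl ; from-+ = λ _ _ → refl ; from-· = λ _ _ → refl
    ; to-from = λ _ → refl ; from-to = λ _ → refl ; to-∈ = λ h → h ; from-∈ = λ h → h }
   f₁ : ∀ {x y v} → (X ⊞ InO ⊞ L) (x , y , v) → P₁ (x + β * y , y , v)
   f₁ {x} {o} (hx , io , hv) = i-+ bi (X⊂B hx) (i-* bi hβ io) , io , subst X (solveH (x ∷ β ∷ o ∷ []) [] (V 0) ((V 0 :+ V 1 :* V 2) :- V 1 :* V 2) refl) hx , hv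
   g₁ : ∀ {x y v} → P₁ (x , y , v) → (X ⊞ InO ⊞ L) (x + - (β * y) , y , v)
   g₁ (hb , io , hx , hv) = hx , io , hv
   f₂ : ∀ {x y v} → P₂ (x , y , v) → P₃ (x + - σ * y , y , v)
   f₂ {o} {b} (hb , io , hx , hv) = from-X (subst InO (solveH (σ ∷ o ∷ b ∷ []) [] (V 1 :+ (:- (V 0 :* V 2))) (V 1 :+ (:- V 0) :* V 2) refl) (O-+ io (O-neg (proj₁ (split hb)))))
     (subst X (solveH (β ∷ σ ∷ o ∷ b ∷ []) [] ((V 3 :- V 0 :* (V 1 :* V 3)) :- (V 3 :- V 0 :* V 2)) (V 0 :* (V 2 :+ (:- V 1) :* V 3)) refl) (i-- xi (proj₂ (split hb)) hx)) , hb , hv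
   g₂ : ∀ {x y v} → P₃ (x , y , v) → P₂ (x + - (- σ * y) , y , v)
   g₂ {q} {b} (hq , hb , hv) = hb , subst InO (solveH (σ ∷ q ∷ b ∷ []) [] (V 1 :+ V 0 :* V 2) (V 1 :- (:- V 0) :* V 2) refl) (O-+ (proj₁ (to-X hq)) (proj₁ (split hb))) ,
    subst X (solveH (β ∷ σ ∷ q ∷ b ∷ []) [] ((V 3 :- V 0 :* (V 1 :* V 3)) :- V 0 :* V 2) (V 3 :- V 0 :* (V 2 :- (:- V 1) :* V 3)) refl) (i-- xi (proj₂ (split hb)) (proj₂ (to-X hq))) , hv

 mem-1 : ∀ {x} → InO x → x /∈ 1ℚ
 mem-1 {x} h = quo x h (sym (trans (cong (_* x) ι-1) (*-identityˡ x)))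

 un-1 : ∀ {x} → x /∈ 1ℚ → InO x
 un-1 (quo o io e) = subst InO (sym (trans e (trans (cong (_* o) ι-1) (*-identityˡ o)))) io

 -- One step towards O in the tree of the prime p: I and I₁ are both of index p² in B,
 -- with isomorphic simple quotients B/I ≅ B/I₁ ≅ O/Q.
 module Neighbour {p N' : ℕ} (pr : Prime p) (N'>0 : 0 ℕ.< N') (gs : List H) (i : NIdeal (Span gs) 1ℚ)
  (NI⊂O : ∀ {x} → Span gs x → InO (ι (fromℕ p) * (ι (fromℕ N') * x))) (n∉I : ¬ Span gs (ι (fromℕ N'))) where
  open AtPrime pr

  I : H → Set
  I = Span gs

  Ii = Span-ideal gs

  n : ℚ
  n = fromℕ N'

  int-n : Int n
  int-n = int-ℕ N'

  n≢0 : ¬ (n ≡ 0ℚ)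
  n≢0 = pos≢0 N'>0

  ιn≢0 : ¬ (ι n ≡ 0#)
  ιn≢0 e = n≢0 (ι-injective (trans e (sym ι-0)))

  by-dual : ∀ {x} → (∀ {y} → I y → InO (conj y * x)) → I x
  by-dual f = dual-mem i (λ hy → mem-1 (f hy))

  Pn∈I : I (ι P * ι n)
  Pn∈I = by-dual λ {y} hy → subst InO (solveH (y ∷ []) (P ∷ n ∷ []) (:c (S 0 :* (S 1 :* V 0))) (:c V 0 :* (S 0 :* S 1)) refl) (O-conj (NI⊂O hy))

  bad-generator : ∃[ g ] (I g × ¬ InO (ι n * g))
  bad-generator = find (search gs)
   where
   search : ∀ hs → (∃[ g ] (g ∈ hs × ¬ InO (ι n * g))) ⊎ (∀ {g} → g ∈ hs → InO (ι n * g))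
   search [] = inj₂ λ ()
   search (g ∷ hs) with InO? (ι n * g) | search hs
   ... | no h | _ = inj₁ (g , here refl , h)
   ... | yes _ | inj₁ (g' , m , h) = inj₁ (g' , there m , h)
   ... | yes h | inj₂ k = inj₂ λ { (here refl) → h ; (there m) → k m }
   scaled : IsIdeal (λ x → InO (ι n * x))
   scaled = record
    { i-0 = subst InO (sym (zeroʳ (ι n))) O-0 ; i-+ = λ {x} {y} h k → subst InO (sym (distribˡ (ι n) x y)) (O-+ h k)
    ; i-* = λ {x} {o} h k → subst InO (*-assoc (ι n) x o) (O-* h k) }
   find : (∃[ g ] (g ∈ gs × ¬ InO (ι n * g))) ⊎ (∀ {g} → g ∈ gs → InO (ι n * g)) → ∃[ g ] (I g × ¬ InO (ι n * g))
   find (inj₁ (g , m , h)) = g , Span-∈ m , h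
   find (inj₂ h) = ⊥-elim (n∉I (by-dual λ {y} hy → subst InO (solveH (y ∷ []) (n ∷ []) (:c (S 0 :* V 0)) (:c V 0 :* S 0) refl) (O-conj (Span-least scaled gs h hy))))

  g₀ = proj₁ bad-generator
  g₀∈ = proj₁ (proj₂ bad-generator)
  g₀∉ = proj₂ (proj₂ bad-generator)

  qs bs is pbs : List H
  qs = map ((ι P * ι n) *_) gs ++ ι P ∷ []
  bs = gs ++ ι n ∷ []
  is = map (ι P *_) gs ++ ι n ∷ []
  pbs = map (ι P *_) bs

  single : ∀ {h x} → Span (h ∷ []) x → ∃[ o ] (InO o × (x ≡ h * o))
  single (o , _ , io , refl , e) = o , io , trans e (+-identityʳ _)

  q-form : ∀ {x} → Span qs x → ∃[ y ] ∃[ o ] (I y × InO o × (x ≡ (ι P * ι n) * y + ι P * o))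
  q-form hx with Span-split (map ((ι P * ι n) *_) gs) (ι P ∷ []) hx
  ... | y , z , hy , hz , refl with Span-unmap (ι P * ι n) gs hy | single hz
  ...   | y' , hy' , refl | o , io , refl = y' , o , hy' , io , refl

  b-form : ∀ {x} → Span bs x → ∃[ y ] ∃[ o ] (I y × InO o × (x ≡ y + ι n * o))
  b-form hx with Span-split gs (ι n ∷ []) hx
  ... | y , z , hy , hz , refl with single hz
  ...   | o , io , refl = y , o , hy , io , refl

  i-form : ∀ {x} → Span is x → ∃[ y ] ∃[ o ] (I y × InO o × (x ≡ ι P * y + ι n * o))
  i-form hx with Span-split (map (ι P *_) gs) (ι n ∷ []) hx
  ... | y , z , hy , hz , refl with Span-unmap (ι P) gs hy | single hz
  ...   | y' , hy' , refl | o , io , refl = y' , o , hy' , io , refl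

  q-in : ∀ {y o} → I y → InO o → Span qs ((ι P * ι n) * y + ι P * o)
  q-in hy io = i-+ (Span-ideal qs) (Span-++ˡ _ (ι P ∷ []) (Span-map (ι P * ι n) gs hy)) (i-* (Span-ideal qs) (Span-++ʳ (map ((ι P * ι n) *_) gs) _ (Span-∈ (here refl))) io)

  i-in : ∀ {y o} → I y → InO o → Span is (ι P * y + ι n * o)
  i-in hy io = i-+ (Span-ideal is) (Span-++ˡ _ (ι n ∷ []) (Span-map (ι P) gs hy)) (i-* (Span-ideal is) (Span-++ʳ (map (ι P *_) gs) _ (Span-∈ (here refl))) io)

  I⊂B : ∀ {x} → I x → Span bs x
  I⊂B = Span-++ˡ gs (ι n ∷ [])

  n∈B : Span bs (ι n)
  n∈B = Span-++ʳ gs (ι n ∷ []) (Span-∈ (here refl))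

  Q⊂O : ∀ {x} → Span qs x → InO x
  Q⊂O hx with q-form hx
  ... | y , o , hy , io , refl = O-+ (subst InO (sym (*-assoc _ _ _)) (NI⊂O hy)) (O-* (O-ι int-P) io)

  nQ⊂I : ∀ {x} → Span qs x → I (ι n * x)
  nQ⊂I hx with q-form hx
  ... | y , o , hy , io , refl = subst I (solveH (y ∷ o ∷ []) (P ∷ n ∷ []) (S 1 :* (S 0 :* (S 1 :* V 0)) :+ (S 0 :* S 1) :* V 1) (S 1 :* ((S 0 :* S 1) :* V 0 :+ S 0 :* V 1)) refl)
    (i-+ Ii (i-ι Ii int-n (i-ι Ii int-P (i-ι Ii int-n hy))) (i-* Ii Pn∈I io))

  P∈Q : Span qs (ι P)
  P∈Q = Span-++ʳ (map ((ι P * ι n) *_) gs) _ (Span-∈ (here refl))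

  1∉Q : ¬ Span qs 1#
  1∉Q h = n∉I (subst I (*-identityʳ (ι n)) (nQ⊂I h))

  q₀ : H
  q₀ = (ι P * ι n) * g₀ + ι P * 0#

  q₀∉ : ¬ (q₀ /∈ P)
  q₀∉ (quo o io e) = g₀∉ (subst InO (ι-cancel P≢0 (trans (sym e) (solveH (g₀ ∷ []) (P ∷ n ∷ []) ((S 0 :* S 1) :* V 0 :+ S 0 :* :0) (S 0 :* (S 1 :* V 0)) refl))) io)

  Qi : NIdeal (Span qs) P
  Qi = prime-norm Q⊂O P∈Q 1∉Q (q-in g₀∈ O-0) q₀∉

  abstract
   opaque-w : TraceZero (Span qs)
   opaque-w = trace-zero Qi Q⊂O (q-in g₀∈ O-0) q₀∉

  w = proj₁ opaque-w
  w∈ = proj₁ (proj₂ opaque-w)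
  w∉ = proj₁ (proj₂ (proj₂ opaque-w))
  w-tr = proj₂ (proj₂ (proj₂ opaque-w))

  abstract
   w-form : ∃[ y ] ∃[ o ] (I y × InO o × (w ≡ (ι P * ι n) * y + ι P * o))
   w-form = q-form w∈

  i₀ = proj₁ w-form
  o₀ = proj₁ (proj₂ w-form)
  i₀∈ = proj₁ (proj₂ (proj₂ w-form))
  o₀∈ = proj₁ (proj₂ (proj₂ (proj₂ w-form)))
  w≡ = proj₂ (proj₂ (proj₂ (proj₂ w-form)))

  pB-form : ∀ {x} → Span pbs x → ∃[ y ] ∃[ o ] (I y × InO o × (x ≡ ι P * (y + ι n * o)))
  pB-form hx with Span-unmap (ι P) bs hx
  ... | b , hb , refl with b-form hb
  ...   | y , o , hy , io , refl = y , o , hy , io , refl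

  pB⊂I : ∀ {x} → Span pbs x → I x
  pB⊂I hx with pB-form hx
  ... | y , o , hy , io , refl = subst I (solveH (y ∷ o ∷ []) (P ∷ n ∷ []) (S 0 :* V 0 :+ (S 0 :* S 1) :* V 1) (S 0 :* (V 0 :+ S 1 :* V 1)) refl) (i-+ Ii (i-ι Ii int-P hy) (i-* Ii Pn∈I io))

  pB⊂I₁ : ∀ {x} → Span pbs x → Span is x
  pB⊂I₁ hx with pB-form hx
  ... | y , o , hy , io , refl = subst (Span is) (solveH (y ∷ o ∷ []) (P ∷ n ∷ []) (S 0 :* V 0 :+ S 1 :* (S 0 :* V 1)) (S 0 :* (V 0 :+ S 1 :* V 1)) refl) (i-in hy (O-* (O-ι int-P) io))

  I₁⊂B : ∀ {x} → Span is x → Span bs x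
  I₁⊂B hx with i-form hx
  ... | y , o , hy , io , refl = i-+ (Span-ideal bs) (I⊂B (i-ι Ii int-P hy)) (i-* (Span-ideal bs) n∈B io)

  Bi-data : ∃[ ν ] (NIdeal (Span bs) ν × (P ℚ.* ν ≡ 1ℚ))
  Bi-data = go (ideal-norm bs (ι n , n∈B , ιn≢0))
   where
   go : ∃[ ν ] NIdeal (Span bs) ν → ∃[ ν ] (NIdeal (Span bs) ν × (P ℚ.* ν ≡ 1ℚ))
   go (ν , j) = pick (sub-norm i j I⊂B) (sub-norm pj i pB⊂I)
    where
    pj : NIdeal (Span pbs) (nrd (ι P) ℚ.* ν)
    pj = span-scale (ι P) ιP≢0 j
    pick : ν ∣ℚ 1ℚ → 1ℚ ∣ℚ (nrd (ι P) ℚ.* ν) → ∃[ ν ] (NIdeal (Span bs) ν × (P ℚ.* ν ≡ 1ℚ))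
    pick (mult k ik e) (mult l il e') = cases (prime²-divisor pr (subst Int (sym μ≡) il) (NIdeal.pos pj) (mult k ik PP≡))
     where
     μ = nrd (ι P) ℚ.* ν
     μ≡ : μ ≡ l
     μ≡ = trans e' (ℚ.*-identityˡ l)
     PP≡ : P ℚ.* P ≡ μ ℚ.* k
     PP≡ = trans (sym (nrd-ι P)) (trans (sym (ℚ.*-identityʳ (nrd (ι P)))) (trans (cong (nrd (ι P) ℚ.*_) e) (sym (ℚ.*-assoc (nrd (ι P)) ν k))))
     PPν : μ ≡ P ℚ.* (P ℚ.* ν)
     PPν = trans (cong (ℚ._* ν) (nrd-ι P)) (ℚ.*-assoc P P ν)
     cases : (μ ≡ 1ℚ) ⊎ ((μ ≡ P) ⊎ (μ ≡ P ℚ.* P)) → ∃[ ν ] (NIdeal (Span bs) ν × (P ℚ.* ν ≡ 1ℚ))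
     cases (inj₁ h) = ⊥-elim (contra (pB-form (equal-norm (nideal-≡ h pj) i pB⊂I g₀∈)))
      where
      contra : ∃[ y ] ∃[ o ] (I y × InO o × (g₀ ≡ ι P * (y + ι n * o))) → ⊥
      contra (y , o , hy , io , eg) = g₀∉ (subst InO (sym (trans (cong (ι n *_) eg) (solveH (y ∷ o ∷ []) (P ∷ n ∷ []) (S 1 :* (S 0 :* (V 0 :+ S 1 :* V 1))) (S 0 :* (S 1 :* V 0) :+ S 0 :* (S 1 :* (S 1 :* V 1))) refl)))
       (O-+ (NI⊂O hy) (O-* (O-ι int-P) (O-* (O-ι int-n) (O-* (O-ι int-n) io)))))
     cases (inj₂ (inj₁ h)) = ν , j , *-cancelˡ P P≢0 (trans (sym PPν) (trans h (sym (ℚ.*-identityʳ P))))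
     cases (inj₂ (inj₂ h)) = ⊥-elim (n∉I (equal-norm i (nideal-≡ ν≡1 j) I⊂B n∈B))
      where
      ν≡1 : ν ≡ 1ℚ
      ν≡1 = *-cancelˡ P P≢0 (trans (*-cancelˡ P P≢0 (trans (sym PPν) h)) (sym (ℚ.*-identityʳ P)))

  ν = proj₁ Bi-data
  Bi = proj₁ (proj₂ Bi-data)
  Pν = proj₂ (proj₂ Bi-data)

  pBi : NIdeal (Span pbs) P
  pBi = nideal-≡ (trans (cong (ℚ._* ν) (nrd-ι P)) (trans (ℚ.*-assoc P P ν) (trans (cong (P ℚ.*_) Pν) (ℚ.*-identityʳ P)))) (span-scale (ι P) ιP≢0 Bi)

  nI₁⊂O : ∀ {x} → Span is x → InO (ι n * x)
  nI₁⊂O hx with i-form hx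
  ... | y , o , hy , io , refl = subst InO (solveH (y ∷ o ∷ []) (P ∷ n ∷ []) (S 0 :* (S 1 :* V 0) :+ S 1 :* (S 1 :* V 1)) (S 1 :* (S 0 :* V 0 :+ S 1 :* V 1)) refl)
   (O-+ (NI⊂O hy) (O-* (O-ι int-n) (O-* (O-ι int-n) io)))

  I₁-integral : ∀ {x} → Span is x → InO (conj x * x)
  I₁-integral {x} hx with i-form hx
  ... | y , o , hy , io , refl = subst InO (solveH (y ∷ o ∷ []) (P ∷ n ∷ []) (S 0 :* (S 0 :* (:c V 0 :* V 0)) :+ :c V 1 :* (S 0 :* (S 1 :* V 0)) :+ :c (S 0 :* (S 1 :* V 0)) :* V 1 :+ S 1 :* (S 1 :* (:c V 1 :* V 1)))
    (:c (S 0 :* V 0 :+ S 1 :* V 1) :* (S 0 :* V 0 :+ S 1 :* V 1)) refl)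
   (O-+ (O-+ (O-+ (O-* (O-ι int-P) (O-* (O-ι int-P) (un-1 (NIdeal.integral i hy hy)))) (O-* (O-conj io) (NI⊂O hy))) (O-* (O-conj (NI⊂O hy)) io)) (O-* (O-ι int-n) (O-* (O-ι int-n) (O-* (O-conj io) io))))

  n∈I₁ : Span is (ι n)
  n∈I₁ = Span-++ʳ (map (ι P *_) gs) _ (Span-∈ (here refl))

  I₁i : NIdeal (Span is) 1ℚ
  I₁i = go (ideal-norm is (ι n , n∈I₁ , ιn≢0))
   where
   go : ∃[ μ ] NIdeal (Span is) μ → NIdeal (Span is) 1ℚ
   go (μ , j) = pick (sum-∣ {N = 1ℚ} (λ {x} hx → mult (nrd x) (O-int (subst InO (conj-*ˡ x) (I₁-integral hx))) (sym (ℚ.*-identityˡ (nrd x)))) (NIdeal.rep j)) (sub-norm pBi j pB⊂I₁)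
    where
    pick : 1ℚ ∣ℚ μ → μ ∣ℚ P → NIdeal (Span is) 1ℚ
    pick (mult k ik e) d = cases (prime-divisor pr (subst Int (sym (trans e (ℚ.*-identityˡ k))) ik) (NIdeal.pos j) d)
     where
     cases : (μ ≡ 1ℚ) ⊎ (μ ≡ P) → NIdeal (Span is) 1ℚ
     cases (inj₁ h) = nideal-≡ h j
     cases (inj₂ h) = ⊥-elim (n∉I (pB⊂I (equal-norm pBi (nideal-≡ h j) pB⊂I₁ n∈I₁)))

  i₀∈B : Span bs i₀
  i₀∈B = I⊂B i₀∈

  w-n : ∀ o → w * o ≡ ι P * (ι n * (i₀ * o) + o₀ * o)
  w-n o = trans (cong (_* o) w≡) (solveH (i₀ ∷ o₀ ∷ o ∷ []) (P ∷ n ∷ []) (((S 0 :* S 1) :* V 0 :+ S 0 :* V 1) :* V 2) (S 0 :* (S 1 :* (V 0 :* V 2) :+ V 1 :* V 2)) refl)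

  i₀-to : ∀ {o} → Span qs o → InO o × Span is (i₀ * o)
  i₀-to {o} hq = io , dual-mem I₁i (λ hx → mem-1 (kill hx))
   where
   io = Q⊂O hq
   n-i₀-o : InO (ι n * (i₀ * o))
   n-i₀-o = out (trace-kills Qi Q⊂O w∈ hq w-tr)
    where
    out : (w * o) /∈ P → InO (ι n * (i₀ * o))
    out (quo c ic e) = subst InO (trans (cong (_+ - (o₀ * o)) (ι-cancel P≢0 (trans (sym e) (w-n o)))) (solveH (ι n * (i₀ * o) ∷ o₀ * o ∷ []) [] ((V 0 :+ V 1) :- V 1) (V 0) refl)) (O-+ ic (O-neg (O-* o₀∈ io)))
   kill : ∀ {x} → Span is x → InO (conj x * (i₀ * o))
   kill hx with i-form hx
   ... | y , o' , hy , io' , refl = subst InO (solveH (y ∷ o' ∷ i₀ ∷ o ∷ []) (P ∷ n ∷ []) (S 0 :* (:c V 0 :* (V 2 :* V 3)) :+ :c V 1 :* (S 1 :* (V 2 :* V 3))) (:c (S 0 :* V 0 :+ S 1 :* V 1) :* (V 2 :* V 3)) refl)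
    (O-+ (O-* (O-ι int-P) (un-1 (NIdeal.integral i hy (i-* Ii i₀∈ io)))) (O-* (O-conj io') n-i₀-o))

  to-pO : ∀ {o} → InO o → Span is (i₀ * o) → (w * o) /∈ P
  to-pO {o} io h = quo _ (O-+ (nI₁⊂O h) (O-* o₀∈ io)) (w-n o)

  i₀-from : ∀ {o} → InO o → Span is (i₀ * o) → Span qs o
  i₀-from {o} io h = go (span? Qi o)
   where
   go : Dec (Span qs o) → Span qs o
   go (yes k) = k
   go (no k) = ⊥-elim (bad (simple Qi Q⊂O io k))
    where
    bad : ∃[ o' ] ∃[ q ] (InO o' × Span qs q × (1# ≡ o * o' + q)) → ⊥
    bad (o' , q , io' , hq , e) = w∉ (subst (_/∈ P) (trans (solveH (w ∷ o ∷ o' ∷ q ∷ []) [] ((V 0 :* V 1) :* V 2 :+ V 0 :* V 3) (V 0 :* (V 1 :* V 2 :+ V 3)) refl) (trans (cong (w *_) (sym e)) (*-identityʳ w)))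
     (i-+ (/∈-ideal P) (i-* (/∈-ideal P) (to-pO io h) io') (trace-kills Qi Q⊂O w∈ hq w-tr)))

  n-from : ∀ {o} → InO o → I (ι n * o) → Span qs o
  n-from {o} io h = go (span? Qi o)
   where
   go : Dec (Span qs o) → Span qs o
   go (yes k) = k
   go (no k) = ⊥-elim (bad (simple Qi Q⊂O io k))
    where
    bad : ∃[ o' ] ∃[ q ] (InO o' × Span qs q × (1# ≡ o * o' + q)) → ⊥
    bad (o' , q , io' , hq , e) = n∉I (subst I (trans (solveH (o ∷ o' ∷ q ∷ []) (n ∷ []) ((S 0 :* V 0) :* V 1 :+ S 0 :* V 2) (S 0 :* (V 0 :* V 1 :+ V 2)) refl) (trans (cong (ι n *_) (sym e)) (*-identityʳ (ι n))))
     (i-+ Ii (i-* Ii h io') (nQ⊂I hq)))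

  i₀∉I₁ : ¬ Span is i₀
  i₀∉I₁ h = w∉ (subst (_/∈ P) (*-identityʳ w) (to-pO O-1 (subst (Span is) (sym (*-identityʳ i₀)) h)))

  cover₁ : ∀ {b} → Span bs b → ∃[ x ] ∃[ o ] (Span is x × InO o × (b ≡ x + i₀ * o))
  cover₁ {b} hb = go (ideal-norm (i₀ ∷ is) (ι n , Span-++ʳ (i₀ ∷ []) is n∈I₁ , ιn≢0))
   where
   X⊂B : ∀ {x} → Span (i₀ ∷ is) x → Span bs x
   X⊂B (o , y , io , hy , refl) = i-+ (Span-ideal bs) (i-* (Span-ideal bs) i₀∈B io) (I₁⊂B hy)
   form : Span (i₀ ∷ is) b → ∃[ x ] ∃[ o ] (Span is x × InO o × (b ≡ x + i₀ * o))
   form (o , y , io , hy , e) = y , o , hy , io , trans e (+-comm _ _)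
   go : ∃[ ξ ] NIdeal (Span (i₀ ∷ is)) ξ → ∃[ x ] ∃[ o ] (Span is x × InO o × (b ≡ x + i₀ * o))
   go (ξ , j) = pick (sub-norm I₁i j (Span-++ʳ (i₀ ∷ []) is)) (sub-norm j Bi X⊂B)
    where
    pick : ξ ∣ℚ 1ℚ → ν ∣ℚ ξ → ∃[ x ] ∃[ o ] (Span is x × InO o × (b ≡ x + i₀ * o))
    pick (mult k ik e) (mult l il e') = cases (prime-divisor pr (subst Int (sym ζ≡) il) (*-pos (fromℕ-pos (prime>0 pr)) (NIdeal.pos j)) (mult k ik (trans (sym (ℚ.*-identityʳ P)) (trans (cong (P ℚ.*_) e) (sym (ℚ.*-assoc P ξ k))))))
     where
     ζ≡ : P ℚ.* ξ ≡ l
     ζ≡ = trans (cong (P ℚ.*_) e') (trans (sym (ℚ.*-assoc P ν l)) (trans (cong (ℚ._* l) Pν) (ℚ.*-identityˡ l)))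
     cases : (P ℚ.* ξ ≡ 1ℚ) ⊎ (P ℚ.* ξ ≡ P) → ∃[ x ] ∃[ o ] (Span is x × InO o × (b ≡ x + i₀ * o))
     cases (inj₁ h) = form (equal-norm (nideal-≡ (*-cancelˡ P P≢0 (trans h (sym Pν))) j) Bi X⊂B hb)
     cases (inj₂ h) = ⊥-elim (i₀∉I₁ (equal-norm I₁i (nideal-≡ (*-cancelˡ P P≢0 (trans h (sym (ℚ.*-identityʳ P)))) j) (Span-++ʳ (i₀ ∷ []) is) (Span-∈ (here refl))))

  neighbour : ∀ {m} {L : Tuple m → Set} → LinIso (I ⊞ InO ⊞ L) (Span is ⊞ InO ⊞ L)
  neighbour = iso-trans
   (schanuel (ι n) Bi Ii n∈B I⊂B b-form (λ hq → Q⊂O hq , nQ⊂I hq) n-from)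
   (iso-sym (schanuel i₀ Bi (Span-ideal is) i₀∈B I₁⊂B cover₁ i₀-to i₀-from))

 prime-divisor-of : ∀ N → 1 ℕ.< N → ∃[ p ] ∃[ m ] (Prime p × (N ≡ p ℕ.* m) × (0 ℕ.< m) × (m ℕ.< N))
 prime-divisor-of N N>1 = go (PrimeFactorisation.factors f) (PrimeFactorisation.isFactorisation f) (PrimeFactorisation.factorsPrime f)
  where
  f = factorise N {{ℕ.>-nonZero (ℕ.<-trans (s≤s z≤n) N>1)}}
  go : ∀ qs → N ≡ product qs → All Prime qs → ∃[ p ] ∃[ m ] (Prime p × (N ≡ p ℕ.* m) × (0 ℕ.< m) × (m ℕ.< N))
  go [] refl _ = ⊥-elim (ℕ.<-irrefl refl N>1)
  go (q ∷ qs) e (pr ∷ _) = q , product qs , pr , e , m>0 (product qs) e , subst (product qs ℕ.<_) (sym e)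
    (subst (product qs ℕ.<_) (ℕ.*-comm (product qs) q) (ℕ.m<m*n (product qs) q {{ℕ.>-nonZero (m>0 (product qs) e)}} (AtPrime.p>1 pr)))
   where
   m>0 : ∀ m → N ≡ q ℕ.* m → 0 ℕ.< m
   m>0 zero h = ⊥-elim (ℕ.<⇒≢ (ℕ.<-trans (s≤s z≤n) N>1) (sym (trans h (ℕ.*-zeroʳ q))))
   m>0 (suc m) h = s≤s z≤n

 norm-one-free : ∀ N → Acc ℕ._<_ N → 0 ℕ.< N → ∀ gs → NIdeal (Span gs) 1ℚ → (∀ {x} → Span gs x → InO (ι (fromℕ N) * x)) →
  ∀ {m} {L : Tuple m → Set} → LinIso (Span gs ⊞ InO ⊞ L) (InO ⊞ InO ⊞ L)
 norm-one-free (suc zero) _ _ gs i h = iso-id (λ { (a , b) → inc a , b }) (λ { (a , b) → all-in a , b })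
  where
  inc : ∀ {x} → Span gs x → InO x
  inc hx = subst InO (trans (cong (_* _) (trans (cong ι fromℕ-1) ι-1)) (*-identityˡ _)) (h hx)
  all-in : ∀ {x} → InO x → Span gs x
  all-in {x} hx = subst (Span gs) (trans (cong (_* x) ι-1) (*-identityˡ x)) (i-* (Span-ideal gs) (norm-mem i inc) hx)
 norm-one-free N@(suc (suc _)) (acc rec) _ gs i h {m} {L} = go (prime-divisor-of N (s≤s (s≤s z≤n)))
  where
  go : ∃[ p ] ∃[ m ] (Prime p × (N ≡ p ℕ.* m) × (0 ℕ.< m) × (m ℕ.< N)) → LinIso (Span gs ⊞ InO ⊞ L) (InO ⊞ InO ⊞ L)
  go (p , n , pr , e , n>0 , n<N) = decide (span? i (ι (fromℕ n)))
   where
   h' : ∀ {x} → Span gs x → InO (ι (fromℕ p) * (ι (fromℕ n) * x))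
   h' {x} hx = subst InO (trans (cong (λ z → ι z * x) (trans (cong fromℕ e) (fromℕ-* p n))) (trans (cong (_* x) (ι-* _ _)) (*-assoc _ _ _))) (h hx)
   decide : Dec (Span gs (ι (fromℕ n))) → LinIso (Span gs ⊞ InO ⊞ L) (InO ⊞ InO ⊞ L)
   decide (yes k) = norm-one-free n (rec n<N) n>0 gs i λ {x} hx →
    subst InO (solveH (x ∷ []) (fromℕ n ∷ []) (:c (:c V 0 :* S 0)) (S 0 :* V 0) refl) (O-conj (un-1 (NIdeal.integral i hx k)))
   decide (no k) = iso-trans (Nb.neighbour {L = L}) (norm-one-free n (rec n<N) n>0 Nb.is Nb.I₁i Nb.nI₁⊂O)
    where module Nb = Neighbour pr n>0 gs i h' k

 common-denominator : ∀ gs → ∃[ d ] ((0 ℕ.< d) × (∀ {x} → Span gs x → InO (ι (fromℕ d) * x)))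
 common-denominator [] = 1 , s≤s z≤n , λ { refl → subst InO (sym (zeroʳ _)) O-0 }
 common-denominator (g ∷ gs) with common-denominator gs | O-denominator g
 ... | d , d>0 , f | e , e>0 , h = d ℕ.* e , ℕ.*-mono-< d>0 e>0 , λ { (o , y , io , hy , refl) → subst InO
    (sym (trans (cong (_* (g * o + y)) (trans (cong ι (fromℕ-* d e)) (ι-* _ _))) (solveH (g ∷ o ∷ y ∷ []) (fromℕ d ∷ fromℕ e ∷ []) ((S 0 :* S 1) :* (V 0 :* V 1 :+ V 2)) (S 0 :* ((S 1 :* V 0) :* V 1) :+ S 1 :* (S 0 :* V 2)) refl)))
    (O-+ (O-* (O-ι (int-ℕ d)) (O-* h io)) (O-* (O-ι (int-ℕ e)) (f hy))) }

 -- nrd is onto the positive rationals, so I may be scaled to norm 1.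
 stably-free : ∀ {gs N} → NIdeal (Span gs) N → ∀ {m} {L : Tuple m → Set} → LinIso (Span gs ⊞ InO ⊞ L) (InO ⊞ InO ⊞ L)
 stably-free {gs} {N} i {m} {L} = go (nrd-surjective N (NIdeal.pos i))
  where
  r = proj₁ (inv N (N≢0 i))
  Nr = proj₂ (inv N (N≢0 i))
  go : ∃[ x ] (nrd x ≡ N) → LinIso (Span gs ⊞ InO ⊞ L) (InO ⊞ InO ⊞ L)
  go (x , e) = use (common-denominator hs)
   where
   α = ι r * conj x
   αx : α * x ≡ 1#
   αx = trans (*-assoc _ _ _) (trans (cong (ι r *_) (trans (conj-*ˡ x) (cong ι e))) (ι-product {r} {N} (trans (ℚ.*-comm r N) Nr)))
   xα : x * α ≡ 1#
   xα = trans (solveH (x ∷ []) (r ∷ []) (V 0 :* (S 0 :* :c V 0)) (S 0 :* (V 0 :* :c V 0)) refl) (trans (cong (ι r *_) (trans (*-conj x) (cong ι e))) (ι-product {r} {N} (trans (ℚ.*-comm r N) Nr)))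
   α≢0 : ¬ (α ≡ 0#)
   α≢0 z = 1≢0 (trans (sym αx) (trans (cong (_* x) z) (zeroˡ x)))
    where
    1≢0 : ¬ (1# ≡ 0#)
    1≢0 z = 1≢0ℚ (ι-injective (trans ι-1 (trans z (sym ι-0))))
   hs = map (α *_) gs
   nrd-α : nrd α ℚ.* N ≡ 1ℚ
   nrd-α = trans (cong (nrd α ℚ.*_) (sym e)) (trans (sym (nrd-* α x)) (trans (cong nrd αx) (ι-injective (trans (sym (*-conj 1#)) (trans (*-identityˡ _) (trans conj-1 (sym ι-1)))))))
   j : NIdeal (Span hs) 1ℚ
   j = nideal-≡ nrd-α (span-scale α α≢0 i)
   use : ∃[ d ] ((0 ℕ.< d) × (∀ {y} → Span hs y → InO (ι (fromℕ d) * y))) → LinIso (Span gs ⊞ InO ⊞ L) (InO ⊞ InO ⊞ L)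
   use (d , d>0 , h) = iso-trans (iso-scale α x αx xα (Span-map α gs) back) (norm-one-free d (<-wellFounded d) d>0 hs j h)
    where
    back : ∀ {y} → Span hs y → Span gs (x * y)
    back hy with Span-unmap α gs hy
    ... | y' , hy' , refl = subst (Span gs) (sym (trans (sym (*-assoc x α y')) (trans (cong (_* y') xα) (*-identityˡ y')))) hy'

 -- An element of I whose normalised norm is prime to q.
 prime-to : ∀ {I N q} → NIdeal I N → Prime q → ∃[ y ] ∃[ t ] (I y × Int t × (nrd y ≡ N ℚ.* t) × Coprime t (fromℕ q))
 prime-to {I} {N} {q} i pr = finish (go (NIdeal.rep i))
  where
  Found = ∃[ y ] ∃[ t ] (I y × Int t × (nrd y ≡ N ℚ.* t) × Coprime t (fromℕ q))
  go : ∀ {r} → NormSum I r → Found ⊎ (∃[ k ] (Dv q k × (r ≡ N ℚ.* k)))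
  go (nil refl) = inj₂ (0ℚ , dv 0ℚ int-0 (sym (ℚ.*-zeroʳ (fromℕ q))) , sym (ℚ.*-zeroʳ N))
  go (cons c x ic hx s refl) = add (go s) (norm-divides i hx)
   where
   add : ∀ {r} → Found ⊎ (∃[ k ] (Dv q k × (r ≡ N ℚ.* k))) → N ∣ℚ nrd x → Found ⊎ (∃[ k ] (Dv q k × (r ℚ.+ c ℚ.* nrd x ≡ N ℚ.* k)))
   add (inj₁ f) _ = inj₁ f
   add {r} (inj₂ (k , dk , ek)) (mult t it et) = pick (prime-dichotomy pr t it)
    where
    lem : ∀ N k c t → N ℚ.* k ℚ.+ c ℚ.* (N ℚ.* t) ≡ N ℚ.* (k ℚ.+ c ℚ.* t)
    lem = solve-∀ ℚ-ring
    pick : Dv q t ⊎ Coprime t (fromℕ q) → Found ⊎ (∃[ k ] (Dv q k × (r ℚ.+ c ℚ.* nrd x ≡ N ℚ.* k)))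
    pick (inj₁ d) = inj₂ (k ℚ.+ c ℚ.* t , dv-+ dk (dv-* ic d) , trans (cong₂ (λ a b → a ℚ.+ c ℚ.* b) ek et) (lem N k c t))
    pick (inj₂ co) = inj₁ (x , t , hx , it , et , co)
  finish : Found ⊎ (∃[ k ] (Dv q k × (N ≡ N ℚ.* k))) → Found
  finish (inj₁ f) = f
  finish (inj₂ (k , d , e)) = ⊥-elim (AtPrime.¬dv-1 pr (subst (Dv q) (sym (*-cancelˡ N (N≢0 i) (trans (ℚ.*-identityʳ N) e))) d))

 ideal-nonzero : ∀ {I N} → NIdeal I N → NonZeroIdeal I
 ideal-nonzero {I} {N} i = go (NIdeal.rep i) (λ e → N≢0 i e)
  where
  go : ∀ {r} → NormSum I r → ¬ (r ≡ 0ℚ) → NonZeroIdeal I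
  go (nil e) h = ⊥-elim (h e)
  go (cons {q} c x ic hx s refl) h = try (x ≟ 0#)
   where
   try : Dec (x ≡ 0#) → NonZeroIdeal I
   try (no k) = x , hx , k
   try (yes refl) = go s (λ e → h (trans (cong₂ (λ a b → a ℚ.+ c ℚ.* b) e nrd-0) (trans (ℚ.+-identityˡ _) (ℚ.*-zeroʳ c))))

 CoprimeElement : (H → Set) → ℚ → ℚ → Set
 CoprimeElement I N s = ∃[ j ] ∃[ t ] (I j × ¬ (j ≡ 0#) × Int t × (nrd j ≡ N ℚ.* t) × Coprime t s)

 coprime-element : ∀ {I N} → NIdeal I N → ∀ s → 0 ℕ.< s → CoprimeElement I N (fromℕ s)
 coprime-element {I} {N} i s s>0 = subst (λ n → CoprimeElement I N (fromℕ n)) (sym (PrimeFactorisation.isFactorisation f))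
   (go (PrimeFactorisation.factors f) (PrimeFactorisation.factorsPrime f))
  where
  f = factorise s {{ℕ.>-nonZero s>0}}
  ii = NIdeal.ideal i
  go : ∀ qs → All Prime qs → CoprimeElement I N (fromℕ (product qs))
  go [] [] = base (ideal-nonzero i)
   where
   base : NonZeroIdeal I → CoprimeElement I N (fromℕ 1)
   base (x , hx , x≢0) = use (norm-divides i hx)
    where
    use : N ∣ℚ nrd x → CoprimeElement I N (fromℕ 1)
    use (mult t it e) = x , t , hx , x≢0 , it , e , 0ℚ , 1ℚ , int-0 , int-1 ,
     trans (cong₂ ℚ._+_ (ℚ.*-zeroˡ t) (trans (ℚ.*-identityˡ (fromℕ 1)) fromℕ-1)) (ℚ.+-identityˡ 1ℚ)
  go (q ∷ qs) (pr ∷ prs) = step (go qs prs)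
   where
   S' = fromℕ (product qs)
   Q = fromℕ q
   QS : fromℕ (q ℕ.* product qs) ≡ Q ℚ.* S'
   QS = fromℕ-* q (product qs)
   step : CoprimeElement I N S' → CoprimeElement I N (fromℕ (q ℕ.* product qs))
   step (j , t , hj , j≢0 , it , ej , co@(u' , v' , iu' , iv' , e')) = pick (prime-dichotomy pr t it)
    where
    pick : Dv q t ⊎ Coprime t Q → CoprimeElement I N (fromℕ (q ℕ.* product qs))
    pick (inj₂ co') = j , t , hj , j≢0 , it , ej , subst (Coprime t) (sym QS)
     (coprime-sym (coprime-* (int-ℕ q) it (coprime-sym co') (coprime-sym co)))
    pick (inj₁ (dv k ik ek)) = new (prime-to i pr)
     where
     lem : ∀ v' s u' q k → v' ℚ.* s ℚ.+ u' ℚ.* k ℚ.* q ≡ u' ℚ.* (q ℚ.* k) ℚ.+ v' ℚ.* s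
     lem = solve-∀ ℚ-ring
     SQ : Coprime S' Q
     SQ = v' , u' ℚ.* k , iv' , int-* iu' ik , trans (lem v' S' u' Q k) (trans (cong (λ z → u' ℚ.* z ℚ.+ v' ℚ.* S') (sym ek)) e')
     new : ∃[ y ] ∃[ t ] (I y × Int t × (nrd y ≡ N ℚ.* t) × Coprime t Q) → CoprimeElement I N (fromℕ (q ℕ.* product qs))
     new (y , r , hy , ir , ey , cr) = out (norm-divides i hsum) (norm-divides i (i-+ ii (i-ι ii (int-ℕ _) hy) (i-ι ii (int-ℕ q) hj)))
      where
      hsum : I (y + j)
      hsum = i-+ ii hy hj
      w = ι S' * y + ι Q * j
      nrd-w : nrd w ≡ (S' ℚ.* S') ℚ.* nrd y ℚ.+ (Q ℚ.* Q) ℚ.* nrd j ℚ.+ (S' ℚ.* Q) ℚ.* polar y j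
      nrd-w = ι-injective (begin
       ι (nrd w)                 ≡⟨ sym (conj-*ˡ w) ⟩
       conj w * w                ≡⟨ solveH (y ∷ j ∷ []) (S' ∷ Q ∷ []) (:c (S 0 :* V 0 :+ S 1 :* V 1) :* (S 0 :* V 0 :+ S 1 :* V 1))
                       ((S 0 :* S 0) :* (:c V 0 :* V 0) :+ (S 1 :* S 1) :* (:c V 1 :* V 1) :+ (S 0 :* S 1) :* (:c V 0 :* V 1 :+ :c V 1 :* V 0)) refl ⟩
       (ι S' * ι S') * (conj y * y) + (ι Q * ι Q) * (conj j * j) + (ι S' * ι Q) * (conj y * j + conj j * y)
                    ≡⟨ cong₂ (λ a b → a + (ι S' * ι Q) * b) (cong₂ (λ a b → (ι S' * ι S') * a + (ι Q * ι Q) * b) (conj-*ˡ y) (conj-*ˡ j))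
                       (trans (cong (_+ conj j * y) (polarˡ y j)) (solveH (y ∷ j ∷ []) (polar y j ∷ []) ((S 0 :- :c V 1 :* V 0) :+ :c V 1 :* V 0) (S 0) refl)) ⟩
       (ι S' * ι S') * ι (nrd y) + (ι Q * ι Q) * ι (nrd j) + (ι S' * ι Q) * ι (polar y j)
                    ≡⟨ sym (trans (ι-+ _ _) (cong₂ _+_ (trans (ι-+ _ _) (cong₂ _+_ (trans (ι-* _ _) (cong (_* ι (nrd y)) (ι-* S' S'))) (trans (ι-* _ _) (cong (_* ι (nrd j)) (ι-* Q Q)))))
                       (trans (ι-* _ _) (cong (_* ι (polar y j)) (ι-* S' Q))))) ⟩
       ι ((S' ℚ.* S') ℚ.* nrd y ℚ.+ (Q ℚ.* Q) ℚ.* nrd j ℚ.+ (S' ℚ.* Q) ℚ.* polar y j) ∎)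
       where open ≡-Reasoning
      out : N ∣ℚ nrd (y + j) → N ∣ℚ nrd w → CoprimeElement I N (fromℕ (q ℕ.* product qs))
      out (mult z iz ez) (mult T iT eT) = w , T , i-+ ii (i-ι ii (int-ℕ _) hy) (i-ι ii (int-ℕ q) hj) , w≢0 , iT , eT , coT
       where
       c = z ℚ.- r ℚ.- t
       ic : Int c
       ic = int-- (int-- iz ir) it
       lem₂ : ∀ N S Q r t z → (S ℚ.* S) ℚ.* (N ℚ.* r) ℚ.+ (Q ℚ.* Q) ℚ.* (N ℚ.* t) ℚ.+ (S ℚ.* Q) ℚ.* (N ℚ.* z ℚ.- N ℚ.* r ℚ.- N ℚ.* t) ≡
        N ℚ.* ((S ℚ.* S) ℚ.* r ℚ.+ (Q ℚ.* Q) ℚ.* t ℚ.+ (S ℚ.* Q) ℚ.* (z ℚ.- r ℚ.- t))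
       lem₂ = solve-∀ ℚ-ring
       T≡ : T ≡ (S' ℚ.* S') ℚ.* r ℚ.+ (Q ℚ.* Q) ℚ.* t ℚ.+ (S' ℚ.* Q) ℚ.* c
       T≡ = *-cancelˡ N (N≢0 i) (trans (sym eT) (trans nrd-w (trans (cong₂ ℚ._+_ (cong₂ (λ a b → (S' ℚ.* S') ℚ.* a ℚ.+ (Q ℚ.* Q) ℚ.* b) ey ej)
        (cong ((S' ℚ.* Q) ℚ.*_) (cong₂ ℚ._-_ (cong₂ ℚ._-_ ez ey) ej))) (lem₂ N S' Q r t z))))
       lem₃ : ∀ S Q r t c → (S ℚ.* S) ℚ.* r ℚ.+ (Q ℚ.* t ℚ.+ S ℚ.* c) ℚ.* Q ≡ (S ℚ.* S) ℚ.* r ℚ.+ (Q ℚ.* Q) ℚ.* t ℚ.+ (S ℚ.* Q) ℚ.* c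
       lem₃ = solve-∀ ℚ-ring
       lem₄ : ∀ S Q r t c → (Q ℚ.* Q) ℚ.* t ℚ.+ (S ℚ.* r ℚ.+ Q ℚ.* c) ℚ.* S ≡ (S ℚ.* S) ℚ.* r ℚ.+ (Q ℚ.* Q) ℚ.* t ℚ.+ (S ℚ.* Q) ℚ.* c
       lem₄ = solve-∀ ℚ-ring
       iQ = int-ℕ q
       iS = int-ℕ (product qs)
       TQ : Coprime T Q
       TQ = subst (λ z → Coprime z Q) (trans (lem₃ S' Q r t c) (sym T≡)) (coprime-+ (int-+ (int-* iQ it) (int-* iS ic))
        (coprime-* (int-* iS iS) iQ (coprime-* iS iQ SQ SQ) cr))
       TS : Coprime T S'
       TS = subst (λ z → Coprime z S') (trans (lem₄ S' Q r t c) (sym T≡)) (coprime-+ (int-+ (int-* iS ir) (int-* iQ ic))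
        (coprime-* (int-* iQ iQ) iS (coprime-* iQ iS (coprime-sym SQ) (coprime-sym SQ)) co))
       coT : Coprime T (fromℕ (q ℕ.* product qs))
       coT = subst (Coprime T) (sym QS) (coprime-sym (coprime-* iQ iT (coprime-sym TQ) (coprime-sym TS)))
       w≢0 : ¬ (w ≡ 0#)
       w≢0 e = zero-T (*-cancelˡ N (N≢0 i) (trans (sym eT) (trans (cong nrd e) (trans nrd-0 (sym (ℚ.*-zeroʳ N)))))) TQ
        where
        zero-T : T ≡ 0ℚ → Coprime T Q → ⊥
        zero-T T0 (a , b , ia , ib , e) = AtPrime.¬dv-1 pr (subst (Dv q) (trans (sym (trans (cong (ℚ._+ b ℚ.* Q) (trans (cong (a ℚ.*_) T0) (ℚ.*-zeroʳ a))) (ℚ.+-identityˡ _))) e) (dv-self {q} ib))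

 iso-rescale : ∀ {gs N n} {L : Tuple n → Set} → (i : NIdeal (Span gs) N) → ∀ x → Span gs x → ¬ (x ≡ 0#) →
  ∃[ α ] (NIdeal (Span (map (α *_) gs)) (nrd α ℚ.* N) × (∀ {y} → Span (map (α *_) gs) y → InO y) × LinIso (Span gs ⊞ L) (Span (map (α *_) gs) ⊞ L) × (nrd α ℚ.* N ℚ.* N ≡ nrd x))
 iso-rescale {gs} {N} i x hx x≢0 = α , span-scale α α≢0 i , sub , iso-scale α α' αα' α'α (Span-map α gs) back , norm≡
  where
  r = proj₁ (inv N (N≢0 i))
  Nr = proj₂ (inv N (N≢0 i))
  s = proj₁ (inv (nrd x) (<⇒≢0 (nrd-pos x x≢0)))
  xs = proj₂ (inv (nrd x) (<⇒≢0 (nrd-pos x x≢0)))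
  α = ι r * conj x
  α' = ι N * (x * ι s)
  one : ι r * ι N * (ι (nrd x) * ι s) ≡ 1#
  one = trans (cong₂ _*_ (ι-product {r} {N} (trans (ℚ.*-comm r N) Nr)) (ι-product {nrd x} {s} xs)) (*-identityˡ 1#)
  αα' : α * α' ≡ 1#
  αα' = trans (solveH (x ∷ []) (r ∷ N ∷ s ∷ []) ((S 0 :* :c V 0) :* (S 1 :* (V 0 :* S 2))) (S 0 :* S 1 :* ((:c V 0 :* V 0) :* S 2)) refl)
   (trans (cong (λ z → ι r * ι N * (z * ι s)) (conj-*ˡ x)) one)
  α'α : α' * α ≡ 1#
  α'α = trans (solveH (x ∷ []) (r ∷ N ∷ s ∷ []) ((S 1 :* (V 0 :* S 2)) :* (S 0 :* :c V 0)) (S 0 :* S 1 :* ((V 0 :* :c V 0) :* S 2)) refl)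
   (trans (cong (λ z → ι r * ι N * (z * ι s)) (*-conj x)) one)
  α≢0 : ¬ (α ≡ 0#)
  α≢0 e = x≢0 (trans (sym (*-identityʳ x)) (trans (cong (x *_) (trans (sym αα') (trans (cong (_* α') e) (zeroˡ α')))) (zeroʳ x)))
  back : ∀ {y} → Span (map (α *_) gs) y → Span gs (α' * y)
  back hy with Span-unmap α gs hy
  ... | y' , hy' , refl = subst (Span gs) (sym (trans (sym (*-assoc α' α y')) (trans (cong (_* y') α'α) (*-identityˡ y')))) hy'
  sub : ∀ {y} → Span (map (α *_) gs) y → InO y
  sub hy with Span-unmap α gs hy
  ... | y' , hy' , refl = out (NIdeal.integral i hx hy')
   where
   out : (conj x * y') /∈ N → InO (α * y')
   out (quo o io e) = subst InO (sym (trans (*-assoc _ _ _) (trans (cong (ι r *_) e) (ι-undo {r} {N} Nr o)))) io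
  norm≡ : nrd α ℚ.* N ℚ.* N ≡ nrd x
  norm≡ = trans (cong (λ z → z ℚ.* N ℚ.* N) (trans (nrd-* (ι r) (conj x)) (cong₂ ℚ._*_ (nrd-ι r) (nrd-conj x))))
   (trans (lem r N (nrd x)) (trans (cong (λ z → (z ℚ.* z) ℚ.* nrd x) Nr) (trans (cong (ℚ._* nrd x) (ℚ.*-identityˡ 1ℚ)) (ℚ.*-identityˡ (nrd x)))))
   where
   lem : ∀ r N x → r ℚ.* r ℚ.* x ℚ.* N ℚ.* N ≡ ((N ℚ.* r) ℚ.* (N ℚ.* r)) ℚ.* x
   lem = solve-∀ ℚ-ring

 -- A ⊕ B ≅ (A ∩ B) ⊕ O for integral ideals with A + B = O.
 coprime-sum : ∀ {as bs s t n} {L : Tuple n → Set} → NIdeal (Span as) s → NIdeal (Span bs) t →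
  (∀ {x} → Span as x → InO x) → (∀ {x} → Span bs x → InO x) → Coprime s t →
  ∃[ ks ] (NonZeroIdeal (Span ks) × LinIso (Span as ⊞ Span bs ⊞ L) (Span ks ⊞ InO ⊞ L))
 coprime-sum {as} {bs} {s} {t} {L = L} i j A⊂O B⊂O (u , v , iu , iv , e) = ks , nonzero ,
   iso-trans iso-swap (iso-trans (iso-shear 1# f₁ g₁) (iso-trans (swap' M₁) (iso-shear (- (ι u * ι s)) f₂ g₂)))
  where
  A = Span as
  B = Span bs
  Ai = Span-ideal as
  Bi = Span-ideal bs
  is = norm-int i A⊂O
  it = norm-int j B⊂O
  ks = map (ι t *_) as ++ map (ι s *_) bs
  K = Span ks
  s∈A : A (ι s)
  s∈A = norm-mem i A⊂O
  t∈B : B (ι t)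
  t∈B = norm-mem j B⊂O
  one : ι u * ι s + ι v * ι t ≡ 1#
  one = trans (cong₂ _+_ (sym (ι-* u s)) (sym (ι-* v t))) (trans (sym (ι-+ _ _)) (trans (cong ι e) ι-1))
  k-in : ∀ {a b} → A a → B b → K (ι t * a + ι s * b)
  k-in ha hb = i-+ (Span-ideal ks) (Span-++ˡ _ _ (Span-map (ι t) as ha)) (Span-++ʳ (map (ι t *_) as) _ (Span-map (ι s) bs hb))
  k-form : ∀ {x} → K x → ∃[ a ] ∃[ b ] (A a × B b × (x ≡ ι t * a + ι s * b))
  k-form hx with Span-split (map (ι t *_) as) (map (ι s *_) bs) hx
  ... | y , z , hy , hz , refl with Span-unmap (ι t) as hy | Span-unmap (ι s) bs hz
  ...   | a , ha , refl | b , hb , refl = a , b , ha , hb , refl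
  K⊂A : ∀ {x} → K x → A x
  K⊂A hx with k-form hx
  ... | a , b , ha , hb , refl = i-+ Ai (i-ι Ai it ha) (i-* Ai s∈A (B⊂O hb))
  K⊂B : ∀ {x} → K x → B x
  K⊂B hx with k-form hx
  ... | a , b , ha , hb , refl = i-+ Bi (i-* Bi t∈B (A⊂O ha)) (i-ι Bi is hb)
  A∩B⊂K : ∀ {x} → A x → B x → K x
  A∩B⊂K {x} ha hb = subst K (trans (solveH (x ∷ []) (u ∷ s ∷ v ∷ t ∷ []) (S 3 :* (S 2 :* V 0) :+ S 1 :* (S 0 :* V 0)) ((S 0 :* S 1 :+ S 2 :* S 3) :* V 0) refl) (trans (cong (_* x) one) (*-identityˡ x)))
   (k-in (i-ι Ai iv ha) (i-ι Bi iu hb))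
  nonzero : NonZeroIdeal K
  nonzero = ι t * ι s , subst K (trans (cong (ι t * ι s +_) (zeroʳ (ι s))) (+-identityʳ _)) (k-in s∈A (i-0 Bi)) ,
   λ z → st≢0 (ι-injective (trans (ι-* t s) (trans z (sym ι-0))))
   where
   st≢0 : ¬ (t ℚ.* s ≡ 0ℚ)
   st≢0 z with *-zero {t} {s} z
   ... | inj₁ q = N≢0 j q
   ... | inj₂ q = N≢0 i q
  M₁ M₂ : Tuple _ → Set
  M₁ (o , a , l) = InO o × A a × B (o + - a) × L l
  M₂ (a , o , l) = M₁ (o , a , l)
  swap' : ∀ {n} (P : Tuple (suc (suc n)) → Set) → LinIso P (λ { (o , b , l) → P (b , o , l) })
  swap' P = record
   { to = λ { (x , y , l) → y , x , l } ; from = λ { (x , y , l) → y , x , l }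
   ; to-+ = λ _ _ → refl ; to-· = λ _ _ → refl ; from-+ = λ _ _ → refl ; from-· = λ _ _ → refl
   ; to-from = λ _ → refl ; from-to = λ _ → refl ; to-∈ = λ h → h ; from-∈ = λ h → h }
  f₁ : ∀ {x y l} → (B ⊞ A ⊞ L) (x , y , l) → M₁ (x + 1# * y , y , l)
  f₁ {b} {a} (hb , ha , hl) = O-+ (B⊂O hb) (O-* O-1 (A⊂O ha)) , ha , subst B (solveH (b ∷ a ∷ []) [] (V 0) ((V 0 :+ :1 :* V 1) :- V 1) refl) hb , hl
  g₁ : ∀ {x y l} → M₁ (x , y , l) → (B ⊞ A ⊞ L) (x + - (1# * y) , y , l)
  g₁ {o} {a} (io , ha , hb , hl) = subst B (cong (λ z → o + - z) (sym (*-identityˡ a))) hb , ha , hl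
  f₂ : ∀ {x y l} → M₂ (x , y , l) → (K ⊞ InO ⊞ L) (x + - (ι u * ι s) * y , y , l)
  f₂ {a} {o} (io , ha , hb , hl) = A∩B⊂K inA inB , io , hl
   where
   inA : A (a + - (ι u * ι s) * o)
   inA = subst A (solveH (a ∷ o ∷ []) (u ∷ s ∷ []) (V 0 :- S 0 :* (S 1 :* V 1)) (V 0 :+ (:- (S 0 :* S 1)) :* V 1) refl) (i-- Ai ha (i-ι Ai iu (i-* Ai s∈A io)))
   inB : B (a + - (ι u * ι s) * o)
   inB = subst B (trans (solveH (a ∷ o ∷ []) (u ∷ s ∷ v ∷ t ∷ []) (S 2 :* (S 3 :* V 1) :- (V 1 :- V 0)) ((V 0 :+ (:- (S 0 :* S 1)) :* V 1) :- (V 1 :- (S 0 :* S 1 :+ S 2 :* S 3) :* V 1)) refl)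
     (trans (cong (λ z → (a + - (ι u * ι s) * o) + - (o + - (z * o))) one) (solveH (a + - (ι u * ι s) * o ∷ o ∷ []) [] (V 0 :- (V 1 :- :1 :* V 1)) (V 0) refl)))
    (i-- Bi (i-ι Bi iv (i-* Bi t∈B io)) hb)
  g₂ : ∀ {x y l} → (K ⊞ InO ⊞ L) (x , y , l) → M₂ (x + - (- (ι u * ι s) * y) , y , l)
  g₂ {c} {o} (hc , io , hl) = io , inA , inB , hl
   where
   inA : A (c + - (- (ι u * ι s) * o))
   inA = subst A (solveH (c ∷ o ∷ []) (u ∷ s ∷ []) (V 0 :+ S 0 :* (S 1 :* V 1)) (V 0 :- (:- (S 0 :* S 1)) :* V 1) refl) (i-+ Ai (K⊂A hc) (i-ι Ai iu (i-* Ai s∈A io)))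
   inB : B (o + - (c + - (- (ι u * ι s) * o)))
   inB = subst B (trans (solveH (c ∷ o ∷ []) (u ∷ s ∷ v ∷ t ∷ []) (S 2 :* (S 3 :* V 1) :- V 0) (((S 0 :* S 1 :+ S 2 :* S 3) :* V 1) :- (V 0 :- (:- (S 0 :* S 1)) :* V 1)) refl)
     (cong (λ z → z + - (c + - (- (ι u * ι s) * o))) (trans (cong (_* o) one) (*-identityˡ o))))
    (i-- Bi (i-ι Bi iv (i-* Bi t∈B io)) (K⊂B hc))

 steinitz : ∀ {gs hs n} {L : Tuple n → Set} → NonZeroIdeal (Span gs) → NonZeroIdeal (Span hs) →
  ∃[ ks ] (NonZeroIdeal (Span ks) × LinIso (Span gs ⊞ Span hs ⊞ L) (Span ks ⊞ InO ⊞ L))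
 steinitz {gs} {hs} {n} {L} nz nz' = go (ideal-norm gs nz) (ideal-norm hs nz')
  where
  Goal = ∃[ ks ] (NonZeroIdeal (Span ks) × LinIso (Span gs ⊞ Span hs ⊞ L) (Span ks ⊞ InO ⊞ L))
  go : ∃[ M ] NIdeal (Span gs) M → ∃[ N ] NIdeal (Span hs) N → Goal
  go (M , i) (N , j) = first (iso-rescale {L = Span hs ⊞ L} i (proj₁ nz) (proj₁ (proj₂ nz)) (proj₂ (proj₂ nz)))
   where
   first : ∃[ α ] (NIdeal (Span (map (α *_) gs)) (nrd α ℚ.* M) × (∀ {y} → Span (map (α *_) gs) y → InO y) × LinIso (Span gs ⊞ Span hs ⊞ L) (Span (map (α *_) gs) ⊞ Span hs ⊞ L) × (nrd α ℚ.* M ℚ.* M ≡ nrd (proj₁ nz))) → Goal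
   first (α , ai , A⊂O , isoA , _) = second (natural (norm-int ai A⊂O) (NIdeal.pos ai))
    where
    second : ∃[ s ] ((0 ℕ.< s) × (nrd α ℚ.* M ≡ fromℕ s)) → Goal
    second (s , s>0 , es) = third (coprime-element j s s>0)
     where
     third : CoprimeElement (Span hs) N (fromℕ s) → Goal
     third (x , t , hx , x≢0 , it , ex , co) = fourth (iso-rescale {L = L} j x hx x≢0)
      where
      fourth : ∃[ β ] (NIdeal (Span (map (β *_) hs)) (nrd β ℚ.* N) × (∀ {y} → Span (map (β *_) hs) y → InO y) × LinIso (Span hs ⊞ L) (Span (map (β *_) hs) ⊞ L) × (nrd β ℚ.* N ℚ.* N ≡ nrd x)) → Goal
      fourth (β , bi , B⊂O , isoB , eβ) = fifth (coprime-sum {L = L} ai bi A⊂O B⊂O (subst₂ Coprime (sym es) (sym t≡) (coprime-sym co)))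
       where
       t≡ : nrd β ℚ.* N ≡ t
       t≡ = *-cancelˡ N (N≢0 j) (trans (ℚ.*-comm N (nrd β ℚ.* N)) (trans eβ ex))
       fifth : ∃[ ks ] (NonZeroIdeal (Span ks) × LinIso (Span (map (α *_) gs) ⊞ Span (map (β *_) hs) ⊞ L) (Span ks ⊞ InO ⊞ L)) → Goal
       fifth (ks , knz , iso) = ks , knz , iso-trans isoA (iso-trans (iso-cons isoB) iso)

 0V : ∀ {n} → Tuple n
 0V {zero} = tt
 0V {suc n} = 0# , 0V

 SpanV : ∀ {n} → List (Tuple n) → Tuple n → Set
 SpanV [] v = v ≡ 0V
 SpanV (l ∷ ls) v = ∃[ o ] ∃[ w ] (InO o × SpanV ls w × (v ≡ l ·V o +V w))

 Full : ∀ {n} → List (Tuple n) → Set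
 Full ls = ∀ v → ∃[ d ] ((0 ℕ.< d) × SpanV ls (v ·V ι (fromℕ d)))

 Free : ∀ n → Tuple n → Set
 Free zero _ = ⊤
 Free (suc n) = InO ⊞ Free n

 +V-identityʳ : ∀ {n} (v : Tuple n) → v +V 0V ≡ v
 +V-identityʳ {zero} _ = refl
 +V-identityʳ {suc n} (x , v) = cong₂ _,_ (+-identityʳ x) (+V-identityʳ v)

 0-·V : ∀ {n} (v : Tuple n) → v ·V 0# ≡ 0V
 0-·V {zero} _ = refl
 0-·V {suc n} (x , v) = cong₂ _,_ (zeroʳ x) (0-·V v)

 0V-· : ∀ {n} h → 0V {n} ·V h ≡ 0V
 0V-· {zero} h = refl
 0V-· {suc n} h = cong₂ _,_ (zeroˡ h) (0V-· h)

 combine-+ : ∀ {n} (l v w : Tuple n) o p → (l ·V o +V v) +V (l ·V p +V w) ≡ l ·V (o + p) +V (v +V w)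
 combine-+ {zero} _ _ _ o p = refl
 combine-+ {suc n} (l , ls) (v , vs) (w , ws) o p = cong₂ _,_
  (solveH (l ∷ v ∷ w ∷ o ∷ p ∷ []) [] ((V 0 :* V 3 :+ V 1) :+ (V 0 :* V 4 :+ V 2)) (V 0 :* (V 3 :+ V 4) :+ (V 1 :+ V 2)) refl) (combine-+ ls vs ws o p)

 combine-· : ∀ {n} (l v : Tuple n) o p → (l ·V o +V v) ·V p ≡ l ·V (o * p) +V v ·V p
 combine-· {zero} _ _ o p = refl
 combine-· {suc n} (l , ls) (v , vs) o p = cong₂ _,_
  (solveH (l ∷ v ∷ o ∷ p ∷ []) [] ((V 0 :* V 2 :+ V 1) :* V 3) (V 0 :* (V 2 :* V 3) :+ V 1 :* V 3) refl) (combine-· ls vs o p)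

 SpanV-0 : ∀ {n} (ls : List (Tuple n)) → SpanV ls 0V
 SpanV-0 [] = refl
 SpanV-0 (l ∷ ls) = 0# , 0V , O-0 , SpanV-0 ls , sym (trans (+V-identityʳ _) (0-·V l))

 SpanV-+ : ∀ {n} (ls : List (Tuple n)) {v w} → SpanV ls v → SpanV ls w → SpanV ls (v +V w)
 SpanV-+ [] refl refl = +V-identityʳ 0V
 SpanV-+ (l ∷ ls) (o , v , io , hv , refl) (p , w , ip , hw , refl) = o + p , v +V w , O-+ io ip , SpanV-+ ls hv hw , combine-+ l v w o p

 SpanV-· : ∀ {n} (ls : List (Tuple n)) {v p} → SpanV ls v → InO p → SpanV ls (v ·V p)
 SpanV-· [] {p = p} refl ip = 0V-· p
 SpanV-· (l ∷ ls) {p = p} (o , v , io , hv , refl) ip = o * p , v ·V p , O-* io ip , SpanV-· ls hv ip , combine-· l v o p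

 SpanV-proj : ∀ {n} (ls : List (Tuple (suc n))) {x v} → SpanV ls (x , v) → Span (map proj₁ ls) x
 SpanV-proj [] refl = refl
 SpanV-proj (l ∷ ls) (o , (y , w) , io , hw , refl) = o , y , io , SpanV-proj ls hw , refl

 SpanV-lift : ∀ {n} (ls : List (Tuple (suc n))) {x} → Span (map proj₁ ls) x → ∃[ v ] SpanV ls (x , v)
 SpanV-lift [] refl = 0V , refl
 SpanV-lift ((l₁ , l₂) ∷ ls) (o , y , io , hy , refl) with SpanV-lift ls hy
 ... | w , hw = l₂ ·V o +V w , o , (y , w) , io , hw , refl

 projection-nonzero : ∀ {n} (ls : List (Tuple (suc n))) → Full ls → NonZeroIdeal (Span (map proj₁ ls))
 projection-nonzero ls full = go (full (1# , 0V))
  where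
  go : ∃[ d ] ((0 ℕ.< d) × SpanV ls ((1# , 0V) ·V ι (fromℕ d))) → NonZeroIdeal (Span (map proj₁ ls))
  go (d , d>0 , h) = 1# * ι (fromℕ d) , SpanV-proj ls h , λ e → pos≢0 d>0 (ι-injective (trans (sym (*-identityˡ _)) (trans e (sym ι-0))))

 -- A norm representation N = Σ cₖ nrd xₖ with xₖ ∈ I splits the projection of L onto its ideal I of first
 -- coordinates: for lifts (xₖ , wₖ) ∈ L put U = N⁻¹ Σ cₖ wₖ x̄ₖ.
 projection-section : ∀ {n} (ls : List (Tuple (suc n))) {N} → NIdeal (Span (map proj₁ ls)) N → ∃[ U ] (∀ {x} → Span (map proj₁ ls) x → SpanV ls (x , U ·V x))
 projection-section {n} ls {N} i = done (go (NIdeal.rep i))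
  where
  I = Span (map proj₁ ls)
  r = proj₁ (inv N (N≢0 i))
  Nr : N ℚ.* r ≡ 1ℚ
  Nr = proj₂ (inv N (N≢0 i))
  Good : ℚ → Tuple n → Set
  Good q U = ∀ {x} → I x → SpanV ls (ι r * ι q * x , U ·V x)
  add : ∀ {m} (U w : Tuple m) c y x → U ·V x +V w ·V (ι c * (ι r * (conj y * x))) ≡ (U +V w ·V (ι c * ι r * conj y)) ·V x
  add {zero} _ _ c y x = refl
  add {suc m} (U , Us) (w , ws) c y x = cong₂ _,_
   (solveH (U ∷ w ∷ y ∷ x ∷ []) (c ∷ r ∷ []) (V 0 :* V 3 :+ V 1 :* (S 0 :* (S 1 :* (:c V 2 :* V 3)))) ((V 0 :+ V 1 :* (S 0 :* S 1 :* :c V 2)) :* V 3) refl) (add Us ws c y x)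
  0V-0 : ∀ {m} (x : H) → 0V {m} ≡ 0V {m} ·V x
  0V-0 x = sym (0V-· x)
  go : ∀ {q} → NormSum I q → ∃[ U ] Good q U
  go (nil refl) = 0V , λ {x} _ → subst (SpanV ls) (cong₂ _,_ (sym (trans (cong (λ z → ι r * z * x) ι-0) (trans (cong (_* x) (zeroʳ (ι r))) (zeroˡ x)))) (0V-0 x)) (SpanV-0 ls)
  go (cons {q} c y ic hy s refl) = next (go s) (SpanV-lift ls hy)
   where
   next : ∃[ U ] Good q U → ∃[ w ] SpanV ls (y , w) → ∃[ U ] Good (q ℚ.+ c ℚ.* nrd y) U
   next (U , good) (w , hw) = U +V w ·V (ι c * ι r * conj y) , λ {x} hx → step hx (NIdeal.integral i hy hx)
    where
    step : ∀ {x} → I x → (conj y * x) /∈ N → SpanV ls (ι r * ι (q ℚ.+ c ℚ.* nrd y) * x , (U +V w ·V (ι c * ι r * conj y)) ·V x)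
    step {x} hx (quo o io e) = subst (SpanV ls) (cong₂ _,_ first (add U w c y x)) (SpanV-+ ls (good hx) (SpanV-· ls hw (O-* (O-ι ic) io')))
     where
     io' : InO (ι r * (conj y * x))
     io' = subst InO (sym (trans (cong (ι r *_) e) (ι-undo {r} {N} Nr o))) io
     first : ι r * ι q * x + y * (ι c * (ι r * (conj y * x))) ≡ ι r * ι (q ℚ.+ c ℚ.* nrd y) * x
     first = trans (solveH (x ∷ y ∷ []) (r ∷ q ∷ c ∷ []) (S 0 :* S 1 :* V 0 :+ V 1 :* (S 2 :* (S 0 :* (:c V 1 :* V 0)))) (S 0 :* (S 1 :+ S 2 :* (V 1 :* :c V 1)) :* V 0) refl)
      (cong (λ z → ι r * z * x) (sym (trans (ι-+ q _) (cong (ι q +_) (trans (ι-* c (nrd y)) (cong (ι c *_) (sym (*-conj y))))))))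
  done : ∃[ U ] Good N U → ∃[ U ] (∀ {x} → I x → SpanV ls (x , U ·V x))
  done (U , good) = U , λ {x} hx → subst (λ z → SpanV ls (z , U ·V x)) (trans (cong (_* x) (ι-product {r} {N} (trans (ℚ.*-comm r N) Nr))) (*-identityˡ x)) (good hx)

 module Transvection {n} (ls : List (Tuple (suc n))) (U : Tuple n) (section : ∀ {x} → Span (map proj₁ ls) x → SpanV ls (x , U ·V x)) where
  shear : Tuple (suc n) → Tuple n
  shear (x , v) = v +V U ·V (- x)

  complement : List (Tuple n)
  complement = map shear ls

  sum-up : ∀ {m} (U l v : Tuple m) l₁ o y → (l ·V o +V v) +V U ·V (- (l₁ * o + y)) ≡ (l +V U ·V (- l₁)) ·V o +V (v +V U ·V (- y))
  sum-up {zero} _ _ _ l₁ o y = refl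
  sum-up {suc m} (U , Us) (l , ls) (v , vs) l₁ o y = cong₂ _,_
   (solveH (U ∷ l ∷ v ∷ l₁ ∷ o ∷ y ∷ []) [] ((V 1 :* V 4 :+ V 2) :+ V 0 :* (:- (V 3 :* V 4 :+ V 5))) ((V 1 :+ V 0 :* (:- V 3)) :* V 4 :+ (V 2 :+ V 0 :* (:- V 5))) refl)
   (sum-up Us ls vs l₁ o y)

  sub : ∀ ls' {x v} → SpanV ls' (x , v) → SpanV (map shear ls') (v +V U ·V (- x))
  sub [] refl = trans (cong (λ z → 0V +V U ·V z) (trans (cong -_ (sym (zeroˡ 0#))) (solveH [] [] (:- (:0 :* :0)) :0 refl))) (trans (cong (0V +V_) (0-·V U)) (+V-identityʳ 0V))
  sub ((l₁ , l₂) ∷ ls') (o , (y , w) , io , hw , refl) = o , w +V U ·V (- y) , io , sub ls' hw , sum-up U l₂ w l₁ o y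

  cancel : ∀ {m} (U v : Tuple m) x → (v +V U ·V (- x)) +V U ·V x ≡ v
  cancel {zero} _ _ x = refl
  cancel {suc m} (U , Us) (v , vs) x = cong₂ _,_ (solveH (U ∷ v ∷ x ∷ []) [] ((V 1 :+ V 0 :* (:- V 2)) :+ V 0 :* V 2) (V 1) refl) (cancel Us vs x)

  cancel' : ∀ {m} (U v : Tuple m) x → (v +V U ·V x) +V U ·V (- x) ≡ v
  cancel' {zero} _ _ x = refl
  cancel' {suc m} (U , Us) (v , vs) x = cong₂ _,_ (solveH (U ∷ v ∷ x ∷ []) [] ((V 1 :+ V 0 :* V 2) :+ V 0 :* (:- V 2)) (V 1) refl) (cancel' Us vs x)

  add-shift : ∀ {m} (U v w : Tuple m) x y → (v +V w) +V U ·V (x + y) ≡ (v +V U ·V x) +V (w +V U ·V y)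
  add-shift {zero} _ _ _ x y = refl
  add-shift {suc m} (U , Us) (v , vs) (w , ws) x y = cong₂ _,_
   (solveH (U ∷ v ∷ w ∷ x ∷ y ∷ []) [] ((V 1 :+ V 2) :+ V 0 :* (V 3 :+ V 4)) ((V 1 :+ V 0 :* V 3) :+ (V 2 :+ V 0 :* V 4)) refl) (add-shift Us vs ws x y)

  mul-shift : ∀ {m} (U v : Tuple m) x h → v ·V h +V U ·V (x * h) ≡ (v +V U ·V x) ·V h
  mul-shift {zero} _ _ x h = refl
  mul-shift {suc m} (U , Us) (v , vs) x h = cong₂ _,_ (solveH (U ∷ v ∷ x ∷ h ∷ []) [] (V 1 :* V 3 :+ V 0 :* (V 2 :* V 3)) ((V 1 :+ V 0 :* V 2) :* V 3) refl) (mul-shift Us vs x h)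

  neg-+ : ∀ x y → - (x + y) ≡ - x + - y
  neg-+ x y = solveH (x ∷ y ∷ []) [] (:- (V 0 :+ V 1)) ((:- V 0) :+ (:- V 1)) refl

  neg-* : ∀ x h → - (x * h) ≡ - x * h
  neg-* x h = solveH (x ∷ h ∷ []) [] (:- (V 0 :* V 1)) ((:- V 0) :* V 1) refl

  first-zero : ∀ {x v} → Span (map proj₁ ls) x → SpanV ls (x , v) → SpanV ls (0# , v +V U ·V (- x))
  first-zero {x} {v} hx hv = subst (λ z → SpanV ls (z , v +V U ·V (- x))) (-‿inverseʳ x) (SpanV-+ ls hv (section (i-neg (Span-ideal (map proj₁ ls)) hx)))

  SpanV-head : ∀ {m} (l : Tuple m) ls' → SpanV (l ∷ ls') l
  SpanV-head l ls' = 1# , 0V , O-1 , SpanV-0 ls' , sym (trans (+V-identityʳ _) (one l))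
   where
   one : ∀ {m} (l : Tuple m) → l ·V 1# ≡ l
   one {zero} _ = refl
   one {suc m} (x , l) = cong₂ _,_ (*-identityʳ x) (one l)

  SpanV-tail : ∀ {m} (l : Tuple m) ls' {v} → SpanV ls' v → SpanV (l ∷ ls') v
  SpanV-tail l ls' {v} hv = 0# , v , O-0 , hv , sym (trans (cong (_+V v) (0-·V l)) (zero-+ v))
   where
   zero-+ : ∀ {m} (v : Tuple m) → 0V +V v ≡ v
   zero-+ {zero} _ = refl
   zero-+ {suc m} (x , v) = cong₂ _,_ (+-identityˡ x) (zero-+ v)

  sup : ∀ ls' → (∀ {v} → SpanV ls' v → SpanV ls v) → ∀ {v} → SpanV (map shear ls') v → SpanV ls (0# , v)
  sup [] inc refl = SpanV-0 ls
  sup ((l₁ , l₂) ∷ ls') inc (o , w , io , hw , refl) = subst (λ z → SpanV ls (z , (l₂ +V U ·V (- l₁)) ·V o +V w)) (trans (cong (_+ 0#) (zeroˡ o)) (+-identityʳ 0#))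
   (SpanV-+ ls (SpanV-· ls (first-zero (SpanV-proj ls hl) hl) io) (sup ls' (λ hv → inc (SpanV-tail (l₁ , l₂) ls' hv)) hw))
   where hl = inc (SpanV-head (l₁ , l₂) ls')

  iso : LinIso (SpanV ls) (Span (map proj₁ ls) ⊞ SpanV complement)
  iso = record
   { to = λ { (x , v) → x , v +V U ·V (- x) } ; from = λ { (x , v) → x , v +V U ·V x }
   ; to-+ = λ { (x , v) (y , w) → cong (x + y ,_) (trans (cong (λ z → (v +V w) +V U ·V z) (neg-+ x y)) (add-shift U v w (- x) (- y))) }
   ; to-· = λ { (x , v) h → cong (x * h ,_) (trans (cong (λ z → v ·V h +V U ·V z) (neg-* x h)) (mul-shift U v (- x) h)) }
   ; from-+ = λ { (x , v) (y , w) → cong (x + y ,_) (add-shift U v w x y) } ; from-· = λ { (x , v) h → cong (x * h ,_) (mul-shift U v x h) }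
   ; to-from = λ { (x , v) → cong (x ,_) (cancel' U v x) } ; from-to = λ { (x , v) → cong (x ,_) (cancel U v x) }
   ; to-∈ = λ h → SpanV-proj ls h , sub ls h
   ; from-∈ = λ { {x , v} (hx , hv) → subst (SpanV ls) (cong₂ _,_ (+-identityˡ x) refl) (SpanV-+ ls (sup ls (λ h → h) hv) (section hx)) } }

  complement-full : Full ls → Full complement
  complement-full full v = go (full (0# , v))
   where
   go : ∃[ d ] ((0 ℕ.< d) × SpanV ls ((0# , v) ·V ι (fromℕ d))) → ∃[ d ] ((0 ℕ.< d) × SpanV complement (v ·V ι (fromℕ d)))
   go (d , d>0 , h) = d , d>0 , subst (SpanV complement) (trans (cong (λ z → v ·V ι (fromℕ d) +V U ·V z) (solveH (ι (fromℕ d) ∷ []) [] (:- (:0 :* V 0)) :0 refl))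
    (trans (cong (v ·V ι (fromℕ d) +V_) (0-·V U)) (+V-identityʳ _))) (sub ls h)

 IdealPlusFree : ∀ n → List (Tuple (suc n)) → Set
 IdealPlusFree n ls = ∃[ ks ] (NonZeroIdeal (Span ks) × LinIso (SpanV ls) (Span ks ⊞ Free n))

 ideal⊞free : ∀ n (ls : List (Tuple (suc n))) → Full ls → IdealPlusFree n ls
 ideal⊞free n ls full = go (ideal-norm gs nz)
  where
  gs = map proj₁ ls
  nz = projection-nonzero ls full
  go : ∃[ N ] NIdeal (Span gs) N → IdealPlusFree n ls
  go (N , i) = split (projection-section ls i)
   where
   split : ∃[ U ] (∀ {x} → Span gs x → SpanV ls (x , U ·V x)) → IdealPlusFree n ls
   split (U , sec) = rest n ls nz (Transvection.complement ls U sec) (Transvection.iso ls U sec) (Transvection.complement-full ls U sec full)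
    where
    rest : ∀ n (ls : List (Tuple (suc n))) → NonZeroIdeal (Span (map proj₁ ls)) → ∀ cs → LinIso (SpanV ls) (Span (map proj₁ ls) ⊞ SpanV cs) → Full cs →
     IdealPlusFree n ls
    rest zero ls nz cs iso _ = map proj₁ ls , nz , iso-trans iso (iso-cons (iso-id (λ _ → tt) (λ _ → SpanV-0 cs)))
    rest (suc m) ls nz cs iso full' = again (ideal⊞free m cs full')
     where
     again : IdealPlusFree m cs → IdealPlusFree (suc m) ls
     again (hs , nz' , iso') = last (steinitz {L = Free m} nz nz')
      where
      last : ∃[ ks ] (NonZeroIdeal (Span ks) × LinIso (Span (map proj₁ ls) ⊞ Span hs ⊞ Free m) (Span ks ⊞ InO ⊞ Free m)) → IdealPlusFree (suc m) ls
      last (ks , nz″ , iso″) = ks , nz″ , iso-trans iso (iso-trans (iso-cons iso') iso″)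

 full⇒free : ∀ n (ls : List (Tuple (suc (suc n)))) → Full ls → LinIso (SpanV ls) (Free (suc (suc n)))
 full⇒free n ls full = go (ideal⊞free (suc n) ls full)
  where
  go : IdealPlusFree (suc n) ls → LinIso (SpanV ls) (Free (suc (suc n)))
  go (ks , nz , iso) = iso-trans iso (stably-free (proj₂ (ideal-norm ks nz)) {L = Free n})

 module Cholesky
  (Σ : ∀ {n} → (Fin n → H) → H)
  (Σ-nil : ∀ (f : Fin zero → H) → Σ f ≡ 0#)
  (Σ-suc : ∀ {n} (f : Fin (suc n) → H) → Σ f ≡ (f zero + Σ (f ∘ suc)))
  (re : H → ℚ) (fixed⇒rational : ∀ {x} → conj x ≡ x → x ≡ ι (re x)) where
  open StarMatrix isRing Σ Σ-nil Σ-suc conj conj-+ conj-* conj-0 conj-1 public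

  Hermitian : ∀ {n} → Mat n → Set
  Hermitian M = (M †) ≈ M

  Positive : ∀ {n} → Mat n → Set
  Positive M = ∀ x → ¬ (∀ i → x i ≡ 0#) → 0ℚ ℚ.< re (form x (M ▹ x))

  prepend : ∀ {n} → H → (Fin n → H) → Fin (suc n) → H
  prepend c v zero = c
  prepend c v (suc i) = v i

  1≢0 : ¬ (1# ≡ 0#)
  1≢0 e = 1≢0ℚ (ι-injective (trans ι-1 (trans e (sym ι-0))))

  module Schur {n} (M : Mat (suc n)) (herm : Hermitian M) (pos : Positive M) where
   h : H
   h = M zero zero
   p : ℚ
   p = re h
   r : Fin n → H
   r j = M zero (suc j)

   h≡p : h ≡ ι p
   h≡p = fixed⇒rational (herm zero zero)

   p>0 : 0ℚ ℚ.< p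
   p>0 = subst (λ z → 0ℚ ℚ.< re z) value (pos e λ z → 1≢0 (z zero))
    where
    e : Fin (suc n) → H
    e = prepend 1# (λ _ → 0#)
    top : (M ▹ e) zero ≡ h
    top = trans (Σ-suc (λ k → M zero k * e k)) (trans (cong₂ _+_ (*-identityʳ h) (Σ-zero (λ i → zeroʳ (r i)))) (+-identityʳ h))
    value : form e (M ▹ e) ≡ h
    value = trans (Σ-suc (λ k → conj (e k) * (M ▹ e) k)) (trans (cong₂ _+_ (trans (cong₂ _*_ conj-1 top) (*-identityˡ h))
     (Σ-zero (λ i → trans (cong (_* (M ▹ e) (suc i)) conj-0) (zeroˡ ((M ▹ e) (suc i)))))) (+-identityʳ h))

   q : ℚ
   q = proj₁ (inv p (<⇒≢0 p>0))
   pq : ι p * ι q ≡ 1#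
   pq = ι-product {p} {q} (proj₂ (inv p (<⇒≢0 p>0)))

   complement : Mat n
   complement i j = M (suc i) (suc j) + - (conj (r i) * (ι q * r j))

   complement-hermitian : Hermitian complement
   complement-hermitian i j = trans (solveH (M (suc j) (suc i) ∷ r j ∷ r i ∷ []) (q ∷ []) (:c (V 0 :- :c V 1 :* (S 0 :* V 2))) (:c V 0 :- :c V 2 :* (S 0 :* V 1)) refl)
    (cong (_+ - (conj (r i) * (ι q * r j))) (herm (suc i) (suc j)))

   complement-positive : Positive complement
   complement-positive v v≢0 = subst (λ z → 0ℚ ℚ.< re z) value (pos w λ z → v≢0 (z ∘ suc))
    where
    t = Σ (λ j → r j * v j)
    w : Fin (suc n) → H
    w = prepend (- (ι q * t)) v
    top : (M ▹ w) zero ≡ 0#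
    top = trans (Σ-suc (λ k → M zero k * w k)) (trans (cong (λ z → z * - (ι q * t) + t) h≡p) (trans (solveH (t ∷ []) (p ∷ q ∷ []) (S 0 :* (:- (S 1 :* V 0)) :+ V 0) (V 0 :- (S 0 :* S 1) :* V 0) refl)
     (trans (cong (λ z → t + - (z * t)) pq) (trans (cong (λ z → t + - z) (*-identityˡ t)) (-‿inverseʳ t)))))
    rest : ∀ i → (M ▹ w) (suc i) ≡ (complement ▹ v) i
    rest i = trans (Σ-suc (λ k → M (suc i) k * w k)) (trans (cong (λ z → z * - (ι q * t) + s) (sym (herm (suc i) zero)))
      (trans (solveH (r i ∷ t ∷ s ∷ []) (q ∷ []) (:c V 0 :* (:- (S 0 :* V 1)) :+ V 2) (V 2 :+ (:- (:c V 0 :* S 0)) :* V 1) refl)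
       (sym (trans (Σ-cong (λ j → solveH (M (suc i) (suc j) ∷ r i ∷ r j ∷ v j ∷ []) (q ∷ []) ((V 0 :- :c V 1 :* (S 0 :* V 2)) :* V 3) (V 0 :* V 3 :+ (:- (:c V 1 :* S 0)) :* (V 2 :* V 3)) refl))
        (trans (Σ-+ (λ j → M (suc i) (suc j) * v j) (λ j → - (conj (r i) * ι q) * (r j * v j))) (cong (s +_) (Σ-*ˡ (- (conj (r i) * ι q)) (λ j → r j * v j))))))))
     where s = Σ (λ j → M (suc i) (suc j) * v j)
    value : form w (M ▹ w) ≡ form v (complement ▹ v)
    value = trans (Σ-suc (λ k → conj (w k) * (M ▹ w) k)) (trans (cong₂ _+_ (trans (cong (conj (w zero) *_) top) (zeroʳ (conj (w zero)))) (Σ-cong (λ i → cong (conj (v i) *_) (rest i)))) (+-identityˡ _))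

   extend : (N : Mat n) → ((N †) ⊠ N) ≈ complement → (x : H) → nrd x ≡ p → ∃ λ (L : Mat (suc n)) → ((L †) ⊠ L) ≈ M
   extend N gram x nx = L , check
    where
    L : Mat (suc n)
    L zero zero = x
    L zero (suc j) = x * (ι q * r j)
    L (suc i) zero = 0#
    L (suc i) (suc j) = N i j
    cx : conj x * x ≡ h
    cx = trans (conj-*ˡ x) (trans (cong ι nx) (sym h≡p))
    cxq : ∀ j → conj x * (x * (ι q * r j)) ≡ r j
    cxq j = trans (sym (*-assoc (conj x) x _)) (trans (cong (_* (ι q * r j)) (trans cx h≡p)) (trans (sym (*-assoc (ι p) (ι q) (r j))) (trans (cong (_* r j) pq) (*-identityˡ (r j)))))
    split : ∀ i j → ((L †) ⊠ L) i j ≡ conj (L zero i) * L zero j + Σ (λ k → conj (L (suc k) i) * L (suc k) j)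
    split i j = Σ-suc (λ k → conj (L k i) * L k j)
    zero-row : ∀ (f : Fin n → H) → Σ (λ k → conj 0# * f k) ≡ 0#
    zero-row f = Σ-zero (λ k → trans (cong (_* f k) conj-0) (zeroˡ (f k)))
    check : ((L †) ⊠ L) ≈ M
    check zero zero = trans (split zero zero) (trans (cong₂ _+_ cx (zero-row (λ _ → 0#))) (+-identityʳ h))
    check zero (suc j) = trans (split zero (suc j)) (trans (cong₂ _+_ (cxq j) (zero-row (λ k → N k j))) (+-identityʳ (r j)))
    check (suc i) zero = trans (split (suc i) zero) (trans (cong₂ _+_ (trans (solveH (x ∷ ι q * r i ∷ []) [] (:c (V 0 :* V 1) :* V 0) (:c (:c V 0 :* (V 0 :* V 1))) refl) (cong conj (cxq i)))
     (Σ-zero (λ k → zeroʳ (conj (N k i))))) (trans (+-identityʳ (conj (r i))) (herm (suc i) zero)))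
    check (suc i) (suc j) = trans (split (suc i) (suc j)) (trans (cong₂ _+_ (trans (solveH (x ∷ r i ∷ x * (ι q * r j) ∷ []) (q ∷ []) (:c (V 0 :* (S 0 :* V 1)) :* V 2) (:c V 1 :* (S 0 :* (:c V 0 :* V 2))) refl)
      (cong (λ z → conj (r i) * (ι q * z)) (cxq j))) (gram i j))
     (solveH (conj (r i) * (ι q * r j) ∷ M (suc i) (suc j) ∷ []) [] (V 0 :+ (V 1 :- V 0)) (V 1) refl))

  cholesky : ∀ n (M : Mat n) → Hermitian M → Positive M → ∃ λ (L : Mat n) → ((L †) ⊠ L) ≈ M
  cholesky zero M herm pos = (λ ()) , λ ()
  cholesky (suc n) M herm pos = go (cholesky n complement complement-hermitian complement-positive) (nrd-surjective p p>0)
   where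
   open Schur M herm pos
   go : (∃ λ (N : Mat n) → ((N †) ⊠ N) ≈ complement) → ∃[ x ] (nrd x ≡ p) → ∃ λ (L : Mat (suc n)) → ((L †) ⊠ L) ≈ M
   go (N , gram) (x , nx) = extend N gram x nx

module Definite (a b : ℚ) (a<0 : a ℚ.< 0ℚ) (b<0 : b ℚ.< 0ℚ) where
 import Data.Fin.Properties as Fin
 open import Data.Rational using (_+_; _*_; -_; _-_; _<_; _≤_; _≟_)
 open StarRingSolver
 open RationalAlgebra
 open RationalVectors
 open Quaternion a b public
 open Alg a b public

 private
  nn : ∀ {c} → c < 0ℚ → ∀ x → 0ℚ ≤ (- c) * (x * x)
  nn h x = *-nonneg (neg-pos h) (square-nonneg x)

  cancel-square : ∀ {c} → 0ℚ < c → ∀ x → c * (x * x) ≡ 0ℚ → x ≡ 0ℚ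
  cancel-square {c} c>0 x h = case-sq (case-c (*-zero {c} {x * x} h))
   where
   case-c : (c ≡ 0ℚ) ⊎ (x * x ≡ 0ℚ) → x * x ≡ 0ℚ
   case-c (inj₁ e) = ⊥-elim (<⇒≢0 c>0 e)
   case-c (inj₂ e) = e
   case-sq : x * x ≡ 0ℚ → x ≡ 0ℚ
   case-sq e with *-zero {x} {x} e
   ... | inj₁ r = r
   ... | inj₂ r = r

 binary : ∀ c → c < 0ℚ → ∀ x y → x * x - c * (y * y) ≡ 0ℚ → (x ≡ 0ℚ) × (y ≡ 0ℚ)
 binary c c<0 x y h = sq (proj₁ both) , cancel-square (neg-pos c<0) y (proj₂ both)
  where
  lem : ∀ c x y → x * x - c * (y * y) ≡ x * x + (- c) * (y * y)
  lem = solve-∀ ℚ-ring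
  both = +-nonneg-zero (square-nonneg x) (nn c<0 y) (trans (sym (lem c x y)) h)
  sq : x * x ≡ 0ℚ → x ≡ 0ℚ
  sq e = cancel-square {1ℚ} (ℚ.positive⁻¹ 1ℚ) x (trans (ℚ.*-identityˡ (x * x)) e)

 nrd-split : ∀ x → nrd x ≡ (re x * re x + (- a) * (ci x * ci x)) + ((- b) * (cj x * cj x) + ((- a) * (- b)) * (ck x * ck x))
 nrd-split ⟨ p , q , r , s ⟩ = lem a b p q r s
  where
  lem : ∀ a b p q r s → p * p - a * (q * q) - b * (r * r) + a * b * (s * s) ≡
      (p * p + (- a) * (q * q)) + ((- b) * (r * r) + ((- a) * (- b)) * (s * s))
  lem = solve-∀ ℚ-ring

 private
  +-nonneg : ∀ {p q} → 0ℚ ≤ p → 0ℚ ≤ q → 0ℚ ≤ p + q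
  +-nonneg {p} {q} hp hq = subst (_≤ p + q) (ℚ.+-identityˡ 0ℚ) (ℚ.+-mono-≤ hp hq)

  ab>0 : 0ℚ < (- a) * (- b)
  ab>0 = *-pos (neg-pos a<0) (neg-pos b<0)

 nrd-nonneg : ∀ x → 0ℚ ≤ nrd x
 nrd-nonneg x = subst (0ℚ ≤_) (sym (nrd-split x)) (+-nonneg
  (+-nonneg (square-nonneg (re x)) (nn a<0 (ci x)))
  (+-nonneg (nn b<0 (cj x)) (*-nonneg ab>0 (square-nonneg (ck x)))))

 nrd-zero : ∀ x → nrd x ≡ 0ℚ → x ≡ 0H
 nrd-zero x h = ℍ-≡
   (cancel-square {1ℚ} (ℚ.positive⁻¹ 1ℚ) (re x) (trans (ℚ.*-identityˡ (re x * re x)) (proj₁ h₁)))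
   (cancel-square (neg-pos a<0) (ci x) (proj₂ h₁))
   (cancel-square (neg-pos b<0) (cj x) (proj₁ h₂)) (cancel-square ab>0 (ck x) (proj₂ h₂))
  where
  both = +-nonneg-zero (+-nonneg (square-nonneg (re x)) (nn a<0 (ci x)))
       (+-nonneg (nn b<0 (cj x)) (*-nonneg ab>0 (square-nonneg (ck x)))) (trans (sym (nrd-split x)) h)
  h₁ = +-nonneg-zero (square-nonneg (re x)) (nn a<0 (ci x)) (proj₁ both)
  h₂ = +-nonneg-zero (nn b<0 (cj x)) (*-nonneg ab>0 (square-nonneg (ck x))) (proj₂ both)

 nrd-pos : ∀ x → ¬ (x ≡ 0H) → 0ℚ < nrd x
 nrd-pos x h with ℚ.<-cmp 0ℚ (nrd x)
 ... | tri< p _ _ = p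
 ... | tri≈ _ p _ = ⊥-elim (h (nrd-zero x (sym p)))
 ... | tri> _ _ p = ⊥-elim (ℚ.<-irrefl refl (ℚ.≤-<-trans (nrd-nonneg x) p))

 _≟H_ : DecidableEquality ℍ
 x ≟H y with re x ≟ re y | ci x ≟ ci y | cj x ≟ cj y | ck x ≟ ck y
 ... | yes p | yes q | yes r | yes s = yes (ℍ-≡ p q r s)
 ... | no h | _ | _ | _ = no λ { refl → h refl }
 ... | _ | no h | _ | _ = no λ { refl → h refl }
 ... | _ | _ | no h | _ = no λ { refl → h refl }
 ... | _ | _ | _ | no h = no λ { refl → h refl }

 ι-inj : ∀ {p q} → ι p ≡ ι q → p ≡ q
 ι-inj = cong re

 ι-mul : ∀ p q → ι (p * q) ≡ ι p *H ι q
 ι-mul p q = sym (trans (ι-* p (ι q)) (ℍ-≡ refl (ℚ.*-zeroʳ p) (ℚ.*-zeroʳ p) (ℚ.*-zeroʳ p)))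

 ι-add : ∀ p q → ι (p + q) ≡ ι p +H ι q
 ι-add p q = ℍ-≡ refl (sym (ℚ.+-identityˡ 0ℚ)) (sym (ℚ.+-identityˡ 0ℚ)) (sym (ℚ.+-identityˡ 0ℚ))

 scale≡ι : ∀ q x → q ·H x ≡ ι q *H x
 scale≡ι q x = sym (ι-* q x)

 inverseH : ∀ x → ¬ (x ≡ 0H) → ∃[ y ] ((x *H y ≡ 1H) × (y *H x ≡ 1H))
 inverseH x h = ι r *H conj x ,
   trans (solveH (x ∷ []) (r ∷ []) (V 0 :* (S 0 :* :c V 0)) (S 0 :* (V 0 :* :c V 0)) refl)
    (trans (cong (ι r *H_) (*-conj x)) unit) ,
   trans (*H-assoc (ι r) (conj x) x) (trans (cong (ι r *H_) (conj-*ˡ x)) unit)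
  where
  open import Data.List using ([]; _∷_)
  N≢0 : ¬ (nrd x ≡ 0ℚ)
  N≢0 = <⇒≢0 (nrd-pos x h)
  r = proj₁ (inv (nrd x) N≢0)
  unit : ι r *H ι (nrd x) ≡ 1H
  unit = trans (sym (ι-mul r (nrd x))) (cong ι (trans (ℚ.*-comm r (nrd x)) (proj₂ (inv (nrd x) N≢0))))

 1≢0H : ¬ (1H ≡ 0H)
 1≢0H h = 1≢0ℚ (cong re h)

 module MH = Matrix isRingH sumH (λ f → refl) (λ f → refl)
 module EH = MH.Elimination _≟H_ inverseH 1≢0H

 +K-comm : ∀ x y → x +K y ≡ y +K x
 +K-comm (p ⊕ q α) (r ⊕ s α) = cong₂ _⊕_α (ℚ.+-comm p r) (ℚ.+-comm q s)

 open Polynomial using (lawK; embed; K₁; K₂; K₃; _⊠K_; _⊞K_; 1P)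

 *K-comm : ∀ x y → x *K y ≡ y *K x
 *K-comm x y = lawK (embed x) (embed y) 0H (K₁ ⊠K K₂) (K₂ ⊠K K₁) refl refl

 *K-assoc : ∀ x y z → (x *K y) *K z ≡ x *K (y *K z)
 *K-assoc x y z = lawK (embed x) (embed y) (embed z) ((K₁ ⊠K K₂) ⊠K K₃) (K₁ ⊠K (K₂ ⊠K K₃)) refl refl

 *K-identityˡ : ∀ x → 1K *K x ≡ x
 *K-identityˡ x = lawK (embed x) 0H 0H (1P ⊠K K₁) K₁ refl refl

 *K-distribˡ : ∀ x y z → x *K (y +K z) ≡ (x *K y) +K (x *K z)
 *K-distribˡ x y z = lawK (embed x) (embed y) (embed z) (K₁ ⊠K (K₂ ⊞K K₃)) (K₁ ⊠K K₂ ⊞K K₁ ⊠K K₃) refl refl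

 isCommutativeRingK : IsCommutativeRing _≡_ _+K_ _*K_ -K_ 0K 1K
 isCommutativeRingK = record
  { isRing = record
   { +-isAbelianGroup = record
    { isGroup = record
     { isMonoid = record
      { isSemigroup = record
       { isMagma = record { isEquivalence = isEquivalence ; ∙-cong = cong₂ _+K_ }
       ; assoc = λ { (p ⊕ q α) (r ⊕ s α) (t ⊕ u α) → cong₂ _⊕_α (ℚ.+-assoc p r t) (ℚ.+-assoc q s u) } }
      ; identity = idˡ , λ x → trans (+K-comm x 0K) (idˡ x) }
     ; inverse = invˡ , λ x → trans (+K-comm x (-K x)) (invˡ x)
     ; ⁻¹-cong = cong -K_ }
    ; comm = +K-comm }
   ; *-cong = cong₂ _*K_
   ; *-assoc = *K-assoc
   ; *-identity = *K-identityˡ , λ x → trans (*K-comm x 1K) (*K-identityˡ x)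
   ; distrib = *K-distribˡ , λ x y z → trans (*K-comm (y +K z) x) (trans (*K-distribˡ x y z) (cong₂ _+K_ (*K-comm x y) (*K-comm x z))) }
  ; *-comm = *K-comm }
  where
  idˡ : ∀ x → 0K +K x ≡ x
  idˡ (p ⊕ q α) = cong₂ _⊕_α (ℚ.+-identityˡ p) (ℚ.+-identityˡ q)
  invˡ : ∀ x → (-K x) +K x ≡ 0K
  invˡ (p ⊕ q α) = cong₂ _⊕_α (ℚ.+-inverseˡ p) (ℚ.+-inverseˡ q)

 zeroˡK : ∀ x → 0K *K x ≡ 0K
 zeroˡK = IsCommutativeRing.zeroˡ isCommutativeRingK

 _≟K_ : DecidableEquality K
 (p ⊕ q α) ≟K (r ⊕ s α) with p ≟ r | q ≟ s
 ... | yes refl | yes refl = yes refl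
 ... | no h | _ = no λ { refl → h refl }
 ... | _ | no h = no λ { refl → h refl }

 inverseK : ∀ x → ¬ (x ≡ 0K) → ∃[ y ] (x *K y ≡ 1K)
 inverseK (p ⊕ q α) h = (p * r) ⊕ (- (q * r)) α ,
   cong₂ _⊕_α (trans (l₁ a p q r) (proj₂ (inv N N≢0))) (l₂ p q r)
  where
  N = p * p - a * (q * q)
  N≢0 : ¬ (N ≡ 0ℚ)
  N≢0 e = h (cong₂ _⊕_α (proj₁ (binary a a<0 p q e)) (proj₂ (binary a a<0 p q e)))
  r = proj₁ (inv N N≢0)
  l₁ : ∀ a p q r → p * (p * r) + a * (q * (- (q * r))) ≡ (p * p - a * (q * q)) * r
  l₁ = solve-∀ ℚ-ring
  l₂ : ∀ p q r → p * (- (q * r)) + q * (p * r) ≡ 0ℚ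
  l₂ = solve-∀ ℚ-ring

 1≢0K : ¬ (1K ≡ 0K)
 1≢0K ()

module Block (a b : ℚ) (a<0 : a ℚ.< 0ℚ) (b<0 : b ℚ.< 0ℚ)
 {A : Set} {_⊕_ _⊛_ : A → A → A} {⊖_ : A → A} {0# 1# : A}
 (isCommutativeRing : IsCommutativeRing _≡_ _⊕_ _⊛_ ⊖_ 0# 1#)
 (Σ : ∀ {n} → (Fin n → A) → A)
 (Σ-nil : ∀ (f : Fin zero → A) → Σ f ≡ 0#)
 (Σ-suc : ∀ {n} (f : Fin (suc n) → A) → Σ f ≡ (f zero ⊕ Σ (f ∘ suc)))
 (_≟A_ : DecidableEquality A)
 (inverse : ∀ x → ¬ (x ≡ 0#) → ∃[ y ] ((x ⊛ y) ≡ 1#))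
 (1≢0 : ¬ (1# ≡ 0#))
 (k : ℕ) (ρ : ℍ → Fin k → Fin k → A)
 (ρ-0 : ∀ i j → ρ (Quaternion.0H a b) i j ≡ 0#)
 (ρ-1 : ∀ i j → ρ (Quaternion.1H a b) i j ≡ Determinant.δ isCommutativeRing Σ Σ-nil Σ-suc i j)
 (ρ-+ : ∀ x y i j → ρ (Quaternion._+H_ a b x y) i j ≡ (ρ x i j ⊕ ρ y i j))
 (ρ-* : ∀ x y i j → ρ (Quaternion._*H_ a b x y) i j ≡ Σ (λ l → ρ x i l ⊛ ρ y l j))
 where
 open import Data.Fin using (combine; remQuot; _↑ˡ_; _↑ʳ_)
 open import Data.Fin.Properties using (splitAt-↑ˡ; splitAt-↑ʳ; combine-remQuot)
 import Data.Fin.Properties as Fin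
 open import Data.Rational using (_+_; _*_; _<_; _≟_)
 open RationalAlgebra
 open RationalVectors
 open Definite a b a<0 b<0 using (_+H_; _*H_; 0H; 1H; ι; conj; sumH; nrd; module MH; module EH)
 open Determinant isCommutativeRing Σ Σ-nil Σ-suc public
 open Field _≟A_ inverse 1≢0 public
 open IsCommutativeRing isCommutativeRing using (+-assoc; +-comm; +-identityˡ; +-identityʳ; -‿inverseˡ; -‿inverseʳ; *-assoc; *-comm; *-identityˡ; *-identityʳ; distribˡ; distribʳ; zeroˡ; zeroʳ)

 block : ∀ {g} → MH.Mat g → Mat (g ℕ.* k)
 block {g} M r c = ρ (M (proj₁ (remQuot {g} k r)) (proj₁ (remQuot {g} k c))) (proj₂ (remQuot {g} k r)) (proj₂ (remQuot {g} k c))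

 Σ-++ : ∀ m n (f : Fin (m ℕ.+ n) → A) → Σ f ≡ (Σ (λ i → f (i ↑ˡ n)) ⊕ Σ (λ j → f (m ↑ʳ j)))
 Σ-++ zero n f = sym (trans (+R (Σ-nil _)) (+-identityˡ _))
 Σ-++ (suc m) n f = trans (Σ-suc f) (trans (+L (Σ-++ m n (f ∘ suc))) (trans (sym (+-assoc _ _ _)) (+R (sym (Σ-suc _)))))

 Σ-block : ∀ g (F : Fin g → Fin k → A) → Σ (λ s → F (proj₁ (remQuot {g} k s)) (proj₂ (remQuot {g} k s))) ≡ Σ (λ i → Σ (F i))
 Σ-block zero F = trans (Σ-nil _) (sym (Σ-nil _))
 Σ-block (suc g) F = trans (Σ-++ k (g ℕ.* k) _) (trans (cong₂ _⊕_ (Σ-cong first) (trans (Σ-cong rest) (Σ-block g (F ∘ suc)))) (sym (Σ-suc _)))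
  where
  first : ∀ i → F (proj₁ (remQuot {suc g} k (i ↑ˡ (g ℕ.* k)))) (proj₂ (remQuot {suc g} k (i ↑ˡ (g ℕ.* k)))) ≡ F zero i
  first i rewrite splitAt-↑ˡ k i (g ℕ.* k) = refl
  rest : ∀ j → F (proj₁ (remQuot {suc g} k (k ↑ʳ j))) (proj₂ (remQuot {suc g} k (k ↑ʳ j))) ≡ F (suc (proj₁ (remQuot {g} k j))) (proj₂ (remQuot {g} k j))
  rest j rewrite splitAt-↑ʳ k (g ℕ.* k) j = refl

 ρ-sum : ∀ {n} (f : Fin n → ℍ) i j → ρ (sumH f) i j ≡ Σ (λ l → ρ (f l) i j)
 ρ-sum {zero} f i j = trans (ρ-0 i j) (sym (Σ-nil _))
 ρ-sum {suc n} f i j = trans (ρ-+ _ _ i j) (trans (+L (ρ-sum (f ∘ suc) i j)) (sym (Σ-suc _)))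

 block-⊠ : ∀ {g} (M N : MH.Mat g) → block (M MH.⊠ N) ≈ (block M ⊠ block N)
 block-⊠ {g} M N r c = trans (ρ-sum _ _ _) (trans (Σ-cong (λ l → ρ-* _ _ _ _))
  (sym (Σ-block g (λ i l → ρ (M _ i) _ l ⊛ ρ (N i _) l _))))

 δ-yes : ∀ {n} (i : Fin n) → δ i i ≡ 1#
 δ-yes zero = refl
 δ-yes (suc i) = δ-yes i

 δ-no : ∀ {n} (i j : Fin n) → ¬ (i ≡ j) → δ i j ≡ 0#
 δ-no zero zero h = ⊥-elim (h refl)
 δ-no zero (suc j) h = refl
 δ-no (suc i) zero h = refl
 δ-no (suc i) (suc j) h = δ-no i j (h ∘ cong suc)

 δH-yes : ∀ {n} (i : Fin n) → MH.δ i i ≡ 1H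
 δH-yes zero = refl
 δH-yes (suc i) = δH-yes i

 δH-no : ∀ {n} (i j : Fin n) → ¬ (i ≡ j) → MH.δ i j ≡ 0H
 δH-no zero zero h = ⊥-elim (h refl)
 δH-no zero (suc j) h = refl
 δH-no (suc i) zero h = refl
 δH-no (suc i) (suc j) h = δH-no i j (h ∘ cong suc)

 block-δ : ∀ {g} → block (MH.δ {g}) ≈ δ
 block-δ {g} r c with r Fin.≟ c
 ... | yes refl = trans (cong (λ z → ρ z (rem r) (rem r)) (δH-yes (quo r))) (trans (ρ-1 _ _) (trans (δ-yes (rem r)) (sym (δ-yes r))))
  where
  quo = λ s → proj₁ (remQuot {g} k s)
  rem = λ s → proj₂ (remQuot {g} k s)
 ... | no r≢c with proj₁ (remQuot {g} k r) Fin.≟ proj₁ (remQuot {g} k c)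
 ...   | no h = trans (cong (λ z → ρ z _ _) (δH-no _ _ h)) (trans (ρ-0 _ _) (sym (δ-no r c r≢c)))
 ...   | yes h with proj₂ (remQuot {g} k r) Fin.≟ proj₂ (remQuot {g} k c)
 ...     | no h' = trans (cong (λ z → ρ z _ _) (trans (cong (λ z → MH.δ z (proj₁ (remQuot {g} k c))) h) (δH-yes (proj₁ (remQuot {g} k c)))))
       (trans (ρ-1 _ _) (trans (δ-no _ _ h') (sym (δ-no r c r≢c))))
 ...     | yes h' = ⊥-elim (r≢c (trans (sym (combine-remQuot {g} k r)) (trans (cong₂ combine h h') (combine-remQuot {g} k c))))

 block-cong : ∀ {g} {M N : MH.Mat g} → M MH.≈ N → block M ≈ block N
 block-cong {g} h r c = cong (λ z → ρ z _ _) (h (proj₁ (remQuot {g} k r)) (proj₁ (remQuot {g} k c)))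

 abstract
  N : ∀ {g} → MH.Mat g → A
  N {g} M = det (g ℕ.* k) (block M)

  N≡det : ∀ {g} (M : MH.Mat g) → N M ≡ det (g ℕ.* k) (block M)
  N≡det M = refl

 N-cong : ∀ {g} {L M : MH.Mat g} → L MH.≈ M → N L ≡ N M
 N-cong {g} {L} {M} h = trans (N≡det L) (trans (det-cong (g ℕ.* k) (block-cong {g} {L} {M} h)) (sym (N≡det M)))

 N-⊠ : ∀ {g} (L M : MH.Mat g) → N (L MH.⊠ M) ≡ (N L ⊛ N M)
 N-⊠ {g} L M = trans (N≡det (L MH.⊠ M)) (trans (det-cong (g ℕ.* k) (block-⊠ L M))
  (trans (det-⊠ (g ℕ.* k) (block L) (block M)) (sym (cong₂ _⊛_ (N≡det L) (N≡det M)))))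

 N-δ : ∀ {g} → N (MH.δ {g}) ≡ 1#
 N-δ {g} = trans (N≡det (MH.δ {g})) (trans (det-cong (g ℕ.* k) (block-δ {g})) (det-δ (g ℕ.* k)))

 unit≢0 : ∀ {x y} → (x ⊛ y) ≡ 1# → ¬ (x ≡ 0#)
 unit≢0 {x} {y} h e = 1≢0 (trans (sym h) (trans (cong (_⊛ y) e) (zeroˡ y)))

 idempotent-unit : ∀ {x y} → (x ⊛ y) ≡ 1# → (x ⊛ x) ≡ x → x ≡ 1#
 idempotent-unit {x} {y} h e = trans (sym (*-identityʳ x)) (trans (cong (x ⊛_) (sym h))
  (trans (sym (*-assoc x x y)) (trans (cong (_⊛ y) e) h)))

 N-invertible : ∀ {g} {M : MH.Mat g} (i : MH.Invertible M) → (N M ⊛ N (proj₁ i)) ≡ 1#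
 N-invertible {g} {M} (M' , h , _) = trans (sym (N-⊠ M M')) (trans (N-cong {g} {M MH.⊠ M'} {MH.δ} h) (N-δ {g}))

 cancel-unit : ∀ {d d' x y} → (d ⊛ d') ≡ 1# → (d ⊛ x) ≡ (d ⊛ y) → x ≡ y
 cancel-unit {d} {d'} {x} {y} h e = trans (go x) (trans (cong (d' ⊛_) e) (sym (go y)))
  where
  go : ∀ z → z ≡ (d' ⊛ (d ⊛ z))
  go z = sym (trans (sym (*-assoc _ _ _)) (trans (cong (_⊛ z) (trans (*-comm d' d) h)) (*-identityˡ z)))

 pow : A → ℕ → A
 pow x zero = 1#
 pow x (suc n) = x ⊛ pow x n

 pow-1 : ∀ n → pow 1# n ≡ 1#
 pow-1 zero = refl
 pow-1 (suc n) = trans (*-identityˡ _) (pow-1 n)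

 det-scalar-block : ∀ m n q (X : Mat (m ℕ.+ n)) (Y : Mat n) →
  (∀ i c → X (i ↑ˡ n) c ≡ (q ⊛ δ (i ↑ˡ n) c)) → (∀ r c → X (m ↑ʳ r) (m ↑ʳ c) ≡ Y r c) →
  det (m ℕ.+ n) X ≡ (pow q m ⊛ det n Y)
 det-scalar-block zero n q X Y h k = trans (det-cong n k) (sym (*-identityˡ _))
 det-scalar-block (suc m) n q X Y h k = trans (det-first _ X (λ j → trans (h zero (suc j)) (zeroʳ q)))
  (trans (cong₂ _⊛_ (trans (h zero zero) (*-identityʳ q))
   (det-scalar-block m n q (minor zero X) Y (λ i c → h (suc i) (suc c)) k)) (sym (*-assoc _ _ _)))

 block-top : ∀ {g} (M : MH.Mat (suc g)) i c → block M (i ↑ˡ (g ℕ.* k)) c ≡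
  ρ (M zero (proj₁ (remQuot {suc g} k c))) i (proj₂ (remQuot {suc g} k c))
 block-top {g} M i c rewrite splitAt-↑ˡ k i (g ℕ.* k) = refl

 block-bottom : ∀ {g} (M : MH.Mat (suc g)) r c → block M (k ↑ʳ r) (k ↑ʳ c) ≡ block {g} (λ i j → M (suc i) (suc j)) r c
 block-bottom {g} M r c rewrite splitAt-↑ʳ k (g ℕ.* k) r | splitAt-↑ʳ k (g ℕ.* k) c = refl

 N-ext : ∀ {g} (M : MH.Mat g) → N (MH.ext M) ≡ N M
 N-ext {g} M = trans (N≡det (MH.ext M)) (trans (det-scalar-block k (g ℕ.* k) 1# (block (MH.ext M)) (block M)
   (λ i c → trans (block-top (MH.ext M) i c) (trans (cong (λ z → ρ z i _) (top (proj₁ (remQuot {suc g} k c))))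
    (trans (sym (block-top MH.δ i c)) (trans (block-δ {suc g} (i ↑ˡ (g ℕ.* k)) c) (sym (*-identityˡ _))))))
   (block-bottom (MH.ext M)))
   (trans (cong₂ _⊛_ (pow-1 k) (sym (N≡det M))) (*-identityˡ _)))
  where
  top : ∀ j → MH.ext M zero j ≡ MH.δ zero j
  top zero = refl
  top (suc j) = refl

 N-scalar : ∀ {g} d q → (∀ i j → ρ d i j ≡ (q ⊛ δ i j)) → N (MH.diag₀ {g} d) ≡ pow q k
 N-scalar {g} d q h = trans (N≡det (MH.diag₀ {g} d)) (trans (det-scalar-block k (g ℕ.* k) q (block (MH.diag₀ {g} d)) (block (MH.δ {g}))
   (λ i c → trans (block-top (MH.diag₀ {g} d) i c) (trans (row i (proj₁ (remQuot {suc g} k c)) (proj₂ (remQuot {suc g} k c)))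
    (cong (q ⊛_) (trans (sym (block-top MH.δ i c)) (block-δ {suc g} (i ↑ˡ (g ℕ.* k)) c)))))
   (block-bottom (MH.diag₀ {g} d)))
   (trans (cong (pow q k ⊛_) (trans (sym (N≡det (MH.δ {g}))) (N-δ {g}))) (*-identityʳ _)))
  where
  row : ∀ i j l → ρ (MH.diag₀ {g} d zero j) i l ≡ (q ⊛ ρ (MH.δ zero j) i l)
  row i zero l = trans (h i l) (cong (q ⊛_) (sym (ρ-1 i l)))
  row i (suc j) l = trans (ρ-0 i l) (sym (trans (cong (q ⊛_) (ρ-0 i l)) (zeroʳ q)))

 private
  2H : ℍ
  2H = 1H +H 1H

  half : ∃[ y ] ((2H *H y ≡ 1H) × (y *H 2H ≡ 1H))
  half = Definite.inverseH a b a<0 b<0 2H λ e → 2≢0 (cong re e)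
   where
   2≢0 : ¬ (1ℚ + 1ℚ ≡ 0ℚ)
   2≢0 ()

 diag-invertible : ∀ {g} d d' → d *H d' ≡ 1H → d' *H d ≡ 1H → MH.Invertible (MH.diag₀ {g} d)
 diag-invertible d d' p q = MH.diag₀ d' ,
  MH.≈-trans {L = MH.diag₀ d MH.⊠ MH.diag₀ d'} {MH.diag₀ (d *H d')} {MH.δ} (EH.diag₀-mul d d') (MH.≈-trans {L = MH.diag₀ (d *H d')} {MH.diag₀ 1H} {MH.δ} (EH.diag₀-cong p) EH.diag₀-1) ,
  MH.≈-trans {L = MH.diag₀ d' MH.⊠ MH.diag₀ d} {MH.diag₀ (d' *H d)} {MH.δ} (EH.diag₀-mul d' d) (MH.≈-trans {L = MH.diag₀ (d' *H d)} {MH.diag₀ 1H} {MH.δ} (EH.diag₀-cong q) EH.diag₀-1)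

 N-2-unit : ∀ {g} → ∃[ y ] ((N (MH.diag₀ {g} 2H) ⊛ y) ≡ 1#)
 N-2-unit {g} = _ , N-invertible {suc g} {MH.diag₀ 2H} (diag-invertible 2H (proj₁ half) (proj₁ (proj₂ half)) (proj₂ (proj₂ half)))

 N-upper : ∀ {g} (u : Fin g → ℍ) → N (MH.upper u) ≡ 1#
 N-upper {g} u = idempotent-unit (N-invertible {suc g} {MH.upper u} (EH.upper-invertible u))
   (sym (cancel-unit (proj₂ (N-2-unit {g})) (begin
    N D ⊛ N U                ≡⟨ sym (N-⊠ D U) ⟩
    N (D MH.⊠ U)             ≡⟨ N-cong {suc g} {D MH.⊠ U} {(U MH.⊠ U) MH.⊠ D} (MH.upper-square u) ⟩
    N ((U MH.⊠ U) MH.⊠ D)    ≡⟨ N-⊠ (U MH.⊠ U) D ⟩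
    N (U MH.⊠ U) ⊛ N D       ≡⟨ *-comm _ _ ⟩
    N D ⊛ N (U MH.⊠ U)       ≡⟨ cong (N D ⊛_) (N-⊠ U U) ⟩
    N D ⊛ (N U ⊛ N U)        ∎)))
  where
  open ≡-Reasoning
  U = MH.upper u
  D = MH.diag₀ {g} 2H

 N-lower : ∀ {g} (u : Fin g → ℍ) → N (MH.lower u) ≡ 1#
 N-lower {g} u = idempotent-unit (N-invertible {suc g} {MH.lower u} (EH.lower-invertible u))
   (cancel-unit (proj₂ (N-2-unit {g})) (begin
    N D ⊛ (N U ⊛ N U)        ≡⟨ cong (N D ⊛_) (sym (N-⊠ U U)) ⟩
    N D ⊛ N (U MH.⊠ U)       ≡⟨ sym (N-⊠ D (U MH.⊠ U)) ⟩
    N (D MH.⊠ (U MH.⊠ U))    ≡⟨ N-cong {suc g} {D MH.⊠ (U MH.⊠ U)} {U MH.⊠ D} (MH.lower-square u) ⟩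
    N (U MH.⊠ D)             ≡⟨ N-⊠ U D ⟩
    N U ⊛ N D                ≡⟨ *-comm _ _ ⟩
    N D ⊛ N U                ∎))
  where
  open ≡-Reasoning
  U = MH.lower u
  D = MH.diag₀ {g} 2H

module ReducedNorm (a b : ℚ) (a<0 : a ℚ.< 0ℚ) (b<0 : b ℚ.< 0ℚ) where
 open import Data.Fin using (punchIn; remQuot; toℕ)
 open import Data.Rational using (_+_; _*_; -_; _-_; _<_)
 open RationalAlgebra
 open RationalVectors
 open Integrality
 open IntegralDeterminants
 open Definite a b a<0 b<0

 private
  open module P = Polynomial using (lawK; splitP; splitXY)

 split-* : ∀ x y i j → split (x *H y) i j ≡ sumK (λ l → split x i l *K split y l j)
 split-* x y zero zero = lawK x y 0H (splitP (P.X P.⊠ P.Y) zero zero) (splitXY zero zero) refl refl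
 split-* x y zero (suc zero) = lawK x y 0H (splitP (P.X P.⊠ P.Y) zero (suc zero)) (splitXY zero (suc zero)) refl refl
 split-* x y (suc zero) zero = lawK x y 0H (splitP (P.X P.⊠ P.Y) (suc zero) zero) (splitXY (suc zero) zero) refl refl
 split-* x y (suc zero) (suc zero) = lawK x y 0H (splitP (P.X P.⊠ P.Y) (suc zero) (suc zero)) (splitXY (suc zero) (suc zero)) refl refl

 split-+ : ∀ x y i j → split (x +H y) i j ≡ split x i j +K split y i j
 split-+ x y zero zero = refl
 split-+ x y zero (suc zero) = cong₂ _⊕_α (ℚ.*-distribˡ-+ b (cj x) (cj y)) (ℚ.*-distribˡ-+ b (ck x) (ck y))
 split-+ x y (suc zero) zero = cong₂ _⊕_α refl (ℚ.neg-distrib-+ (ck x) (ck y))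
 split-+ x y (suc zero) (suc zero) = cong₂ _⊕_α refl (ℚ.neg-distrib-+ (ci x) (ci y))

 module DK = Determinant isCommutativeRingK sumK (λ f → refl) (λ f → refl)

 split-0 : ∀ i j → split 0H i j ≡ 0K
 split-0 zero zero = refl
 split-0 zero (suc zero) = cong₂ _⊕_α (ℚ.*-zeroʳ b) (ℚ.*-zeroʳ b)
 split-0 (suc zero) zero = refl
 split-0 (suc zero) (suc zero) = refl

 split-1 : ∀ i j → split 1H i j ≡ DK.δ i j
 split-1 zero zero = refl
 split-1 zero (suc zero) = cong₂ _⊕_α (ℚ.*-zeroʳ b) (ℚ.*-zeroʳ b)
 split-1 (suc zero) zero = refl
 split-1 (suc zero) (suc zero) = refl

 module BK = Block a b a<0 b<0 isCommutativeRingK sumK (λ f → refl) (λ f → refl) _≟K_ inverseK 1≢0K 2 split split-0 split-1 split-+ split-*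

 sgnK : ℕ → K → K
 sgnK zero x = x
 sgnK (suc zero) x = -K x
 sgnK (suc (suc m)) x = sgnK m x

 laplace : ∀ n → (Fin n → Fin n → K) → K
 laplace zero A = 1K
 laplace (suc n) A = sumK (λ j → sgnK (toℕ j) (A zero j *K laplace n (λ r c → A (suc r) (punchIn j c))))

 sumK-cong : ∀ {n} {f g : Fin n → K} → (∀ i → f i ≡ g i) → sumK f ≡ sumK g
 sumK-cong {zero} h = refl
 sumK-cong {suc n} h = cong₂ _+K_ (h zero) (sumK-cong (λ i → h (suc i)))

 -- The sign function inside detK has no name here, so the types of sign and sign'
 -- are left to unification with the unfolding of detK.
 mutual
  detK≡laplace : ∀ n A → detK n A ≡ laplace n A
  detK≡laplace zero A = refl
  detK≡laplace (suc n) A = cong₂ _+K_ (cong (A zero zero *K_) (detK≡laplace n _)) (sumK-cong {n} (λ j → sign n A j))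

  sign : ∀ n A (j : Fin n) → _ ≡ sgnK (toℕ (suc j)) (A zero (suc j) *K laplace n (λ r c → A (suc r) (punchIn (suc j) c)))
  sign n A j rewrite detK≡laplace n (λ r c → A (suc r) (punchIn (suc j) c)) with toℕ j | A zero (suc j) *K laplace n (λ r c → A (suc r) (punchIn (suc j) c))
  ... | m | y = sign' n A m y

  sign' : ∀ n A m y → _ ≡ sgnK (suc m) y
  sign' n A zero y = refl
  sign' n A (suc zero) y = refl
  sign' n A (suc (suc m)) y = sign' n A m y

 laplace≡det : ∀ n A → laplace n A ≡ BK.det n A
 laplace≡det zero A = refl
 laplace≡det (suc n) A = sumK-cong (λ j → trans (cong (λ z → sgnK (toℕ j) (A zero j *K z)) (laplace≡det n (λ r c → A (suc r) (punchIn j c)))) (sgnK≡sgn (toℕ j) _))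
  where
  sgnK≡sgn : ∀ m x → sgnK m x ≡ BK.sgn m x
  sgnK≡sgn zero x = refl
  sgnK≡sgn (suc zero) x = refl
  sgnK≡sgn (suc (suc m)) x = sgnK≡sgn m x

 detK≡det : ∀ n A → detK n A ≡ BK.det n A
 detK≡det n A = trans (detK≡laplace n A) (laplace≡det n A)

 Nm≡N : ∀ {g} (M : Mat g) → Nm M ≡ K.kre (BK.N M)
 Nm≡N {g} M = cong K.kre (trans (detK≡det (g ℕ.* 2) (BK.block M)) (sym (BK.N≡det M)))

 N-diag : ∀ {g} d → BK.N (MH.diag₀ {g} d) ≡ nrd d ⊕ 0ℚ α
 N-diag {g} d = trans (BK.N≡det (MH.diag₀ {g} d)) (begin
   BK.det (suc (suc n)) X
    ≡⟨⟩
   (X zero zero *K BK.det (suc n) (BK.minor zero X)) +K ((-K (X zero (suc zero) *K BK.det (suc n) (BK.minor (suc zero) X))) +K rest)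
    ≡⟨ cong₂ (λ z w → (X zero zero *K z) +K w) (trans (BK.det-first n (BK.minor zero X) (λ j → split-0 (suc zero) _)) (cong (X (suc zero) (suc zero) *K_) one))
       (cong₂ (λ z w → (-K (X zero (suc zero) *K z)) +K w) (trans (BK.det-first n (BK.minor (suc zero) X) (λ j → split-0 (suc zero) _)) (cong (X (suc zero) zero *K_) one)) rest≡0) ⟩
   (X zero zero *K (X (suc zero) (suc zero) *K 1K)) +K ((-K (X zero (suc zero) *K (X (suc zero) zero *K 1K))) +K 0K)
    ≡⟨ cong₂ _⊕_α (l₁ a b (re d) (ci d) (cj d) (ck d)) (l₂ a b (re d) (ci d) (cj d) (ck d)) ⟩
   nrd d ⊕ 0ℚ α ∎)
  where
  open ≡-Reasoning
  n = g ℕ.* 2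
  X = BK.block (MH.diag₀ {g} d)
  rest = sumK (λ (j : Fin n) → BK.sgn (toℕ (suc (suc j))) (X zero (suc (suc j)) *K BK.det (suc n) (BK.minor (suc (suc j)) X)))
  rest≡0 : rest ≡ 0K
  rest≡0 = BK.Σ-zero (λ j → trans (cong (BK.sgn (toℕ j)) (trans (cong (_*K BK.det (suc n) (BK.minor (suc (suc j)) X)) (split-0 zero (proj₂ (remQuot {g} 2 j))))
   (zeroˡK (BK.det (suc n) (BK.minor (suc (suc j)) X))))) (BK.sgn-zero (toℕ j)))
  one : BK.det n (λ r c → X (suc (suc r)) (suc (suc c))) ≡ 1K
  one = trans (sym (BK.N≡det (MH.δ {g}))) (BK.N-δ {g})
  l₁ : ∀ a b p q r s → (p * (p * 1ℚ + a * ((- q) * 0ℚ)) + a * (q * (p * 0ℚ + (- q) * 1ℚ))) +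
      ((- ((b * r) * (r * 1ℚ + a * ((- s) * 0ℚ)) + a * ((b * s) * (r * 0ℚ + (- s) * 1ℚ)))) + 0ℚ)
     ≡ p * p - a * (q * q) - b * (r * r) + a * b * (s * s)
  l₁ = solve-∀ ℚ-ring
  l₂ : ∀ a b p q r s → (p * (p * 0ℚ + (- q) * 1ℚ) + q * (p * 1ℚ + a * ((- q) * 0ℚ))) +
      ((- ((b * r) * (r * 0ℚ + (- s) * 1ℚ) + (b * s) * (r * 1ℚ + a * ((- s) * 0ℚ)))) + 0ℚ)
     ≡ 0ℚ
  l₂ = solve-∀ ℚ-ring

module Correspondence (a b : ℚ) (a<0 : a ℚ.< 0ℚ) (b<0 : b ℚ.< 0ℚ)
 (O : Quaternion.Basis a b) (maximal : Quaternion.IsMaximalOrder a b O) where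
 open import Data.Rational using (_+_; _*_; -_; _-_; _<_; _≤_; _≟_)
 open import Data.Fin.Properties using (all?)
 open import Relation.Nullary.Decidable using (map′; toWitness)
 open RationalAlgebra
 open RationalVectors
 open Integrality
 open IntegralDeterminants
 open PrimeResidues using (pos≢0)
 open NormForm
 open import Data.Integer using (+_)
 open Definite a b a<0 b<0 public hiding (_▹_)
 open ReducedNorm a b a<0 b<0 public using (module BK; Nm≡N; N-diag)
 open Over O public

 private
  module Q = DetInt.Field _≟_ inv 1≢0ℚ
  module D = DetInt

 comp : Fin 4 → ℍ → ℚ
 comp zero = re
 comp (suc zero) = ci
 comp (suc (suc zero)) = cj
 comp (suc (suc (suc zero))) = ck

 comp-≡ : ∀ {x y} → (∀ r → comp r x ≡ comp r y) → x ≡ y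
 comp-≡ h = ℍ-≡ (h zero) (h (suc zero)) (h (suc (suc zero))) (h (suc (suc (suc zero))))

 comp-0 : ∀ r → comp r 0H ≡ 0ℚ
 comp-0 zero = refl
 comp-0 (suc zero) = refl
 comp-0 (suc (suc zero)) = refl
 comp-0 (suc (suc (suc zero))) = refl

 comp-+ : ∀ r x y → comp r (x +H y) ≡ comp r x + comp r y
 comp-+ zero x y = refl
 comp-+ (suc zero) x y = refl
 comp-+ (suc (suc zero)) x y = refl
 comp-+ (suc (suc (suc zero))) x y = refl

 comp-· : ∀ r q x → comp r (q ·H x) ≡ q * comp r x
 comp-· zero q x = refl
 comp-· (suc zero) q x = refl
 comp-· (suc (suc zero)) q x = refl
 comp-· (suc (suc (suc zero))) q x = refl

 comp-sum : ∀ {n} r (f : Fin n → ℍ) → comp r (sumH f) ≡ sumℚ (λ i → comp r (f i))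
 comp-sum {zero} r f = comp-0 r
 comp-sum {suc n} r f = trans (comp-+ r (f zero) (sumH (f ∘ suc))) (cong (_+_ (comp r (f zero))) (comp-sum r (f ∘ suc)))

 basisMatrix : D.Mat 4
 basisMatrix r i = comp r (O i)

 combine : (Fin 4 → ℚ) → ℍ
 combine c = sumH (λ i → c i ·H O i)

 comp-combine : ∀ c r → comp r (combine c) ≡ sumℚ (λ i → basisMatrix r i * c i)
 comp-combine c r = trans (comp-sum r (λ i → c i ·H O i))
  (D.Σ-cong (λ i → trans (comp-· r (c i) (O i)) (ℚ.*-comm (c i) (comp r (O i)))))

 basis-invertible : D.Invertible basisMatrix
 basis-invertible with Q.invertible⊎kernel basisMatrix
 ... | inj₁ h = h
 ... | inj₂ (v , (i , vᵢ≢0) , h) = ⊥-elim (vᵢ≢0 (proj₁ (proj₁ maximal) v (comp-≡ λ r → trans (comp-combine v r) (trans (h r) (sym (comp-0 r)))) i))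

 private
  B : D.Mat 4
  B = proj₁ basis-invertible

 coord : ℍ → Fin 4 → ℚ
 coord x i = sumℚ (λ r → B i r * comp r x)

 combine-coord : ∀ x → combine (coord x) ≡ x
 combine-coord x = comp-≡ λ r → trans (comp-combine (coord x) r)
  (trans (sym (Q.⊠-vec basisMatrix B (λ r → comp r x) r))
   (trans (D.Σ-cong (λ k → cong (_* comp k x) (proj₁ (proj₂ basis-invertible) r k))) (D.Σ-δˡ r (λ r → comp r x))))

 coord-combine : ∀ c i → coord (combine c) i ≡ c i
 coord-combine c i = trans (D.Σ-cong (λ r → cong (B i r *_) (comp-combine c r)))
  (trans (sym (Q.⊠-vec B basisMatrix c i))
   (trans (D.Σ-cong (λ k → cong (_* c k) (proj₂ (proj₂ basis-invertible) i k))) (D.Σ-δˡ i c)))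

 coord-+ : ∀ x y i → coord (x +H y) i ≡ coord x i + coord y i
 coord-+ x y i = trans (D.Σ-cong (λ r → trans (cong (B i r *_) (comp-+ r x y)) (ℚ.*-distribˡ-+ (B i r) (comp r x) (comp r y))))
  (D.Σ-+ (λ r → B i r * comp r x) (λ r → B i r * comp r y))

 coord-· : ∀ q x i → coord (q ·H x) i ≡ q * coord x i
 coord-· q x i = trans (D.Σ-cong (λ r → trans (cong (B i r *_) (comp-· r q x)) (lem (B i r) q (comp r x))))
  (D.Σ-*ˡ q (λ r → B i r * comp r x))
  where
  lem : ∀ p q r → p * (q * r) ≡ q * (p * r)
  lem = solve-∀ ℚ-ring

 coord-0 : ∀ i → coord 0H i ≡ 0ℚ
 coord-0 i = D.Σ-zero (λ r → trans (cong (B i r *_) (comp-0 r)) (ℚ.*-zeroʳ (B i r)))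

 coord-sum : ∀ {n} (f : Fin n → ℍ) i → coord (sumH f) i ≡ sumℚ (λ k → coord (f k) i)
 coord-sum {zero} f i = coord-0 i
 coord-sum {suc n} f i = trans (coord-+ (f zero) (sumH (f ∘ suc)) i) (cong (_+_ (coord (f zero) i)) (coord-sum (f ∘ suc) i))

 ∈O⇒int : ∀ {x} → x ∈O → ∀ i → Int (coord x i)
 ∈O⇒int (n , refl) i = n i , coord-combine (λ i → ℤ→ℚ (n i)) i

 int⇒∈O : ∀ {x} → (∀ i → Int (coord x i)) → x ∈O
 int⇒∈O {x} h = (λ i → proj₁ (h i)) , trans (sym (combine-coord x)) (MH.Σ-cong (λ i → cong (_·H O i) (proj₂ (h i))))

 ∈O? : ∀ x → Dec (x ∈O)
 ∈O? x = map′ int⇒∈O ∈O⇒int (all? (λ i → int? (coord x i)))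

 O-+ : ∀ {x y} → x ∈O → y ∈O → (x +H y) ∈O
 O-+ {x} {y} h k = int⇒∈O λ i → subst Int (sym (coord-+ x y i)) (int-+ (∈O⇒int h i) (∈O⇒int k i))

 O-· : ∀ {q x} → Int q → x ∈O → (q ·H x) ∈O
 O-· {q} {x} h k = int⇒∈O λ i → subst Int (sym (coord-· q x i)) (int-* h (∈O⇒int k i))

 O-0 : 0H ∈O
 O-0 = int⇒∈O λ i → subst Int (sym (coord-0 i)) int-0

 O-sum : ∀ {n} {f : Fin n → ℍ} → (∀ i → f i ∈O) → sumH f ∈O
 O-sum {zero} h = O-0
 O-sum {suc n} h = O-+ (h zero) (O-sum (h ∘ suc))

 O-1 : 1H ∈O
 O-1 = proj₁ (proj₂ (proj₁ maximal))

 scale-*ˡ : ∀ q x y → (q ·H x) *H y ≡ q ·H (x *H y)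
 scale-*ˡ q x y = trans (cong (_*H y) (scale≡ι q x)) (trans (*H-assoc (ι q) x y) (sym (scale≡ι q (x *H y))))

 scale-*ʳ : ∀ q x y → x *H (q ·H y) ≡ q ·H (x *H y)
 scale-*ʳ q x y = trans (cong (x *H_) (trans (scale≡ι q y) (ι-central q y))) (trans (sym (*H-assoc x y (ι q)))
  (trans (sym (ι-central q (x *H y))) (sym (scale≡ι q (x *H y)))))

 O-left : ∀ {x y} → x ∈O → (∀ i → (O i *H y) ∈O) → (x *H y) ∈O
 O-left {x} {y} (n , refl) h = subst _∈O (MH.Σ-*ʳ y (λ i → ℤ→ℚ (n i) ·H O i))
  (O-sum λ i → subst _∈O (sym (scale-*ˡ (ℤ→ℚ (n i)) (O i) y)) (O-· (n i , refl) (h i)))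

 O-right : ∀ {x y} → y ∈O → (∀ i → (x *H O i) ∈O) → (x *H y) ∈O
 O-right {x} {y} (n , refl) h = subst _∈O (MH.Σ-*ˡ x (λ i → ℤ→ℚ (n i) ·H O i))
  (O-sum λ i → subst _∈O (sym (scale-*ʳ (ℤ→ℚ (n i)) x (O i))) (O-· (n i , refl) (h i)))

 O-* : ∀ {x y} → x ∈O → y ∈O → (x *H y) ∈O
 O-* {x} {y} h k = O-left {x} {y} h λ i → O-right {O i} {y} k λ j → proj₂ (proj₂ (proj₁ maximal)) i j

 O-ι : ∀ {q} → Int q → ι q ∈O
 O-ι {q} h = subst _∈O (trans (scale≡ι q 1H) (*H-identityʳ (ι q))) (O-· h O-1)

 O-gen : ∀ i → O i ∈O
 O-gen i = int⇒∈O λ j → subst Int (sym (trans (cong (λ z → coord z j) (sym (gen i))) (coord-combine (D.δ i) j))) (int-δ i j)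
  where
  int-δ : ∀ {n} (i j : Fin n) → Int (D.δ i j)
  int-δ zero zero = int-1
  int-δ zero (suc j) = int-0
  int-δ (suc i) zero = int-0
  int-δ (suc i) (suc j) = int-δ i j
  gen : ∀ i → combine (D.δ i) ≡ O i
  gen i = comp-≡ λ r → trans (comp-combine (D.δ i) r) (trans (D.Σ-cong (λ k → ℚ.*-comm (basisMatrix r k) (D.δ i k))) (D.Σ-δˡ i (basisMatrix r)))

 -- Left multiplication by x in the ℤ-basis O.
 leftMul : ℍ → Fin 4 → Fin 4 → ℚ
 leftMul x i j = coord (x *H O j) i

 leftMul-0 : ∀ i j → leftMul 0H i j ≡ 0ℚ
 leftMul-0 i j = trans (cong (λ z → coord z i) (zeroˡH (O j))) (coord-0 i)

 coord-O : ∀ i j → coord (O j) i ≡ D.δ i j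
 coord-O i j = trans (cong (λ z → coord z i) (sym (gen j))) (trans (coord-combine (D.δ j) i) (δ-sym j i))
  where
  δ-sym : ∀ {n} (i j : Fin n) → D.δ i j ≡ D.δ j i
  δ-sym zero zero = refl
  δ-sym zero (suc j) = refl
  δ-sym (suc i) zero = refl
  δ-sym (suc i) (suc j) = δ-sym i j
  gen : ∀ i → combine (D.δ i) ≡ O i
  gen i = comp-≡ λ r → trans (comp-combine (D.δ i) r) (trans (D.Σ-cong (λ k → ℚ.*-comm (basisMatrix r k) (D.δ i k))) (D.Σ-δˡ i (basisMatrix r)))

 leftMul-1 : ∀ i j → leftMul 1H i j ≡ D.δ i j
 leftMul-1 i j = trans (cong (λ z → coord z i) (*H-identityˡ (O j))) (coord-O i j)

 leftMul-+ : ∀ x y i j → leftMul (x +H y) i j ≡ leftMul x i j + leftMul y i j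
 leftMul-+ x y i j = trans (cong (λ z → coord z i) (distribʳH (O j) x y)) (coord-+ (x *H O j) (y *H O j) i)

 leftMul-* : ∀ x y i j → leftMul (x *H y) i j ≡ sumℚ (λ l → leftMul x i l * leftMul y l j)
 leftMul-* x y i j = begin
  coord ((x *H y) *H O j) i                           ≡⟨ cong (λ z → coord z i) (*H-assoc x y (O j)) ⟩
  coord (x *H (y *H O j)) i                           ≡⟨ cong (λ z → coord (x *H z) i) (sym (combine-coord (y *H O j))) ⟩
  coord (x *H combine (coord (y *H O j))) i           ≡⟨ cong (λ z → coord z i) (sym (MH.Σ-*ˡ x (λ l → coord (y *H O j) l ·H O l))) ⟩
  coord (sumH (λ l → x *H (coord (y *H O j) l ·H O l))) i
                            ≡⟨ coord-sum (λ l → x *H (coord (y *H O j) l ·H O l)) i ⟩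
  sumℚ (λ l → coord (x *H (coord (y *H O j) l ·H O l)) i)
                            ≡⟨ D.Σ-cong (λ l → step l) ⟩
  sumℚ (λ l → leftMul x i l * leftMul y l j)          ∎
  where
  open ≡-Reasoning
  step : ∀ l → coord (x *H (coord (y *H O j) l ·H O l)) i ≡ leftMul x i l * leftMul y l j
  step l = trans (cong (λ z → coord z i) (scale-*ʳ (coord (y *H O j) l) x (O l)))
   (trans (coord-· (coord (y *H O j) l) (x *H O l) i) (ℚ.*-comm (leftMul y l j) (leftMul x i l)))

 module BQ = Block a b a<0 b<0 isCommutativeRingℚ sumℚ (λ f → refl) (λ f → refl) _≟_ inv 1≢0ℚ 4 leftMul leftMul-0 leftMul-1 leftMul-+ leftMul-*

 pow4 : ℚ → ℚ
 pow4 q = q * (q * (q * (q * 1ℚ)))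

 leftMul-ι : ∀ q i j → leftMul (ι q) i j ≡ q * D.δ i j
 leftMul-ι q i j = trans (cong (λ z → coord z i) (sym (scale≡ι q (O j)))) (trans (coord-· q (O j) i) (cong (q *_) (coord-O i j)))

 -- Every quaternion is conjugate to its conjugate: conjugate by a pure quaternion
 -- orthogonal to its imaginary part.
 conjugator : ∀ x → ∃[ u ] (¬ (u ≡ 0H) × (u *H x ≡ conj x *H u))
 conjugator x with ⟨ 0ℚ , b * cj x , - (a * ci x) , 0ℚ ⟩ ≟H 0H
 ... | no h = ⟨ 0ℚ , b * cj x , - (a * ci x) , 0ℚ ⟩ , h , eq x
  where
  u : ℍ → ℍ
  u x = ⟨ 0ℚ , b * cj x , - (a * ci x) , 0ℚ ⟩
  eq : ∀ x → u x *H x ≡ conj x *H u x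
  eq x = law x 0H 0H (U ⊠ X) (bar X ⊠ U) refl refl refl refl
   where
   open Polynomial
   U = quat 0E (bE ⊙ q₂ X) (⊝ (aE ⊙ q₁ X)) 0E
 ... | yes e = ⟨ 0ℚ , 1ℚ , 0ℚ , 0ℚ ⟩ , (λ e → 1≢0ℚ (cong ci e)) , eq x ci≡0 cj≡0
  where
  ci≡0 : ci x ≡ 0ℚ
  ci≡0 = *-cancelˡ a (λ a≡0 → ℚ.<-irrefl a≡0 a<0)
   (trans (sym (neg-neg (a * ci x))) (trans (cong -_ (cong cj e)) (sym (ℚ.*-zeroʳ a))))
  cj≡0 : cj x ≡ 0ℚ
  cj≡0 = *-cancelˡ b (λ b≡0 → ℚ.<-irrefl b≡0 b<0) (trans (cong ci e) (sym (ℚ.*-zeroʳ b)))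
  eq : ∀ x → ci x ≡ 0ℚ → cj x ≡ 0ℚ → ⟨ 0ℚ , 1ℚ , 0ℚ , 0ℚ ⟩ *H x ≡ conj x *H ⟨ 0ℚ , 1ℚ , 0ℚ , 0ℚ ⟩
  eq ⟨ x₀ , .0ℚ , .0ℚ , x₃ ⟩ refl refl = law ⟨ x₀ , 0ℚ , 0ℚ , x₃ ⟩ 0H 0H (I ⊠ X₀) (bar X₀ ⊠ I) refl refl refl refl
   where
   open Polynomial
   I = quat 0E 1E 0E 0E
   X₀ = quat (q₀ X) 0E 0E (q₃ X)

 N₄ : ∀ {g} → MH.Mat g → ℚ
 N₄ = BQ.N

 χ : ∀ {g} → ℍ → ℚ
 χ {g} d = N₄ (MH.diag₀ {g} d)

 χ-* : ∀ {g} x y → χ {g} (x *H y) ≡ χ {g} x * χ {g} y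
 χ-* {g} x y = trans (sym (BQ.N-cong {suc g} {MH.diag₀ x MH.⊠ MH.diag₀ y} {MH.diag₀ (x *H y)} (EH.diag₀-mul x y))) (BQ.N-⊠ {suc g} (MH.diag₀ x) (MH.diag₀ y))

 χ-conj : ∀ {g} x → χ {g} (conj x) ≡ χ {g} x
 χ-conj {g} x = BQ.cancel-unit {χ {g} u} {χ {g} (proj₁ u⁻¹)}
   (BQ.N-invertible {suc g} {MH.diag₀ u} (BQ.diag-invertible u (proj₁ u⁻¹) (proj₁ (proj₂ u⁻¹)) (proj₂ (proj₂ u⁻¹))))
   (trans (ℚ.*-comm (χ {g} u) (χ {g} (conj x))) (trans (sym (χ-* {g} (conj x) u)) (trans (cong (χ {g}) (sym (proj₂ (proj₂ (conjugator x))))) (χ-* {g} u x))))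
  where
  u = proj₁ (conjugator x)
  u⁻¹ = inverseH u (proj₁ (proj₂ (conjugator x)))

 χ-square : ∀ {g} x → χ {g} x * χ {g} x ≡ pow4 (nrd x)
 χ-square {g} x = begin
  χ {g} x * χ {g} x           ≡⟨ cong (χ {g} x *_) (sym (χ-conj {g} x)) ⟩
  χ {g} x * χ {g} (conj x)    ≡⟨ sym (χ-* {g} x (conj x)) ⟩
  χ {g} (x *H conj x)         ≡⟨ cong (χ {g}) (*-conj x) ⟩
  χ {g} (ι (nrd x))           ≡⟨ BQ.N-scalar {g} (ι (nrd x)) (nrd x) (leftMul-ι (nrd x)) ⟩
  pow4 (nrd x)                ∎
  where open ≡-Reasoning

 -- The determinant of the integral representation is, up to sign, the square of the reduced norm.
 NormData : ∀ {g} → MH.Mat g → Set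
 NormData M = ∃[ ν ] ((0ℚ ≤ ν) × (BK.N M ≡ ν ⊕ 0ℚ α) × (N₄ M * N₄ M ≡ pow4 ν))

 norm-one : ∀ {g} (M : MH.Mat g) → BK.N M ≡ 1K → N₄ M ≡ 1ℚ → NormData M
 norm-one M h k = 1ℚ , ℚ.<⇒≤ (ℚ.positive⁻¹ 1ℚ) , h , trans (cong₂ _*_ k k) refl

 norm-elem : ∀ {g} {E : MH.Mat g} → MH.Elem E → NormData E
 norm-elem (MH.dia {g} d) = nrd d , nrd-nonneg d , N-diag {g} d , χ-square {g} d
 norm-elem (MH.upp {g} x) = norm-one (MH.upper {suc g} (MH.e₀ x)) (BK.N-upper {suc g} (MH.e₀ x)) (BQ.N-upper {suc g} (MH.e₀ x))
 norm-elem (MH.low {g} x) = norm-one (MH.lower {suc g} (MH.e₀ x)) (BK.N-lower {suc g} (MH.e₀ x)) (BQ.N-lower {suc g} (MH.e₀ x))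
 norm-elem (MH.sub {g} {M} e) = extend (norm-elem e)
  where
  extend : NormData M → NormData (MH.ext M)
  extend (ν , p , q , r) = ν , p , trans (BK.N-ext {g} M) q , trans (cong₂ _*_ (BQ.N-ext {g} M) (BQ.N-ext {g} M)) r

 norm-gen : ∀ {g} {M : MH.Mat g} → MH.Gen M → NormData M
 norm-gen (MH.idn {g} {M} h) = norm-one M (trans (BK.N-cong {g} {M} {MH.δ} h) (BK.N-δ {g})) (trans (BQ.N-cong {g} {M} {MH.δ} h) (BQ.N-δ {g}))
 norm-gen (MH.elm {g} {M} {E} e h) = transport (norm-elem e)
  where
  transport : NormData E → NormData M
  transport (ν , p , q , r) = ν , p , trans (BK.N-cong {g} {M} {E} h) q , trans (cong₂ _*_ (BQ.N-cong {g} {M} {E} h) (BQ.N-cong {g} {M} {E} h)) r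
 norm-gen (MH.mul {g} {L} {M} {M'} x y h) = multiply (norm-gen x) (norm-gen y)
  where
  N₄L : N₄ L ≡ N₄ M * N₄ M'
  N₄L = trans (BQ.N-cong {g} {L} {M MH.⊠ M'} h) (BQ.N-⊠ {g} M M')
  nn : ∀ {p q} → 0ℚ ≤ p → 0ℚ ≤ q → 0ℚ ≤ p * q
  nn {p} {q} h k = ℚ.nonNegative⁻¹ (p * q) {{ℚ.nonNeg*nonNeg⇒nonNeg p {{Data.Rational.nonNegative h}} q {{Data.Rational.nonNegative k}}}}
   where import Data.Rational
  l₁ : ∀ a ν ν' → ν * ν' + a * (0ℚ * 0ℚ) ≡ ν * ν'
  l₁ = solve-∀ ℚ-ring
  l₂ : ∀ ν ν' → ν * 0ℚ + 0ℚ * ν' ≡ 0ℚ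
  l₂ = solve-∀ ℚ-ring
  l₃ : ∀ x y → (x * y) * (x * y) ≡ (x * x) * (y * y)
  l₃ = solve-∀ ℚ-ring
  l₄ : ∀ x y → (x * (x * (x * (x * 1ℚ)))) * (y * (y * (y * (y * 1ℚ)))) ≡ (x * y) * ((x * y) * ((x * y) * ((x * y) * 1ℚ)))
  l₄ = solve-∀ ℚ-ring
  multiply : NormData M → NormData M' → NormData L
  multiply (ν , p , q , r) (ν' , p' , q' , r') = ν * ν' , nn p p' ,
    trans (BK.N-cong {g} {L} {M MH.⊠ M'} h) (trans (BK.N-⊠ {g} M M') (trans (cong₂ _*K_ q q') (cong₂ _⊕_α (l₁ a ν ν') (l₂ ν ν')))) ,
    trans (cong₂ _*_ N₄L N₄L) (trans (l₃ (N₄ M) (N₄ M')) (trans (cong₂ _*_ r r') (l₄ ν ν')))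

 norm-data : ∀ {g} (M : MH.Mat g) → NormData M
 norm-data M = norm-gen (EH.gen M)

 leftMul-int : ∀ {x} → x ∈O → ∀ i j → Int (leftMul x i j)
 leftMul-int h i j = ∈O⇒int (O-* h (O-gen j)) i

 int-leftMul : ∀ {x} → (∀ i j → Int (leftMul x i j)) → x ∈O
 int-leftMul {x} h = subst _∈O (*H-identityʳ x) (O-right {x} {1H} O-1 λ j → int⇒∈O {x *H O j} λ i → h i j)

 N₄-int : ∀ {g} (M : MH.Mat g) → MatO M → Int (N₄ M)
 N₄-int {g} M h = subst Int (sym (BQ.N≡det M)) (int-det (g ℕ.* 4) (BQ.block M) (λ r c → leftMul-int (h _ _) _ _))

 pow4-square : ∀ ν → pow4 ν ≡ (ν * ν) * (ν * ν)
 pow4-square ν = lem ν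
  where
  lem : ∀ ν → ν * (ν * (ν * (ν * 1ℚ))) ≡ (ν * ν) * (ν * ν)
  lem = solve-∀ ℚ-ring

 nrd-int : ∀ {x} → x ∈O → Int (nrd x)
 nrd-int {x} h = int-square-root (nrd x) (int-square-root (nrd x * nrd x) (subst Int (trans (χ-square {0} x) (pow4-square (nrd x))) (int-* N-int N-int)))
  where
  N-int : Int (χ {0} x)
  N-int = N₄-int (MH.diag₀ {0} x) λ { zero zero → h }

 trd-int : ∀ {x} → x ∈O → Int (trd x)
 trd-int {x} h = subst Int (lem x) (int-- (int-- (nrd-int (O-+ h O-1)) (nrd-int h)) int-1)
  where
  l : ∀ a b p q r s → ((p + 1ℚ) * (p + 1ℚ) - a * ((q + 0ℚ) * (q + 0ℚ)) - b * ((r + 0ℚ) * (r + 0ℚ)) + a * b * ((s + 0ℚ) * (s + 0ℚ)))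
   - (p * p - a * (q * q) - b * (r * r) + a * b * (s * s)) - 1ℚ ≡ p + p
  l = solve-∀ ℚ-ring
  lem : ∀ x → nrd (x +H 1H) - nrd x - 1ℚ ≡ trd x
  lem x = l a b (re x) (ci x) (cj x) (ck x)

 O-neg : ∀ {x} → x ∈O → negH x ∈O
 O-neg {x} h = subst _∈O (ℍ-≡ (l (re x)) (l (ci x)) (l (cj x)) (l (ck x))) (O-· (int-neg int-1) h)
  where
  l : ∀ p → (- 1ℚ) * p ≡ - p
  l = solve-∀ ℚ-ring

 conj≡trd- : ∀ x → conj x ≡ ι (trd x) +H negH x
 conj≡trd- x = ℍ-≡ (l (re x)) (sym (ℚ.+-identityˡ (- ci x))) (sym (ℚ.+-identityˡ (- cj x))) (sym (ℚ.+-identityˡ (- ck x)))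
  where
  l : ∀ p → p ≡ (p + p) + (- p)
  l = solve-∀ ℚ-ring

 O-conj : ∀ {x} → x ∈O → conj x ∈O
 O-conj {x} h = subst _∈O (sym (conj≡trd- x)) (O-+ (O-ι (trd-int h)) (O-neg h))

 Singular : ∀ {g} → MH.Mat g → Set
 Singular M = BK.N M ≡ 0K

 invertible⊎singular : ∀ {g} (M : MH.Mat g) → MH.Invertible M ⊎ Singular M
 invertible⊎singular = EH.Dichotomy.dichotomy Singular
  (λ {g} {M} {N} h k → trans (BK.N-cong {g} {M} {N} h) k)
  (λ {g} → trans (N-diag {g} 0H) (cong (_⊕ 0ℚ α) (l a b)))
  (λ {g} {M} k → trans (BK.N-ext {g} M) k)
  (λ {g} {M} {N} k _ → trans (BK.N-⊠ {g} M N) (trans (cong (_*K BK.N N) k) (zeroˡK (BK.N N))))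
  (λ {g} {M} {N} k → trans (BK.N-⊠ {g} M N) (trans (cong (BK.N M *K_) k) (trans (*K-comm (BK.N M) 0K) (zeroˡK (BK.N M)))))
  where
  l : ∀ a b → 0ℚ * 0ℚ - a * (0ℚ * 0ℚ) - b * (0ℚ * 0ℚ) + a * b * (0ℚ * 0ℚ) ≡ 0ℚ
  l = solve-∀ ℚ-ring

 inverse-integral : ∀ {g} (M M' : MH.Mat g) → M MH.⊠ M' MH.≈ MH.δ → MatO M → Nm M ≡ 1ℚ → MatO M'
 inverse-integral {g} M M' p hM h = integral
  where
  n = g ℕ.* 4
  RM RM' : BQ.Mat n
  RM = BQ.block M
  RM' = BQ.block M'
  D² : N₄ M * N₄ M ≡ 1ℚ
  D² = go (norm-data M)
   where
   go : NormData M → N₄ M * N₄ M ≡ 1ℚ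
   go (ν , _ , q , r) = trans r (cong pow4 (trans (cong K.kre (sym q)) (trans (sym (Nm≡N M)) h)))
  entry : ∀ r c → Int (RM' r c)
  entry r c = subst Int (trans (cong (N₄ M *_) (trans (BQ.det-cong n eq) (trans (BQ.cramer n RM r (λ k → RM' k c)) (cong (_* RM' r c) (sym (BQ.N≡det M))))))
    (trans (sym (ℚ.*-assoc (N₄ M) (N₄ M) (RM' r c))) (trans (cong (_* RM' r c) D²) (ℚ.*-identityˡ (RM' r c)))))
   (int-* (N₄-int M hM) (int-det n (BQ.replace r (λ i → BQ.δ i c) RM) int-replace))
   where
   block-product : (RM BQ.⊠ RM') BQ.≈ BQ.δ
   block-product i j = trans (sym (BQ.block-⊠ {g} M M' i j)) (trans (BQ.block-cong {g} {M MH.⊠ M'} {MH.δ} p i j) (BQ.block-δ {g} i j))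
   eq : BQ.replace r (λ i → BQ.δ i c) RM BQ.≈ BQ.replace r (λ i → sumℚ (λ l → RM i l * RM' l c)) RM
   eq = BQ.replace-cong r RM (λ i → sym (block-product i c))
   int-δ : ∀ {n} (i j : Fin n) → Int (BQ.δ i j)
   int-δ zero zero = int-1
   int-δ zero (suc j) = int-0
   int-δ (suc i) zero = int-0
   int-δ (suc i) (suc j) = int-δ i j
   int-replace : ∀ i j → Int (BQ.replace r (λ i → BQ.δ i c) RM i j)
   int-replace = BQ.replace-all Int r {M = RM} (λ i → int-δ i c) (λ i j → leftMul-int (hM _ _) _ _)
  integral : MatO M'
  integral i j = int-leftMul λ r s → subst Int (at r s) (entry (Data.Fin.combine i r) (Data.Fin.combine j s))
   where
   import Data.Fin
   open import Data.Fin.Properties using (remQuot-combine)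
   at : ∀ r s → RM' (Data.Fin.combine i r) (Data.Fin.combine j s) ≡ leftMul (M' i j) r s
   at r s = cong₂ (λ x y → leftMul (M' (proj₁ x) (proj₁ y)) (proj₂ x) (proj₂ y)) (remQuot-combine {g} {4} i r) (remQuot-combine {g} {4} j s)

 IntegralInverse : ∀ {g} → MH.Mat g → Set
 IntegralInverse {g} M = ∃ λ (M' : MH.Mat g) → MatO M' × (M MH.⊠ M' MH.≈ MH.δ) × (M' MH.⊠ M MH.≈ MH.δ)

 SL-inverse : ∀ {g} (M : MH.Mat g) → MatO M → Nm M ≡ 1ℚ → IntegralInverse M
 SL-inverse {g} M hM h = go (invertible⊎singular M)
  where
  go : MH.Invertible M ⊎ Singular M → IntegralInverse M
  go (inj₂ k) = ⊥-elim (1≢0ℚ (trans (sym h) (trans (Nm≡N M) (cong K.kre k))))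
  go (inj₁ (M' , p , p')) = M' , inverse-integral M M' p hM h , p , p'

 unit-Nm : ∀ {g} (M M' : MH.Mat g) → MatO M → MatO M' → M MH.⊠ M' MH.≈ MH.δ → Nm M ≡ 1ℚ
 unit-Nm {g} M M' h h' p = go (norm-data M)
  where
  DD' : N₄ M * N₄ M' ≡ 1ℚ
  DD' = trans (sym (BQ.N-⊠ {g} M M')) (trans (BQ.N-cong {g} {M MH.⊠ M'} {MH.δ} p) (BQ.N-δ {g}))
  go : NormData M → Nm M ≡ 1ℚ
  go (ν , ν≥0 , q , r) = trans (Nm≡N M) (trans (cong K.kre q) (sqrt-one ν≥0 (sqrt-one (square-nonneg ν)
    (trans (sym (pow4-square ν)) (trans (sym r) (unit-square (N₄-int M h) (N₄-int M' h') DD'))))))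

 surjective : ∀ q → 0ℚ < q → ∃[ x ] (nrd x ≡ q)
 surjective q q>0 = go (norm-surjective a<0 b<0 q>0)
  where
  go : Rep a b q → ∃[ x ] (nrd x ≡ q)
  go (rep x₀ x₁ x₂ x₃ e) = ⟨ x₀ , x₁ , x₂ , x₃ ⟩ , e

 +-conj : ∀ x → x +H conj x ≡ ι (trd x)
 +-conj x = ℍ-≡ refl (ℚ.+-inverseʳ (ci x)) (ℚ.+-inverseʳ (cj x)) (ℚ.+-inverseʳ (ck x))

 O-ι-int : ∀ {q} → ι q ∈O → Int q
 O-ι-int {q} h = int-square-root q (subst Int (lem a b q) (nrd-int h))
  where
  lem : ∀ a b q → q * q - a * (0ℚ * 0ℚ) - b * (0ℚ * 0ℚ) + a * b * (0ℚ * 0ℚ) ≡ q * q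
  lem = solve-∀ ℚ-ring

 coordinates : ∀ {x} → x ∈O → ∃ λ (n : Fin 4 → ℚ) → (∀ i → Int (n i)) × (x ≡ (ι (n zero) *H O zero) +H ((ι (n (suc zero)) *H O (suc zero)) +H
  ((ι (n (suc (suc zero))) *H O (suc (suc zero))) +H (ι (n (suc (suc (suc zero)))) *H O (suc (suc (suc zero)))))))
 coordinates {x} h = coord x , ∈O⇒int h , trans (sym (combine-coord x)) (cong₂ _+H_ (s zero) (cong₂ _+H_ (s (suc zero)) (cong₂ _+H_ (s (suc (suc zero)))
   (trans (+H-identityʳ (coord x (suc (suc (suc zero))) ·H O (suc (suc (suc zero))))) (s (suc (suc (suc zero))))))))
  where
  s : ∀ i → coord x i ·H O i ≡ ι (coord x i) *H O i
  s i = scale≡ι (coord x i) (O i)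

 common-denominator : ∀ n (f : Fin n → ℚ) → ∃[ d ] ((0 ℕ.< d) × (∀ i → Int (fromℕ d * f i)))
 common-denominator zero f = 1 , ℕ.s≤s ℕ.z≤n , λ ()
 common-denominator (suc n) f = go (denominator (f zero)) (common-denominator n (f ∘ suc))
  where
  l₁ : ∀ d e x → e * (d * x) ≡ (d * e) * x
  l₁ = solve-∀ ℚ-ring
  l₂ : ∀ d e x → d * (e * x) ≡ (d * e) * x
  l₂ = solve-∀ ℚ-ring
  go : ∃[ d ] ((0 ℕ.< d) × Int (fromℕ d * f zero)) → ∃[ d ] ((0 ℕ.< d) × (∀ i → Int (fromℕ d * f (suc i)))) → ∃[ d ] ((0 ℕ.< d) × (∀ i → Int (fromℕ d * f i)))
  go (suc d , d>0 , h) (suc e , e>0 , k) = suc d ℕ.* suc e , ℕ.s≤s ℕ.z≤n , λ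
   { zero → subst Int (trans (l₁ (fromℕ (suc d)) (fromℕ (suc e)) (f zero)) (cong (_* f zero) (sym (fromℕ-* (suc d) (suc e))))) (int-* (int-ℕ (suc e)) h)
   ; (suc i) → subst Int (trans (l₂ (fromℕ (suc d)) (fromℕ (suc e)) (f (suc i))) (cong (_* f (suc i)) (sym (fromℕ-* (suc d) (suc e))))) (int-* (int-ℕ (suc d)) (k i)) }

 clear-denominators : ∀ x → ∃[ d ] ((0 ℕ.< d) × (ι (fromℕ d) *H x) ∈O)
 clear-denominators x = go (common-denominator 4 (coord x))
  where
  go : ∃[ d ] ((0 ℕ.< d) × (∀ i → Int (fromℕ d * coord x i))) → ∃[ d ] ((0 ℕ.< d) × (ι (fromℕ d) *H x) ∈O)
  go (d , d>0 , h) = d , d>0 , subst _∈O (scale≡ι (fromℕ d) x) (int⇒∈O λ i → subst Int (sym (coord-· (fromℕ d) x i)) (h i))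

 units : Fin 4 → ℍ
 units zero = ⟨ 1ℚ , 0ℚ , 0ℚ , 0ℚ ⟩
 units (suc zero) = ⟨ 0ℚ , 1ℚ , 0ℚ , 0ℚ ⟩
 units (suc (suc zero)) = ⟨ 0ℚ , 0ℚ , 1ℚ , 0ℚ ⟩
 units (suc (suc (suc zero))) = ⟨ 0ℚ , 0ℚ , 0ℚ , 1ℚ ⟩

 comp-units : ∀ r s → comp r (units s) ≡ DetInt.δ r s
 comp-units = toWitness {a? = all? λ r → all? λ s → comp r (units s) ≟ DetInt.δ r s} tt

 Z : List ℍ → ℍ → Set
 Z = IntegerSpan _+H_ 0H (λ z x → ι z *H x)

 Z⇒ℤspan : ∀ n (e : Fin n → ℍ) {x} → Z (tabulate e) x → ∃ λ (k : Fin n → _) → x ≡ sumH (λ i → ℤ→ℚ (k i) ·H e i)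
 Z⇒ℤspan zero e refl = (λ ()) , refl
 Z⇒ℤspan (suc n) e (z , y , (m , refl) , hy , refl) = go (Z⇒ℤspan n (e ∘ suc) hy)
  where
  go : (∃ λ (k : Fin n → _) → y ≡ sumH (λ i → ℤ→ℚ (k i) ·H e (suc i))) → ∃ λ (k : Fin (suc n) → _) → (ι (ℤ→ℚ m) *H e zero) +H y ≡ sumH (λ i → ℤ→ℚ (k i) ·H e i)
  go (k , h) = (λ { zero → m ; (suc i) → k i }) , cong₂ _+H_ (sym (scale≡ι (ℤ→ℚ m) (e zero))) h

 ℤspan⇒Z : ∀ n (e : Fin n → ℍ) (k : Fin n → _) → Z (tabulate e) (sumH (λ i → ℤ→ℚ (k i) ·H e i))
 ℤspan⇒Z zero e k = refl
 ℤspan⇒Z (suc n) e k = ℤ→ℚ (k zero) , sumH (λ i → ℤ→ℚ (k (suc i)) ·H e (suc i)) , (k zero , refl) , ℤspan⇒Z n (e ∘ suc) (k ∘ suc) ,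
  cong (_+H sumH (λ i → ℤ→ℚ (k (suc i)) ·H e (suc i))) (scale≡ι (ℤ→ℚ (k zero)) (e zero))

 maximality : ∀ (e : Fin 4 → ℍ) → (∀ (c : Fin 4 → ℚ) → (∀ r → sumℚ (λ i → c i * comp r (e i)) ≡ 0ℚ) → ∀ i → c i ≡ 0ℚ) →
  (∀ x → x ∈O → Z (tabulate e) x) → (∀ x y → Z (tabulate e) x → Z (tabulate e) y → Z (tabulate e) (x *H y)) → ∀ x → Z (tabulate e) x → x ∈O
 maximality e ind cover closed x hx = proj₂ maximal e (indep , Z⇒ℤspan 4 e (cover 1H O-1) , λ i j → Z⇒ℤspan 4 e (closed (e i) (e j) (member i) (member j)))
   (λ y hy → Z⇒ℤspan 4 e (cover y hy)) x (Z⇒ℤspan 4 e hx)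
  where
  indep : ∀ (c : Fin 4 → ℚ) → sumH (λ i → c i ·H e i) ≡ 0H → ∀ i → c i ≡ 0ℚ
  indep c h = ind c λ r → trans (DetInt.Σ-cong {f = λ i → c i * comp r (e i)} (λ i → sym (comp-· r (c i) (e i)))) (trans (sym (comp-sum r (λ i → c i ·H e i))) (trans (cong (comp r) h) (comp-0 r)))
  member : ∀ i → Z (tabulate e) (e i)
  member i = go (int-δ i)
   where
   int-δ : ∀ i j → Int (DetInt.δ {4} i j)
   int-δ i j = entry i j
    where
    entry : ∀ {n} (i j : Fin n) → Int (DetInt.δ i j)
    entry zero zero = int-1
    entry zero (suc j) = int-0
    entry (suc i) zero = int-0
    entry (suc i) (suc j) = entry i j
   go : (∀ j → Int (DetInt.δ i j)) → Z (tabulate e) (e i)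
   go h = subst (Z (tabulate e)) eq (ℤspan⇒Z 4 e (λ j → proj₁ (h j)))
    where
    eq : sumH (λ j → ℤ→ℚ (proj₁ (h j)) ·H e j) ≡ e i
    eq = comp-≡ λ r → trans (comp-sum r (λ j → ℤ→ℚ (proj₁ (h j)) ·H e j)) (trans (DetInt.Σ-cong {f = λ j → comp r (ℤ→ℚ (proj₁ (h j)) ·H e j)} {g = λ j → DetInt.δ i j * comp r (e j)}
     (λ j → trans (comp-· r (ℤ→ℚ (proj₁ (h j))) (e j)) (cong (_* comp r (e j)) (sym (proj₂ (h j)))))) (DetInt.Σ-δˡ i (λ j → comp r (e j))))

 central⇒rational : ∀ q → (∀ x → x ∈O → x *H q ≡ q *H x) → ∃[ r ] (q ≡ ι r)
 central⇒rational q comm = re q , ℍ-≡ refl (half (ci q) eᵢ) (half (cj q) eⱼ) (half (ck q) eₖ)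
  where
  all : ∀ x → x *H q ≡ q *H x
  all x = go (clear-denominators x)
   where
   go : ∃[ d ] ((0 ℕ.< d) × (ι (fromℕ d) *H x) ∈O) → x *H q ≡ q *H x
   go (d , d>0 , h) = comp-≡ λ r → *-cancelˡ (fromℕ d) (pos≢0 d>0) (trans (sym (comp-· r (fromℕ d) (x *H q))) (trans (cong (comp r) eq) (comp-· r (fromℕ d) (q *H x))))
    where
    eq : fromℕ d ·H (x *H q) ≡ fromℕ d ·H (q *H x)
    eq = trans (sym (scale-*ˡ (fromℕ d) x q)) (trans (cong (_*H q) (scale≡ι (fromℕ d) x)) (trans (comm (ι (fromℕ d) *H x) h) (trans (cong (q *H_) (sym (scale≡ι (fromℕ d) x))) (scale-*ʳ (fromℕ d) q x))))
  half : ∀ x → x + x ≡ 0ℚ → x ≡ 0ℚ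
  half x e = go (*-zero {1ℚ + 1ℚ} {x} (trans (lem x) e))
   where
   lem : ∀ x → (1ℚ + 1ℚ) * x ≡ x + x
   lem = solve-∀ ℚ-ring
   go : (1ℚ + 1ℚ ≡ 0ℚ) ⊎ (x ≡ 0ℚ) → x ≡ 0ℚ
   go (inj₁ ())
   go (inj₂ h) = h
  i₁ = ⟨ 0ℚ , 1ℚ , 0ℚ , 0ℚ ⟩
  j₁ = ⟨ 0ℚ , 0ℚ , 1ℚ , 0ℚ ⟩
  eₖ : ck q + ck q ≡ 0ℚ
  eₖ = *-cancelˡ a (<⇒≢0 (neg-pos a<0) ∘ λ e → trans (cong -_ e) refl) (trans (lem₁ a (re q) (ci q) (cj q) (ck q)) (trans (cong (λ z → z - cj (q *H i₁)) (cong cj (all i₁))) (trans (lem₂ (cj (q *H i₁)) ) (sym (ℚ.*-zeroʳ a)))))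
   where
   lem₂ : ∀ x → x - x ≡ 0ℚ
   lem₂ = solve-∀ ℚ-ring
   lem₁ : ∀ a p q r s → a * (s + s) ≡ (0ℚ * r + 0ℚ * p + a * (1ℚ * s) - a * (0ℚ * q)) - (p * 0ℚ + r * 0ℚ + a * (q * 0ℚ) - a * (s * 1ℚ))
   lem₁ = solve-∀ ℚ-ring
  eⱼ : cj q + cj q ≡ 0ℚ
  eⱼ = trans (lem₁ (re q) (ci q) (cj q) (ck q)) (trans (cong (λ z → z - ck (q *H i₁)) (cong ck (all i₁))) (lem₂ (ck (q *H i₁))))
   where
   lem₂ : ∀ x → x - x ≡ 0ℚ
   lem₂ = solve-∀ ℚ-ring
   lem₁ : ∀ p q r s → r + r ≡ (0ℚ * s + 0ℚ * p + 1ℚ * r - 0ℚ * q) - (p * 0ℚ + s * 0ℚ + q * 0ℚ - r * 1ℚ)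
   lem₁ = solve-∀ ℚ-ring
  eᵢ : ci q + ci q ≡ 0ℚ
  eᵢ = trans (lem₁ (re q) (ci q) (cj q) (ck q)) (trans (cong (λ z → ck (q *H j₁) - z) (cong ck (all j₁))) (lem₂ (ck (q *H j₁))))
   where
   lem₂ : ∀ x → x - x ≡ 0ℚ
   lem₂ = solve-∀ ℚ-ring
   lem₁ : ∀ p q r s → q + q ≡ (p * 0ℚ + s * 0ℚ + q * 1ℚ - r * 0ℚ) - (0ℚ * s + 0ℚ * p + 0ℚ * r - 1ℚ * q)
   lem₁ = solve-∀ ℚ-ring

 𝕊 : Setup
 𝕊 = record
  { H = ℍ ; _+_ = _+H_ ; _*_ = _*H_ ; -_ = negH ; 0# = 0H ; 1# = 1H ; isRing = isRingH ; _≟_ = _≟H_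
  ; conj = conj ; conj-+ = conj-+ ; conj-* = conj-* ; conj-conj = conj-conj ; conj-1 = conj-ι 1ℚ
  ; ι = ι ; ι-comm = ι-central ; conj-ι = conj-ι ; ι-+ = ι-add ; ι-* = ι-mul ; ι-0 = refl ; ι-1 = refl ; ι-injective = ι-inj
  ; nrd = nrd ; trd = trd ; *-conj = *-conj ; conj-*ˡ = conj-*ˡ ; +-conj = +-conj ; nrd-pos = nrd-pos ; nrd-surjective = surjective
  ; InO = _∈O ; InO? = ∈O? ; O-0 = O-0 ; O-1 = O-1 ; O-+ = O-+ ; O-neg = O-neg ; O-* = O-* ; O-conj = O-conj ; O-ι = O-ι ; O-int = O-ι-int
  ; basis = O ; O-basis = O-gen ; O-coord = coordinates ; O-denominator = clear-denominators
  ; coordinate = comp ; coordinate-+ = comp-+ ; coordinate-ι = λ r q x → trans (cong (comp r) (sym (scale≡ι q x))) (comp-· r q x) ; coordinate-≡ = comp-≡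
  ; unit = units ; coordinate-unit = comp-units ; O-maximal = maximality ; O-noncommutative = central⇒rational }

 fixed⇒rational : ∀ {x} → conj x ≡ x → x ≡ ι (re x)
 fixed⇒rational {x} h = ℍ-≡ refl (neg-fixed (ci x) (cong ci h)) (neg-fixed (cj x) (cong cj h)) (neg-fixed (ck x) (cong ck h))
  where
  neg-fixed : ∀ p → - p ≡ p → p ≡ 0ℚ
  neg-fixed p e = go (*-zero {1ℚ + 1ℚ} {p} (trans (lem p) (trans (cong (_+ p) (sym e)) (ℚ.+-inverseˡ p))))
   where
   lem : ∀ p → (1ℚ + 1ℚ) * p ≡ p + p
   lem = solve-∀ ℚ-ring
   go : (1ℚ + 1ℚ ≡ 0ℚ) ⊎ (p ≡ 0ℚ) → p ≡ 0ℚ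
   go (inj₁ ())
   go (inj₂ z) = z

 module C = StarMatrix isRingH sumH (λ _ → refl) (λ _ → refl) conj conj-+ conj-* refl refl
 open C using (_▹_)

 IdM≈δ : ∀ {g} (i j : Fin g) → IdM i j ≡ MH.δ i j
 IdM≈δ i j with Data.Fin._≟_ i j
 ... | yes refl = sym (BK.δH-yes i)
 ... | no h = sym (BK.δH-no i j h)

 scale-scale : ∀ p q x → p ·H (q ·H x) ≡ (p * q) ·H x
 scale-scale p q x = ℍ-≡ (sym (ℚ.*-assoc p q (re x))) (sym (ℚ.*-assoc p q (ci x))) (sym (ℚ.*-assoc p q (cj x))) (sym (ℚ.*-assoc p q (ck x)))

 scale-1 : ∀ x → 1ℚ ·H x ≡ x
 scale-1 x = ℍ-≡ (ℚ.*-identityˡ (re x)) (ℚ.*-identityˡ (ci x)) (ℚ.*-identityˡ (cj x)) (ℚ.*-identityˡ (ck x))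

 scale-conj : ∀ q x → conj (q ·H x) ≡ q ·H conj x
 scale-conj q x = ℍ-≡ refl (ℚ.neg-distribʳ-* q (ci x)) (ℚ.neg-distribʳ-* q (cj x)) (ℚ.neg-distribʳ-* q (ck x))

 scale-inverse : ∀ {p q} x → p * q ≡ 1ℚ → p ·H (q ·H x) ≡ x
 scale-inverse {p} {q} x e = trans (scale-scale p q x) (trans (cong (_·H x) e) (scale-1 x))

 scale-sum : ∀ {n} q (f : Fin n → ℍ) → sumH (λ k → q ·H f k) ≡ q ·H sumH f
 scale-sum q f = trans (MH.Σ-cong {f = λ k → q ·H f k} (λ k → scale≡ι q (f k))) (trans (MH.Σ-*ˡ (ι q) f) (sym (scale≡ι q (sumH f))))

 ▹-scale : ∀ {g} (M : Mat g) q v i → (M ▹ (λ k → q ·H v k)) i ≡ q ·H (M ▹ v) i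
 ▹-scale M q v i = trans (MH.Σ-cong {f = λ k → M i k *H (q ·H v k)} (λ k → scale-*ʳ q (M i k) (v k))) (scale-sum q (λ k → M i k *H v k))

 scale-▹ : ∀ {g} q (M : Mat g) v i → ((λ i j → q ·H M i j) ▹ v) i ≡ q ·H (M ▹ v) i
 scale-▹ q M v i = trans (MH.Σ-cong {f = λ k → (q ·H M i k) *H v k} (λ k → scale-*ˡ q (M i k) (v k))) (scale-sum q (λ k → M i k *H v k))

 H₀-scale : ∀ {g} (x : Vec g) q y → H₀ x (λ k → q ·H y k) ≡ q ·H H₀ x y
 H₀-scale x q y = trans (MH.Σ-cong {f = λ k → conj (x k) *H (q ·H y k)} (λ k → scale-*ʳ q (conj (x k)) (y k))) (scale-sum q (λ k → conj (x k) *H y k))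

 scalar : ∀ {g} → ℚ → Mat g
 scalar q i j = q ·H MH.δ i j

 scalar-⊠ : ∀ {g} q (M : Mat g) → (scalar q ⊗ M) ≈M (λ i j → q ·H M i j)
 scalar-⊠ q M i j = trans (scale-▹ q MH.δ (λ k → M k j) i) (cong (q ·H_) (MH.⊠-identityˡ M i j))

 ⊠-scalar : ∀ {g} q (M : Mat g) → (M ⊗ scalar q) ≈M (λ i j → q ·H M i j)
 ⊠-scalar q M i j = trans (▹-scale M q (λ k → MH.δ k j) i) (cong (q ·H_) (MH.⊠-identityʳ M i j))

 scalar-central : ∀ {g} q (M : Mat g) → (scalar q ⊗ M) ≈M (M ⊗ scalar q)
 scalar-central q M i j = trans (scalar-⊠ q M i j) (sym (⊠-scalar q M i j))

 scalar-inverse : ∀ {g p q} → p * q ≡ 1ℚ → (scalar {g} p ⊗ scalar q) ≈M MH.δ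
 scalar-inverse {p = p} {q} e i j = trans (scalar-⊠ p (scalar q) i j) (scale-inverse {p} {q} (MH.δ i j) e)

 -- Matrix identities are applied through these instances, in which every matrix is a variable: otherwise
 -- the comparison of types would multiply out the products of quaternions.
 isometry : ∀ {g} (M N M' H H' V W U : Mat g) → ((M †) ⊗ M) ≈M H → (M ⊗ N) ≈M MH.δ → ((M' †) ⊗ M') ≈M H' → ((V †) ⊗ (H ⊗ V)) ≈M H' →
  (V ⊗ W) ≈M MH.δ → U ≈M (M' ⊗ (W ⊗ N)) → ((U †) ⊗ U) ≈M MH.δ
 isometry {g} M N M' H H' V W U = C.StarLemmas.isometry g {M} {N} {M'} {H} {H'} {V} {W} {U}

 similitude : ∀ {g} (M M' N' H H' U V s : Mat g) → ((M †) ⊗ M) ≈M H → (M' ⊗ N') ≈M MH.δ → ((M' †) ⊗ M') ≈M H' → ((U †) ⊗ U) ≈M s →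
  (s ⊗ M) ≈M (M ⊗ s) → V ≈M (N' ⊗ (U ⊗ M)) → ((V †) ⊗ (H' ⊗ V)) ≈M (H ⊗ s)
 similitude {g} M M' N' H H' U V s = C.StarLemmas.similitude g {M} {M'} {N'} {H} {H'} {U} {V} {s}

 similitude-back : ∀ {g} (H H' V W s t : Mat g) → ((V †) ⊗ (H' ⊗ V)) ≈M (H ⊗ s) → (V ⊗ W) ≈M MH.δ → (s ⊗ t) ≈M MH.δ →
  (∀ X → (s ⊗ X) ≈M (X ⊗ s)) → ((W †) ⊗ (H ⊗ W)) ≈M (H' ⊗ t)
 similitude-back {g} H H' V W s t = C.StarLemmas.similitude-back g {H} {H'} {V} {W} {s} {t}

 rescaled-isometry : ∀ {g} (M M₁ N₁ s t U : Mat g) → ((M₁ †) ⊗ M₁) ≈M (s ⊗ ((M †) ⊗ M)) → (M₁ ⊗ N₁) ≈M MH.δ → (t ⊗ s) ≈M MH.δ →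
  (∀ X → (s ⊗ X) ≈M (X ⊗ s)) → U ≈M (M ⊗ N₁) → ((U †) ⊗ U) ≈M t
 rescaled-isometry {g} M M₁ N₁ s t U = C.StarLemmas.rescaled-isometry g {M} {M₁} {N₁} {s} {t} {U}

 inverse-of-product : ∀ {g} (A B X Y : Mat g) → Y ≈M (B ⊗ X) → (A ⊗ B) ≈M MH.δ → (A ⊗ Y) ≈M X
 inverse-of-product {g} A B X Y e h i j = trans (C.▹-congʳ A {λ k → Y k j} {λ k → (B ⊗ X) k j} (λ k → e k j) i) (C.StarLemmas.left-cancel g {A} {B} h X i j)

 sum-norms : ∀ {n} (x : Vec n) → H₀ x x ≡ ι (sumℚ (λ k → nrd (x k)))
 sum-norms {zero} x = refl
 sum-norms {suc n} x = trans (cong₂ _+H_ (conj-*ˡ (x zero)) (sum-norms (x ∘ suc))) (sym (ι-add (nrd (x zero)) (sumℚ (λ k → nrd (x (suc k))))))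

 sum-nonneg : ∀ {n} (x : Vec n) → 0ℚ ≤ sumℚ (λ k → nrd (x k))
 sum-nonneg {zero} x = ℚ.≤-refl
 sum-nonneg {suc n} x = subst (_≤ nrd (x zero) + sumℚ (λ k → nrd (x (suc k)))) (ℚ.+-identityˡ 0ℚ) (ℚ.+-mono-≤ (nrd-nonneg (x zero)) (sum-nonneg (x ∘ suc)))

 sum-zero : ∀ {n} (x : Vec n) → sumℚ (λ k → nrd (x k)) ≡ 0ℚ → ∀ k → x k ≡ 0H
 sum-zero {suc n} x e = go (+-nonneg-zero (nrd-nonneg (x zero)) (sum-nonneg (x ∘ suc)) e)
  where
  go : (nrd (x zero) ≡ 0ℚ) × (sumℚ (λ k → nrd (x (suc k))) ≡ 0ℚ) → ∀ k → x k ≡ 0H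
  go (p , q) zero = nrd-zero (x zero) p
  go (p , q) (suc k) = sum-zero (x ∘ suc) q k

 sum-positive : ∀ {n} (x : Vec n) → ¬ (∀ k → x k ≡ 0H) → 0ℚ < sumℚ (λ k → nrd (x k))
 sum-positive x h = go (ℚ.<-cmp 0ℚ (sumℚ (λ k → nrd (x k))))
  where
  go : Relation.Binary.Tri (0ℚ < sumℚ (λ k → nrd (x k))) (0ℚ ≡ sumℚ (λ k → nrd (x k))) (sumℚ (λ k → nrd (x k)) < 0ℚ) → 0ℚ < sumℚ (λ k → nrd (x k))
  go (tri< p _ _) = p
  go (tri≈ _ p _) = ⊥-elim (h (sum-zero x (sym p)))
  go (tri> _ _ p) = ⊥-elim (ℚ.<-irrefl refl (ℚ.≤-<-trans (sum-nonneg x) p))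

 IntV : ∀ {n} → Vec n → Set
 IntV v = ∀ k → v k ∈O

 ▹-int : ∀ {g} {M : Mat g} {v} → MatO M → IntV v → IntV (M ▹ v)
 ▹-int h k i = O-sum (λ j → O-* (h i j) (k j))

 ⊗-int : ∀ {g} {M N : Mat g} → MatO M → MatO N → MatO (M ⊗ N)
 ⊗-int h k i j = O-sum (λ l → O-* (h i l) (k l j))

 †-int : ∀ {g} {M : Mat g} → MatO M → MatO (M †)
 †-int h i j = O-conj (h j i)

 int-≈ : ∀ {g} {M N : Mat g} → M ≈M N → MatO M → MatO N
 int-≈ e h i j = subst _∈O (e i j) (h i j)

 δ-int : ∀ {n} (i j : Fin n) → MH.δ i j ∈O
 δ-int zero zero = O-1
 δ-int zero (suc j) = O-0
 δ-int (suc i) zero = O-0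
 δ-int (suc i) (suc j) = δ-int i j

 columns : ∀ {g} → Mat g → Lat g
 columns {g} M = record { m = g ; gens = λ k i → M i k }

 column-∈ : ∀ {g} (M : Mat g) k → (λ i → M i k) ∈L columns M
 column-∈ M k = (λ l → MH.δ l k) , (λ l → δ-int l k) , λ i → sym (MH.⊠-identityʳ M i k)

 clear-vector : ∀ {n} (v : Vec n) → ∃[ d ] ((0 ℕ.< d) × (∀ k → (ℤ→ℚ (+ d) ·H v k) ∈O))
 clear-vector {zero} v = 1 , ℕ.s≤s ℕ.z≤n , λ ()
 clear-vector {suc n} v = go (clear-denominators (v zero)) (clear-vector (v ∘ suc))
  where
  go : ∃[ d ] ((0 ℕ.< d) × (ι (fromℕ d) *H v zero) ∈O) → ∃[ d ] ((0 ℕ.< d) × (∀ k → (ℤ→ℚ (+ d) ·H v (suc k)) ∈O)) → ∃[ d ] ((0 ℕ.< d) × (∀ k → (ℤ→ℚ (+ d) ·H v k) ∈O))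
  go (suc d , _ , h) (suc e , _ , k) = suc d ℕ.* suc e , ℕ.s≤s ℕ.z≤n , λ
    { zero → subst _∈O (trans (cong (E ·H_) (sym (scale≡ι D (v zero)))) (trans (scale-scale E D (v zero)) (cong (_·H v zero) (trans (ℚ.*-comm E D) DE)))) (O-· (int-ℕ (suc e)) h)
    ; (suc i) → subst _∈O (trans (scale-scale D (ℤ→ℚ (+ suc e)) (v (suc i))) (cong (_·H v (suc i)) (trans (cong (D *_) (sym (fromℕ≡ (suc e)))) DE))) (O-· (int-ℕ (suc d)) (k i)) }
   where
   D = fromℕ (suc d)
   E = fromℕ (suc e)
   DE : D * E ≡ ℤ→ℚ (+ (suc d ℕ.* suc e))
   DE = trans (sym (fromℕ-* (suc d) (suc e))) (fromℕ≡ (suc d ℕ.* suc e))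

 module Principal {g} {M H N : Mat g} (gram : ((M †) ⊗ M) ≈M H) (MN : (M ⊗ N) ≈M MH.δ) (NM : (N ⊗ M) ≈M MH.δ)
  (int : MatO H) (norm : Nm H ≡ 1ℚ) where
  H-inverse : IntegralInverse H
  H-inverse = SL-inverse H int norm

  full : ∀ (x : Vec g) → ∃[ d ] ((0 ℕ.< d) × ((λ i → ℤ→ℚ (+ d) ·H x i) ∈L columns M))
  full x = go (clear-vector (N ▹ x))
   where
   go : ∃[ d ] ((0 ℕ.< d) × (∀ k → (ℤ→ℚ (+ d) ·H (N ▹ x) k) ∈O)) → ∃[ d ] ((0 ℕ.< d) × ((λ i → ℤ→ℚ (+ d) ·H x i) ∈L columns M))
   go (d , d>0 , h) = d , d>0 , (λ k → ℤ→ℚ (+ d) ·H (N ▹ x) k) , h , λ i →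
    sym (trans (▹-scale M (ℤ→ℚ (+ d)) (N ▹ x) i) (cong (ℤ→ℚ (+ d) ·H_) (C.▹-inverse {M = M} {N} MN x i)))

  integral : ∀ x y → x ∈L columns M → y ∈L columns M → (1ℚ ·H H₀ x y) ∈O
  integral x y (o , io , ex) (p , ip , ey) = O-· int-1 (subst _∈O (sym eq) (O-sum (λ k → O-* (O-conj (io k)) (▹-int {M = H} int ip k))))
   where
   eq : H₀ x y ≡ H₀ o (H ▹ p)
   eq = trans (C.form-cong {x = x} {M ▹ o} {y} {M ▹ p} ex ey) (trans (C.form-gram M o p) (C.form-cong {x = o} {o} {((M †) ⊗ M) ▹ p} {H ▹ p} (λ _ → refl) (C.▹-cong {v = p} {p} gram (λ _ → refl))))

  dual : ∀ y → (∀ x → x ∈L columns M → (1ℚ ·H H₀ x y) ∈O) → y ∈L columns M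
  dual y h = go H-inverse
   where
   o = N ▹ y
   Ho : ∀ k → (H ▹ o) k ≡ 1ℚ ·H H₀ (λ i → M i k) y
   Ho k = sym (trans (scale-1 _) (trans (sym (C.▹-congʳ (M †) {M ▹ o} {y} (C.▹-inverse {M = M} {N} MN y) k))
    (trans (sym (C.▹-⊠ (M †) M o k)) (C.▹-cong {v = o} {o} gram (λ _ → refl) k))))
   go : IntegralInverse H → y ∈L columns M
   go (H' , iH' , _ , H'H) = o , (λ k → subst _∈O (C.▹-inverse {M = H'} {H} H'H o k) (▹-int {M = H'} {H ▹ o} iH' (λ l → subst _∈O (sym (Ho l)) (h _ (column-∈ M l))) k)) ,
    λ i → sym (C.▹-inverse {M = M} {N} MN y i)

  principal : IsPPLattice (columns M)
  principal = full , 1ℚ , 1≢0ℚ , integral , dual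

 one-norm : ∀ {g} (H : Mat g) → HNm≡ H 1 → Nm H ≡ 1ℚ
 one-norm H (_ , e) = sym e

 Root : ∀ {g} → Mat g → Set
 Root {g} H = ∃ λ (M : Mat g) → (((M †) ⊗ M) ≈M H) × ∃ λ (N : Mat g) → ((M ⊗ N) ≈M MH.δ) × ((N ⊗ M) ≈M MH.δ)

 root : ∀ {g} (x : 𝓗₁ g) → Root (proj₁ x)
 root {g} (H , _ , herm , pos , _) = go (IdealTheory.Cholesky.cholesky 𝕊 sumH (λ _ → refl) (λ _ → refl) re fixed⇒rational g H herm pos)
  where
  go : (∃ λ (M : Mat g) → ((M †) ⊗ M) ≈M H) → Root H
  go (M , gram) = M , gram , inverse (EH.invertible⊎kernel M)
   where
   inverse : MH.Invertible M ⊎ EH.Kernel M → ∃ λ (N : Mat g) → ((M ⊗ N) ≈M MH.δ) × ((N ⊗ M) ≈M MH.δ)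
   inverse (inj₁ h) = h
   inverse (inj₂ (v , (i , vi) , Mv)) = ⊥-elim (ℚ.<-irrefl refl (subst (0ℚ <_) (cong re value) (pos v λ z → vi (z i))))
    where
    value : H₀ v (H ▹ v) ≡ 0H
    value = trans (C.form-cong {x = v} {v} {H ▹ v} {((M †) ⊗ M) ▹ v} (λ _ → refl) (C.▹-cong {v = v} {v} (λ i j → sym (gram i j)) (λ _ → refl)))
     (trans (sym (C.form-gram M v v)) (MH.Σ-zero {f = λ k → conj ((M ▹ v) k) *H (M ▹ v) k} (λ k → trans (cong (conj ((M ▹ v) k) *H_) (Mv k)) (+H-*-zero (conj ((M ▹ v) k))))))
     where
     +H-*-zero : ∀ x → x *H 0H ≡ 0H
     +H-*-zero x = trans (*-ι 0ℚ x) (ℍ-≡ (ℚ.*-zeroˡ (re x)) (ℚ.*-zeroˡ (ci x)) (ℚ.*-zeroˡ (cj x)) (ℚ.*-zeroˡ (ck x)))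

 Similar : ∀ {g} → Lat g → Lat g → Set
 Similar {g} L L' = ∃ λ (U : Mat g) → IsGU U × (∀ v → v ∈L L → (U ▹ v) ∈L L') × (∀ w → w ∈L L' → ∃[ v ] (v ∈L L × (U ▹ v) ≈V w))

 toLattice : ∀ {g} → 𝓗₁ g → 𝓛 g
 toLattice x@(H , int , _ , _ , hnm) = columns (proj₁ (root x)) , Principal.principal {M = proj₁ (root x)} {H} {proj₁ (proj₂ (proj₂ (root x)))} (proj₁ (proj₂ (root x)))
  (proj₁ (proj₂ (proj₂ (proj₂ (root x))))) (proj₂ (proj₂ (proj₂ (proj₂ (root x))))) int (one-norm H hnm)

 well-defined : ∀ {g} (x y : 𝓗₁ g) → x ~SL y → toLattice x ~GU toLattice y
 well-defined {g} x@(H , _) y@(H' , _) (V , (iV , nV) , VHV) = go (root x) (root y) (SL-inverse V iV nV)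
  where
  go : (r : Root H) (r' : Root H') → IntegralInverse V →
   Similar (columns (proj₁ r)) (columns (proj₁ r'))
  go (M , gram , N , MN , NM) (M' , gram' , N' , MN' , NM') (W , iW , VW , WV) = U , (1ℚ , 1≢0ℚ , λ i j → trans (UU i j) (trans (sym (IdM≈δ i j)) (sym (scale-1 (IdM i j))))) , fwd , bwd
   where
   U = M' ⊗ (W ⊗ N)
   UU : ((U †) ⊗ U) ≈M MH.δ
   UU = isometry M N M' H H' V W U gram MN gram' VHV VW λ _ _ → refl
   act : ∀ o i → (U ▹ M ▹ o) i ≡ (M' ▹ W ▹ o) i
   act o i = trans (C.▹-⊠ M' (W ⊗ N) (M ▹ o) i) (C.▹-congʳ M' {(W ⊗ N) ▹ M ▹ o} {W ▹ o}
    (λ j → trans (C.▹-⊠ W N (M ▹ o) j) (C.▹-congʳ W {N ▹ M ▹ o} {o} (C.▹-inverse {M = N} {M} NM o) j)) i)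
   fwd : ∀ v → v ∈L columns M → (U ▹ v) ∈L columns M'
   fwd v (o , io , e) = W ▹ o , ▹-int {M = W} iW io , λ i → trans (C.▹-congʳ U {v} {M ▹ o} e i) (act o i)
   bwd : ∀ w → w ∈L columns M' → ∃[ v ] (v ∈L columns M × (U ▹ v) ≈V w)
   bwd w (o , io , e) = M ▹ V ▹ o , (V ▹ o , ▹-int {M = V} iV io , λ _ → refl) , λ i → trans (act (V ▹ o) i)
    (trans (C.▹-congʳ M' {W ▹ V ▹ o} {o} (C.▹-inverse {M = W} {V} WV o) i) (sym (e i)))

 rational-entry : ∀ {n} q → MatO (scalar {suc n} q) → Int q
 rational-entry q h = O-ι-int (subst _∈O (trans (scale≡ι q 1H) (*H-identityʳ (ι q))) (h zero zero))

 injective : ∀ {n} (x y : 𝓗₁ (suc n)) → toLattice x ~GU toLattice y → x ~SL y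
 injective {n} x@(H , iH , _ , _ , hnm) y@(H' , iH' , _ , _ , hnm') (U , (μ , μ≢0 , UU) , fwd , bwd) = go (root x) (root y) fwd bwd
  where
  g = suc n
  go : (r : Root H) (r' : Root H') → (∀ v → v ∈L columns (proj₁ r) → (U ▹ v) ∈L columns (proj₁ r')) →
   (∀ w → w ∈L columns (proj₁ r') → ∃[ v ] (v ∈L columns (proj₁ r) × (U ▹ v) ≈V w)) → x ~SL y
  go (M , gram , N , MN , NM) (M' , gram' , N' , MN' , NM') fwd bwd = finish (SL-inverse V iV nV) (SL-inverse H iH (one-norm H hnm)) (SL-inverse H' iH' (one-norm H' hnm'))
   where
   V = N' ⊗ (U ⊗ M)
   s t : Mat g
   s = scalar μ
   ν = proj₁ (inv μ μ≢0)
   t = scalar ν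
   UU' : ((U †) ⊗ U) ≈M s
   UU' i j = trans (UU i j) (cong (μ ·H_) (IdM≈δ i j))
   iV : MatO V
   iV i k = use (fwd (λ i → M i k) (column-∈ M k))
    where
    use : (U ▹ (λ i → M i k)) ∈L columns M' → V i k ∈O
    use (o , io , e) = subst _∈O (sym (trans (C.▹-congʳ N' {U ▹ (λ i → M i k)} {M' ▹ o} e i) (C.▹-inverse {M = N'} {M'} NM' o i))) (io i)
   W : Mat g
   W i k = proj₁ (proj₁ (proj₂ (bwd (λ i → M' i k) (column-∈ M' k)))) i
   iW : MatO W
   iW i k = proj₁ (proj₂ (proj₁ (proj₂ (bwd (λ i → M' i k) (column-∈ M' k))))) i
   VW : (V ⊗ W) ≈M MH.δ
   VW i k = use (bwd (λ i → M' i k) (column-∈ M' k)) refl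
    where
    use : (r : ∃[ v ] (v ∈L columns M × (U ▹ v) ≈V (λ i → M' i k))) → r ≡ bwd (λ i → M' i k) (column-∈ M' k) → (V ▹ proj₁ (proj₁ (proj₂ r))) i ≡ MH.δ i k
    use (v , (o , _ , e) , e') _ = trans (C.▹-⊠ N' (U ⊗ M) o i) (trans (C.▹-congʳ N' {(U ⊗ M) ▹ o} {λ i → M' i k}
     (λ j → trans (C.▹-⊠ U M o j) (trans (C.▹-congʳ U {M ▹ o} {v} (λ l → sym (e l)) j) (e' j))) i) (NM' i k))
   nV : Nm V ≡ 1ℚ
   nV = unit-Nm V W iV iW VW
   sim : ((V †) ⊗ (H' ⊗ V)) ≈M (H ⊗ s)
   sim = similitude M M' N' H H' U V s gram MN' gram' UU' (scalar-central μ M) λ _ _ → refl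
   μ≥0 : 0ℚ ≤ μ
   μ≥0 = subst (0ℚ ≤_) (ι-inj (trans (sym (sum-norms (λ k → U k zero))) (trans (UU' zero zero) (trans (scale≡ι μ 1H) (*H-identityʳ (ι μ)))))) (sum-nonneg (λ k → U k zero))
   finish : IntegralInverse V →
    IntegralInverse H →
    IntegralInverse H' → x ~SL y
   finish (V' , iV' , VV' , V'V) (I , iI , _ , IH) (I' , iI' , _ , IH') = V' , (iV' , unit-Nm V' V iV' iV V'V) ,
     λ i j → trans (back' i j) (trans (⊠-scalar ν H' i j) (trans (cong (_·H H' i j) ν≡1) (scale-1 (H' i j))))
    where
    back' : ((V' †) ⊗ (H ⊗ V')) ≈M (H' ⊗ t)
    back' = similitude-back H H' V V' s t sim VV' (scalar-inverse {p = μ} {ν} (proj₂ (inv μ μ≢0))) (scalar-central μ)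
    int-s : MatO s
    int-s = int-≈ {M = I ⊗ ((V †) ⊗ (H' ⊗ V))} {s} (inverse-of-product I H s ((V †) ⊗ (H' ⊗ V)) sim IH)
     (⊗-int {M = I} iI (⊗-int {M = V †} (†-int {M = V} iV) (⊗-int {M = H'} {V} iH' iV)))
    int-t : MatO t
    int-t = int-≈ {M = I' ⊗ ((V' †) ⊗ (H ⊗ V'))} {t} (inverse-of-product I' H' t ((V' †) ⊗ (H ⊗ V')) back' IH')
     (⊗-int {M = I'} iI' (⊗-int {M = V' †} (†-int {M = V'} iV') (⊗-int {M = H} {V'} iH iV')))
    μ≡1 : μ ≡ 1ℚ
    μ≡1 = sqrt-one μ≥0 (unit-square (rational-entry μ int-s) (rational-entry ν int-t) (proj₂ (inv μ μ≢0)))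
    ν≡1 : ν ≡ 1ℚ
    ν≡1 = trans (sym (ℚ.*-identityˡ ν)) (trans (cong (_* ν) (sym μ≡1)) (proj₂ (inv μ μ≢0)))

 open IdealTheory 𝕊 using (Tuple; _+V_; _·V_; 0V; SpanV; LinIso; Full; Free; 0-·V; full⇒free)

 toTuple : ∀ {n} → Vec n → Tuple n
 toTuple {zero} v = tt
 toTuple {suc n} v = v zero , toTuple (v ∘ suc)

 fromTuple : ∀ {n} → Tuple n → Vec n
 fromTuple (x , t) zero = x
 fromTuple (x , t) (suc i) = fromTuple t i

 from-to : ∀ {n} (v : Vec n) i → fromTuple (toTuple v) i ≡ v i
 from-to v zero = refl
 from-to v (suc i) = from-to (v ∘ suc) i

 tuple-≡ : ∀ {n} {s t : Tuple n} → (∀ i → fromTuple s i ≡ fromTuple t i) → s ≡ t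
 tuple-≡ {zero} h = refl
 tuple-≡ {suc n} h = cong₂ _,_ (h zero) (tuple-≡ (h ∘ suc))

 from-+V : ∀ {n} (s t : Tuple n) i → fromTuple (s +V t) i ≡ fromTuple s i +H fromTuple t i
 from-+V (x , s) (y , t) zero = refl
 from-+V (x , s) (y , t) (suc i) = from-+V s t i

 from-·V : ∀ {n} (s : Tuple n) h i → fromTuple (s ·V h) i ≡ fromTuple s i *H h
 from-·V (x , s) h zero = refl
 from-·V (x , s) h (suc i) = from-·V s h i

 from-0V : ∀ {n} i → fromTuple (0V {n}) i ≡ 0H
 from-0V {suc n} zero = refl
 from-0V {suc n} (suc i) = from-0V {n} i

 sumV : ∀ {m n} → (Fin m → Tuple n) → Tuple n
 sumV {zero} f = 0V
 sumV {suc m} f = f zero +V sumV (f ∘ suc)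

 from-sumV : ∀ {m n} (f : Fin m → Tuple n) i → fromTuple (sumV f) i ≡ sumH (λ k → fromTuple (f k) i)
 from-sumV {zero} {n} f i = from-0V {n} i
 from-sumV {suc m} f i = trans (from-+V (f zero) (sumV (f ∘ suc)) i) (cong (fromTuple (f zero) i +H_) (from-sumV (f ∘ suc) i))

 module Linear {n} (φ : Tuple n → Tuple n) (φ-+ : ∀ s t → φ (s +V t) ≡ φ s +V φ t) (φ-· : ∀ s h → φ (s ·V h) ≡ φ s ·V h) where
  φ-0 : φ 0V ≡ 0V
  φ-0 = trans (cong φ (sym (0-·V 0V))) (trans (φ-· 0V 0H) (0-·V (φ 0V)))

  φ-sum : ∀ {m} (f : Fin m → Tuple n) → φ (sumV f) ≡ sumV (λ k → φ (f k))
  φ-sum {zero} f = φ-0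
  φ-sum {suc m} f = trans (φ-+ (f zero) (sumV (f ∘ suc))) (cong (φ (f zero) +V_) (φ-sum (f ∘ suc)))

  unitV : Fin n → Tuple n
  unitV k = toTuple (λ i → MH.δ i k)

  matrix : Mat n
  matrix i k = fromTuple (φ (unitV k)) i

  expand : ∀ t → t ≡ sumV (λ k → unitV k ·V fromTuple t k)
  expand t = tuple-≡ λ i → sym (trans (from-sumV (λ k → unitV k ·V fromTuple t k) i)
   (trans (MH.Σ-cong {g = λ k → MH.δ i k *H fromTuple t k} (λ k → trans (from-·V (unitV k) (fromTuple t k) i) (cong (_*H fromTuple t k) (from-to (λ j → MH.δ j k) i)))) (MH.Σ-δˡ i (fromTuple t))))

  represents : ∀ t i → (matrix ▹ fromTuple t) i ≡ fromTuple (φ t) i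
  represents t i = sym (trans (cong (λ z → fromTuple (φ z) i) (expand t)) (trans (cong (λ z → fromTuple z i) (φ-sum (λ k → unitV k ·V fromTuple t k)))
   (trans (from-sumV (λ k → φ (unitV k ·V fromTuple t k)) i) (MH.Σ-cong {g = λ k → matrix i k *H fromTuple t k} (λ k → trans (cong (λ z → fromTuple z i) (φ-· (unitV k) (fromTuple t k))) (from-·V (φ (unitV k)) (fromTuple t k) i))))))

 span⇒combination : ∀ m {n} (G : Fin m → Vec n) {t} → SpanV (tabulate (λ k → toTuple (G k))) t →
  ∃ λ (o : Fin m → ℍ) → (∀ k → o k ∈O) × (∀ i → fromTuple t i ≡ sumH (λ k → G k i *H o k))
 span⇒combination zero {n} G refl = (λ ()) , (λ ()) , from-0V {n}
 span⇒combination (suc m) {n} G (o , w , io , hw , refl) = go (span⇒combination m (G ∘ suc) hw)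
  where
  go : (∃ λ (p : Fin m → ℍ) → (∀ k → p k ∈O) × (∀ i → fromTuple w i ≡ sumH (λ k → G (suc k) i *H p k))) →
   ∃ λ (p : Fin (suc m) → ℍ) → (∀ k → p k ∈O) × (∀ i → fromTuple (toTuple (G zero) ·V o +V w) i ≡ sumH (λ k → G k i *H p k))
  go (p , ip , e) = (λ { zero → o ; (suc k) → p k }) , (λ { zero → io ; (suc k) → ip k }) ,
   λ i → trans (from-+V (toTuple (G zero) ·V o) w i) (cong₂ _+H_ (trans (from-·V (toTuple (G zero)) o i) (cong (_*H o) (from-to (G zero) i))) (e i))

 combination⇒span : ∀ m {n} (G : Fin m → Vec n) {t} (o : Fin m → ℍ) → (∀ k → o k ∈O) → (∀ i → fromTuple t i ≡ sumH (λ k → G k i *H o k)) →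
  SpanV (tabulate (λ k → toTuple (G k))) t
 combination⇒span zero {n} G o io e = tuple-≡ λ i → trans (e i) (sym (from-0V {n} i))
 combination⇒span (suc m) G {t} o io e = o zero , w , io zero , combination⇒span m (G ∘ suc) (o ∘ suc) (io ∘ suc) (from-to _) ,
   tuple-≡ λ i → trans (e i) (sym (trans (from-+V (toTuple (G zero) ·V o zero) w i) (cong₂ _+H_ (trans (from-·V (toTuple (G zero)) (o zero) i) (cong (_*H o zero) (from-to (G zero) i))) (from-to _ i))))
  where w = toTuple (λ i → sumH (λ k → G (suc k) i *H o (suc k)))

 free⇒int : ∀ n {t : Tuple n} → Free n t → IntV (fromTuple t)
 free⇒int (suc n) (h , k) zero = h
 free⇒int (suc n) (h , k) (suc i) = free⇒int n k i

 int⇒free : ∀ n {t : Tuple n} → IntV (fromTuple t) → Free n t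
 int⇒free zero h = tt
 int⇒free (suc n) h = h zero , int⇒free n (h ∘ suc)

 ∈L-≈ : ∀ {g} (L : Lat g) {x y} → x ≈V y → x ∈L L → y ∈L L
 ∈L-≈ L e (o , io , h) = o , io , λ i → trans (sym (e i)) (h i)

 record FreeBasis {g} (L : Lat g) : Set where
  field
   M N : Mat g
   MN : (M ⊗ N) ≈M MH.δ
   NM : (N ⊗ M) ≈M MH.δ
   coordinates-int : ∀ x → x ∈L L → IntV (N ▹ x)
   combination-∈ : ∀ o → IntV o → (M ▹ o) ∈L L

 free-basis : ∀ n (L : Lat (suc (suc n))) → (∀ (x : Vec (suc (suc n))) → ∃[ d ] ((0 ℕ.< d) × ((λ i → ℤ→ℚ (+ d) ·H x i) ∈L L))) → FreeBasis L
 free-basis n L full = build (full⇒free n ls full')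
  where
  g = suc (suc n)
  ls = tabulate (λ k → toTuple (gens L k))
  span : ∀ {t} → (fromTuple t) ∈L L → SpanV ls t
  span (o , io , e) = combination⇒span (m L) (gens L) o io e
  full' : Full ls
  full' t = go (full (fromTuple t))
   where
   go : ∃[ d ] ((0 ℕ.< d) × ((λ i → ℤ→ℚ (+ d) ·H fromTuple t i) ∈L L)) → ∃[ d ] ((0 ℕ.< d) × SpanV ls (t ·V ι (fromℕ d)))
   go (d , d>0 , h) = d , d>0 , span (∈L-≈ L (λ i → sym (trans (from-·V t (ι (fromℕ d)) i) (trans (*-ι (fromℕ d) (fromTuple t i)) (cong (_·H fromTuple t i) (fromℕ≡ d))))) h)
  build : LinIso (SpanV ls) (Free g) → FreeBasis L
  build iso = record { M = φ.matrix ; N = ψ.matrix ; MN = inverse from to from-+ from-· to-+ to-· from-to' ; NM = inverse to from to-+ to-· from-+ from-· to-from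
   ; coordinates-int = λ x h i → subst _∈O (sym (coords x i)) (free⇒int g (to-∈ (span (∈L-≈ L (λ j → sym (from-to x j)) h))) i)
   ; combination-∈ = λ o io → ∈L-≈ L (combs o) (span⇒combination (m L) (gens L) (from-∈ (int⇒free g {toTuple o} λ i → subst _∈O (sym (from-to o i)) (io i)))) }
   where
   open LinIso iso renaming (from-to to from-to')
   module φ = Linear from from-+ from-·
   module ψ = Linear to to-+ to-·
   inverse : ∀ (f f' : Tuple g → Tuple g) (f-+ : ∀ s t → f (s +V t) ≡ f s +V f t) (f-· : ∀ s h → f (s ·V h) ≡ f s ·V h)
    (f'-+ : ∀ s t → f' (s +V t) ≡ f' s +V f' t) (f'-· : ∀ s h → f' (s ·V h) ≡ f' s ·V h) → (∀ t → f (f' t) ≡ t) → (Linear.matrix f f-+ f-· ⊗ Linear.matrix f' f'-+ f'-·) ≈M MH.δ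
   inverse f f' f-+ f-· f'-+ f'-· h i k = trans (Linear.represents f f-+ f-· (f' (Linear.unitV f' f'-+ f'-· k)) i)
    (trans (cong (λ z → fromTuple z i) (h (Linear.unitV f' f'-+ f'-· k))) (from-to (λ j → MH.δ j k) i))
   coords : ∀ x i → (ψ.matrix ▹ x) i ≡ fromTuple (to (toTuple x)) i
   coords x i = trans (C.▹-congʳ ψ.matrix {x} {fromTuple (toTuple x)} (λ j → sym (from-to x j)) i) (ψ.represents (toTuple x) i)
   combs : ∀ o i → fromTuple (from (toTuple o)) i ≡ (φ.matrix ▹ o) i
   combs o i = sym (trans (C.▹-congʳ φ.matrix {o} {fromTuple (toTuple o)} (λ j → sym (from-to o j)) i) (φ.represents (toTuple o) i))

 SelfDual : ∀ {g} → Lat g → ℚ → Set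
 SelfDual L c = (∀ x y → x ∈L L → y ∈L L → (c ·H H₀ x y) ∈O) × (∀ y → (∀ x → x ∈L L → (c ·H H₀ x y) ∈O) → y ∈L L)

 positive-scale : ∀ {g} (L : Lat g) c → ¬ (c ≡ 0ℚ) → SelfDual L c → ∃[ c' ] ((0ℚ < c') × SelfDual L c')
 positive-scale L c c≢0 (int , dual) = go (ℚ.<-cmp 0ℚ c)
  where
  flip : ∀ {z} c → (c ·H z) ∈O → ((- c) ·H z) ∈O
  flip {z} c h = subst _∈O (trans (scale-scale (- 1ℚ) c z) (cong (_·H z) (lem c))) (O-· (int-neg int-1) h)
   where
   lem : ∀ c → (- 1ℚ) * c ≡ - c
   lem = solve-∀ ℚ-ring
  go : Tri (0ℚ < c) (0ℚ ≡ c) (c < 0ℚ) → ∃[ c' ] ((0ℚ < c') × SelfDual L c')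
  go (tri< p _ _) = c , p , int , dual
  go (tri≈ _ p _) = ⊥-elim (c≢0 (sym p))
  go (tri> _ _ p) = - c , neg-pos p , (λ x y h k → flip c (int x y h k)) ,
   λ y h → dual y λ x k → subst (λ z → (z ·H H₀ x y) ∈O) (neg-neg c) (flip (- c) (h x k))

 module Preimage {g} (L : Lat g) (basis : FreeBasis L) (c : ℚ) (c>0 : 0ℚ < c) (self-dual : SelfDual L c) where
  open FreeBasis basis

  r : ℚ
  r = proj₁ (inv c (<⇒≢0 c>0))
  cr : c * r ≡ 1ℚ
  cr = proj₂ (inv c (<⇒≢0 c>0))
  rc : r * c ≡ 1ℚ
  rc = trans (ℚ.*-comm r c) cr

  H : Mat g
  H i j = c ·H ((M †) ⊗ M) i j

  column∈ : ∀ k → (λ i → M i k) ∈L L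
  column∈ k = ∈L-≈ L (λ i → MH.⊠-identityʳ M i k) (combination-∈ (λ l → MH.δ l k) (λ l → δ-int l k))

  integral : MatO H
  integral i j = proj₁ self-dual (λ k → M k i) (λ k → M k j) (column∈ i) (column∈ j)

  hermitian : IsHermitian H
  hermitian i j = trans (scale-conj c (((M †) ⊗ M) j i)) (cong (c ·H_) (trans (C.†-⊠ (M †) M i j)
   (MH.Σ-cong {f = λ k → conj (M k i) *H conj (conj (M k j))} (λ k → cong (conj (M k i) *H_) (conj-conj (M k j))))))

  act : ∀ x i → (H ▹ x) i ≡ c ·H ((M †) ▹ M ▹ x) i
  act x i = trans (scale-▹ c ((M †) ⊗ M) x i) (cong (c ·H_) (C.▹-⊠ (M †) M x i))

  positive : IsPosDef H
  positive x x≢0 = subst (0ℚ <_) (sym (cong re value)) (*-pos c>0 (sum-positive (M ▹ x) λ z → x≢0 λ i → trans (sym (C.▹-inverse {M = N} {M} NM x i))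
    (MH.Σ-zero {f = λ k → N i k *H (M ▹ x) k} (λ k → trans (cong (N i k *H_) (z k)) (x*0 (N i k))))))
   where
   x*0 : ∀ x → x *H 0H ≡ 0H
   x*0 x = trans (*-ι 0ℚ x) (ℍ-≡ (ℚ.*-zeroˡ (re x)) (ℚ.*-zeroˡ (ci x)) (ℚ.*-zeroˡ (cj x)) (ℚ.*-zeroˡ (ck x)))
   value : H₀ x (H ▹ x) ≡ c ·H ι (sumℚ (λ k → nrd ((M ▹ x) k)))
   value = trans (C.form-cong {x = x} {x} {H ▹ x} {λ i → c ·H ((M †) ▹ M ▹ x) i} (λ _ → refl) (act x)) (trans (H₀-scale x c ((M †) ▹ M ▹ x))
    (cong (c ·H_) (trans (sym (C.form-adjoint M x (M ▹ x))) (sum-norms (M ▹ x)))))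

  dual-vector : Fin g → Vec g
  dual-vector k i = r ·H conj (N k i)

  dual-vector-∈ : ∀ k → dual-vector k ∈L L
  dual-vector-∈ k = proj₂ self-dual (dual-vector k) λ x hx → subst _∈O (sym (trans (cong (c ·H_) (H₀-scale x r (λ i → conj (N k i)))) (trans (scale-inverse {c} {r} (H₀ x (λ i → conj (N k i))) cr)
    (sym (trans (C.conj-Σ (λ i → N k i *H x i)) (MH.Σ-cong {f = λ i → conj (N k i *H x i)} (λ i → conj-* (N k i) (x i)))))))) (O-conj (coordinates-int x hx k))

  H⁻¹ : Mat g
  H⁻¹ i k = (N ▹ dual-vector k) i

  HH⁻¹ : (H ⊗ H⁻¹) ≈M MH.δ
  HH⁻¹ i k = trans (act (N ▹ dual-vector k) i) (trans (cong (c ·H_) (C.▹-congʳ (M †) {M ▹ N ▹ dual-vector k} {dual-vector k} (C.▹-inverse {M = M} {N} MN (dual-vector k)) i))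
   (trans (cong (c ·H_) (▹-scale (M †) r (λ l → conj (N k l)) i)) (trans (scale-inverse {c} {r} _ cr) (trans (sym (C.†-⊠ N M i k)) (trans (cong conj (NM k i)) (C.†-δ i k))))))

  point : 𝓗₁ g
  point = H , integral , hermitian , positive , ℕ.s≤s ℕ.z≤n , sym (unit-Nm H H⁻¹ integral (λ i k → coordinates-int (dual-vector k) (dual-vector-∈ k) i) HH⁻¹)

  equivalent : (pp : IsPPLattice L) → toLattice point ~GU (L , pp)
  equivalent pp = go (root point)
   where
   go : (ρ : Root H) → Similar (columns (proj₁ ρ)) L
   go (R , gram , S , RS , SR) = U , (r , r≢0 , λ i j → trans (UU i j) (cong (r ·H_) (sym (IdM≈δ i j)))) , fwd , bwd
    where
    U = M ⊗ S
    r≢0 : ¬ (r ≡ 0ℚ)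
    r≢0 e = 1≢0ℚ (trans (sym cr) (trans (cong (c *_) e) (ℚ.*-zeroʳ c)))
    UU : ((U †) ⊗ U) ≈M scalar r
    UU = rescaled-isometry M R S (scalar c) (scalar r) U (λ i j → trans (gram i j) (sym (scalar-⊠ c ((M †) ⊗ M) i j))) RS (scalar-inverse {p = r} {c} rc) (scalar-central c) λ _ _ → refl
    on : ∀ o i → (U ▹ R ▹ o) i ≡ (M ▹ o) i
    on o i = trans (C.▹-⊠ M S (R ▹ o) i) (C.▹-congʳ M {S ▹ R ▹ o} {o} (C.▹-inverse {M = S} {R} SR o) i)
    fwd : ∀ v → v ∈L columns R → (U ▹ v) ∈L L
    fwd v (o , io , e) = ∈L-≈ L (λ i → sym (trans (C.▹-congʳ U {v} {R ▹ o} e i) (on o i))) (combination-∈ o io)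
    bwd : ∀ w → w ∈L L → ∃[ v ] (v ∈L columns R × (U ▹ v) ≈V w)
    bwd w hw = R ▹ N ▹ w , (N ▹ w , coordinates-int w hw , λ _ → refl) , λ i → trans (on (N ▹ w) i) (C.▹-inverse {M = M} {N} MN w i)

 surjective-on-classes : ∀ n (z : 𝓛 (suc (suc n))) → ∃[ x ] (toLattice x ~GU z)
 surjective-on-classes n (L , pp@(full , c , c≢0 , sd)) = go (positive-scale L c c≢0 sd)
  where
  go : ∃[ c' ] ((0ℚ < c') × SelfDual L c') → ∃[ x ] (toLattice x ~GU (L , pp))
  go (c' , c'>0 , sd') = Preimage.point L fb c' c'>0 sd' , Preimage.equivalent L fb c' c'>0 sd' pp
   where fb = free-basis n L full

open import Data.Nat using (ℕ; _<_)
open import Data.Rational using (ℚ; 0ℚ)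
import Data.Rational as ℚ

theorem2p8 : (a b : ℚ) → a ℚ.< 0ℚ → b ℚ.< 0ℚ
    → (O : Quaternion.Basis a b) → Quaternion.IsMaximalOrder a b O
    → (g : ℕ) → 1 < g
    → QuotientBijection
    (Quaternion.Over.𝓗₁ a b O g) (Quaternion.Over._~SL_ a b O)
    (Quaternion.Over.𝓛 a b O g) (Quaternion.Over._~GU_ a b O)
theorem2p8 _ _ _ _ _ _ (suc zero) (s≤s ())
theorem2p8 a b a<0 b<0 O maximal (suc (suc n)) _ =
  Correspondence.toLattice a b a<0 b<0 O maximal , Correspondence.well-defined a b a<0 b<0 O maximal ,
  Correspondence.injective a b a<0 b<0 O maximal , Correspondence.surjective-on-classes a b a<0 b<0 O maximal n
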